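{- Let $G$ be a (finite, simple, undirected) graph with four distinct nominated vertices $a,b,c,d$. Then exactly one of the following holds: (i) $G$ contains a $K_4$-minor rooted at $a,b,c,d$; (ii) $G$ is a spanning subgraph of some graph in $\mathcal{A}\cup\mathcal{B}\cup\mathcal{C}\cup\mathcal{D}\cup\mathcal{E}\cup\mathcal{F}$ whose four nominated vertices are $a,b,c,d$.
   Context: A $K_4$-minor rooted at distinct vertices $a,b,c,d$ of $G$ is a set of four pairwise vertex-disjoint connected subgraphs of $G$ (branch sets), respectively containing $a,b,c,d$, such that every two of them are joined by an edge of $G$. For a graph $H$, $H^+$ denotes any graph obtained from $H$ as follows: for each triangle $T$ of $H$ add a (possibly empty) clique $X_T$, where these cliques are pairwise disjoint and disjoint from $H$, and every vertex of $X_T$ is joined to every vertex of $T$; no other edges are added. The classes (each graph carries four nominated vertices): - $\mathcal{A}$: all $H^+$ where $H$ consists of an edge $pq$ with $p$ nominated, together with three further nominated vertices each adjacent to both $p$ and $q$. - $\mathcal{B}$: all $H^+$ where $H$ consists of an edge $pq$ together with four nominated vertices each adjacent to both $p$ and $q$. - $\mathcal{C}$: all $H^+$ where $H$ consists of a triangle $uvw$, two nominated vertices each adjacent to $u$ and $v$, and two nominated vertices each adjacent to $v$ and $w$. - $\mathcal{D}$: all $H^+$ where $H$ is a plane graph whose outer face is bounded by a 4-cycle on the four nominated vertices, every internal face is a triangle, and every triangle of $H$ is a face. - $\mathcal{E}$: all $H^+$ where $H$ is obtained as follows: take a plane graph with outer face bounded by the cycle $(p,q,r,s)$, with $p,q$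 nominated, every internal face a triangle and every triangle a face; then add two nominated vertices $v,w$, each adjacent to $r$ and $s$. - $\mathcal{F}$: all $H^+$ where $H$ is obtained as follows: take a plane graph with outer face bounded by the cycle $(p,q,r,s)$, every other face a triangle and every triangle a face; then add two nominated vertices each adjacent to $p$ and $q$, and two nominated vertices each adjacent to $r$ and $s$. -}

module Defs where

open import Data.Nat using (ℕ; zero; suc; _+_; _≡ᵇ_; _<ᵇ_)
open import Data.Nat.ListAction using (sum)
open import Data.Bool using (Bool; true; false; _∧_; _∨_; if_then_else_)
open import Data.Fin using (Fin; zero; suc; toℕ; #_; _≟_)
open import Data.List using (List; []; _∷_; _++_; zip; map; allFin; foldr)
open import Data.List.Membership.Propositional using (_∈_)
open import Data.Vec using (Vec; lookup) renaming (_∷_ to _∷ᵥ_; [] to []ᵥ)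
open import Data.Product using (Σ; ∃; ∃₂; _×_; _,_)
open import Data.Sum using (_⊎_; inj₁; inj₂)
open import Relation.Nullary using (¬_)
open import Data.Empty using (⊥)
open import Relation.Nullary.Decidable using (⌊_⌋)
open import Relation.Binary.PropositionalEquality using (_≡_; _≢_)
open import Relation.Binary.Construct.Closure.ReflexiveTransitive using (Star)
open import Function.Bundles using (_⇔_)

Adj : ℕ → Set
Adj m = Fin m → Fin m → Bool

record Graph (n : ℕ) : Set where
  field
    adj    : Adj n
    sym    : ∀ x y → adj x y ≡ adj y x
    irrefl : ∀ x → adj x x ≡ false
open Graph public

_∼[_]_ : ∀ {m} → Fin m → Adj m → Fin m → Set
x ∼[ A ] y = A x y ≡ true

roots : ∀ {n} → Fin n → Fin n → Fin n → Fin n → Fin 4 → Fin n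
roots a b c d = lookup (a ∷ᵥ b ∷ᵥ c ∷ᵥ d ∷ᵥ []ᵥ)

record RootedK4 {n} (G : Graph n) (a b c d : Fin n) : Set where
  field
    branch    : Fin 4 → Fin n → Bool
    rooted    : ∀ i → branch i (roots a b c d i) ≡ true
    disjoint  : ∀ i j x → i ≢ j → branch i x ≡ true → branch j x ≡ true → ⊥
    connected : ∀ i x y → branch i x ≡ true → branch i y ≡ true →
                Star (λ u v → (u ∼[ adj G ] v) × branch i u ≡ true × branch i v ≡ true) x y
    touching  : ∀ i j → i ≢ j →
                ∃₂ λ x y → branch i x ≡ true × branch j y ≡ true × (x ∼[ adj G ] y)

Tri : ℕ → Set
Tri m = Fin m × Fin m × Fin m

_∈₃_ : ∀ {m} → Fin m → Tri m → Set
h ∈₃ (u , v , w) = h ≡ u ⊎ h ≡ v ⊎ h ≡ w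

IsTriangle : ∀ {m} → Adj m → Tri m → Set
IsTriangle A (u , v , w) = (u ∼[ A ] v) × (v ∼[ A ] w) × (u ∼[ A ] w)

-- adjacency in H⁺ between labelled vertices: a vertex of H⁺ is either a
-- vertex of H (inj₁) or belongs to the clique X_T attached to the
-- triangle T (inj₂); two triangle-labels denote the same clique iff they
-- have the same vertex set.
LAdj : ∀ {m} → Adj m → Fin m ⊎ Tri m → Fin m ⊎ Tri m → Set
LAdj A (inj₁ i) (inj₁ j) = i ∼[ A ] j
LAdj A (inj₁ i) (inj₂ t) = i ∈₃ t
LAdj A (inj₂ t) (inj₁ i) = i ∈₃ t
LAdj A (inj₂ t) (inj₂ s) = ∀ h → (h ∈₃ t) ⇔ (h ∈₃ s)

record PlusOf {n m} (G' : Graph n) (H : Adj m) : Set where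
  field
    label : Fin n → Fin m ⊎ Tri m
    onto  : ∀ i → ∃ λ x → label x ≡ inj₁ i
    inj   : ∀ x y i → label x ≡ inj₁ i → label y ≡ inj₁ i → x ≡ y
    triOK : ∀ x t → label x ≡ inj₂ t → IsTriangle H t
    adjOK : ∀ x y → x ≢ y → (x ∼[ adj G' ] y) ⇔ LAdj H (label x) (label y)

fromEdges : ∀ {m} → List (ℕ × ℕ) → Adj m
fromEdges es i j =
  foldr (λ { (a , b) r → ((toℕ i ≡ᵇ a) ∧ (toℕ j ≡ᵇ b)) ∨ ((toℕ i ≡ᵇ b) ∧ (toℕ j ≡ᵇ a)) ∨ r }) false es

ext : ∀ {m} → Adj m → Fin m → Fin m → Adj (suc m)
ext A x y zero    zero    = false
ext A x y zero    (suc j) = ⌊ j ≟ x ⌋ ∨ ⌊ j ≟ y ⌋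
ext A x y (suc i) zero    = ⌊ i ≟ x ⌋ ∨ ⌊ i ≟ y ⌋
ext A x y (suc i) (suc j) = A i j

-- Class A: p = 0, q = 1, nominated 0,2,3,4
HA : Adj 5
HA = fromEdges ((0 , 1) ∷ (0 , 2) ∷ (1 , 2) ∷ (0 , 3) ∷ (1 , 3) ∷ (0 , 4) ∷ (1 , 4) ∷ [])
nomA : Fin 4 → Fin 5
nomA = lookup (# 0 ∷ᵥ # 2 ∷ᵥ # 3 ∷ᵥ # 4 ∷ᵥ []ᵥ)

-- Class B: p = 0, q = 1, nominated 2,3,4,5
HB : Adj 6
HB = fromEdges ((0 , 1) ∷ (0 , 2) ∷ (1 , 2) ∷ (0 , 3) ∷ (1 , 3)
                ∷ (0 , 4) ∷ (1 , 4) ∷ (0 , 5) ∷ (1 , 5) ∷ [])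
nomB : Fin 4 → Fin 6
nomB = lookup (# 2 ∷ᵥ # 3 ∷ᵥ # 4 ∷ᵥ # 5 ∷ᵥ []ᵥ)

-- Class C: u = 0, v = 1, w = 2; nominated 3,4 (adjacent to u,v) and
-- 5,6 (adjacent to v,w)
HC : Adj 7
HC = fromEdges ((0 , 1) ∷ (1 , 2) ∷ (0 , 2) ∷ (3 , 0) ∷ (3 , 1) ∷ (4 , 0) ∷ (4 , 1)
                ∷ (5 , 1) ∷ (5 , 2) ∷ (6 , 1) ∷ (6 , 2) ∷ [])
nomC : Fin 4 → Fin 7
nomC = lookup (# 3 ∷ᵥ # 4 ∷ᵥ # 5 ∷ᵥ # 6 ∷ᵥ []ᵥ)

-- Plane graphs whose outer face is bounded by the 4-cycle (p,q,r,s),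
-- all other faces triangles, and every triangle a face.
-- The embedding is given combinatorially: an explicit list of oriented
-- facial walks (the outer 4-cycle and k triangles) such that every dart
-- lies on exactly one face, the faces around each vertex form a single
-- cyclic rotation (so the faces glue to a closed orientable surface),
-- the graph is connected, and Euler's formula V - E + F = 2 holds
-- (so the surface is the sphere).

cpairs : ∀ {m} → List (Fin m) → List (Fin m × Fin m)
cpairs []       = []
cpairs (x ∷ xs) = zip (x ∷ xs) (xs ++ (x ∷ []))

edgeCount : ∀ {m} → Graph m → ℕ
edgeCount {m} G =
  sum (map (λ i → sum (map (λ j → if adj G i j ∧ (toℕ i <ᵇ toℕ j) then 1 else 0) (allFin m))) (allFin m))

triList : ∀ {m} → Tri m → List (Fin m)
triList (x , y , z) = x ∷ y ∷ z ∷ []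

faces : ∀ {m k} → Fin m → Fin m → Fin m → Fin m → (Fin k → Tri m) → Fin (suc k) → List (Fin m)
faces p q r s tri zero    = p ∷ q ∷ r ∷ s ∷ []
faces p q r s tri (suc i) = triList (tri i)

-- u → v → w is a corner of some face (the rotation at v sends u to w)
Turn : ∀ {m k} → (Fin (suc k) → List (Fin m)) → Fin m → Fin m → Fin m → Set
Turn fs v u w = ∃ λ i → ((u , v) ∈ cpairs (fs i)) × ((v , w) ∈ cpairs (fs i))

record PlaneQuad {m} (P : Graph m) (p q r s : Fin m) : Set where
  field
    k   : ℕ
    tri : Fin k → Tri m
  field
    pq : p ∼[ adj P ] q
    qr : q ∼[ adj P ] r
    rs : r ∼[ adj P ] s
    sp : s ∼[ adj P ] p
    p≢r : p ≢ r
    q≢s : q ≢ s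
    triOK : ∀ i → IsTriangle (adj P) (tri i)
    dartFace : ∀ u v → u ∼[ adj P ] v → ∃ λ i → (u , v) ∈ cpairs (faces p q r s tri i)
    dartUniq : ∀ u v i j → (u , v) ∈ cpairs (faces p q r s tri i) → (u , v) ∈ cpairs (faces p q r s tri j) → i ≡ j
    -- the faces around each vertex form a single cycle
    rotation : ∀ v u u' → v ∼[ adj P ] u → v ∼[ adj P ] u' → Star (Turn (faces p q r s tri) v) u u'
    connected : ∀ x y → Star (λ u w → u ∼[ adj P ] w) x y
    euler : m + suc k ≡ 2 + edgeCount P
    trianglesAreFaces : ∀ t → IsTriangle (adj P) t →
                        ∃ λ i → ∀ h → (h ∈₃ t) ⇔ (h ∈₃ tri i)

data ClassWitness : Set where
  cA cB cC : ClassWitness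
  cD : (m : ℕ) (P : Graph m) (p q r s : Fin m) → PlaneQuad P p q r s → ClassWitness
  cE : (m : ℕ) (P : Graph m) (p q r s : Fin m) → PlaneQuad P p q r s → ClassWitness
  cF : (m : ℕ) (P : Graph m) (p q r s : Fin m) → PlaneQuad P p q r s → ClassWitness

size : ClassWitness → ℕ
size cA = 5
size cB = 6
size cC = 7
size (cD m _ _ _ _ _ _) = m
size (cE m _ _ _ _ _ _) = suc (suc m)
size (cF m _ _ _ _ _ _) = suc (suc (suc (suc m)))

graphH : (w : ClassWitness) → Adj (size w)
graphH cA = HA
graphH cB = HB
graphH cC = HC
graphH (cD m P p q r s _) = adj P
-- E: vertices zero and suc zero are the two added nominated vertices,
-- each adjacent to r and s
graphH (cE m P p q r s _) = ext (ext (adj P) r s) (suc r) (suc s)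
-- F: zero, suc zero adjacent to r,s; suc² zero, suc³ zero adjacent to p,q
graphH (cF m P p q r s _) =
  ext (ext (ext (ext (adj P) p q) (suc p) (suc q)) (suc (suc r)) (suc (suc s)))
      (suc (suc (suc r))) (suc (suc (suc s)))

nominated : (w : ClassWitness) → Fin 4 → Fin (size w)
nominated cA = nomA
nominated cB = nomB
nominated cC = nomC
nominated (cD m P p q r s _) = lookup (p ∷ᵥ q ∷ᵥ r ∷ᵥ s ∷ᵥ []ᵥ)
nominated (cE m P p q r s _) = lookup (suc (suc p) ∷ᵥ suc (suc q) ∷ᵥ suc zero ∷ᵥ zero ∷ᵥ []ᵥ)
nominated (cF m P p q r s _) = lookup (zero ∷ᵥ suc zero ∷ᵥ suc (suc zero) ∷ᵥ suc (suc (suc zero)) ∷ᵥ []ᵥ)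

InClasses : ∀ {n} → Graph n → Fin n → Fin n → Fin n → Fin n → Set
InClasses G' a b c d =
  Σ ClassWitness λ w → Σ (PlusOf G' (graphH w)) λ π →
    ∀ x → (∃ λ i → x ≡ roots a b c d i) ⇔ (∃ λ k → PlusOf.label π x ≡ inj₁ (nominated w k))

SpanningSub : ∀ {n} → Graph n → Graph n → Set
SpanningSub {n} G G' = ∀ (x y : Fin n) → x ∼[ adj G ] y → x ∼[ adj G' ] y

Obstructed : ∀ {n} → Graph n → Fin n → Fin n → Fin n → Fin n → Set
Obstructed {n} G a b c d = Σ (Graph n) λ G' → SpanningSub G G' × InClasses G' a b c d

{- Join nonadjacent roots a, b and induct: a K₄ there leaves a 4-cycle model a c b d. If no disjoint paths join a b and c d, the two
paths theorem gives class D; else uncrossing gives a K₄, class A, or a 2-cut behind two roots. For the converse, Euler's formula. -}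
module Submission where

open import Defs hiding (sym; irrefl; size)
open import Data.Bool using (Bool; true; false; _∧_; _∨_; if_then_else_)
import Data.Bool.Properties as Bool
open import Data.Empty using (⊥) renaming (⊥-elim to absurd)
open import Data.Fin using (Fin; zero; suc; toℕ; _≟_; #_; punchOut)
open import Data.Fin.Patterns using (0F; 1F; 2F; 3F)
open import Data.Fin.Properties using (any?; all?; toℕ-injective; suc-injective; pigeonhole; punchOut-injective; <⇒≢)
open import Data.Fin.Subset as Subset using (Subset)
open import Data.Fin.Subset.Properties using (anySubset?) renaming (_∈?_ to _∈ₛ?_)
open import Data.List using (List; []; _∷_; _++_; [_]; length; map; concatMap; filter; reverse; allFin; lookup; cartesianProduct)
open import Data.List.Membership.DecPropositional using () renaming (_∈?_ to mem?)
open import Data.List.Membership.Propositional using (_∈_; _∉_)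
open import Data.List.Membership.Propositional.Properties using (∈-allFin; ∈-cartesianProduct⁺; ∈-filter⁺; ∈-filter⁻; ∈-lookup; ∈-map⁺; ∈-map⁻; ∈-∃++) renaming (∈-++⁺ʳ to ∈ʳ; ∈-++⁺ˡ to ∈ˡ; ∈-++⁻ to ∈⁻)
open import Data.List.Properties using (++-assoc; ++-identityʳ; length-filter; length-map; length-tabulate; map-++; unfold-reverse; ∷-injective; ∷ʳ-injective)
open import Data.List.Relation.Binary.Permutation.Propositional as ↭ using (_↭_; prep; ↭-refl; ↭-sym; module PermutationReasoning)
import Data.List.Relation.Binary.Permutation.Propositional.Properties as ↭P
open import Data.List.Relation.Binary.Pointwise using (Pointwise-≡⇒≡)
open import Data.List.Relation.Binary.Sublist.Heterogeneous.Properties using (toPointwise)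
open import Data.List.Relation.Binary.Sublist.Propositional using (_⊆_; []; _∷_; _∷ʳ_; ⊆-refl; ⊆-reflexive; ⊆-trans; minimum; from∈; to∈)
import Data.List.Relation.Binary.Sublist.Propositional.Properties as SubP
open SubP using (++⁺; ++⁺ʳ; ++⁺ˡ)
open import Data.List.Relation.Unary.All as All using (All; []; _∷_)
import Data.List.Relation.Unary.All.Properties as AllP
open import Data.List.Relation.Unary.AllPairs as AllPairs using (AllPairs; []; _∷_)
import Data.List.Relation.Unary.AllPairs.Properties as APP
open import Data.List.Relation.Unary.Any as Any using (Any; here; there)
open import Data.List.Relation.Unary.Any.Properties using (reverse⁺)
open import Data.List.Relation.Unary.Linked using (Linked; []; [-]; _∷_)
open import Data.List.Relation.Unary.Unique.Propositional using (Unique)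
open import Data.List.Relation.Unary.Unique.Propositional.Properties using (allFin⁺) renaming (filter⁺ to Unique-filter)
open import Data.Nat as ℕ using (ℕ; zero; suc; _+_; _≤_; _<_; _<ᵇ_; z≤n; s≤s)
open import Data.Nat.ListAction using (sum)
open import Data.Nat.Properties using (+-identityʳ; +-mono-<-≤; +-mono-≤; +-mono-≤-<; +-monoʳ-≤; +-monoˡ-≤; +-suc; <-cmp; <-irrefl; <ᵇ⇒<; <⇒<ᵇ; m≤n⇒m≤1+n; n≤1+n; n<1+n; n≮0; ≤-pred; ≤-refl; ≤-reflexive; ≤-trans; +-commutativeSemigroup; module ≤-Reasoning)
open import Algebra.Properties.CommutativeSemigroup +-commutativeSemigroup using (interchange)
open import Data.Product using (Σ; ∃; ∃₂; _×_; _,_; swap) renaming (proj₁ to fst; proj₂ to snd)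
open import Data.Product.Properties using (≡-dec)
open import Data.Sum as Sum using (_⊎_; [_,_]′) renaming (inj₁ to inl; inj₂ to inr)
open import Data.Unit using (⊤; tt)
open import Data.Vec as Vec using ([]; _∷_)
open import Data.Vec.Properties using ([]=⇒lookup; lookup⇒[]=; lookup∘tabulate)
open import Function using (mk⇔; Equivalence; _⇔_)
open import Function.Construct.Identity using (⇔-id)
open import Function.Construct.Symmetry using (⇔-sym)
open import Relation.Binary.Construct.Closure.ReflexiveTransitive using (Star; ε; _◅_; _◅◅_)
open import Relation.Binary.Definitions using (tri<; tri≈; tri>)
open import Relation.Binary.PropositionalEquality using (_≡_; _≢_; refl; sym; trans; cong; cong₂; subst; subst₂)
open import Relation.Nullary using (¬_; Dec; yes; no)
open import Relation.Nullary.Decidable using (¬?; map′; toWitness; toSum; ⌊_⌋) renaming (_×-dec_ to _×?_; _⊎-dec_ to _⊎?_; _→-dec_ to _→?_; decidable-stable to stable)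
open import Relation.Unary using () renaming (Decidable to Dec₁)

-- Walks

-- More edges make (ii) harder, so an answer (ii) for the graph with an added root edge serves the
-- original graph too, and only a rooted K₄ has to be brought back. The pieces behind a 2-cut `v`,
-- `s` are deleted, and `v`, `s` become adjacent roots of a smaller graph. Nominated vertices of
-- classes B, C, F are pairwise nonadjacent, so the smaller graph returns A, D or E, which become C,
-- E and F when the pieces are put back; B arises when the cut also separates the other two roots.
-- This explains the list of classes. In the two paths theorem, a set with at most three attachments
-- is first deleted, its attachments made adjacent, and later put back as a clique `X_T`. What
-- remains is drawn by induction as a shelling, a list of moves on a boundary walk, from which
-- rotations and Euler's formula follow without topology; a triangle that is not a face would
-- enclose a set with three attachments, and there is none. Vertex sets are predicates on a fixed
-- `Fin n`, so that deletion and contraction change no type.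

_∈?_ : ∀ {n} (v : Fin n) xs -> Dec (v ∈ xs)
_∈?_ = mem? _≟_

Dec₂ : ∀ {n} -> (Fin n -> Fin n -> Set) -> Set
Dec₂ {n} E = ∀ u v -> Dec (E u v)

-- `S` is demanded of every vertex except the first. Thus a walk may start at a vertex outside `S`,
-- such as a root, and concatenation has no side condition.
data W {n} (E : Fin n -> Fin n -> Set) (S : Fin n -> Set) : Fin n -> Fin n -> Set where
 ε    : ∀ {u} -> W E S u u
 step : ∀ {u w v} -> E u w -> S w -> W E S w v -> W E S u v

module _ {n} {E : Fin n -> Fin n -> Set} where

 infixr 5 _∙_
 _∙_ : ∀ {S u v w} -> W E S u v -> W E S v w -> W E S u w
 ε ∙ q = q
 step e s p ∙ q = step e s (p ∙ q)

 edge : ∀ {S u v} -> E u v -> S v -> W E S u v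
 edge e s = step e s ε

 W-end : ∀ {S u v} -> W E S u v -> u ≡ v ⊎ S v
 W-end ε = inl refl
 W-end (step e s p) with W-end p
 ... | inl refl = inr s
 ... | inr t = inr t

 W-end∈ : ∀ {S u v} -> S u -> W E S u v -> S v
 W-end∈ su ε = su
 W-end∈ su (step _ s p) = W-end∈ s p

 W-rev : (∀ {u v} -> E u v -> E v u) -> ∀ {S u v} -> S u -> W E S u v -> W E S v u
 W-rev sy su ε = ε
 W-rev sy su (step e s p) = W-rev sy s p ∙ edge (sy e) su

W-map : ∀ {n} {E E' : Fin n -> Fin n -> Set} {S S' : Fin n -> Set} ->
    (∀ {u v} -> E u v -> E' u v) -> (∀ {v} -> S v -> S' v) -> ∀ {u v} -> W E S u v -> W E' S' u v
W-map f g ε = ε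
W-map f g (step e s p) = step (f e) (g s) (W-map f g p)

W-mono : ∀ {n} {E : Fin n -> Fin n -> Set} {S S' : Fin n -> Set} ->
     (∀ {v} -> S v -> S' v) -> ∀ {u v} -> W E S u v -> W E S' u v
W-mono = W-map (λ e -> e)

W-ind : ∀ {n} {E : Fin n -> Fin n -> Set} {S : Fin n -> Set} (P : Fin n -> Set) ->
    (∀ {u v} -> P u -> E u v -> S v -> P v) -> ∀ {u v} -> P u -> W E S u v -> P v
W-ind P f pu ε = pu
W-ind P f pu (step e s p) = W-ind P f (f pu e s) p

W-keep : ∀ {n} {E : Fin n -> Fin n -> Set} {S : Fin n -> Set} (P : Fin n -> Set) ->
    (∀ {u v} -> P u -> E u v -> S v -> P v) -> ∀ {u v} -> P u -> W E S u v -> W E (λ z -> S z × P z) u v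
W-keep P f pu ε = ε
W-keep P f pu (step e s p) = step e (s , f pu e s) (W-keep P f (f pu e s) p)

module _ {A : Set} where
 cntL : {P : A -> Set} -> Dec₁ P -> List A -> ℕ
 cntL P? [] = 0
 cntL P? (x ∷ xs) with P? x
 ... | yes _ = suc (cntL P? xs)
 ... | no _ = cntL P? xs

 cntL-mono : {P Q : A -> Set} (P? : Dec₁ P) (Q? : Dec₁ Q) -> (∀ {x} -> P x -> Q x) ->
       ∀ xs -> cntL P? xs ≤ cntL Q? xs
 cntL-mono P? Q? f [] = z≤n
 cntL-mono P? Q? f (x ∷ xs) with P? x | Q? x
 ... | yes p | yes q = s≤s (cntL-mono P? Q? f xs)
 ... | yes p | no ¬q = absurd (¬q (f p))
 ... | no _ | yes q = m≤n⇒m≤1+n (cntL-mono P? Q? f xs)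
 ... | no _ | no _ = cntL-mono P? Q? f xs

 cntL-strict : {P Q : A -> Set} (P? : Dec₁ P) (Q? : Dec₁ Q) -> (∀ {x} -> P x -> Q x) ->
        ∀ {z} -> Q z -> ¬ P z -> ∀ {xs} -> z ∈ xs -> cntL P? xs < cntL Q? xs
 cntL-strict P? Q? f {z} qz ¬pz {x ∷ xs} (here refl) with P? x | Q? x
 ... | yes p | _ = absurd (¬pz p)
 ... | no _ | yes q = s≤s (cntL-mono P? Q? f xs)
 ... | no _ | no ¬q = absurd (¬q qz)
 cntL-strict P? Q? f {z} qz ¬pz {x ∷ xs} (there m) with P? x | Q? x
 ... | yes p | yes q = s≤s (cntL-strict P? Q? f qz ¬pz m)
 ... | yes p | no ¬q = absurd (¬q (f p))
 ... | no _ | yes q = m≤n⇒m≤1+n (cntL-strict P? Q? f qz ¬pz m)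
 ... | no _ | no _ = cntL-strict P? Q? f qz ¬pz m

cnt : ∀ {n} {P : Fin n -> Set} -> Dec₁ P -> ℕ
cnt {n} P? = cntL P? (allFin n)

cnt-mono : ∀ {n} {P Q : Fin n -> Set} (P? : Dec₁ P) (Q? : Dec₁ Q) -> (∀ {x} -> P x -> Q x) ->
      cnt P? ≤ cnt Q?
cnt-mono {n} P? Q? f = cntL-mono P? Q? f (allFin n)

cnt-strict : ∀ {n} {P Q : Fin n -> Set} (P? : Dec₁ P) (Q? : Dec₁ Q) -> (∀ {x} -> P x -> Q x) ->
       ∀ z -> Q z -> ¬ P z -> cnt P? < cnt Q?
cnt-strict P? Q? f z qz ¬pz = cntL-strict P? Q? f qz ¬pz (∈-allFin z)

_∖_ : ∀ {n} -> (Fin n -> Set) -> Fin n -> (Fin n -> Set)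
(S ∖ w) v = S v × v ≢ w

∖? : ∀ {n} {S : Fin n -> Set} -> Dec₁ S -> ∀ w -> Dec₁ (S ∖ w)
∖? S? w v = S? v ×? ¬? (v ≟ w)

module _ {n} {E : Fin n -> Fin n -> Set} where

 -- Cut the walk at its last visit to `z`: the remainder never enters `z` again. This removes
 -- repetitions without a notion of path.
 W-last : ∀ {S} z {u v} -> W E S u v -> W E (S ∖ z) u v ⊎ W E (S ∖ z) z v
 W-last z ε = inl ε
 W-last z (step {w = w} e s p) with W-last z p
 ... | inr q = inr q
 ... | inl q with w ≟ z
 ... | yes refl = inr q
 ... | no w≢z = inl (step e (s , w≢z) q)

 private
  -- The fuel `k` bounds the number of vertices that may still be entered. After a first step to `w`
  -- the rest can avoid `w`, by `W-last`, so the bound drops.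
  W-dec : ∀ k {S} (E? : Dec₂ E) (S? : Dec₁ S) -> cnt S? ≤ k -> ∀ u v -> Dec (W E S u v)
  W-dec k E? S? le u v with u ≟ v
  ... | yes refl = yes ε
  W-dec zero E? S? le u v | no u≢v = no λ
   { ε -> u≢v refl
   ; (step {w = w} _ s _) -> n≮0 (≤-trans (cnt-strict {P = λ _ -> ⊥} (λ _ -> no λ ()) S? (λ ()) w s (λ ())) le) }
  W-dec (suc k) {S} E? S? le u v | no u≢v = map′ to from (any? λ w -> nxt w)
   where
   nxt : ∀ w -> Dec (E u w × S w × W E (S ∖ w) w v)
   nxt w with S? w
   ... | no ¬s = no λ (_ , s , _) -> ¬s s
   ... | yes s = map′ (λ (e , p) -> e , s , p) (λ (e , _ , p) -> e , p)
      (E? u w ×? W-dec k E? (∖? S? w) (≤-pred (≤-trans (cnt-strict (∖? S? w) S? fst w s (λ x -> snd x refl)) le)) w v)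
   to : (∃ λ w -> E u w × S w × W E (S ∖ w) w v) -> W E S u v
   to (w , e , s , p) = step e s (W-mono fst p)
   from : W E S u v -> ∃ λ w -> E u w × S w × W E (S ∖ w) w v
   from ε = absurd (u≢v refl)
   from (step {w = w} e s p) with W-last w p
   ... | inl q = w , e , s , q
   ... | inr q = w , e , s , q

 W? : ∀ {S} -> Dec₂ E -> Dec₁ S -> ∀ u v -> Dec (W E S u v)
 W? E? S? = W-dec _ E? S? ≤-refl

 -- Vertices of `S` outside `K` touch `K` at `z` only, so each excursion into `K` ends at `z`, and
 -- the walk can be continued from there. The first vertex need not lie in `S`, hence the extra
 -- hypothesis on `u`: if it touches `K`, it is `z` or adjacent to `z`.
 W-detour : ∀ {S K : Fin n -> Set} (K? : Dec₁ K) {z v} -> ¬ K v ->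
       (∀ {o k} -> S o -> ¬ K o -> K k -> E k o -> o ≡ z) ->
       (∀ {o k} -> S o -> ¬ K o -> K k -> E o k -> o ≡ z) ->
       ∀ {u} -> W E S u v ->
       (¬ K u -> (∀ {k} -> K k -> E u k -> u ≡ z ⊎ (E u z)) -> W E (λ y -> S y × ¬ K y) u v)
       × (K u -> S z × ¬ K z × W E (λ y -> S y × ¬ K y) z v)
 W-detour K? ¬kv ex en ε = (λ _ _ -> ε) , λ ku -> absurd (¬kv ku)
 W-detour {S} {K} K? {z} ¬kv ex en {u} (step {w = w} e s p) with K? w | W-detour K? ¬kv ex en p
 ... | yes kw | (_ , g) = out , λ _ -> g kw
  where
  out : ¬ K u -> (∀ {k} -> K k -> E u k -> u ≡ z ⊎ (E u z)) -> _
  out ¬ku h with h kw e | g kw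
  ... | inl refl | (_ , _ , q) = q
  ... | inr e' | (sz , ¬kz , q) = step e' (sz , ¬kz) q
 ... | no ¬kw | (f , _) = (λ _ _ -> step e (s , ¬kw) q) , λ ku -> h ku
  where
  q = f ¬kw (λ kk ek -> inl (en s ¬kw kk ek))
  h : K u -> _
  h ku with ex s ¬kw ku e
  ... | refl = s , ¬kw , q

 W-first : ∀ {S Q : Fin n -> Set} (Q? : Dec₁ Q) {u v} -> W E S u v -> Q v ->
      ∃ λ w -> Q w × (u ≡ w ⊎ (¬ Q u × ∃ λ w' -> W E (λ y -> S y × ¬ Q y) u w' × E w' w × S w))
 W-first Q? {u} p qv with Q? u
 ... | yes qu = u , qu , inl refl
 W-first Q? ε qv | no ¬qu = absurd (¬qu qv)
 W-first Q? {u} (step {w = w} e s p) qv | no ¬qu with W-first Q? p qv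
 ... | _ , q , inl refl = _ , q , inr (¬qu , u , ε , e , s)
 ... | x , q , inr (¬qw , w' , r , e' , sx) = x , q , inr (¬qu , w' , step e (s , ¬qw) r , e' , sx)

-- Menger's theorem for three paths

module Menger {n : ℕ} where
 V = Fin n
 Arcs = List (V × V)

 Arc : Arcs -> V -> V -> Set
 Arc E u v = (u , v) ∈ E

 -- A path from u to v; the list omits the start u.
 data Pth (E : Arcs) : V -> V -> List V -> Set where
  nil  : ∀ {v} -> Pth E v v []
  cons : ∀ {u w v l} -> (u , w) ∈ E -> u ∉ w ∷ l -> Pth E w v l -> Pth E u v (w ∷ l)

 Pth-map : ∀ {E E'} -> (∀ {a} -> a ∈ E -> a ∈ E') -> ∀ {u v l} -> Pth E u v l -> Pth E' u v l
 Pth-map f nil = nil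
 Pth-map f (cons e u∉ p) = cons (f e) u∉ (Pth-map f p)

 last∈ : ∀ {E u v l} -> Pth E u v l -> v ∈ u ∷ l
 last∈ nil = here refl
 last∈ (cons _ _ p) = there (last∈ p)

 start-only : ∀ {E u v l} -> Pth E u v l -> u ∉ l
 start-only nil ()
 start-only (cons _ u∉ _) = u∉

 join : ∀ {E u v w l l'} -> Pth E u v l -> Pth E v w l' -> (∀ {z} -> z ∈ u ∷ l -> z ∈ l' -> ⊥) -> Pth E u w (l ++ l')
 join nil q d = q
 join {l = w ∷ l} (cons e u∉ p) q d = cons e (λ m -> [ u∉ , (λ m' -> d (here refl) m') ]′ (∈⁻ (w ∷ l) m)) (join p q (λ m -> d (there m)))

 prefix : ∀ {E u v l z} -> Pth E u v l -> z ∈ u ∷ l -> z ≢ v -> u ≢ v × W (Arc E) (λ w -> w ∈ u ∷ l × w ≢ v) u z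
 prefix nil (here refl) ne = absurd (ne refl)
 prefix (cons e u∉ p) (here refl) ne = ne , ε
 prefix (cons e u∉ p) (there m) ne with prefix p m ne
 ... | w≢v , q = (λ { refl -> u∉ (last∈ p) }) , step e (there (here refl) , w≢v) (W-mono (λ (a , b) -> there a , b) q)

 walk : ∀ {E u v l z} -> Pth E u v l -> z ∈ u ∷ l -> W (Arc E) (_∈ l) z v
 walk nil (here refl) = ε
 walk (cons e u∉ p) (here refl) = step e (here refl) (W-mono there (walk p (here refl)))
 walk (cons e u∉ p) (there m) = W-mono there (walk p m)

 -- The vertices `s` and `t` may coincide. `W` does not test its first vertex, hence the separate
 -- conditions on `a`.
 Sep : Arcs -> (V -> Set) -> (V -> Set) -> V -> V -> Set
 Sep E A B s t = ∀ {a b} -> A a -> B b -> a ≢ s -> a ≢ t -> W (Arc E) (λ v -> v ≢ s × v ≢ t) a b -> ⊥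

 record Three (E : Arcs) (A B : V -> Set) : Set where
  field
   a b : Fin 3 -> V
   l   : Fin 3 -> List V
   a∈  : ∀ i -> A (a i)
   b∈  : ∀ i -> B (b i)
   pth : ∀ i -> Pth E (a i) (b i) (l i)
   dis : ∀ {i j z} -> z ∈ a i ∷ l i -> z ∈ a j ∷ l j -> i ≡ j

 one-of : V -> V -> V -> V -> Set
 one-of p q r v = v ≡ p ⊎ v ≡ q ⊎ v ≡ r

 private
  pig2 : ∀ (f : Fin 3 -> V) -> (∀ {i j} -> f i ≡ f j -> i ≡ j) -> ∀ {p q} -> (∀ i -> f i ≡ p ⊎ f i ≡ q) -> ⊥
  pig2 f inj g with g 0F | g 1F | g 2F
  ... | inl x | inl y | _ with () ← inj (trans x (sym y))
  ... | inr x | inr y | _ with () ← inj (trans x (sym y))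
  ... | inl x | inr _ | inl y with () ← inj (trans x (sym y))
  ... | inr x | inl _ | inr y with () ← inj (trans x (sym y))
  ... | inl _ | inr x | inr y with () ← inj (trans x (sym y))
  ... | inr _ | inl x | inl y with () ← inj (trans x (sym y))

 -- Two values cannot accommodate three distinct images, so none of `p`, `q`, `r` is missed, and `p`
 -- differs from `q`.
 hit : ∀ (f : Fin 3 -> V) -> (∀ {i j} -> f i ≡ f j -> i ≡ j) -> ∀ {p q r} -> (∀ i -> one-of p q r (f i)) ->
    (∃ λ i -> f i ≡ p) × p ≢ q
 hit f inj {p} {q} {r} g = found , λ { refl -> pig2 f inj (λ i -> [ inl , (λ x -> x) ]′ (g i)) }
  where
  found : ∃ λ i -> f i ≡ p
  found with any? (λ i -> f i ≟ p)
  ... | yes x = x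
  ... | no no-hit = absurd (pig2 f inj (λ i -> [ (λ e -> absurd (no-hit (i , e))) , (λ x -> x) ]′ (g i)))

 private
  rot : ∀ {p q r v} -> one-of p q r v -> one-of q r p v
  rot (inl x) = inr (inr x)
  rot (inr (inl x)) = inl x
  rot (inr (inr x)) = inr (inl x)

 -- Göring's proof, run on arcs so that initial and final segments never use the removed arc.
 menger : V -> ∀ E {A B : V -> Set} (A? : Dec₁ A) (B? : Dec₁ B) -> (∃₂ λ s t -> Sep E A B s t) ⊎ Three E A B
 -- Without arcs all paths are single vertices: the question is whether `A` and `B` share three
 -- vertices.
 menger v₀ [] {A} {B} A? B? = base
  where
  AB? = λ v -> A? v ×? B? v
  sep : ∀ s t -> (∀ v -> A v × B v -> v ≡ s ⊎ v ≡ t) -> Sep [] A B s t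
  sep s t f aa bb ne₁ ne₂ ε = [ ne₁ , ne₂ ]′ (f _ (aa , bb))
  base : (∃₂ λ s t -> Sep [] A B s t) ⊎ Three [] A B
  base with any? AB?
  ... | no ¬s = inl (v₀ , v₀ , sep v₀ v₀ (λ v m -> absurd (¬s (v , m))))
  ... | yes (s , ms) with any? (λ v -> AB? v ×? ¬? (v ≟ s))
  ... | no ¬t = inl (s , s , sep s s h)
   where
    h : ∀ v -> A v × B v -> v ≡ s ⊎ v ≡ s
    h v m with v ≟ s
    ... | yes e = inl e
    ... | no e = absurd (¬t (v , m , e))
  ... | yes (t , mt , t≢s) with any? (λ v -> AB? v ×? ¬? (v ≟ s) ×? ¬? (v ≟ t))
  ... | no ¬r = inl (s , t , sep s t h)
   where
    h : ∀ v -> A v × B v -> v ≡ s ⊎ v ≡ t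
    h v m with v ≟ s | v ≟ t
    ... | yes e | _ = inl e
    ... | no _ | yes e = inr e
    ... | no e | no e' = absurd (¬r (v , m , e , e'))
  ... | yes (r , mr , r≢s , r≢t) = inr record
   { a = f ; b = f ; l = λ _ -> [] ; a∈ = λ i -> fst (m i) ; b∈ = λ i -> snd (m i) ; pth = λ _ -> nil
   ; dis = λ { {i} {j} (here refl) (here e) -> inj i j e } }
   where
   f : Fin 3 -> V
   f 0F = s
   f 1F = t
   f 2F = r
   m : ∀ i -> A (f i) × B (f i)
   m 0F = ms
   m 1F = mt
   m 2F = mr
   inj : ∀ i j -> f i ≡ f j -> i ≡ j
   inj 0F 0F e = refl
   inj 0F 1F e = absurd (t≢s (sym e))
   inj 0F 2F e = absurd (r≢s (sym e))
   inj 1F 0F e = absurd (t≢s e)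
   inj 1F 1F e = refl
   inj 1F 2F e = absurd (r≢t (sym e))
   inj 2F 0F e = absurd (r≢s e)
   inj 2F 1F e = absurd (r≢t e)
   inj 2F 2F e = refl
 menger v₀ ((x , y) ∷ E) {A} {B} A? B? with menger v₀ E A? B?
 ... | inr T = inr record { Three T ; pth = λ i -> Pth-map there (Three.pth T i) }
 -- Together with `t₁` and `t₂`, either end of the arc `x y` meets every walk from `A` to `B`. So
 -- two vertices separating `A` from `t₁`, `t₂`, `x`, or separating `t₁`, `t₂`, `y` from `B`, answer
 -- the question. Otherwise three paths to the one triple and three from the other are glued at
 -- `t₁`, at `t₂` and along the arc.
 ... | inl (t₁ , t₂ , sepE)
  with menger v₀ E {B = one-of t₁ t₂ x} A? (λ v -> (v ≟ t₁) ⊎? ((v ≟ t₂) ⊎? (v ≟ x)))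
 ... | inl (s , t , sep) = inl (s , t , sep')
  where
  sep' : Sep ((x , y) ∷ E) A B s t
  sep' {a} {b} aa bb a≢s a≢t p = go aa a≢s a≢t p ε
   where
   go : ∀ {a u} -> A a -> a ≢ s -> a ≢ t -> W (Arc ((x , y) ∷ E)) (λ v -> v ≢ s × v ≢ t) u b ->
      W (Arc E) (λ v -> (v ≢ s × v ≢ t) × v ≢ t₁ × v ≢ t₂ × v ≢ x) a u -> ⊥
   go {a} {u} aa a≢s a≢t p q with (u ≟ t₁) ⊎? ((u ≟ t₂) ⊎? (u ≟ x))
   ... | yes hit = sep aa hit a≢s a≢t (W-mono fst q)
   go aa a≢s a≢t ε q | no ¬h = sepE aa bb (λ e -> sep aa (inl e) a≢s a≢t ε) (λ e -> sep aa (inr (inl e)) a≢s a≢t ε)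
                  (W-mono (λ (_ , c , d , _) -> c , d) q)
   go aa a≢s a≢t (step (here refl) m p) q | no ¬h = ¬h (inr (inr refl))
   go aa a≢s a≢t (step {w = w} (there e) m p) q | no ¬h with (w ≟ t₁) ⊎? ((w ≟ t₂) ⊎? (w ≟ x))
   ... | yes h = sep aa h a≢s a≢t (W-mono fst q ∙ edge e m)
   ... | no ¬h' = go aa a≢s a≢t p (q ∙ edge e (m , (λ e -> ¬h' (inl e)) , (λ e -> ¬h' (inr (inl e))) , (λ e -> ¬h' (inr (inr e)))))
 ... | inr Π
  with menger v₀ E {A = one-of t₁ t₂ y} (λ v -> (v ≟ t₁) ⊎? ((v ≟ t₂) ⊎? (v ≟ y))) B?
 ... | inl (s , t , sep) = inl (s , t , sep')
  where
  Seen : V -> V -> Set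
  Seen u b = W (Arc E) (λ v -> v ≢ s × v ≢ t) u b
  go : ∀ {u b} -> B b -> u ≢ s -> u ≢ t -> W (Arc ((x , y) ∷ E)) (λ v -> v ≢ s × v ≢ t) u b ->
     W (Arc E) (λ v -> v ≢ t₁ × v ≢ t₂) u b × Seen u b × u ≢ t₁ × u ≢ t₂
  at : ∀ {u b} -> B b -> u ≢ s -> u ≢ t -> Seen u b -> u ≢ t₁ × u ≢ t₂ × u ≢ y
  at bb n₁ n₂ q = (λ e -> sep (inl e) bb n₁ n₂ q) , (λ e -> sep (inr (inl e)) bb n₁ n₂ q) , (λ e -> sep (inr (inr e)) bb n₁ n₂ q)
  go bb n₁ n₂ ε with at bb n₁ n₂ ε
  ... | m₁ , m₂ , _ = ε , ε , m₁ , m₂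
  go bb n₁ n₂ (step {w = w} e (k₁ , k₂) p) with go bb k₁ k₂ p
  ... | q , r , m₁ , m₂ with e
  ... | here refl = absurd (snd (snd (at bb k₁ k₂ r)) refl)
  ... | there e' with at bb n₁ n₂ (step e' (k₁ , k₂) r)
  ... | o₁ , o₂ , _ = step e' (m₁ , m₂) q , step e' (k₁ , k₂) r , o₁ , o₂
  sep' : Sep ((x , y) ∷ E) A B s t
  sep' aa bb a≢s a≢t p with go bb a≢s a≢t p
  ... | q , _ , m₁ , m₂ = sepE aa bb m₁ m₂ q
 ... | inr Ρ = inr res
  where
  module Π = Three Π
  module Ρ = Three Ρ
  πinj : ∀ {i j} -> Π.b i ≡ Π.b j -> i ≡ j
  πinj {i} {j} e = Π.dis (last∈ (Π.pth i)) (subst (_∈ _) (sym e) (last∈ (Π.pth j)))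
  ρinj : ∀ {i j} -> Ρ.a i ≡ Ρ.a j -> i ≡ j
  ρinj e = Ρ.dis (here refl) (here e)
  c d : Fin 3 -> V
  c 0F = t₁
  c 1F = t₂
  c 2F = x
  d 0F = t₁
  d 1F = t₂
  d 2F = y
  h1 = hit Π.b πinj Π.b∈
  h2 = hit Π.b πinj (λ i -> rot (Π.b∈ i))
  h3 = hit Π.b πinj (λ i -> rot (rot (Π.b∈ i)))
  k1 = hit Ρ.a ρinj Ρ.a∈
  k2 = hit Ρ.a ρinj (λ i -> rot (Ρ.a∈ i))
  k3 = hit Ρ.a ρinj (λ i -> rot (rot (Ρ.a∈ i)))
  pi : ∀ i -> ∃ λ j -> Π.b j ≡ c i
  pi 0F = fst h1
  pi 1F = fst h2
  pi 2F = fst h3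
  ro : ∀ i -> ∃ λ j -> Ρ.a j ≡ d i
  ro 0F = fst k1
  ro 1F = fst k2
  ro 2F = fst k3
  c-inj : ∀ i j -> c i ≡ c j -> i ≡ j
  c-inj 0F 0F e = refl
  c-inj 0F 1F e = absurd (snd h1 e)
  c-inj 0F 2F e = absurd (snd h3 (sym e))
  c-inj 1F 0F e = absurd (snd h1 (sym e))
  c-inj 1F 1F e = refl
  c-inj 1F 2F e = absurd (snd h2 e)
  c-inj 2F 0F e = absurd (snd h3 e)
  c-inj 2F 1F e = absurd (snd h2 (sym e))
  c-inj 2F 2F e = refl
  d-inj : ∀ i j -> d i ≡ d j -> i ≡ j
  d-inj 0F 0F e = refl
  d-inj 0F 1F e = absurd (snd k1 e)
  d-inj 0F 2F e = absurd (snd k3 (sym e))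
  d-inj 1F 0F e = absurd (snd k1 (sym e))
  d-inj 1F 1F e = refl
  d-inj 1F 2F e = absurd (snd k2 e)
  d-inj 2F 0F e = absurd (snd k3 e)
  d-inj 2F 1F e = absurd (snd k2 (sym e))
  d-inj 2F 2F e = refl
  A' B' : Fin 3 -> V
  A' i = Π.a (fst (pi i))
  B' i = Ρ.b (fst (ro i))
  L M : Fin 3 -> List V
  L i = Π.l (fst (pi i))
  M i = Ρ.l (fst (ro i))
  π : ∀ i -> Pth E (A' i) (c i) (L i)
  π i = subst (λ z -> Pth E (A' i) z (L i)) (snd (pi i)) (Π.pth (fst (pi i)))
  ρ : ∀ i -> Pth E (d i) (B' i) (M i)
  ρ i = subst (λ z -> Pth E z (B' i) (M i)) (snd (ro i)) (Ρ.pth (fst (ro i)))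
  πdis : ∀ {i j z} -> z ∈ A' i ∷ L i -> z ∈ A' j ∷ L j -> i ≡ j
  πdis {i} {j} m m' = c-inj i j (trans (sym (snd (pi i))) (trans (cong Π.b (Π.dis m m')) (snd (pi j))))
  ρdis : ∀ {i j z} -> z ∈ d i ∷ M i -> z ∈ d j ∷ M j -> i ≡ j
  ρdis {i} {j} {z} m m' = d-inj i j (trans (sym (snd (ro i))) (trans (cong Ρ.a (Ρ.dis (tr i m) (tr j m'))) (snd (ro j))))
   where
   tr : ∀ i -> z ∈ d i ∷ M i -> z ∈ Ρ.a (fst (ro i)) ∷ M i
   tr i = subst (λ q -> z ∈ q ∷ M i) (sym (snd (ro i)))
  t : Fin 2 -> V
  t 0F = t₁
  t 1F = t₂
  emb : Fin 2 -> Fin 3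
  emb 0F = 0F
  emb 1F = 1F
  tc : ∀ k -> t k ≡ c (emb k)
  tc 0F = refl
  tc 1F = refl
  td : ∀ k -> t k ≡ d (emb k)
  td 0F = refl
  td 1F = refl
  -- A common vertex other than `t₁`, `t₂` would join an initial segment to a final one by a walk
  -- that `sepE` forbids; it matters here that neither family uses the arc `x y`.
  cross : ∀ {i j z} -> z ∈ A' i ∷ L i -> z ∈ d j ∷ M j -> z ≢ t₁ -> z ≢ t₂ -> ⊥
  cross {i} {j} {z} m m' n₁ n₂ = sepE (Π.a∈ _) (Ρ.b∈ _) (s≢ 0F) (s≢ 1F) (first ∙ second)
   where
   n' : ∀ k -> z ≢ t k
   n' 0F = n₁
   n' 1F = n₂
   off : ∀ k {v} -> v ∈ A' i ∷ L i -> v ≡ t k -> i ≡ emb k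
   off k mv e = πdis mv (subst (_∈ _) (sym (trans e (tc k))) (last∈ (π (emb k))))
   s≢ : ∀ k -> A' i ≢ t k
   s≢ k e with off k (here refl) e
   ... | refl = fst (prefix (π i) m (λ e' -> n' k (trans e' (sym (tc k))))) (trans e (tc k))
   first : W (Arc E) (λ v -> v ≢ t₁ × v ≢ t₂) (A' i) z
   first with z ≟ c i
   ... | yes refl = W-mono (λ {v} mv -> (λ e -> bad 0F (there mv) e) , (λ e -> bad 1F (there mv) e)) (walk (π i) (here refl))
    where
    bad : ∀ k {v} -> v ∈ A' i ∷ L i -> v ≡ t k -> ⊥
    bad k mv e with off k mv e
    ... | refl = n' k (sym (tc k))
   ... | no z≢ = W-mono (λ {v} (mv , ne) -> (λ e -> bad 0F mv ne e) , (λ e -> bad 1F mv ne e)) (snd (prefix (π i) m z≢))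
    where
    bad : ∀ k {v} -> v ∈ A' i ∷ L i -> v ≢ c i -> v ≡ t k -> ⊥
    bad k mv ne e with off k mv e
    ... | refl = ne (trans e (tc k))
   second : W (Arc E) (λ v -> v ≢ t₁ × v ≢ t₂) z (B' j)
   second = W-mono (λ {v} mv -> (λ e -> bad 0F mv e) , (λ e -> bad 1F mv e)) (walk (ρ j) m')
    where
    bad : ∀ k {v} -> v ∈ M j -> v ≡ t k -> ⊥
    bad k mv e with ρdis {i = j} {j = emb k} (there mv) (here (trans e (td k)))
    ... | refl = start-only (ρ j) (subst (_∈ _) (trans e (td k)) mv)
  meet : ∀ {i j z} -> z ∈ A' i ∷ L i -> z ∈ d j ∷ M j -> ∃ λ k -> z ≡ t k × i ≡ emb k × j ≡ emb k
  meet {i} {j} {z} m m' with z ≟ t₁ | z ≟ t₂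
  ... | yes refl | _ = 0F , refl , πdis {i} {0F} m (last∈ (π 0F)) , ρdis {j} {0F} m' (here refl)
  ... | no _ | yes refl = 1F , refl , πdis {i} {1F} m (last∈ (π 1F)) , ρdis {j} {1F} m' (here refl)
  ... | no n₁ | no n₂ = absurd (cross {i} {j} m m' n₁ n₂)
  LM : Fin 3 -> List V
  LM 0F = L 0F ++ M 0F
  LM 1F = L 1F ++ M 1F
  LM 2F = L 2F ++ y ∷ M 2F
  E+ = (x , y) ∷ E
  up : ∀ {u v l} -> Pth E u v l -> Pth E+ u v l
  up = Pth-map there
  tail-dis : ∀ k {z} -> z ∈ A' (emb k) ∷ L (emb k) -> z ∈ M (emb k) -> ⊥
  tail-dis k m m' with meet {emb k} {emb k} m (there m')
  tail-dis 0F m m' | 0F , refl , _ , _ = start-only (ρ 0F) m'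
  tail-dis 0F m m' | 1F , refl , () , _
  tail-dis 1F m m' | 0F , refl , () , _
  tail-dis 1F m m' | 1F , refl , _ , _ = start-only (ρ 1F) m'
  dis2 : ∀ {z} -> z ∈ A' 2F ∷ L 2F -> z ∈ y ∷ M 2F -> ⊥
  dis2 m m' with meet {2F} {2F} m m'
  ... | 0F , _ , () , _
  ... | 1F , _ , () , _
  path : ∀ i -> Pth E+ (A' i) (B' i) (LM i)
  path 0F = join (up (π 0F)) (up (ρ 0F)) (tail-dis 0F)
  path 1F = join (up (π 1F)) (up (ρ 1F)) (tail-dis 1F)
  path 2F = join (up (π 2F)) (cons (here refl) (λ m -> dis2 (last∈ (π 2F)) m) (up (ρ 2F))) dis2
  split : ∀ i {z} -> z ∈ A' i ∷ LM i -> z ∈ A' i ∷ L i ⊎ z ∈ d i ∷ M i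
  split i (here e) = inl (here e)
  split 0F (there m) = [ (λ a -> inl (there a)) , (λ a -> inr (there a)) ]′ (∈⁻ (L 0F) m)
  split 1F (there m) = [ (λ a -> inl (there a)) , (λ a -> inr (there a)) ]′ (∈⁻ (L 1F) m)
  split 2F (there m) = [ (λ a -> inl (there a)) , inr ]′ (∈⁻ (L 2F) m)
  res : Three E+ A B
  res = record
   { a = A' ; b = B' ; l = LM ; a∈ = λ i -> Π.a∈ _ ; b∈ = λ i -> Ρ.b∈ _ ; pth = path ; dis = λ {i} {j} m m' -> dd {i} {j} (split i m) (split j m') }
   where
   dd : ∀ {i j z} -> z ∈ A' i ∷ L i ⊎ z ∈ d i ∷ M i -> z ∈ A' j ∷ L j ⊎ z ∈ d j ∷ M j -> i ≡ j
   dd {i} {j} (inl m) (inl m') = πdis {i} {j} m m'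
   dd {i} {j} (inr m) (inr m') = ρdis {i} {j} m m'
   dd {i} {j} (inl m) (inr m') = let (_ , _ , p , q) = meet {i} {j} m m' in trans p (sym q)
   dd {i} {j} (inr m) (inl m') = let (_ , _ , p , q) = meet {j} {i} m' m in trans q (sym p)

-- Plane maps as shellings

-- An open walk u (part of the boundary of the outer face) is modified by
-- attaching a pendant vertex, or by covering two consecutive edges with a triangle.
-- The lists record the new vertices, edges and triangles.
data Sh {n} (u₀ : List (Fin n)) : List (Fin n) -> List (Fin n) -> List (Fin n × Fin n) -> List (Fin n × Fin n × Fin n) -> Set where
 start : Sh u₀ u₀ [] [] []
 pend  : ∀ {Ws Es Ts} l p r v -> Sh u₀ (l ++ p ∷ r) Ws Es Ts -> Sh u₀ (l ++ p ∷ v ∷ p ∷ r) (v ∷ Ws) ((p , v) ∷ Es) Ts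
 cov   : ∀ {Ws Es Ts} l a b c r -> Sh u₀ (l ++ a ∷ b ∷ c ∷ r) Ws Es Ts -> Sh u₀ (l ++ a ∷ c ∷ r) Ws ((a , c) ∷ Es) ((a , b , c) ∷ Ts)

Adj± : ∀ {n} -> List (Fin n × Fin n) -> Fin n -> Fin n -> Set
Adj± Es u v = (u , v) ∈ Es ⊎ (v , u) ∈ Es

Adj±-sym : ∀ {n} (Es : List (Fin n × Fin n)) {u v} -> Adj± Es u v -> Adj± Es v u
Adj±-sym Es (inl x) = inr x
Adj±-sym Es (inr x) = inl x

infixr 4 _⨾_
_⨾_ : ∀ {n} {u v w : List (Fin n)} {W₁ W₂ E₁ E₂ T₁ T₂} -> Sh u v W₁ E₁ T₁ -> Sh v w W₂ E₂ T₂ -> Sh u w (W₂ ++ W₁) (E₂ ++ E₁) (T₂ ++ T₁)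
s ⨾ start = s
s ⨾ pend l p r v t = pend l p r v (s ⨾ t)
s ⨾ cov l a b c r t = cov l a b c r (s ⨾ t)

module _ {A : Set} where
 re : ∀ (pre l x post : List A) -> pre ++ (l ++ x) ++ post ≡ (pre ++ l) ++ (x ++ post)
 re pre l x post = trans (cong (pre ++_) (++-assoc l x post)) (sym (++-assoc pre l (x ++ post)))

ctx : ∀ {n} {u v : List (Fin n)} {Ws Es Ts} pre post -> Sh u v Ws Es Ts -> Sh (pre ++ u ++ post) (pre ++ v ++ post) Ws Es Ts
ctx pre post start = start
ctx {u = u} pre post (pend l p r v s) =
 subst (λ z -> Sh (pre ++ u ++ post) z _ _ _) (sym (re pre l (p ∷ v ∷ p ∷ r) post))
  (pend (pre ++ l) p (r ++ post) v (subst (λ z -> Sh (pre ++ u ++ post) z _ _ _) (re pre l (p ∷ r) post) (ctx pre post s)))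
ctx {u = u} pre post (cov l a b c r s) =
 subst (λ z -> Sh (pre ++ u ++ post) z _ _ _) (sym (re pre l (a ∷ c ∷ r) post))
  (cov (pre ++ l) a b c (r ++ post) (subst (λ z -> Sh (pre ++ u ++ post) z _ _ _) (re pre l (a ∷ b ∷ c ∷ r) post) (ctx pre post s)))

module _ {A : Set} {R : A -> A -> Set} where
 Linked-retail : ∀ l {x s s'} -> Linked R (l ++ x ∷ s) -> (Linked R (x ∷ s) -> Linked R (x ∷ s')) -> Linked R (l ++ x ∷ s')
 Linked-retail [] k f = f k
 Linked-retail (y ∷ []) (r ∷ k) f = r ∷ f k
 Linked-retail (y ∷ z ∷ l) (r ∷ k) f = r ∷ Linked-retail (z ∷ l) k f

 Linked-tail : ∀ {x xs} -> Linked R (x ∷ xs) -> Linked R xs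
 Linked-tail [-] = []
 Linked-tail (_ ∷ k) = k

 Linked-drop : ∀ l {s} -> Linked R (l ++ s) -> Linked R s
 Linked-drop [] k = k
 Linked-drop (x ∷ l) k = Linked-drop l (Linked-tail k)

Linked-map : ∀ {A : Set} {R R' : A -> A -> Set} -> (∀ {x y} -> R x y -> R' x y) -> ∀ {xs} -> Linked R xs -> Linked R' xs
Linked-map f [] = []
Linked-map f [-] = [-]
Linked-map f (r ∷ k) = f r ∷ Linked-map f k

module _ {A : Set} where
 ⊆-split : ∀ (l : List A) {r xs} -> xs ⊆ l ++ r -> ∃₂ λ ys zs -> xs ≡ ys ++ zs × ys ⊆ l × zs ⊆ r
 ⊆-split [] τ = [] , _ , refl , [] , τ
 ⊆-split (y ∷ l) (.y ∷ʳ τ) with ⊆-split l τ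
 ... | ys , zs , e , p , q = ys , zs , e , y ∷ʳ p , q
 ⊆-split (y ∷ l) (refl ∷ τ) with ⊆-split l τ
 ... | ys , zs , refl , p , q = y ∷ ys , zs , refl , refl ∷ p , q

 -- A list without equal neighbours picks at most one of two adjacent copies of `p`, so one copy can
 -- be deleted.
 destutter : ∀ l {p : A} {s xs} -> Linked _≢_ xs -> xs ⊆ l ++ p ∷ p ∷ s -> xs ⊆ l ++ p ∷ s
 destutter [] k (_ ∷ʳ τ) = τ
 destutter [] k (refl ∷ (_ ∷ʳ τ)) = refl ∷ τ
 destutter [] (ne ∷ k) (refl ∷ (refl ∷ τ)) = absurd (ne refl)
 destutter (y ∷ l) k (_ ∷ʳ τ) = y ∷ʳ destutter l k τ
 destutter (y ∷ l) k (refl ∷ τ) = refl ∷ destutter l (Linked-tail k) τ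

 after-once : ∀ l {v p : A} {s xs} -> v ∉ l -> v ≢ p -> v ∷ xs ⊆ l ++ p ∷ v ∷ s -> xs ⊆ s
 after-once [] v∉ v≢p (_ ∷ʳ (_ ∷ʳ τ)) = ⊆-trans (_ ∷ʳ ⊆-refl) τ
 after-once [] v∉ v≢p (_ ∷ʳ (refl ∷ τ)) = τ
 after-once [] v∉ v≢p (refl ∷ τ) = absurd (v≢p refl)
 after-once (y ∷ l) v∉ v≢p (_ ∷ʳ τ) = after-once l (λ m -> v∉ (there m)) v≢p τ
 after-once (y ∷ l) v∉ v≢p (refl ∷ τ) = absurd (v∉ (here refl))

 ∈-mid : ∀ (l : List A) {x r} -> x ∈ l ++ x ∷ r
 ∈-mid l = ∈ʳ l (here refl)

 ⊆-pred : ∀ {x : A} {xs ys} -> x ∷ xs ⊆ ys -> xs ⊆ ys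
 ⊆-pred τ = ⊆-trans (_ ∷ʳ ⊆-refl) τ

 ⊆-pair-∈ : ∀ {x y : A} {l} -> x ∷ [ y ] ⊆ l -> x ∈ l × y ∈ l
 ⊆-pair-∈ τ = to∈ (⊆-trans (refl ∷ (_ ∷ʳ [])) τ) , to∈ (⊆-pred τ)

 Unique-drop : ∀ (l : List A) {s} -> Unique (l ++ s) -> Unique s
 Unique-drop [] u = u
 Unique-drop (x ∷ l) (_ ∷ u) = Unique-drop l u

 Unique-∉ : ∀ {x : A} {xs} -> Unique (x ∷ xs) -> x ∉ xs
 Unique-∉ (a ∷ _) m = All.lookup a m refl

module Shell {n : ℕ} where
 V = Fin n

 Sh-⊂ : ∀ {u₀ u : List V} {Ws Es Ts} -> Sh u₀ u Ws Es Ts -> ∀ {z} -> z ∈ u -> z ∈ Ws ++ u₀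
 Sh-⊂ start m = m
 Sh-⊂ (pend l p r v s) {z} m with ∈⁻ l m
 ... | inl m' = there (Sh-⊂ s (∈ˡ m'))
 ... | inr (here refl) = there (Sh-⊂ s (∈-mid l))
 ... | inr (there (here refl)) = here refl
 ... | inr (there (there m')) = there (Sh-⊂ s (∈ʳ l m'))
 Sh-⊂ (cov l a b c r s) m with ∈⁻ l m
 ... | inl m' = Sh-⊂ s (∈ˡ m')
 ... | inr (here refl) = Sh-⊂ s (∈-mid l)
 ... | inr (there m') = Sh-⊂ s (∈ʳ l (there (there m')))

 Sh-ends : ∀ {u₀ u : List V} {Ws Es Ts} -> Sh u₀ u Ws Es Ts -> ∀ {a b} -> (a , b) ∈ Es -> a ∈ Ws ++ u₀ × b ∈ Ws ++ u₀
 Sh-ends (pend l p r v s) (here refl) = there (Sh-⊂ s (∈-mid l)) , here refl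
 Sh-ends (pend l p r v s) (there m) = let x , y = Sh-ends s m in there x , there y
 Sh-ends (cov l a b c r s) (here refl) = Sh-⊂ s (∈-mid l) , Sh-⊂ s (∈ʳ l (there (there (here refl))))
 Sh-ends (cov l a b c r s) (there m) = Sh-ends s m

 Adj-there : ∀ {E₀ : V -> V -> Set} {e Es x y} -> E₀ x y ⊎ Adj± Es x y -> E₀ x y ⊎ Adj± (e ∷ Es) x y
 Adj-there (inl e) = inl e
 Adj-there (inr (inl m)) = inr (inl (there m))
 Adj-there (inr (inr m)) = inr (inr (there m))

 Sh-linked : ∀ {u₀ u : List V} {Ws Es Ts} (E₀ : V -> V -> Set) -> Linked E₀ u₀ -> Sh u₀ u Ws Es Ts ->
       Linked (λ x y -> E₀ x y ⊎ Adj± Es x y) u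
 Sh-linked E₀ k start = Linked-map inl k
 Sh-linked E₀ k (pend l p r v s) =
  Linked-retail l (Linked-map (Adj-there {E₀}) (Sh-linked E₀ k s)) λ j -> inr (inl (here refl)) ∷ inr (inr (here refl)) ∷ j
 Sh-linked E₀ k (cov l a b c r s) =
  Linked-retail l (Linked-map (Adj-there {E₀}) (Sh-linked E₀ k s)) λ { (_ ∷ _ ∷ j) -> inr (inl (here refl)) ∷ j }

 -- What remains of a walk over the edge `a₀ c₀`: the part before its traversal and the part after
 -- it, for either direction.
 Via : (V -> V -> Set) -> (V -> Set) -> V -> V -> V -> V -> Set
 Via E P a₀ c₀ a c = (W E P a a₀ × P c₀ × W E P c₀ c) ⊎ (W E P a c₀ × P a₀ × W E P a₀ c)

 -- A second traversal of the new edge closes a loop, which is cut out, so one traversal is enough.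
 W-edge : ∀ {E E' : V -> V -> Set} {a₀ c₀ : V} ->
      (∀ {u v} -> E' u v -> E u v ⊎ (u ≡ a₀ × v ≡ c₀) ⊎ (u ≡ c₀ × v ≡ a₀)) ->
      ∀ {P a c} -> W E' P a c -> W E P a c ⊎ Via E P a₀ c₀ a c
 W-edge f ε = inl ε
 W-edge f (step e s p) with f e | W-edge f p
 ... | inl o | inl q = inl (step o s q)
 ... | inl o | inr (inl (q , r)) = inr (inl (step o s q , r))
 ... | inl o | inr (inr (q , r)) = inr (inr (step o s q , r))
 ... | inr (inl (refl , refl)) | inl q = inr (inl (ε , s , q))
 ... | inr (inl (refl , refl)) | inr (inl (q , r)) = inr (inl (ε , r))
 ... | inr (inl (refl , refl)) | inr (inr (q , _ , r)) = inl r
 ... | inr (inr (refl , refl)) | inl q = inr (inr (ε , s , q))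
 ... | inr (inr (refl , refl)) | inr (inl (q , _ , r)) = inl r
 ... | inr (inr (refl , refl)) | inr (inr (q , r)) = inr (inr (ε , r))

 -- The discrete form of the Jordan curve theorem for a disk: disjoint connected sets do not
 -- alternate along its boundary walk. `P` and `Q` are arbitrary predicates and need not be
 -- decidable.
 Alternates : (V -> V -> Set) -> List V -> Set₁
 Alternates E u = ∀ (P Q : V -> Set) -> (∀ {z} -> P z -> Q z -> ⊥) -> ∀ {a b c d} -> P a -> Q b ->
          a ∷ b ∷ c ∷ d ∷ [] ⊆ u -> W E P a c -> W E Q b d -> ⊥

 private
  split-new : ∀ {a c : V} {Es u v} -> Adj± ((a , c) ∷ Es) u v -> Adj± Es u v ⊎ (u ≡ a × v ≡ c) ⊎ (u ≡ c × v ≡ a)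
  split-new (inl (here refl)) = inr (inl (refl , refl))
  split-new (inl (there m)) = inl (inl m)
  split-new (inr (here refl)) = inr (inr (refl , refl))
  split-new (inr (there m)) = inl (inr m)

 module Corner {E : V -> V -> Set} (E-sym : ∀ {u v} -> E u v -> E v u) (l : List V) (a₀ b₀ c₀ : V) (r : List V)
        (alt : Alternates E (l ++ a₀ ∷ b₀ ∷ c₀ ∷ r)) where
  private
   L = l ++ [ a₀ ]
   R = c₀ ∷ r
   mk : ∀ {ys zs} bs -> ys ⊆ L -> bs ⊆ [ b₀ ] -> zs ⊆ R -> ys ++ bs ++ zs ⊆ l ++ a₀ ∷ b₀ ∷ c₀ ∷ r
   mk bs τ σ ρ = subst (_ ⊆_) (++-assoc l [ a₀ ] (b₀ ∷ R)) (++⁺ τ (++⁺ σ ρ))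
   toL : ∀ {ys} -> ys ⊆ l -> ys ++ [ a₀ ] ⊆ L
   toL τ = ++⁺ τ ⊆-refl
   strip : ∀ l {x} ys -> x ≢ a₀ -> ys ++ [ x ] ⊆ l ++ [ a₀ ] -> ys ++ [ x ] ⊆ l
   strip [] [] ne (_ ∷ʳ ())
   strip [] [] ne (refl ∷ τ) = absurd (ne refl)
   strip [] (y ∷ ys) ne (_ ∷ʳ ())
   strip [] (y ∷ []) ne (refl ∷ ())
   strip [] (y ∷ z ∷ ys) ne (refl ∷ ())
   strip (z ∷ l) [] ne (_ ∷ʳ τ) = z ∷ʳ strip l [] ne τ
   strip (z ∷ l) (y ∷ ys) ne (_ ∷ʳ τ) = z ∷ʳ strip l (y ∷ ys) ne τ
   strip (z ∷ l) [] ne (refl ∷ τ) = refl ∷ minimum l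
   strip (z ∷ l) (y ∷ ys) ne (refl ∷ τ) = refl ∷ strip l ys ne τ
   stripR : ∀ {x zs} -> x ≢ c₀ -> x ∷ zs ⊆ R -> x ∷ zs ⊆ r
   stripR ne (_ ∷ʳ τ) = τ
   stripR ne (refl ∷ τ) = absurd (ne refl)
   tailR : ∀ {x zs} -> x ∷ zs ⊆ R -> zs ⊆ r
   tailR (_ ∷ʳ τ) = ⊆-pred τ
   tailR (refl ∷ τ) = τ
   initL : ∀ {x y zs} -> x ∷ y ∷ zs ⊆ L -> [ x ] ⊆ l
   initL = go l
    where
    go : ∀ l {x y zs} -> x ∷ y ∷ zs ⊆ l ++ [ a₀ ] -> [ x ] ⊆ l
    go [] (_ ∷ʳ ())
    go [] (refl ∷ ())
    go (z ∷ l) (_ ∷ʳ τ) = z ∷ʳ go l τ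
    go (z ∷ l) (refl ∷ τ) = refl ∷ minimum l
   two : ∀ {x y zs} -> x ∷ y ∷ zs ⊆ L -> x ∷ [ y ] ⊆ L
   two = ⊆-trans (refl ∷ refl ∷ minimum _)
   twoR : ∀ {x y zs} -> x ∷ y ∷ zs ⊆ R -> x ∷ [ y ] ⊆ R
   twoR = ⊆-trans (refl ∷ refl ∷ minimum _)
   assoc : ∀ {xs} -> xs ⊆ l ++ a₀ ∷ c₀ ∷ r -> xs ⊆ L ++ R
   assoc = subst (_ ⊆_) (sym (++-assoc l [ a₀ ] R))
   b⊆ = ⊆-refl {x = [ b₀ ]}

  -- `P` uses the edge `a₀ c₀` that cuts off the corner `b₀`, and `Q` reaches `b₀`. Wherever the
  -- four vertices lie relative to the corner, putting `b₀` or an end of the new edge in place of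
  -- some of them gives an alternating quadruple of the old walk.
  crossing₁ : ∀ {P Q : V -> Set} -> (∀ {z} -> P z -> Q z -> ⊥) -> ∀ {a b c d} -> P a -> Q b ->
        a ∷ b ∷ c ∷ d ∷ [] ⊆ l ++ a₀ ∷ c₀ ∷ r -> Via E P a₀ c₀ a c -> W E Q b d -> W E Q b b₀ -> ⊥
  crossing₁ {P} {Q} dis {a} {b} {c} {d} pa qb τ via bd bb₀ = go (⊆-split L (assoc τ)) via
   where
   qd = W-end∈ qb bd
   qb₀ = W-end∈ qb bb₀
   b₀b = W-rev E-sym qb bb₀
   b₀d = b₀b ∙ bd
   db₀ = W-rev E-sym qb bd ∙ bb₀
   sid : ∀ {z} -> Q z -> P z -> ⊥
   sid x y = dis y x
   ≢a : ∀ {x} -> Q x -> P a₀ -> x ≢ a₀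
   ≢a q p refl = dis p q
   ≢c : ∀ {x} -> Q x -> P c₀ -> x ≢ c₀
   ≢c q p refl = dis p q
   PQ = alt P Q dis
   QP = alt Q P sid
   go : ∃₂ (λ ys zs -> a ∷ b ∷ c ∷ d ∷ [] ≡ ys ++ zs × ys ⊆ L × zs ⊆ R) -> Via E P a₀ c₀ a c -> ⊥
   go ([] , _ , refl , _ , ρ) (inl (x , _ , _)) = PQ (W-end∈ pa x) qb₀ (mk [ b₀ ] (toL (minimum l)) b⊆ (twoR ρ)) (W-rev E-sym pa x) b₀b
   go ([] , _ , refl , _ , ρ) (inr (_ , p₀ , y)) = PQ p₀ qb₀ (mk [ b₀ ] (toL (minimum l)) b⊆ (⊆-pred (⊆-pred ρ))) y b₀d
   go (_ ∷ [] , _ , refl , σ , ρ) (inl (_ , p₀ , y)) = QP qb₀ p₀ (mk [ b₀ ] (minimum L) b⊆ (refl ∷ stripR (≢c qb p₀) (twoR ρ))) b₀b y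
   go (_ ∷ [] , _ , refl , σ , ρ) (inr (_ , p₀ , y)) = PQ p₀ qb₀ (mk [ b₀ ] (toL (minimum l)) b⊆ (⊆-pred ρ)) y b₀d
   go (_ ∷ _ ∷ [] , _ , refl , σ , ρ) (inl (x , _ , _)) =
    PQ pa qb (mk [ b₀ ] (toL (strip l [ a ] (≢a qb (W-end∈ pa x)) σ)) b⊆ (minimum R)) x bb₀
   go (_ ∷ _ ∷ [] , _ , refl , σ , ρ) (inr (x , _ , _)) =
    PQ pa qb (mk [] σ (minimum _) (refl ∷ tailR ρ)) x bd
   go (_ ∷ _ ∷ _ ∷ [] , _ , refl , σ , ρ) (inl (x , p₀ , y)) =
    QP qb (W-end∈ p₀ y) (mk [ b₀ ] (⊆-pred σ) b⊆ (refl ∷ minimum r)) bb₀ (W-rev E-sym p₀ y)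
   go (_ ∷ _ ∷ _ ∷ [] , _ , refl , σ , ρ) (inr (x , p₀ , y)) =
    PQ pa qb (mk [] (two σ) (minimum _) (refl ∷ stripR (≢c qd (W-end∈ pa x)) ρ)) x bd
   go (_ ∷ _ ∷ _ ∷ _ ∷ [] , _ , refl , σ , ρ) (inl (x , p₀ , y)) =
    PQ pa qb (mk [ b₀ ] (toL (⊆-trans (refl ∷ refl ∷ minimum _) (strip l (a ∷ b ∷ [ c ]) (≢a qd (W-end∈ pa x)) σ))) b⊆ (minimum R)) x bb₀
   go (_ ∷ _ ∷ _ ∷ _ ∷ [] , _ , refl , σ , ρ) (inr (x , p₀ , y)) =
    PQ (W-end∈ p₀ y) qd (mk [ b₀ ] (toL (⊆-pred (⊆-pred (strip l (a ∷ b ∷ [ c ]) (≢a qd p₀) σ)))) b⊆ (minimum R)) (W-rev E-sym p₀ y) db₀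
   go (_ ∷ _ ∷ _ ∷ _ ∷ _ ∷ _ , _ , () , _)

  crossing₂ : ∀ {P Q : V -> Set} -> (∀ {z} -> P z -> Q z -> ⊥) -> ∀ {a b c d} -> P a -> Q b ->
        a ∷ b ∷ c ∷ d ∷ [] ⊆ l ++ a₀ ∷ c₀ ∷ r -> Via E Q a₀ c₀ b d -> W E P a c -> W E P a b₀ -> ⊥
  crossing₂ {P} {Q} dis {a} {b} {c} {d} pa qb τ via ac ab₀ = go (⊆-split L (assoc τ)) via
   where
   pc = W-end∈ pa ac
   pb₀ = W-end∈ pa ab₀
   b₀a = W-rev E-sym pa ab₀
   b₀c = b₀a ∙ ac
   cb₀ = W-rev E-sym pa ac ∙ ab₀
   sid : ∀ {z} -> Q z -> P z -> ⊥
   sid x y = dis y x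
   ≢a : ∀ {x} -> P x -> Q a₀ -> x ≢ a₀
   ≢a q p refl = dis q p
   ≢c : ∀ {x} -> P x -> Q c₀ -> x ≢ c₀
   ≢c q p refl = dis q p
   PQ = alt P Q dis
   QP = alt Q P sid
   go : ∃₂ (λ ys zs -> a ∷ b ∷ c ∷ d ∷ [] ≡ ys ++ zs × ys ⊆ L × zs ⊆ R) -> Via E Q a₀ c₀ b d -> ⊥
   go ([] , _ , refl , _ , ρ) (inl (x , _ , _)) = QP (W-end∈ qb x) pb₀ (mk [ b₀ ] (toL (minimum l)) b⊆ (twoR (⊆-pred ρ))) (W-rev E-sym qb x) b₀c
   go ([] , _ , refl , _ , ρ) (inr (x , _ , _)) = PQ pb₀ (W-end∈ qb x) (mk [ b₀ ] (minimum L) b⊆ (refl ∷ stripR (≢c pa (W-end∈ qb x)) (twoR ρ))) b₀a (W-rev E-sym qb x)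
   go (_ ∷ [] , _ , refl , σ , ρ) (inl (x , _ , _)) = QP (W-end∈ qb x) pb₀ (mk [ b₀ ] (toL (minimum l)) b⊆ (twoR ρ)) (W-rev E-sym qb x) b₀c
   go (_ ∷ [] , _ , refl , σ , ρ) (inr (x , q₀ , y)) = PQ pa q₀ (mk [ b₀ ] (toL (strip l [] (≢a pa q₀) σ)) b⊆ (⊆-pred (⊆-pred ρ))) ab₀ y
   go (_ ∷ _ ∷ [] , _ , refl , σ , ρ) (inl (x , q₀ , y)) = PQ pb₀ q₀ (mk [ b₀ ] (minimum L) b⊆ (refl ∷ stripR (≢c pc q₀) ρ)) b₀c y
   go (_ ∷ _ ∷ [] , _ , refl , σ , ρ) (inr (x , q₀ , y)) = PQ pa q₀ (mk [ b₀ ] (toL (initL σ)) b⊆ (⊆-pred ρ)) ab₀ y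
   go (_ ∷ _ ∷ _ ∷ [] , _ , refl , σ , ρ) (inl (x , q₀ , y)) =
    QP qb pc (mk [ b₀ ] (toL (⊆-pred (strip l (a ∷ [ b ]) (≢a pc (W-end∈ qb x)) σ))) b⊆ (minimum R)) x cb₀
   go (_ ∷ _ ∷ _ ∷ [] , _ , refl , σ , ρ) (inr (x , q₀ , y)) = PQ pa q₀ (mk [ b₀ ] (toL (initL σ)) b⊆ ρ) ab₀ y
   go (_ ∷ _ ∷ _ ∷ _ ∷ [] , _ , refl , σ , ρ) (inl (x , q₀ , y)) =
    QP qb pc (mk [ b₀ ] (toL (⊆-pred (strip l (a ∷ [ b ]) (≢a pc (W-end∈ qb x)) (⊆-trans (refl ∷ refl ∷ refl ∷ minimum _) σ)))) b⊆ (minimum R)) x cb₀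
   go (_ ∷ _ ∷ _ ∷ _ ∷ [] , _ , refl , σ , ρ) (inr (x , q₀ , y)) =
    PQ pa qb (mk [ b₀ ] (two σ) b⊆ (refl ∷ minimum r)) ab₀ x
   go (_ ∷ _ ∷ _ ∷ _ ∷ _ ∷ _ , _ , () , _)

 -- Induction on the shelling. A pendant vertex is a leaf and is replaced by its neighbour `p`.
 -- After a covering step the two sets cannot both use the new edge `a₀ c₀`, since both would
 -- contain `a₀`. If one uses it and the other reaches `b₀`, the old walk already alternates;
 -- otherwise the edge is replaced by the path through `b₀`.
 nc : ∀ {v₀ : V} {u Ws Es Ts} -> Sh [ v₀ ] u Ws Es Ts -> Unique (Ws ++ [ v₀ ]) -> Alternates (Adj± Es) u
 nc start un P Q dis pa qb (_ ∷ʳ ()) wp wq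
 nc start un P Q dis pa qb (_ ∷ ()) wp wq
 nc (pend {Ws} {Es} l p r v s) un@(_ ∷ un') P Q dis {a} {b} {c} {d} pa qb τ wp wq =
  nc s un' (P ∖ v) (Q ∖ v) (λ (x , _) (y , _) -> dis x y) pa' qb' τ'
    (snd PP) (snd QQ)
  where
  v∉ : v ∉ Ws ++ _
  v∉ = Unique-∉ un
  v∉l : v ∉ l
  v∉l m = v∉ (Sh-⊂ s (∈ˡ m))
  v∉r : v ∉ p ∷ r
  v∉r m = v∉ (Sh-⊂ s (∈ʳ l m))
  v≢p : v ≢ p
  v≢p refl = v∉r (here refl)
  E' = Adj± ((p , v) ∷ Es)
  E = Adj± Es
  old : ∀ {x y} -> E x y -> x ≢ v × y ≢ v
  old (inl m) = (λ { refl -> v∉ (fst (Sh-ends s m)) }) , (λ { refl -> v∉ (snd (Sh-ends s m)) })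
  old (inr m) = (λ { refl -> v∉ (snd (Sh-ends s m)) }) , (λ { refl -> v∉ (fst (Sh-ends s m)) })
  leaf : ∀ {S : V -> Set} {x y} -> W E' S x y -> y ≢ v -> (x ≢ v -> W E (S ∖ v) x y) × (x ≡ v -> S p × W E (S ∖ v) p y)
  leaf ε y≢ = (λ _ -> ε) , λ e -> absurd (y≢ e)
  leaf (step e sw q) y≢ with split-new e | leaf q y≢
  ... | inl o | f , g = (λ _ -> step o (sw , snd (old o)) (f (snd (old o)))) , λ e -> absurd (fst (old o) e)
  ... | inr (inl (refl , refl)) | f , g = (λ _ -> snd (g refl)) , λ e -> absurd (v≢p (sym e))
  ... | inr (inr (refl , refl)) | f , g = (λ ne -> absurd (ne refl)) , λ _ -> sw , f (λ e -> v≢p (sym e))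
  f : V -> V
  f z with z ≟ v
  ... | yes _ = p
  ... | no _ = z
  f-id : ∀ {z} -> z ≢ v -> f z ≡ z
  f-id {z} ne with z ≟ v
  ... | yes e = absurd (ne e)
  ... | no _ = refl
  f-v : f v ≡ p
  f-v with v ≟ v
  ... | yes _ = refl
  ... | no ne = absurd (ne refl)
  f-map : ∀ xs -> v ∉ xs -> map f xs ≡ xs
  f-map [] _ = refl
  f-map (x ∷ xs) ne = cong₂ _∷_ (f-id (λ e -> ne (here (sym e)))) (f-map xs (λ m -> ne (there m)))
  push : ∀ {S : V -> Set} {x y} -> S x -> (x ≡ v -> y ≡ v -> ⊥) -> W E' S x y -> (S ∖ v) (f x) × W E (S ∖ v) (f x) (f y)
  push {S} {x} {y} sx ne q with x ≟ v | y ≟ v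
  ... | yes refl | yes refl = absurd (ne refl refl)
  ... | yes refl | no y≢ = let sp , k = snd (leaf q y≢) refl in (sp , λ e -> v≢p (sym e)) , k
  ... | no x≢ | no y≢ = (sx , x≢) , fst (leaf q y≢) x≢
  ... | no x≢ | yes refl with snd (leaf (W-rev (Adj±-sym _) sx q) x≢) refl
  ... | sp , k = (sx , x≢) , W-rev (Adj±-sym _) (sp , λ e -> v≢p (sym e)) k
  twice : ∀ {xs} -> v ∷ xs ⊆ l ++ p ∷ v ∷ p ∷ r -> v ∈ xs -> ⊥
  twice τ m = v∉r (to∈ (⊆-trans (from∈ m) (after-once l v∉l v≢p τ)))
  -- `v` occurs only once on the walk, so it is not both ends of one connection.
  PP = push pa (λ { refl refl -> twice τ (there (here refl)) }) wp
  QQ = push qb (λ { refl refl -> twice (⊆-pred τ) (there (here refl)) }) wq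
  pa' = fst PP
  qb' = fst QQ
  ne : ∀ {x y} -> (P ∖ v) x -> (Q ∖ v) y -> x ≢ y
  ne (x , _) (y , _) refl = dis x y
  pc' = W-end∈ pa' (snd PP)
  qd' = W-end∈ qb' (snd QQ)
  alt : Linked _≢_ (f a ∷ f b ∷ f c ∷ f d ∷ [])
  alt = ne pa' qb' ∷ (λ e -> ne pc' qb' (sym e)) ∷ ne pc' qd' ∷ [-]
  τ₁ : f a ∷ f b ∷ f c ∷ f d ∷ [] ⊆ l ++ p ∷ p ∷ p ∷ r
  τ₁ = subst (f a ∷ f b ∷ f c ∷ f d ∷ [] ⊆_)
      (trans (map-++ f l (p ∷ v ∷ p ∷ r)) (cong₂ _++_ (f-map l v∉l)
       (cong₂ _∷_ (f-id (λ e -> v≢p (sym e))) (cong₂ _∷_ f-v (f-map (p ∷ r) v∉r))))) (SubP.map⁺ f τ)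
  τ' = destutter l alt (destutter l alt τ₁)
 nc (cov {Ws} {Es} l a₀ b₀ c₀ r s) un P Q dis {a} {b} {c} {d} pa qb τ wp wq
  with W-edge split-new wp | W-edge split-new wq
 ... | inl p | inl q = nc s un P Q dis pa qb (⊆-trans τ (++⁺ (⊆-refl {x = l}) (refl ∷ (b₀ ∷ʳ ⊆-refl)))) p q
 ... | inr x | inr y = dis (both pa x) (both qb y)
  where
  both : ∀ {S : V -> Set} {x y} -> S x -> Via (Adj± Es) S a₀ c₀ x y -> S a₀
  both sx (inl (p , _)) = W-end∈ sx p
  both sx (inr (_ , p , _)) = p
 ... | inr x | inl y = far close
  where
  E = Adj± Es
  close : W E Q b b₀ -> ⊥
  close = Corner.crossing₁ (Adj±-sym Es) l a₀ b₀ c₀ r (nc s un) dis pa qb τ x y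
  far : (W E Q b b₀ -> ⊥) -> ⊥
  -- `Q` is cut down to what `b` reaches. This misses `b₀`, so `b₀` can be added to `P`.
  far ¬bb₀ = nc s un P' Q' dis' (inl pa) (qb , ε) (⊆-trans τ (++⁺ (⊆-refl {x = l}) (refl ∷ (b₀ ∷ʳ ⊆-refl)))) (ac x)
         (W-mono snd (W-keep (λ z -> Q z × W E Q b z) (λ (_ , k) e sv -> sv , k ∙ edge e sv) (qb , ε) y))
   where
   P' Q' : V -> Set
   P' z = P z ⊎ z ≡ b₀
   Q' z = Q z × W E Q b z
   dis' : ∀ {z} -> P' z -> Q' z -> ⊥
   dis' (inl p) (q , _) = dis p q
   dis' (inr refl) (_ , k) = ¬bb₀ k
   lk : E a₀ b₀ × E b₀ c₀
   lk with Linked-drop l (Sh-linked (λ _ _ -> ⊥) [-] s)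
   ... | inr e ∷ inr e' ∷ _ = e , e'
   ac : Via E P a₀ c₀ a c -> W E P' a c
   ac (inl (p , s , q)) = W-mono inl p ∙ step (fst lk) (inr refl) (step (snd lk) (inl s) (W-mono inl q))
   ac (inr (p , s , q)) = W-mono inl p ∙ step (Adj±-sym Es (snd lk)) (inr refl) (step (Adj±-sym Es (fst lk)) (inl s) (W-mono inl q))
 ... | inl x | inr y = far close
  where
  E = Adj± Es
  close : W E P a b₀ -> ⊥
  close = Corner.crossing₂ (Adj±-sym Es) l a₀ b₀ c₀ r (nc s un) dis pa qb τ y x
  far : (W E P a b₀ -> ⊥) -> ⊥
  far ¬ab₀ = nc s un P' Q' dis' (pa , ε) (inl qb) (⊆-trans τ (++⁺ (⊆-refl {x = l}) (refl ∷ (b₀ ∷ʳ ⊆-refl))))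
         (W-mono snd (W-keep (λ z -> P z × W E P a z) (λ (_ , k) e sv -> sv , k ∙ edge e sv) (pa , ε) x)) (bd y)
   where
   P' Q' : V -> Set
   Q' z = Q z ⊎ z ≡ b₀
   P' z = P z × W E P a z
   dis' : ∀ {z} -> P' z -> Q' z -> ⊥
   dis' (p , _) (inl q) = dis p q
   dis' (_ , k) (inr refl) = ¬ab₀ k
   lk : E a₀ b₀ × E b₀ c₀
   lk with Linked-drop l (Sh-linked (λ _ _ -> ⊥) [-] s)
   ... | inr e ∷ inr e' ∷ _ = e , e'
   bd : Via E Q a₀ c₀ b d -> W E Q' b d
   bd (inl (p , s , q)) = W-mono inl p ∙ step (fst lk) (inr refl) (step (snd lk) (inl s) (W-mono inl q))
   bd (inr (p , s , q)) = W-mono inl p ∙ step (Adj±-sym Es (snd lk)) (inr refl) (step (Adj±-sym Es (fst lk)) (inl s) (W-mono inl q))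

 Same : (x y z : V) -> V × V × V -> Set
 Same x y z (a , b , c) = (∀ {h} -> h ≡ a ⊎ h ≡ b ⊎ h ≡ c -> h ≡ x ⊎ h ≡ y ⊎ h ≡ z) × (∀ {h} -> h ≡ x ⊎ h ≡ y ⊎ h ≡ z -> h ≡ a ⊎ h ≡ b ⊎ h ≡ c)

 -- What lies strictly inside a triangle that is not a face: off the boundary, and attached to the
 -- three corners only. `SepFree` will forbid it.
 record Hidden (v₀ : V) (u Ws : List V) (Es : List (V × V)) (x y z : V) : Set₁ where
  field
   L      : V -> Set
   wit    : V
   wit∈   : L wit
   in-Ws  : ∀ {v} -> L v -> v ∈ Ws ++ [ v₀ ]
   off-u  : ∀ {v} -> L v -> v ∈ u -> ⊥
   closed : ∀ {v w} -> L v -> Adj± Es v w -> L w ⊎ (w ≡ x ⊎ w ≡ y ⊎ w ≡ z)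

 Good : (v₀ : V) (u Ws : List V) (Es : List (V × V)) (Ts : List (V × V × V)) -> V -> V -> V -> Set₁
 Good v₀ u Ws Es Ts x y z = (∃ λ t -> t ∈ Ts × Same x y z t) ⊎ Hidden v₀ u Ws Es x y z

 private
  rot₃ : ∀ {a b c h : V} -> h ≡ a ⊎ h ≡ b ⊎ h ≡ c -> h ≡ b ⊎ h ≡ c ⊎ h ≡ a
  rot₃ (inl e) = inr (inr e)
  rot₃ (inr (inl e)) = inl e
  rot₃ (inr (inr e)) = inr (inl e)
  sl₃ : ∀ {a b c h : V} -> h ≡ a ⊎ h ≡ b ⊎ h ≡ c -> h ≡ a ⊎ h ≡ c ⊎ h ≡ b
  sl₃ (inl e) = inl e
  sl₃ (inr (inl e)) = inr (inr e)
  sl₃ (inr (inr e)) = inr (inl e)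
  Good-perm : ∀ {v₀ u Ws Es Ts x y z x' y' z'} -> (∀ {h} -> h ≡ x ⊎ h ≡ y ⊎ h ≡ z -> h ≡ x' ⊎ h ≡ y' ⊎ h ≡ z') ->
        (∀ {h} -> h ≡ x' ⊎ h ≡ y' ⊎ h ≡ z' -> h ≡ x ⊎ h ≡ y ⊎ h ≡ z) ->
        Good v₀ u Ws Es Ts x y z -> Good v₀ u Ws Es Ts x' y' z'
  Good-perm f g (inl (t , m , p , q)) = inl (t , m , (λ h -> f (p h)) , (λ h -> q (g h)))
  Good-perm f g (inr H) = inr record { Hidden H ; closed = λ l e -> [ inl , (λ h -> inr (f h)) ]′ (Hidden.closed H l e) }

 -- A pendant edge lies in no triangle, so new triangles come from covering steps. Later steps add
 -- edges at boundary vertices and at new vertices only, so they cannot break a hidden set, which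
 -- stays off the boundary.
 triangles : ∀ {v₀ : V} {u Ws Es Ts} -> Sh [ v₀ ] u Ws Es Ts -> (∀ {a b} -> (a , b) ∈ Es -> a ≢ b) -> Unique (Ws ++ [ v₀ ]) ->
       ∀ {x y z} -> Adj± Es x y -> Adj± Es y z -> Adj± Es x z -> x ≢ y -> y ≢ z -> x ≢ z -> Good v₀ u Ws Es Ts x y z
 triangles start nl un (inl ()) _ _ _ _ _
 triangles start nl un (inr ()) _ _ _ _ _
 triangles {v₀} (pend {Ws} {Es} {Ts} l p r v s) nl un@(_ ∷ un') {x} {y} {z} xy yz xz x≢y y≢z x≢z =
  lift (triangles s (λ m -> nl (there m)) un' (old xy yz xz x≢y y≢z x≢z) (old yz (Adj±-sym _ xz) (Adj±-sym _ xy) y≢z (λ e -> x≢z (sym e)) (λ e -> x≢y (sym e)))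
    (old xz (Adj±-sym _ yz) xy x≢z (λ e -> y≢z (sym e)) x≢y) x≢y y≢z x≢z)
  where
  v∉ : v ∉ Ws ++ [ v₀ ]
  v∉ = Unique-∉ un
  v≢p : v ≢ p
  v≢p refl = v∉ (Sh-⊂ s (∈-mid l))
  E = Adj± ((p , v) ∷ Es)
  nbr : ∀ {w} -> E v w -> w ≡ p
  nbr e with split-new e
  ... | inl (inl m) = absurd (v∉ (fst (Sh-ends s m)))
  ... | inl (inr m) = absurd (v∉ (snd (Sh-ends s m)))
  ... | inr (inl (refl , e)) = e
  ... | inr (inr (_ , e)) = e
  old : ∀ {a b c} -> E a b -> E b c -> E a c -> a ≢ b -> b ≢ c -> a ≢ c -> Adj± Es a b
  old ab bc ac a≢b b≢c a≢c with split-new ab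
  ... | inl o = o
  ... | inr (inl (refl , refl)) = absurd (a≢c (sym (nbr bc)))
  ... | inr (inr (refl , refl)) = absurd (b≢c (sym (nbr ac)))
  lift : Good v₀ (l ++ p ∷ r) Ws Es Ts x y z -> Good v₀ (l ++ p ∷ v ∷ p ∷ r) (v ∷ Ws) ((p , v) ∷ Es) Ts x y z
  lift (inl t) = inl t
  lift (inr H) = inr record { L = L ; wit = wit ; wit∈ = wit∈ ; in-Ws = λ m -> there (in-Ws m) ; off-u = off ; closed = cl }
   where
   open Hidden H
   off : ∀ {w} -> L w -> w ∈ l ++ p ∷ v ∷ p ∷ r -> ⊥
   off lw m with ∈⁻ l m
   ... | inl m' = off-u lw (∈ˡ m')
   ... | inr (here refl) = off-u lw (∈-mid l)
   ... | inr (there (here refl)) = v∉ (in-Ws lw)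
   ... | inr (there (there m')) = off-u lw (∈ʳ l m')
   cl : ∀ {a b} -> L a -> E a b -> L b ⊎ (b ≡ x ⊎ b ≡ y ⊎ b ≡ z)
   cl la e with split-new e
   ... | inl o = closed la o
   ... | inr (inl (refl , refl)) = absurd (off-u la (∈-mid l))
   ... | inr (inr (refl , refl)) = absurd (v∉ (in-Ws la))
 triangles {v₀} (cov {Ws} {Es} {Ts} l a₀ b₀ c₀ r s) nl un xy yz xz x≢y y≢z x≢z = go (split-new xy) (split-new yz) (split-new xz) x≢y y≢z x≢z
  where
  E = Adj± ((a₀ , c₀) ∷ Es)
  u = l ++ a₀ ∷ c₀ ∷ r
  u⊂ : ∀ {z} -> z ∈ u -> z ∈ l ++ a₀ ∷ b₀ ∷ c₀ ∷ r
  u⊂ m with ∈⁻ l m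
  ... | inl m' = ∈ˡ m'
  ... | inr (here refl) = ∈-mid l
  ... | inr (there m') = ∈ʳ l (there (there m'))
  G = Good v₀ u Ws ((a₀ , c₀) ∷ Es) ((a₀ , b₀ , c₀) ∷ Ts)
  lift : ∀ {x y z} -> Good v₀ (l ++ a₀ ∷ b₀ ∷ c₀ ∷ r) Ws Es Ts x y z -> G x y z
  lift (inl (t , m , q)) = inl (t , there m , q)
  lift {x} {y} {z} (inr H) = inr record { L = L ; wit = wit ; wit∈ = wit∈ ; in-Ws = in-Ws ; off-u = λ lw m -> off-u lw (u⊂ m) ; closed = cl }
   where
   open Hidden H
   cl : ∀ {a b} -> L a -> E a b -> L b ⊎ (b ≡ x ⊎ b ≡ y ⊎ b ≡ z)
   cl la e with split-new e
   ... | inl o = closed la o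
   ... | inr (inl (refl , refl)) = absurd (off-u la (∈-mid l))
   ... | inr (inr (refl , refl)) = absurd (off-u la (∈ʳ l (there (there (here refl)))))
  lk : Adj± Es a₀ b₀ × Adj± Es b₀ c₀
  lk with Linked-drop l (Sh-linked (λ _ _ -> ⊥) [-] s)
  ... | inr e ∷ inr e' ∷ _ = e , e'
  -- A triangle a₀c₀w through the new edge, other than the new face, separates b₀ from the rest of the boundary.
  new : ∀ w -> Adj± Es a₀ w -> Adj± Es w c₀ -> w ≢ a₀ -> w ≢ c₀ -> b₀ ≢ a₀ -> b₀ ≢ c₀ -> G a₀ w c₀
  new w aw wc w≢a w≢c b≢a b≢c with w ≟ b₀
  ... | yes refl = inl (_ , here refl , (λ h -> h) , (λ h -> h))
  ... | no w≢b = inr record { L = L ; wit = b₀ ; wit∈ = (b≢a , (λ e -> w≢b (sym e)) , b≢c) , ε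
    ; in-Ws = inW ; off-u = off ; closed = cl }
   where
   N : V -> Set
   N v = v ≢ a₀ × v ≢ w × v ≢ c₀
   L : V -> Set
   L v = N v × W (Adj± Es) N b₀ v
   inW : ∀ {v} -> L v -> v ∈ Ws ++ [ v₀ ]
   inW (_ , p) = W-ind (_∈ Ws ++ [ v₀ ]) (λ { _ (inl m) _ -> snd (Sh-ends s m) ; _ (inr m) _ -> fst (Sh-ends s m) })
           (Sh-⊂ s (∈ʳ l (there (here refl)))) p
   P : V -> Set
   P v = v ≡ a₀ ⊎ v ≡ w ⊎ v ≡ c₀
   PN : ∀ {v} -> P v -> N v -> ⊥
   PN (inl refl) (k , _) = k refl
   PN (inr (inl refl)) (_ , k , _) = k refl
   PN (inr (inr refl)) (_ , _ , k) = k refl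
   Nb : N b₀
   Nb = b≢a , (λ e -> w≢b (sym e)) , b≢c
   a~c : W (Adj± Es) P a₀ c₀
   a~c = step aw (inr (inl refl)) (edge wc (inr (inr refl)))
   off : ∀ {v} -> L v -> v ∈ u -> ⊥
   off (nv , p) m with ∈⁻ l m
   ... | inl m' = nc s un N P (λ a b -> PN b a) nv (inl refl) (++⁺ (from∈ m') (refl ∷ refl ∷ refl ∷ minimum r))
            (W-rev (Adj±-sym Es) Nb p) a~c
   ... | inr (here refl) = fst nv refl
   ... | inr (there (here refl)) = snd (snd nv) refl
   ... | inr (there (there m')) = nc s un P N PN (inl refl) Nb (++⁺ˡ l (refl ∷ refl ∷ refl ∷ from∈ m')) a~c p
   cl : ∀ {a b} -> L a -> E a b -> L b ⊎ (b ≡ a₀ ⊎ b ≡ w ⊎ b ≡ c₀)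
   cl (na , p) e with split-new e
   ... | inr (inl (refl , refl)) = absurd (fst na refl)
   ... | inr (inr (refl , refl)) = absurd (snd (snd na) refl)
   cl {b = b} (na , p) e | inl o with b ≟ a₀ | b ≟ w | b ≟ c₀
   ... | yes q | _ | _ = inr (inl q)
   ... | no _ | yes q | _ = inr (inr (inl q))
   ... | no _ | no _ | yes q = inr (inr (inr q))
   ... | no i | no j | no k = inl ((i , j , k) , p ∙ edge o (i , j , k))
  new' : ∀ w -> Adj± Es a₀ w -> Adj± Es w c₀ -> w ≢ a₀ -> w ≢ c₀ -> G a₀ w c₀
  new' w aw wc w≢a w≢c = new w aw wc w≢a w≢c (λ e -> loop (fst lk) (sym e)) (loop (snd lk))
   where
   loop : ∀ {a b} -> Adj± Es a b -> a ≢ b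
   loop (inl m) = nl (there m)
   loop (inr m) e = nl (there m) (sym e)
  New St : V -> V -> Set
  New x y = (x ≡ a₀ × y ≡ c₀) ⊎ (x ≡ c₀ × y ≡ a₀)
  St x y = Adj± Es x y ⊎ New x y
  flip : ∀ {x y} -> St x y -> St y x
  flip (inl e) = inl (Adj±-sym Es e)
  flip (inr (inl (p , q))) = inr (inr (q , p))
  flip (inr (inr (p , q))) = inr (inl (q , p))
  one : ∀ {x y z} -> New x y -> St y z -> St x z -> y ≢ z -> x ≢ z -> G x y z
  one (inl (refl , refl)) (inl yz) (inl xz) y≢z x≢z = Good-perm sl₃ sl₃ (new' _ xz (Adj±-sym Es yz) (λ e -> x≢z (sym e)) (λ e -> y≢z (sym e)))
  one (inl (refl , refl)) (inr (inl (_ , e))) _ y≢z x≢z = absurd (y≢z (sym e))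
  one (inl (refl , refl)) (inr (inr (_ , e))) _ y≢z x≢z = absurd (x≢z (sym e))
  one (inl (refl , refl)) (inl _) (inr (inl (_ , e))) y≢z x≢z = absurd (y≢z (sym e))
  one (inl (refl , refl)) (inl _) (inr (inr (_ , e))) y≢z x≢z = absurd (x≢z (sym e))
  one (inr (refl , refl)) (inl yz) (inl xz) y≢z x≢z =
   Good-perm (λ h -> rot₃ (rot₃ h)) rot₃ (new' _ yz (Adj±-sym Es xz) (λ e -> y≢z (sym e)) (λ e -> x≢z (sym e)))
  one (inr (refl , refl)) (inr (inl (_ , e))) _ y≢z x≢z = absurd (x≢z (sym e))
  one (inr (refl , refl)) (inr (inr (_ , e))) _ y≢z x≢z = absurd (y≢z (sym e))
  one (inr (refl , refl)) (inl _) (inr (inl (_ , e))) y≢z x≢z = absurd (x≢z (sym e))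
  one (inr (refl , refl)) (inl _) (inr (inr (_ , e))) y≢z x≢z = absurd (y≢z (sym e))
  go : ∀ {x y z} -> St x y -> St y z -> St x z -> x ≢ y -> y ≢ z -> x ≢ z -> G x y z
  go (inl xy) (inl yz) (inl xz) x≢y y≢z x≢z = lift (triangles s (λ m -> nl (there m)) un xy yz xz x≢y y≢z x≢z)
  go (inr xy) yz xz x≢y y≢z x≢z = one xy yz xz y≢z x≢z
  go xy@(inl _) (inr yz) xz x≢y y≢z x≢z =
   Good-perm (λ h -> rot₃ (rot₃ h)) rot₃ (one yz (flip xz) (flip xy) (λ e -> x≢z (sym e)) (λ e -> x≢y (sym e)))
  go xy@(inl _) yz@(inl _) (inr xz) x≢y y≢z x≢z = Good-perm sl₃ sl₃ (one xz (flip yz) xy (λ e -> y≢z (sym e)) x≢y)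

-- Societies

module _ {A : Set} where
 data Consec : List A -> A -> A -> Set where
  here  : ∀ {a b xs} -> Consec (a ∷ b ∷ xs) a b
  there : ∀ {y xs a b} -> Consec xs a b -> Consec (y ∷ xs) a b

 Con± : List A -> A -> A -> Set
 Con± xs a b = Consec xs a b ⊎ Consec xs b a

 Con±-sym : ∀ {xs a b} -> Con± xs a b -> Con± xs b a
 Con±-sym = Sum.swap

 Consec-∈ : ∀ {xs a b} -> Consec xs a b -> a ∈ xs × b ∈ xs
 Consec-∈ here = here refl , there (here refl)
 Consec-∈ (there c) = let p , q = Consec-∈ c in there p , there q

 Con±-∈ : ∀ {xs a b} -> Con± xs a b -> a ∈ xs × b ∈ xs
 Con±-∈ (inl c) = Consec-∈ c
 Con±-∈ (inr c) = swap (Consec-∈ c)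

 Consec-∈ʳ : ∀ {c xs a b} -> Consec (c ∷ xs) a b -> b ∈ xs
 Consec-∈ʳ here = here refl
 Consec-∈ʳ {xs = x ∷ xs} (there k) = there (Consec-∈ʳ k)

 Consec-∈ˡ : ∀ xs {c a b} -> Consec (xs ++ [ c ]) a b -> a ∈ xs
 Consec-∈ˡ [] (there ())
 Consec-∈ˡ (y ∷ []) here = here refl
 Consec-∈ˡ (y ∷ []) (there (there ()))
 Consec-∈ˡ (y ∷ z ∷ xs) here = here refl
 Consec-∈ˡ (y ∷ z ∷ xs) (there k) = there (Consec-∈ˡ (z ∷ xs) k)

 Consec-split : ∀ xs {c ys a b} -> Consec (xs ++ c ∷ ys) a b -> Consec (xs ++ [ c ]) a b ⊎ Consec (c ∷ ys) a b
 Consec-split [] k = inr k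
 Consec-split (x ∷ []) here = inl here
 Consec-split (x ∷ y ∷ xs) here = inl here
 Consec-split (x ∷ xs) (there k) = Sum.map₁ there (Consec-split xs k)

 Consec-++ʳ : ∀ xs {ys a b} -> Consec ys a b -> Consec (xs ++ ys) a b
 Consec-++ʳ [] k = k
 Consec-++ʳ (x ∷ xs) k = there (Consec-++ʳ xs k)

 Consec-++ˡ : ∀ {xs ys a b} -> Consec xs a b -> Consec (xs ++ ys) a b
 Consec-++ˡ here = here
 Consec-++ˡ (there k) = there (Consec-++ˡ k)

 Consec-mid : ∀ xs {a b ys} -> Consec (xs ++ a ∷ b ∷ ys) a b
 Consec-mid xs = Consec-++ʳ xs here

 Linked-consec : ∀ {R : A -> A -> Set} {xs a b} -> Linked R xs -> Consec xs a b -> R a b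
 Linked-consec (r ∷ _) here = r
 Linked-consec (_ ∷ k) (there c) = Linked-consec k c

 Consec-linked : ∀ xs -> Linked (Consec xs) xs
 Consec-linked [] = []
 Consec-linked (x ∷ []) = [-]
 Consec-linked (x ∷ y ∷ xs) = here ∷ Linked-map there (Consec-linked (y ∷ xs))

 Diff : A × A -> A × A -> Set
 Diff (a , b) (c , d) = ¬ ((a ≡ c × b ≡ d) ⊎ (a ≡ d × b ≡ c))

 ++-uniq : ∀ {xs ys : List A} -> Unique xs -> Unique ys -> (∀ {z} -> z ∈ xs -> z ∈ ys -> ⊥) -> Unique (xs ++ ys)
 ++-uniq u v d = APP.++⁺ u v (All.tabulate λ m -> All.tabulate λ m' -> λ { refl -> d m m' })

 uniq-dis : ∀ xs {ys : List A} -> Unique (xs ++ ys) -> ∀ {z} -> z ∈ xs -> z ∈ ys -> ⊥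
 uniq-dis (x ∷ xs) (a ∷ u) (here refl) m' = All.lookup a (∈ʳ xs m') refl
 uniq-dis (x ∷ xs) (a ∷ u) (there m) m' = uniq-dis xs u m m'

 uniq-init : ∀ xs {ys : List A} -> Unique (xs ++ ys) -> Unique xs
 uniq-init [] u = []
 uniq-init (x ∷ xs) (a ∷ u) = AllP.++⁻ˡ xs a ∷ uniq-init xs u

 AllPairs-++ : ∀ {xs ys : List (A × A)} -> AllPairs Diff xs -> AllPairs Diff ys -> (∀ {e f} -> e ∈ xs -> f ∈ ys -> Diff e f) -> AllPairs Diff (xs ++ ys)
 AllPairs-++ u v d = APP.++⁺ u v (All.tabulate λ m -> All.tabulate λ m' -> d m m')

first-such : ∀ {A : Set} {P : A -> Set} -> Dec₁ P -> ∀ xs ->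
       (∃ λ l -> ∃₂ λ j r -> xs ≡ l ++ j ∷ r × P j × (∀ {z} -> z ∈ l -> ¬ P z)) ⊎ (∀ {z} -> z ∈ xs -> ¬ P z)
first-such P? [] = inr λ ()
first-such P? (x ∷ xs) with P? x | first-such P? xs
... | yes p | _ = inl ([] , x , xs , refl , p , λ ())
... | no ¬p | inl (l , j , r , e , p , f) = inl (x ∷ l , j , r , cong (x ∷_) e , p , λ { (here refl) -> ¬p ; (there m) -> f m })
... | no ¬p | inr f = inr λ { (here refl) -> ¬p ; (there m) -> f m }

last-view : ∀ {A : Set} (b : A) B -> ∃₂ λ m t -> b ∷ B ≡ m ++ [ t ]
last-view b [] = [] , b , refl
last-view b (c ∷ B) = let m , t , e = last-view c B in b ∷ m , t , cong (b ∷_) e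

inner-split : ∀ {A : Set} {h t : A} {m} a₀ {A' c b₀ B'} -> h ∷ m ++ [ t ] ≡ (a₀ ∷ A') ++ c ∷ b₀ ∷ B' ->
       ∃₂ λ m₁ m₂ -> m ≡ m₁ ++ c ∷ m₂ × a₀ ∷ A' ≡ h ∷ m₁ × b₀ ∷ B' ≡ m₂ ++ [ t ]
inner-split {m = m} a₀ {A'} {c} {b₀} {B'} e with last-view b₀ B'
... | m₂ , t' , eB with ∷-injective e
... | refl , e' with ∷ʳ-injective m (A' ++ c ∷ m₂) (trans e' (trans (cong (λ z -> A' ++ c ∷ z) eB) (sym (++-assoc A' (c ∷ m₂) [ t' ]))))
... | e₁ , refl = A' , m₂ , e₁ , refl , eB

module _ {A : Set} where
 ∈-≡ : ∀ {xs ys : List A} {v} -> xs ≡ ys -> v ∈ xs -> v ∈ ys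
 ∈-≡ refl p = p
 Consec-≡ : ∀ {xs ys : List A} {a b} -> xs ≡ ys -> Consec xs a b -> Consec ys a b
 Consec-≡ refl p = p
 ⊆-≡ : ∀ {xs ys zs : List A} -> ys ≡ zs -> xs ⊆ ys -> xs ⊆ zs
 ⊆-≡ refl p = p

module Society {n : ℕ} where
 V = Fin n

 -- Only inner vertices are tested against `S`; a single edge is a link for every `S`.
 Link : (V -> V -> Set) -> (V -> Set) -> V -> V -> Set
 Link E S u v = ∃ λ w -> W E S u w × E w v

 one-of : V -> V -> V -> V -> Set
 one-of p q r v = v ≡ p ⊎ v ≡ q ⊎ v ≡ r

 Inn : (V -> Set) -> V -> List V -> V -> Set
 Inn U x xs v = U v × v ∉ x ∷ xs

 Inn? : ∀ {U} -> Dec₁ U -> ∀ x xs -> Dec₁ (Inn U x xs)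
 Inn? U? x xs v = U? v ×? ¬? (v ∈? (x ∷ xs))

 CrossFree : (V -> V -> Set) -> (V -> Set) -> V -> List V -> Set₁
 CrossFree E U x xs = ∀ (S T : V -> Set) -> (∀ {v} -> S v -> Inn U x xs v) -> (∀ {v} -> T v -> Inn U x xs v) ->
  (∀ {v} -> S v -> T v -> ⊥) -> ∀ {a b c d} -> a ∷ b ∷ c ∷ d ∷ [] ⊆ x ∷ xs -> Link E S a c -> Link E T b d -> ⊥

 -- The three attachments may coincide, so this excludes all separations of order at most three that
 -- cut off inner vertices only.
 SepFree : (V -> V -> Set) -> (V -> Set) -> V -> List V -> Set₁
 SepFree E U x xs = ∀ (L : V -> Set) p q r w -> L w -> (∀ {v} -> L v -> Inn U x xs v) ->
  (∀ {u v} -> L u -> E u v -> U v -> L v ⊎ one-of p q r v) -> ⊥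

 -- A drawing of the society without its apex `x`, in the strip between the boundary path `xs` and a
 -- path `μ` that carries all neighbours of `x`; a fan from `x` over `μ` completes it. The induction
 -- rests on this form, since such strips can be set side by side and stacked. Edges of `Es` need
 -- not be edges of `E`.
 record Out (E : V -> V -> Set) (U : V -> Set) (x h : V) (m : List V) (t : V) : Set where
  xs : List V
  xs = h ∷ m ++ [ t ]
  field
   k  : List V
   Ws : List V
   Es : List (V × V)
   Ts : List (V × V × V)
   sh : Sh xs (h ∷ k ++ [ t ]) Ws Es Ts
   μ-uniq  : Unique (h ∷ k ++ [ t ])
   k⊂N     : ∀ {v} -> v ∈ k -> E x v
   N⊂μ     : ∀ {v} -> U v -> E x v -> v ∈ h ∷ k ++ [ t ]
   Ws⊂I    : ∀ {v} -> v ∈ Ws -> Inn U x xs v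
   I⊂Ws    : ∀ {v} -> Inn U x xs v -> v ∈ Ws
   Ws-uniq : Unique Ws
   cover   : ∀ {u v} -> U u -> U v -> u ≢ x -> v ≢ x -> E u v -> Adj± Es u v ⊎ Con± xs u v
   new     : ∀ {a b} -> (a , b) ∈ Es -> ¬ Con± xs a b
   noloop  : ∀ {a b} -> (a , b) ∈ Es -> a ≢ b
   Es-uniq : AllPairs Diff Es

  μ : List V
  μ = h ∷ k ++ [ t ]

  new± : ∀ {a b} -> Adj± Es a b -> ¬ Con± xs a b
  new± (inl m) c = new m c
  new± (inr m) c = new m (Con±-sym c)

 module _ {E : V -> V -> Set} {U : V -> Set} {x h : V} {m : List V} {t : V}
      (xs⊂ : ∀ {v} -> v ∈ h ∷ m ++ [ t ] -> U v × v ≢ x) (O : Out E U x h m t) where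
  open Shell {n}
  open Out O
  private
   in-U : ∀ {v} -> v ∈ Ws ++ h ∷ m ++ [ t ] -> U v × v ≢ x
   in-U p with ∈⁻ Ws p
   ... | inl w = fst (Ws⊂I w) , λ e -> snd (Ws⊂I w) (here e)
   ... | inr w = xs⊂ w

  μ⊂ : ∀ {v} -> v ∈ μ -> U v × v ≢ x
  μ⊂ p = in-U (Sh-⊂ sh p)

  ends⊂ : ∀ {a b} -> (a , b) ∈ Es -> (U a × a ≢ x) × (U b × b ≢ x)
  ends⊂ p = let q , r = Sh-ends sh p in in-U q , in-U r

  ends±⊂ : ∀ {a b} -> Adj± Es a b -> (U a × a ≢ x) × (U b × b ≢ x)
  ends±⊂ (inl p) = ends⊂ p
  ends±⊂ (inr p) = swap (ends⊂ p)

  μ-linked : ∀ {a b} -> Con± μ a b -> Adj± Es a b ⊎ Con± (h ∷ m ++ [ t ]) a b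
  μ-linked c = [ go , (λ c -> Sum.map (Adj±-sym Es) Con±-sym (go c)) ]′ c
   where
   go : ∀ {a b} -> Consec μ a b -> Adj± Es a b ⊎ Con± (h ∷ m ++ [ t ]) a b
   go c = [ (λ p -> inr (inl p)) , inl ]′ (Linked-consec (Sh-linked _ (Consec-linked _) sh) c)

 -- Successive covering steps at `x` shrink the walk from `x` over the path to a single edge. The
 -- edge from `x` to `a` is present at the start and hence not listed in `Es`.
 fan : ∀ (x a : V) ks t -> ∃₂ λ Es Ts -> Sh (x ∷ a ∷ ks ++ [ t ]) (x ∷ t ∷ []) [] Es Ts ×
    (∀ {v} -> v ∈ ks ++ [ t ] -> (x , v) ∈ Es) × (∀ {p q} -> (p , q) ∈ Es -> p ≡ x × q ∈ ks ++ [ t ]) ×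
    (x ∉ ks ++ [ t ] -> Unique (ks ++ [ t ]) -> AllPairs Diff Es)
 fan x a [] t = _ , _ , cov [] x a t [] start , (λ { (here refl) -> here refl }) , (λ { (here refl) -> refl , here refl }) , λ _ _ -> [] ∷ []
 fan x a (b ∷ ks) t with fan x b ks t
 ... | Es , Ts , s , f , g , u = _ , _ , (cov [] x a b (ks ++ [ t ]) start ⨾ s)
  , (λ { (here refl) -> ∈ʳ Es (here refl) ; (there p) -> ∈ˡ (f p) })
  , g' , λ x∉ un -> AllPairs-++ (u (λ p -> x∉ (there p)) (Unique-drop [ b ] un)) ([] ∷ []) (d x∉ un)
  where
  g' : ∀ {p q} -> (p , q) ∈ Es ++ [ (x , b) ] -> p ≡ x × q ∈ b ∷ ks ++ [ t ]
  g' p with ∈⁻ Es p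
  ... | inl p' = let q , r = g p' in q , there r
  ... | inr (here refl) = refl , here refl
  d : x ∉ b ∷ ks ++ [ t ] -> Unique (b ∷ ks ++ [ t ]) -> ∀ {e f} -> e ∈ Es -> f ∈ [ (x , b) ] -> Diff e f
  d x∉ un {e₁ , e₂} p (here refl) (inl (_ , q)) = Unique-∉ un (subst (_∈ _) q (snd (g p)))
  d x∉ un {e₁ , e₂} p (here refl) (inr (q , _)) = x∉ (here (trans (sym (fst (g p))) q))

 base-out : ∀ {E : V -> V -> Set} {U : V -> Set} {x h t} -> (∀ {u v} -> E u v -> u ≢ v) -> Unique (x ∷ h ∷ [ t ]) ->
       (∀ {v} -> U v -> one-of x h t v) -> Out E U x h [] t
 base-out {E} {U} {x} {h} {t} irr un all = record
  { k = [] ; Ws = [] ; Es = [] ; Ts = [] ; sh = start ; μ-uniq = Unique-drop [ x ] un ; k⊂N = λ ()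
  ; N⊂μ = λ u e -> [ (λ q -> absurd (irr e (sym q))) , [ here , (λ q -> there (here q)) ]′ ]′ (all u)
  ; Ws⊂I = λ () ; I⊂Ws = λ (u , v∉) -> absurd (v∉ ([ here , [ (λ q -> there (here q)) , (λ q -> there (there (here q))) ]′ ]′ (all u)))
  ; Ws-uniq = [] ; cover = λ p q np nq e -> inr (cv (all p) (all q) np nq e) ; new = λ () ; noloop = λ () ; Es-uniq = [] }
  where
  cv : ∀ {u v} -> one-of x h t u -> one-of x h t v -> u ≢ x -> v ≢ x -> E u v -> Con± (h ∷ t ∷ []) u v
  cv (inl p) _ np nq e = absurd (np p)
  cv (inr _) (inl p) np nq e = absurd (nq p)
  cv (inr (inl refl)) (inr (inl refl)) np nq e = absurd (irr e refl)
  cv (inr (inl refl)) (inr (inr refl)) np nq e = inl here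
  cv (inr (inr refl)) (inr (inl refl)) np nq e = inr here
  cv (inr (inr refl)) (inr (inr refl)) np nq e = absurd (irr e refl)

 -- The apex x has no neighbour besides h and t: solve with apex h, then fan out from h.
 ear-out : ∀ {E : V -> V -> Set} {U : V -> Set} {x h h' m t} -> (∀ {u v} -> E u v -> E v u) -> Unique (x ∷ h ∷ h' ∷ m ++ [ t ]) ->
      (∀ {v} -> v ∈ h ∷ h' ∷ m ++ [ t ] -> U v × v ≢ x) -> (∀ {v} -> U v -> E x v -> v ≡ h ⊎ v ≡ t) ->
      Out E (λ v -> U v × v ≢ x) h h' m t -> Out E U x h (h' ∷ m) t
 ear-out {E} {U} {x} {h} {h'} {m} {t} Esym un xs⊂ N O = record
  { k = [] ; Ws = Ws ; Es = Fs ++ Es ; Ts = _ ; sh = s₁ ⨾ s₂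
  ; μ-uniq = ((λ { refl -> h∉ (∈ʳ (h' ∷ m) (here refl)) }) ∷ []) ∷ [] ∷ []
  ; k⊂N = λ () ; N⊂μ = λ u e -> [ here , (λ q -> there (here q)) ]′ (N u e)
  ; Ws⊂I = λ w -> let (u , ne) , v∉ = Ws⊂I w in u , λ { (here e) -> ne e ; (there p) -> v∉ p }
  ; I⊂Ws = λ (u , v∉) -> I⊂Ws ((u , λ e -> v∉ (here e)) , λ p -> v∉ (there p))
  ; Ws-uniq = Ws-uniq ; cover = cv
  ; new = nw ; noloop = nl ; Es-uniq = AllPairs-++ (fu h∉ks (Unique-drop [ h' ] μ-uniq)) Es-uniq df }
  where
  open Out O
  un' = Unique-drop [ x ] un
  h∉ : h ∉ h' ∷ m ++ [ t ]
  h∉ = Unique-∉ un'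
  xs'⊂ : ∀ {v} -> v ∈ h' ∷ m ++ [ t ] -> (U v × v ≢ x) × v ≢ h
  xs'⊂ p = xs⊂ (there p) , λ { refl -> h∉ p }
  h∉ks : h ∉ k ++ [ t ]
  h∉ks p = snd (μ⊂ xs'⊂ O (there p)) refl
  F = fan h h' k t
  Fs = fst F
  s₂ = fst (snd (snd F))
  f⁺ = fst (snd (snd (snd F)))
  f⁻ = fst (snd (snd (snd (snd F))))
  fu = snd (snd (snd (snd (snd F))))
  s₁ : Sh (h ∷ h' ∷ m ++ [ t ]) (h ∷ h' ∷ k ++ [ t ]) Ws Es Ts
  s₁ = subst₂ (λ a b -> Sh (h ∷ h' ∷ a) (h ∷ h' ∷ b) Ws Es Ts) (++-identityʳ _) (++-identityʳ _) (ctx [ h ] [] sh)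
  es : ∀ {e} -> e ∈ Fs ++ Es -> e ∈ Fs ⊎ e ∈ Es
  es p = ∈⁻ Fs p
  inF : ∀ {e} -> e ∈ Fs -> e ∈ Fs ++ Es
  inF = ∈ˡ
  inE : ∀ {e} -> e ∈ Es -> e ∈ Fs ++ Es
  inE p = ∈ʳ Fs p
  toh : ∀ {v} -> U v -> v ≢ x -> E h v -> Adj± (Fs ++ Es) h v ⊎ Con± (h ∷ h' ∷ m ++ [ t ]) h v
  toh u ne e with N⊂μ (u , ne) e
  ... | here refl = inr (inl here)
  ... | there p = inl (inl (inF (f⁺ p)))
  cv : ∀ {u v} -> U u -> U v -> u ≢ x -> v ≢ x -> E u v -> Adj± (Fs ++ Es) u v ⊎ Con± (h ∷ h' ∷ m ++ [ t ]) u v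
  cv {u} {v} uu uv nu nv e with u ≟ h | v ≟ h
  ... | yes refl | _ = toh uv nv e
  ... | no _ | yes refl = Sum.map (Adj±-sym _) Con±-sym (toh uu nu (Esym e))
  ... | no u≢h | no v≢h = Sum.map (Sum.map inE inE) (Sum.map there there) (cover (uu , nu) (uv , nv) u≢h v≢h e)
  conh : ∀ {v} -> Con± (h ∷ h' ∷ m ++ [ t ]) h v -> v ≡ h'
  conh (inl here) = refl
  conh (inl (there c)) = absurd (h∉ (fst (Consec-∈ c)))
  conh (inr here) = absurd (h∉ (here refl))
  conh (inr (there c)) = absurd (h∉ (snd (Consec-∈ c)))
  down : ∀ {a b} -> a ≢ h -> b ≢ h -> Con± (h ∷ h' ∷ m ++ [ t ]) a b -> Con± (h' ∷ m ++ [ t ]) a b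
  down na nb (inl here) = absurd (na refl)
  down na nb (inl (there c)) = inl c
  down na nb (inr here) = absurd (nb refl)
  down na nb (inr (there c)) = inr c
  nw : ∀ {a b} -> (a , b) ∈ Fs ++ Es -> ¬ Con± (h ∷ h' ∷ m ++ [ t ]) a b
  nw p c with es p
  nw p c | inl q with f⁻ q
  ... | refl , r with conh c
  ... | refl = Unique-∉ μ-uniq r
  nw p c | inr q = let (_ , na) , (_ , nb) = ends⊂ xs'⊂ O q in new q (down na nb c)
  nl : ∀ {a b} -> (a , b) ∈ Fs ++ Es -> a ≢ b
  nl p with es p
  ... | inr q = noloop q
  ... | inl q with f⁻ q
  ... | refl , r = λ { refl -> h∉ks r }
  df : ∀ {e f} -> e ∈ Fs -> f ∈ Es -> Diff e f
  df p q d with f⁻ p | ends⊂ xs'⊂ O q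
  df p q (inl (refl , refl)) | refl , _ | (_ , na) , _ = na refl
  df p q (inr (refl , refl)) | refl , _ | _ , (_ , nb) = nb refl

 -- Stacks a strip that starts at `μ₂` on the strip from `xs` to `μ₂`. By the last hypothesis, edges
 -- of the lower strip between vertices of `μ₂` are steps of `μ₂`; this prevents the upper strip
 -- from drawing an edge a second time.
 seq-out : ∀ {E E₂ Ez : V -> V -> Set} {U U₂ Uz : V -> Set} {x h m t} ->
      (∀ {v} -> v ∈ h ∷ m ++ [ t ] -> U₂ v × v ≢ x) ->
      (O₂ : Out E₂ U₂ x h m t) -> let open Out O₂ using () renaming (k to k₂; Es to E₂s; μ to μ₂) in
      (Oz : Out Ez Uz x h k₂ t) ->
      (∀ {v} -> v ∈ μ₂ -> Uz v × v ≢ x) ->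
      (∀ {u v} -> Ez u v -> E u v) ->
      (∀ {v} -> U v -> E x v -> Uz v × Ez x v) ->
      (∀ {v} -> Inn U x (h ∷ m ++ [ t ]) v -> Inn U₂ x (h ∷ m ++ [ t ]) v ⊎ Inn Uz x μ₂ v) ->
      (∀ {v} -> U₂ v -> U v) -> (∀ {v} -> Uz v -> U v) ->
      (∀ {v} -> U₂ v -> Uz v -> v ≢ x -> v ∈ μ₂) ->
      (∀ {u v} -> U u -> U v -> u ≢ x -> v ≢ x -> E u v -> (U₂ u × U₂ v × E₂ u v) ⊎ (Uz u × Uz v × Ez u v)) ->
      (∀ {a b} -> a ∈ μ₂ -> b ∈ μ₂ -> a ≢ b -> Adj± E₂s a b ⊎ Con± (h ∷ m ++ [ t ]) a b -> Con± μ₂ a b) ->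
      Out E U x h m t
 seq-out {E} {E₂} {Ez} {U} {U₂} {Uz} {x} {h} {m} {t} xs⊂ O₂ Oz μ₂⊂ EzE xN Isp U₂U UzU shared edges chordless = record
  { k = Z.k ; Ws = Z.Ws ++ A.Ws ; Es = Z.Es ++ A.Es ; Ts = _ ; sh = A.sh ⨾ Z.sh ; μ-uniq = Z.μ-uniq
  ; k⊂N = λ p -> EzE (Z.k⊂N p) ; N⊂μ = λ u e -> let a , b = xN u e in Z.N⊂μ a b
  ; Ws⊂I = λ p -> [ zI , (λ q -> let a , b = A.Ws⊂I q in U₂U a , b) ]′ (∈⁻ Z.Ws p)
  ; I⊂Ws = λ p -> [ (λ q -> ∈ʳ Z.Ws (A.I⊂Ws q)) , (λ q -> ∈ˡ (Z.I⊂Ws q)) ]′ (Isp p)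
  ; Ws-uniq = ++-uniq Z.Ws-uniq A.Ws-uniq λ p q -> let a , b = Z.Ws⊂I p ; c , d = A.Ws⊂I q in b (there (shared c a (λ e -> d (here e))))
  ; cover = cv ; new = nw
  ; noloop = λ p -> [ Z.noloop , A.noloop ]′ (∈⁻ Z.Es p)
  ; Es-uniq = AllPairs-++ Z.Es-uniq A.Es-uniq df }
  where
  module A = Out O₂
  module Z = Out Oz
  xs = h ∷ m ++ [ t ]
  inμ : ∀ {a b} -> Adj± Z.Es a b -> U₂ a × a ≢ x -> U₂ b × b ≢ x -> a ∈ A.μ × b ∈ A.μ
  inμ p (ua , na) (ub , nb) = let (za , _) , (zb , _) = ends±⊂ μ₂⊂ Oz p in shared ua za na , shared ub zb nb
  conflict : ∀ {a b} -> Adj± Z.Es a b -> a ≢ b -> Adj± A.Es a b ⊎ Con± xs a b -> ⊥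
  conflict p ne q = let a , b = inμ p (fst (in₂ q)) (snd (in₂ q)) in Z.new± p (chordless a b ne q)
   where
   in₂ : ∀ {a b} -> Adj± A.Es a b ⊎ Con± xs a b -> (U₂ a × a ≢ x) × (U₂ b × b ≢ x)
   in₂ (inl e) = ends±⊂ xs⊂ O₂ e
   in₂ (inr c) = let a , b = Con±-∈ c in xs⊂ a , xs⊂ b
  zI : ∀ {v} -> v ∈ Z.Ws -> Inn U x xs v
  zI p = let a , b = Z.Ws⊂I p in UzU a , λ { (here e) -> b (here e) ; (there q) -> b (there (shared (fst (xs⊂ q)) a (snd (xs⊂ q)))) }
  cv : ∀ {u v} -> U u -> U v -> u ≢ x -> v ≢ x -> E u v -> Adj± (Z.Es ++ A.Es) u v ⊎ Con± xs u v
  cv uu uv nu nv e with edges uu uv nu nv e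
  ... | inl (a , b , e₂) = Sum.map₁ (Sum.map (∈ʳ Z.Es) (∈ʳ Z.Es)) (A.cover a b nu nv e₂)
  ... | inr (a , b , ez) with Z.cover a b nu nv ez
  ... | inl p = inl (Sum.map ∈ˡ ∈ˡ p)
  ... | inr c = Sum.map₁ (Sum.map (∈ʳ Z.Es) (∈ʳ Z.Es)) (μ-linked xs⊂ O₂ c)
  nw : ∀ {a b} -> (a , b) ∈ Z.Es ++ A.Es -> ¬ Con± xs a b
  nw p c = [ (λ q -> conflict (inl q) (Z.noloop q) (inr c)) , (λ q -> A.new q c) ]′ (∈⁻ Z.Es p)
  df : ∀ {e f} -> e ∈ Z.Es -> f ∈ A.Es -> Diff e f
  df p q (inl (refl , refl)) = conflict (inl p) (Z.noloop p) (inl (inl q))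
  df p q (inr (refl , refl)) = conflict (inl p) (Z.noloop p) (inl (inr q))

 -- Two strips side by side, meeting at a neighbour `z` of the apex. In one use `z` is a vertex of
 -- `xs` and `base` is trivial; in the other `z` is an inner vertex, which `base` first hangs on
 -- `xs` as a pendant vertex, recorded in `W₀` and `E₀`.
 split-out : ∀ {E : V -> V -> Set} {U Uₗ Uᵣ : V -> Set} {x h t z : V} (m mₗ mᵣ : List V) {W₀ E₀} ->
       Sh (h ∷ m ++ [ t ]) (h ∷ mₗ ++ z ∷ mᵣ ++ [ t ]) W₀ E₀ [] ->
       (∀ {v} -> v ∈ h ∷ m ++ [ t ] -> U v × v ≢ x) ->
       (Oₗ : Out E Uₗ x h mₗ z) -> (∀ {v} -> v ∈ h ∷ mₗ ++ [ z ] -> Uₗ v × v ≢ x) ->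
       (Oᵣ : Out E Uᵣ x z mᵣ t) -> (∀ {v} -> v ∈ z ∷ mᵣ ++ [ t ] -> Uᵣ v × v ≢ x) ->
       E x z -> h ≢ t -> ¬ Uᵣ h -> ¬ Uₗ t ->
       (∀ {v} -> Uₗ v -> Uᵣ v -> v ≢ x -> v ≡ z ⊎ ¬ E x v) ->
       (∀ {a b} -> Uₗ a × Uᵣ a × a ≢ x -> Uₗ b × Uᵣ b × b ≢ x -> a ≢ b -> Con± (h ∷ mₗ ++ [ z ]) a b × Con± (z ∷ mᵣ ++ [ t ]) a b) ->
       (∀ {v} -> U v -> Uₗ v ⊎ Uᵣ v) -> (∀ {v} -> Uₗ v -> U v) -> (∀ {v} -> Uᵣ v -> U v) ->
       (∀ {u v} -> U u -> U v -> u ≢ x -> v ≢ x -> E u v -> (Uₗ u × Uₗ v) ⊎ (Uᵣ u × Uᵣ v)) ->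
       (∀ {v} -> Inn U x (h ∷ m ++ [ t ]) v -> Inn Uₗ x (h ∷ mₗ ++ [ z ]) v ⊎ Inn Uᵣ x (z ∷ mᵣ ++ [ t ]) v ⊎ v ∈ W₀) ->
       (∀ {v} -> Inn Uₗ x (h ∷ mₗ ++ [ z ]) v -> Inn U x (h ∷ m ++ [ t ]) v × v ∉ W₀) ->
       (∀ {v} -> Inn Uᵣ x (z ∷ mᵣ ++ [ t ]) v -> Inn U x (h ∷ m ++ [ t ]) v × v ∉ W₀) ->
       (∀ {v} -> Inn Uₗ x (h ∷ mₗ ++ [ z ]) v -> Inn Uᵣ x (z ∷ mᵣ ++ [ t ]) v -> ⊥) ->
       (∀ {v} -> v ∈ W₀ -> Inn U x (h ∷ m ++ [ t ]) v) -> Unique W₀ ->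
       (∀ {a b} -> Uₗ a × Uₗ b ⊎ Uᵣ a × Uᵣ b -> Con± (h ∷ m ++ [ t ]) a b -> (Uₗ a × Uₗ b -> Con± (h ∷ mₗ ++ [ z ]) a b) × (Uᵣ a × Uᵣ b -> Con± (z ∷ mᵣ ++ [ t ]) a b)) ->
       (∀ {a b} -> Con± (h ∷ mₗ ++ [ z ]) a b ⊎ Con± (z ∷ mᵣ ++ [ t ]) a b -> Con± (h ∷ m ++ [ t ]) a b ⊎ Adj± E₀ a b) ->
       (∀ {a b} -> (a , b) ∈ E₀ -> ¬ Con± (h ∷ m ++ [ t ]) a b × a ≢ b × Con± (h ∷ mₗ ++ [ z ]) a b × Con± (z ∷ mᵣ ++ [ t ]) a b) ->
       AllPairs Diff E₀ ->
       Out E U x h m t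
 split-out {E} {U} {Uₗ} {Uᵣ} {x} {h} {t} {z} m mₗ mᵣ {W₀} {E₀} base xs⊂ Oₗ ⊂ₗ Oᵣ ⊂ᵣ xz h≢t h∉r t∉l share share₂ cov-U Uₗ⊂ Uᵣ⊂ edges
      I-cov I-l I-r I-dis W₀⊂ W₀-uniq con-down con-up E₀-prop E₀-uniq = record
  { k = L.k ++ z ∷ R.k ; Ws = R.Ws ++ L.Ws ++ W₀ ; Es = R.Es ++ L.Es ++ E₀ ; Ts = R.Ts ++ L.Ts ++ []
  ; sh = subst (λ w -> Sh (h ∷ m ++ [ t ]) w (R.Ws ++ L.Ws ++ W₀) (R.Es ++ L.Es ++ E₀) (R.Ts ++ L.Ts ++ [])) (cong (h ∷_) (sym (++-assoc L.k (z ∷ R.k) [ t ]))) ((base ⨾ s₁) ⨾ s₂)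
  ; μ-uniq = subst Unique (cong (h ∷_) (sym (++-assoc L.k (z ∷ R.k) [ t ]))) μu
  ; k⊂N = λ p -> [ L.k⊂N , (λ { (here refl) -> xz ; (there q) -> R.k⊂N q }) ]′ (∈⁻ L.k p)
  ; N⊂μ = λ {v} u e -> subst (v ∈_) (cong (h ∷_) (sym (++-assoc L.k (z ∷ R.k) [ t ]))) (inμ u e)
  ; Ws⊂I = wi
  ; I⊂Ws = λ i -> [ (λ q -> ∈ʳ R.Ws (∈ˡ (L.I⊂Ws q))) , [ (λ q -> ∈ˡ (R.I⊂Ws q)) , (λ q -> ∈ʳ R.Ws (∈ʳ L.Ws q)) ]′ ]′ (I-cov i)
  ; Ws-uniq = ++-uniq R.Ws-uniq (++-uniq L.Ws-uniq W₀-uniq λ p q -> snd (I-l (L.Ws⊂I p)) q)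
    λ p q -> [ (λ q -> I-dis (L.Ws⊂I q) (R.Ws⊂I p)) , snd (I-r (R.Ws⊂I p)) ]′ (∈⁻ L.Ws q)
  ; cover = cv ; new = nw
  ; noloop = λ p -> [ R.noloop , (λ q -> [ L.noloop , (λ q -> fst (snd (E₀-prop q))) ]′ (∈⁻ L.Es q)) ]′ (∈⁻ R.Es p)
  ; Es-uniq = AllPairs-++ R.Es-uniq (AllPairs-++ L.Es-uniq E₀-uniq dl₀) dr }
  where
  module L = Out Oₗ
  module R = Out Oᵣ
  up : ∀ {e} -> e ∈ R.Es ⊎ e ∈ L.Es ⊎ e ∈ E₀ -> e ∈ R.Es ++ L.Es ++ E₀
  up = [ ∈ˡ , [ (λ q -> ∈ʳ R.Es (∈ˡ q)) , (λ q -> ∈ʳ R.Es (∈ʳ L.Es q)) ]′ ]′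
  s₁ : Sh (h ∷ mₗ ++ z ∷ mᵣ ++ [ t ]) (h ∷ L.k ++ z ∷ mᵣ ++ [ t ]) L.Ws L.Es L.Ts
  s₁ = subst₂ (λ a b -> Sh (h ∷ a) (h ∷ b) L.Ws L.Es L.Ts) (++-assoc mₗ [ z ] (mᵣ ++ [ t ])) (++-assoc L.k [ z ] (mᵣ ++ [ t ]))
      (ctx [] (mᵣ ++ [ t ]) L.sh)
  s₂ : Sh (h ∷ L.k ++ z ∷ mᵣ ++ [ t ]) (h ∷ L.k ++ z ∷ R.k ++ [ t ]) R.Ws R.Es R.Ts
  s₂ = subst₂ (λ a b -> Sh (h ∷ L.k ++ a) (h ∷ L.k ++ b) R.Ws R.Es R.Ts) (++-identityʳ _) (++-identityʳ _) (ctx (h ∷ L.k) [] R.sh)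
  μL : ∀ {v} -> v ∈ h ∷ L.k -> Uₗ v × v ≢ x × v ≢ z
  μL p = let a , b = μ⊂ ⊂ₗ Oₗ (∈ˡ p) in a , b , λ { refl -> uniq-dis (h ∷ L.k) L.μ-uniq p (here refl) }
  dis-μ : ∀ {v} -> v ∈ h ∷ L.k -> v ∈ z ∷ R.k ++ [ t ] -> ⊥
  dis-μ p q with μL p | μ⊂ ⊂ᵣ Oᵣ q
  ... | a , b , c | d , _ with share a d b
  ... | inl e = c e
  ... | inr ¬e with p
  ... | here refl = h∉r d
  ... | there p' = ¬e (L.k⊂N p')
  μu : Unique (h ∷ L.k ++ z ∷ R.k ++ [ t ])
  μu = ++-uniq {xs = h ∷ L.k} (uniq-init (h ∷ L.k) L.μ-uniq) R.μ-uniq dis-μ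
  inμ : ∀ {v} -> U v -> E x v -> v ∈ h ∷ L.k ++ z ∷ R.k ++ [ t ]
  inμ u e with cov-U u
  ... | inr r = ∈ʳ (h ∷ L.k) (R.N⊂μ r e)
  ... | inl l with ∈⁻ (h ∷ L.k) (L.N⊂μ l e)
  ... | inl q = ∈ˡ q
  ... | inr (here refl) = ∈ʳ (h ∷ L.k) (here refl)
  wi : ∀ {v} -> v ∈ R.Ws ++ L.Ws ++ W₀ -> Inn U x (h ∷ m ++ [ t ]) v
  wi p with ∈⁻ R.Ws p
  ... | inl q = fst (I-r (R.Ws⊂I q))
  ... | inr q with ∈⁻ L.Ws q
  ... | inl r = fst (I-l (L.Ws⊂I r))
  ... | inr r = W₀⊂ r
  cv : ∀ {u v} -> U u -> U v -> u ≢ x -> v ≢ x -> E u v -> Adj± (R.Es ++ L.Es ++ E₀) u v ⊎ Con± (h ∷ m ++ [ t ]) u v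
  cv uu uv nu nv e with edges uu uv nu nv e
  ... | inl (a , b) with L.cover a b nu nv e
  ... | inl p = inl (Sum.map (λ q -> up (inr (inl q))) (λ q -> up (inr (inl q))) p)
  ... | inr c = [ inr , (λ p -> inl (Sum.map (λ q -> up (inr (inr q))) (λ q -> up (inr (inr q))) p)) ]′ (con-up (inl c))
  cv uu uv nu nv e | inr (a , b) with R.cover a b nu nv e
  ... | inl p = inl (Sum.map (λ q -> up (inl q)) (λ q -> up (inl q)) p)
  ... | inr c = [ inr , (λ p -> inl (Sum.map (λ q -> up (inr (inr q))) (λ q -> up (inr (inr q))) p)) ]′ (con-up (inr c))
  endsₗ : ∀ {a b} -> (a , b) ∈ L.Es -> (Uₗ a × a ≢ x) × (Uₗ b × b ≢ x)
  endsₗ = ends⊂ ⊂ₗ Oₗ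
  endsᵣ : ∀ {a b} -> (a , b) ∈ R.Es -> (Uᵣ a × a ≢ x) × (Uᵣ b × b ≢ x)
  endsᵣ = ends⊂ ⊂ᵣ Oᵣ
  nw : ∀ {a b} -> (a , b) ∈ R.Es ++ L.Es ++ E₀ -> ¬ Con± (h ∷ m ++ [ t ]) a b
  nw p c with ∈⁻ R.Es p
  ... | inl q = let (a , _) , (b , _) = endsᵣ q in R.new q (snd (con-down (inr (a , b)) c) (a , b))
  ... | inr q with ∈⁻ L.Es q
  ... | inl r = let (a , _) , (b , _) = endsₗ r in L.new r (fst (con-down (inl (a , b)) c) (a , b))
  ... | inr r = fst (E₀-prop r) c
  dl₀ : ∀ {e f} -> e ∈ L.Es -> f ∈ E₀ -> Diff e f
  dl₀ p q (inl (refl , refl)) = L.new p (fst (snd (snd (E₀-prop q))))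
  dl₀ p q (inr (refl , refl)) = L.new p (Con±-sym (fst (snd (snd (E₀-prop q)))))
  both : ∀ {a b} -> (a , b) ∈ R.Es -> (Uₗ a × a ≢ x) × (Uₗ b × b ≢ x) -> ⊥
  both p ((la , na) , (lb , nb)) = let (ra , _) , (rb , _) = endsᵣ p in R.new p (snd (share₂ (la , ra , na) (lb , rb , nb) (R.noloop p)))
  dr : ∀ {e f} -> e ∈ R.Es -> f ∈ L.Es ++ E₀ -> Diff e f
  dr p q d with ∈⁻ L.Es q
  dr p q (inl (refl , refl)) | inl r = both p (endsₗ r)
  dr p q (inr (refl , refl)) | inl r = both p (swap (endsₗ r))
  dr p q (inl (refl , refl)) | inr r = R.new p (snd (snd (snd (E₀-prop r))))
  dr p q (inr (refl , refl)) | inr r = R.new p (Con±-sym (snd (snd (snd (E₀-prop r)))))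

 record Soc (E : V -> V -> Set) (U : V -> Set) (x h : V) (m : List V) (t : V) : Set₁ where
  xs : List V
  xs = h ∷ m ++ [ t ]
  field
   E?   : Dec₂ E
   Esym : ∀ {u v} -> E u v -> E v u
   irr  : ∀ {u v} -> E u v -> u ≢ v
   U?   : Dec₁ U
   un   : Unique (x ∷ xs)
   x∈U  : U x
   xs∈U : ∀ {v} -> v ∈ xs -> U v
   cf   : CrossFree E U x xs
   sf   : SepFree E U x xs
  x∉xs : x ∉ xs
  x∉xs = Unique-∉ un
  I : V -> Set
  I = Inn U x xs
  I? : Dec₁ I
  I? = Inn? U? x xs
  xs⊂ : ∀ {v} -> v ∈ xs -> U v × v ≢ x
  xs⊂ p = xs∈U p , λ { refl -> x∉xs p }
  -- Most reductions lose a vertex of `U`. The zone society may merely move an inner vertex to the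
  -- boundary, which is why inner vertices are counted a second time.
  size : ℕ
  size = cnt U? + cnt I?

 module _ where
  open Soc

  sub-sf : ∀ {E E' U U' x x' xs xs'} -> SepFree E U x xs -> (∀ {v} -> Inn U' x' xs' v -> Inn U x xs v) ->
       (∀ {u v} -> Inn U' x' xs' u -> E u v -> U v -> U' v × E' u v) -> SepFree E' U' x' xs'
  sub-sf sf up cl L p q r w lw L⊂ clo = sf L p q r w lw (λ l -> up (L⊂ l)) λ l e u -> let a , b = cl (L⊂ l) e u in clo l b a

  sub-cf : ∀ {E U U' x x' xs xs'} -> CrossFree E U x xs -> (∀ {v} -> Inn U' x' xs' v -> Inn U x xs v) ->
       x' ∷ xs' ⊆ x ∷ xs -> CrossFree E U' x' xs'
  sub-cf cf up τ S T S⊂ T⊂ dis σ = cf S T (λ s -> up (S⊂ s)) (λ t -> up (T⊂ t)) dis (⊆-trans σ τ)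

  smaller : ∀ {U U' I I' : V -> Set} (U? : Dec₁ U) (U'? : Dec₁ U') (I? : Dec₁ I) (I'? : Dec₁ I') ->
       (∀ {v} -> U' v -> U v) -> (∀ {v} -> I' v -> I v) -> ∀ z -> U z -> ¬ U' z -> cnt U'? + cnt I'? < cnt U? + cnt I?
  smaller U? U'? I? I'? f g z uz ¬z = +-mono-<-≤ (cnt-strict U'? U? f z uz ¬z) (cnt-mono I'? I? g)

  ear : ∀ {E U x h h' m t} (S : Soc E U x h (h' ∷ m) t) -> (∀ {v} -> I S v -> E x v -> ⊥) ->
     Soc E (λ v -> U v × v ≢ x) h h' m t
  ear {E} {U} {x} {h} {h'} {m} {t} S ¬N = record
   { E? = E? S ; Esym = Esym S ; irr = irr S ; U? = ∖? (U? S) x ; un = Unique-drop [ x ] (un S)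
   ; x∈U = xs⊂ S (here refl) ; xs∈U = λ p -> xs⊂ S (there p)
   ; cf = sub-cf (cf S) up (x ∷ʳ ⊆-refl)
   ; sf = sub-sf (sf S) up λ i e u -> (u , λ { refl -> ¬N (up i) (Esym S e) }) , e }
   where
   up : ∀ {v} -> Inn (λ v -> U v × v ≢ x) h (h' ∷ m ++ [ t ]) v -> I S v
   up ((u , ne) , v∉) = u , λ { (here e) -> ne e ; (there p) -> v∉ p }

  -- Cutting the society along x - y - c; the case y = c is that of a chord x - c.
  module Cut {E U x h m₁ c m₂ t} (S : Soc E U x h (m₁ ++ c ∷ m₂) t) (y : V) (y? : y ≡ c ⊎ I S y) where
   A B X : List V
   A = h ∷ m₁
   B = m₂ ++ [ t ]
   X = Soc.xs S
   eqX : X ≡ A ++ c ∷ B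
   eqX = cong (h ∷_) (++-assoc m₁ (c ∷ m₂) [ t ])
   J : V -> Set
   J v = I S v × v ≢ y
   J? : Dec₁ J
   J? = ∖? (I? S) y
   -- Inner vertices are sorted by whether they reach the left arc `A` without using `y`. The
   -- hypotheses `straddle` and `across` below say that nothing reaches both arcs.
   Touch : V -> Set
   Touch v = ∃ λ z -> W E J v z × ∃ λ w -> E z w × w ∈ A
   Touch? : Dec₁ Touch
   Touch? v = any? λ z -> W? (E? S) J? v z ×? any? λ w -> E? S z w ×? (w ∈? A)

   module Sides (straddle : ∀ {u v} -> J u -> Touch u -> E u v -> v ∈ B -> ⊥) (across : ∀ {a b} -> a ∈ A -> b ∈ B -> E a b -> ⊥) where
    Both Lo Ro Uₗ Uᵣ : V -> Set
    Both v = v ≡ x ⊎ v ≡ c ⊎ v ≡ y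
    Lo v = v ∈ A ⊎ (J v × Touch v)
    Ro v = v ∈ B ⊎ (J v × ¬ Touch v)
    Uₗ v = Both v ⊎ Lo v
    Uᵣ v = Both v ⊎ Ro v
    Both? : Dec₁ Both
    Both? v = (v ≟ x) ⊎? ((v ≟ c) ⊎? (v ≟ y))
    Uₗ? : Dec₁ Uₗ
    Uₗ? v = Both? v ⊎? ((v ∈? A) ⊎? (J? v ×? Touch? v))
    Uᵣ? : Dec₁ Uᵣ
    Uᵣ? v = Both? v ⊎? ((v ∈? B) ⊎? (J? v ×? ¬? (Touch? v)))
    unX : Unique (A ++ c ∷ B)
    unX = subst Unique eqX (Unique-drop [ x ] (un S))
    toX : ∀ {v} -> v ∈ A ++ c ∷ B -> v ∈ X
    toX = ∈-≡ (sym eqX)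
    frX : ∀ {v} -> v ∈ X -> v ∈ A ++ c ∷ B
    frX = ∈-≡ eqX
    A⊂X : ∀ {v} -> v ∈ A -> v ∈ X
    A⊂X p = toX (∈ˡ p)
    c∈X : c ∈ X
    c∈X = toX (∈-mid A)
    B⊂X : ∀ {v} -> v ∈ B -> v ∈ X
    B⊂X p = toX (∈ʳ A (there p))
    J∉ : ∀ {v} -> J v -> v ∈ X -> ⊥
    J∉ ((_ , v∉) , _) p = v∉ (there p)
    y∉AB : ∀ {v} -> v ≡ y -> v ∈ A ⊎ v ∈ B -> ⊥
    y∉AB refl p = go y? p
     where
     go : y ≡ c ⊎ I S y -> y ∈ A ⊎ y ∈ B -> ⊥
     go (inr (_ , v∉)) p = v∉ (there ([ A⊂X , B⊂X ]′ p))
     go (inl e) (inl p) = uniq-dis A unX p (here e)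
     go (inl e) (inr p) = Unique-∉ (Unique-drop A unX) (subst (_∈ B) e p)
    y∈U : U y
    y∈U = [ (λ { refl -> xs∈U S c∈X }) , fst ]′ y?
    Both⊂ : ∀ {v} -> Both v -> U v
    Both⊂ (inl refl) = x∈U S
    Both⊂ (inr (inl refl)) = xs∈U S c∈X
    Both⊂ (inr (inr refl)) = y∈U
    Uₗ⊂ : ∀ {v} -> Uₗ v -> U v
    Uₗ⊂ (inl b) = Both⊂ b
    Uₗ⊂ (inr (inl p)) = xs∈U S (A⊂X p)
    Uₗ⊂ (inr (inr (j , _))) = fst (fst j)
    Uᵣ⊂ : ∀ {v} -> Uᵣ v -> U v
    Uᵣ⊂ (inl b) = Both⊂ b
    Uᵣ⊂ (inr (inl p)) = xs∈U S (B⊂X p)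
    Uᵣ⊂ (inr (inr (j , _))) = fst (fst j)
    class : ∀ {v} -> U v -> Both v ⊎ Lo v ⊎ Ro v
    class {v} u with Both? v | v ∈? X
    ... | yes b | _ = inl b
    ... | no ¬b | yes p with ∈⁻ A (frX p)
    ... | inl a = inr (inl (inl a))
    ... | inr (here e) = absurd (¬b (inr (inl e)))
    ... | inr (there b) = inr (inr (inl b))
    class {v} u | no ¬b | no v∉ with Touch? v
    ... | yes τ = inr (inl (inr (((u , λ { (here e) -> ¬b (inl e) ; (there p) -> v∉ p }) , λ e -> ¬b (inr (inr e))) , τ)))
    ... | no ¬τ = inr (inr (inr (((u , λ { (here e) -> ¬b (inl e) ; (there p) -> v∉ p }) , λ e -> ¬b (inr (inr e))) , ¬τ)))
    LoRo : ∀ {v} -> Lo v -> Ro v -> ⊥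
    LoRo (inl p) (inl q) = uniq-dis A unX p (there q)
    LoRo (inl p) (inr (j , _)) = J∉ j (A⊂X p)
    LoRo (inr (j , _)) (inl q) = J∉ j (B⊂X q)
    LoRo (inr (_ , τ)) (inr (_ , ¬τ)) = ¬τ τ
    BothLo : ∀ {v} -> Both v -> Lo v ⊎ Ro v -> ⊥
    BothLo (inl refl) (inl (inl p)) = x∉xs S (A⊂X p)
    BothLo (inl refl) (inl (inr (((_ , v∉) , _) , _))) = v∉ (here refl)
    BothLo (inl refl) (inr (inl p)) = x∉xs S (B⊂X p)
    BothLo (inl refl) (inr (inr (((_ , v∉) , _) , _))) = v∉ (here refl)
    BothLo (inr (inl refl)) (inl (inl p)) = uniq-dis A unX p (here refl)
    BothLo (inr (inl refl)) (inl (inr (j , _))) = J∉ j c∈X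
    BothLo (inr (inl refl)) (inr (inl p)) = Unique-∉ (Unique-drop A unX) p
    BothLo (inr (inl refl)) (inr (inr (j , _))) = J∉ j c∈X
    BothLo (inr (inr refl)) (inl (inl p)) = y∉AB refl (inl p)
    BothLo (inr (inr refl)) (inl (inr ((_ , ne) , _))) = ne refl
    BothLo (inr (inr refl)) (inr (inl p)) = y∉AB refl (inr p)
    BothLo (inr (inr refl)) (inr (inr ((_ , ne) , _))) = ne refl
    LR : ∀ {u v} -> Lo u -> Ro v -> E u v -> ⊥
    LR (inl a) (inl b) e = across a b e
    LR (inl a) (inr (j , ¬τ)) e = ¬τ (_ , ε , _ , Esym S e , a)
    LR (inr (j , τ)) (inl b) e = straddle j τ e b
    LR (inr (j , z , p , q)) (inr (j' , ¬τ)) e = ¬τ (z , step (Esym S e) j p , q)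
    cov-U : ∀ {v} -> U v -> Uₗ v ⊎ Uᵣ v
    cov-U u = [ (λ b -> inl (inl b)) , [ (λ l -> inl (inr l)) , (λ r -> inr (inr r)) ]′ ]′ (class u)
    edges : ∀ {u v} -> U u -> U v -> E u v -> (Uₗ u × Uₗ v) ⊎ (Uᵣ u × Uᵣ v)
    edges uu uv e with class uu | class uv
    ... | inl b | inl b' = inl (inl b , inl b')
    ... | inl b | inr (inl l) = inl (inl b , inr l)
    ... | inl b | inr (inr r) = inr (inl b , inr r)
    ... | inr (inl l) | inl b = inl (inr l , inl b)
    ... | inr (inr r) | inl b = inr (inr r , inl b)
    ... | inr (inl l) | inr (inl l') = inl (inr l , inr l')
    ... | inr (inr r) | inr (inr r') = inr (inr r , inr r')
    ... | inr (inl l) | inr (inr r) = absurd (LR l r e)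
    ... | inr (inr r) | inr (inl l) = absurd (LR l r (Esym S e))
    share : ∀ {v} -> Uₗ v -> Uᵣ v -> v ≢ x -> v ≡ c ⊎ v ≡ y
    share (inl (inl e)) _ ne = absurd (ne e)
    share (inl (inr b)) _ ne = b
    share (inr l) (inl b) ne = absurd (BothLo b (inl l))
    share (inr l) (inr r) ne = absurd (LoRo l r)
    closedₗ : ∀ {u v} -> J u × Touch u -> E u v -> U v -> Uₗ v
    closedₗ l e u with class u
    ... | inl b = inl b
    ... | inr (inl l') = inr l'
    ... | inr (inr r) = absurd (LR (inr l) r e)
    closedᵣ : ∀ {u v} -> J u × ¬ Touch u -> E u v -> U v -> Uᵣ v
    closedᵣ r e u with class u
    ... | inl b = inl b
    ... | inr (inr r') = inr r'
    ... | inr (inl l) = absurd (LR l (inr r) (Esym S e))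
    ¬Uₗt : ∀ {v} -> v ∈ B -> ¬ Uₗ v
    ¬Uₗt p (inl b) = BothLo b (inr (inl p))
    ¬Uₗt p (inr l) = LoRo l (inl p)
    ¬Uᵣh : ∀ {v} -> v ∈ A -> ¬ Uᵣ v
    ¬Uᵣh p (inl b) = BothLo b (inl (inl p))
    ¬Uᵣh p (inr r) = LoRo (inl p) r
    conL : ∀ {a b} -> Uₗ a -> Uₗ b -> Consec X a b -> Consec (A ++ [ c ]) a b
    conL ua ub k with Consec-split A (Consec-≡ eqX k)
    ... | inl k' = k'
    ... | inr k' = absurd (¬Uₗt (Consec-∈ʳ k') ub)
    conR : ∀ {a b} -> Uᵣ a -> Uᵣ b -> Consec X a b -> Consec (c ∷ B) a b
    conR ua ub k with Consec-split A (Consec-≡ eqX k)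
    ... | inr k' = k'
    ... | inl k' = absurd (¬Uᵣh (Consec-∈ˡ A k') ua)
    conL± : ∀ {a b} -> Uₗ a -> Uₗ b -> Con± X a b -> Con± (A ++ [ c ]) a b
    conL± ua ub = Sum.map (conL ua ub) (conL ub ua)
    conR± : ∀ {a b} -> Uᵣ a -> Uᵣ b -> Con± X a b -> Con± (c ∷ B) a b
    conR± ua ub = Sum.map (conR ua ub) (conR ub ua)
    upL : ∀ {a b} -> Consec (A ++ [ c ]) a b -> Consec X a b
    upL k = Consec-≡ (trans (++-assoc A [ c ] B) (sym eqX)) (Consec-++ˡ k)
    upR : ∀ {a b} -> Consec (c ∷ B) a b -> Consec X a b
    upR k = Consec-≡ (sym eqX) (Consec-++ʳ A k)
    h≢t : h ≢ t
    h≢t refl = uniq-dis A unX (here refl) (there (∈ʳ m₂ (here refl)))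

  -- The chord is a link from `x` to `c`, so a link from `A` to `B` would cross it. Both sides are
  -- societies with apex `x`, and a crossing or small separation in one of them would be one of the
  -- whole.
  chord-out : ∀ {E U x h m₁ c m₂ t} (S : Soc E U x h (m₁ ++ c ∷ m₂) t) -> E x c ->
        (∀ {U' h m t} (S' : Soc E U' x h m t) -> size S' < size S -> Out E U' x h m t) -> Out E U x h (m₁ ++ c ∷ m₂) t
  chord-out {E} {U} {x} {h} {m₁} {c} {m₂} {t} S xc rec = split-out (m₁ ++ c ∷ m₂) m₁ m₂ base (xs⊂ S)
    (rec Sₗ (smaller (U? S) Uₗ? (I? S) (I? Sₗ) Uₗ⊂ upₗ t (xs∈U S (B⊂X t∈B)) (¬Uₗt t∈B))) (xs⊂ Sₗ)
    (rec Sᵣ (smaller (U? S) Uᵣ? (I? S) (I? Sᵣ) Uᵣ⊂ upᵣ h (xs∈U S (A⊂X (here refl))) (¬Uᵣh (here refl)))) (xs⊂ Sᵣ)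
    xc h≢t (¬Uᵣh (here refl)) (¬Uₗt t∈B) (λ a b ne -> inl (c₂ (share a b ne)))
    (λ { (a , b , ne) (a' , b' , ne') ab -> absurd (ab (trans (c₂ (share a b ne)) (sym (c₂ (share a' b' ne'))))) })
    cov-U Uₗ⊂ Uᵣ⊂ (λ a b _ _ e -> edges a b e)
    Icov (λ i -> upₗ i , λ ()) (λ i -> upᵣ i , λ ()) (λ i j -> snd (inₗ i) |> λ τ -> snd (inᵣ j) τ) (λ ()) []
    (λ _ k -> (λ (a , b) -> conL± a b k) , λ (a , b) -> conR± a b k)
    (λ { (inl k) -> inl (Sum.map upL upL k) ; (inr k) -> inl (Sum.map upR upR k) }) (λ ()) []
   where
   infixl 1 _|>_
   _|>_ : ∀ {A B : Set} -> A -> (A -> B) -> B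
   a |> f = f a
   module C = Cut S c (inl refl)
   open C using (A; B; X; eqX; J; J?; Touch; Touch?)
   cross : ∀ {w v} -> w ∈ A -> v ∈ B -> Link E J w v -> ⊥
   cross {w} {v} p q l = cf S (λ _ -> ⊥) J (λ ()) fst (λ ())
    (refl ∷ ⊆-≡ (sym eqX) (++⁺ (from∈ p) (refl ∷ from∈ q))) (x , ε , xc) l
   straddle : ∀ {u v} -> J u -> Touch u -> E u v -> v ∈ B -> ⊥
   straddle ju (z , p , w , e , w∈) uv v∈ = cross w∈ v∈ (_ , step (Esym S e) (W-end∈ ju p) (W-rev (Esym S) ju p) , uv)
   across : ∀ {a b} -> a ∈ A -> b ∈ B -> E a b -> ⊥
   across p q e = cross p q (_ , ε , e)
   open C.Sides straddle across
   t∈B : t ∈ B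
   t∈B = ∈ʳ m₂ (here refl)
   c₂ : ∀ {v} -> v ≡ c ⊎ v ≡ c -> v ≡ c
   c₂ = [ (λ z -> z) , (λ z -> z) ]′
   base : Sh (h ∷ (m₁ ++ c ∷ m₂) ++ [ t ]) (h ∷ m₁ ++ c ∷ m₂ ++ [ t ]) [] [] []
   base = subst (λ z -> Sh (h ∷ (m₁ ++ c ∷ m₂) ++ [ t ]) z [] [] []) eqX start
   inₗ : ∀ {v} -> Inn Uₗ x (h ∷ m₁ ++ [ c ]) v -> J v × Touch v
   inₗ (inl (inl e) , v∉) = absurd (v∉ (here e))
   inₗ (inl (inr e) , v∉) = absurd (v∉ (there (∈ʳ A (here (c₂ e)))))
   inₗ (inr (inl p) , v∉) = absurd (v∉ (there (∈ˡ p)))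
   inₗ (inr (inr l) , v∉) = l
   inᵣ : ∀ {v} -> Inn Uᵣ x (c ∷ m₂ ++ [ t ]) v -> J v × ¬ Touch v
   inᵣ (inl (inl e) , v∉) = absurd (v∉ (here e))
   inᵣ (inl (inr e) , v∉) = absurd (v∉ (there (here (c₂ e))))
   inᵣ (inr (inl p) , v∉) = absurd (v∉ (there (there p)))
   inᵣ (inr (inr l) , v∉) = l
   upₗ : ∀ {v} -> Inn Uₗ x (h ∷ m₁ ++ [ c ]) v -> I S v
   upₗ i = fst (fst (inₗ i))
   upᵣ : ∀ {v} -> Inn Uᵣ x (c ∷ m₂ ++ [ t ]) v -> I S v
   upᵣ i = fst (fst (inᵣ i))
   Icov : ∀ {v} -> I S v -> Inn Uₗ x (h ∷ m₁ ++ [ c ]) v ⊎ Inn Uᵣ x (c ∷ m₂ ++ [ t ]) v ⊎ v ∈ []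
   Icov {v} i@(u , v∉) with Touch? v
   ... | yes τ = inl (inr (inr ((i , λ { refl -> v∉ (there c∈X) }) , τ)) , λ
     { (here e) -> v∉ (here e) ; (there p) -> v∉ (there ([ A⊂X , (λ { (here refl) -> c∈X }) ]′ (∈⁻ A p))) })
   ... | no ¬τ = inr (inl (inr (inr ((i , λ { refl -> v∉ (there c∈X) }) , ¬τ)) , λ
     { (here e) -> v∉ (here e) ; (there (here refl)) -> v∉ (there c∈X) ; (there (there p)) -> v∉ (there (B⊂X p)) }))
   Sₗ : Soc E Uₗ x h m₁ c
   Sₗ = record { E? = E? S ; Esym = Esym S ; irr = irr S ; U? = Uₗ?
    ; un = All.tabulate (λ { p refl -> x∉xs S ([ A⊂X , (λ { (here refl) -> c∈X }) ]′ (∈⁻ A p)) }) ∷ uniq-init (A ++ [ c ]) (subst Unique (sym (++-assoc A [ c ] B)) unX)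
    ; x∈U = inl (inl refl)
    ; xs∈U = λ p -> [ (λ a -> inr (inl a)) , (λ { (here e) -> inl (inr (inl e)) }) ]′ (∈⁻ A p)
    ; cf = sub-cf (cf S) upₗ (refl ∷ ⊆-≡ (trans (++-assoc A [ c ] B) (sym eqX)) (++⁺ʳ B ⊆-refl))
    ; sf = sub-sf (sf S) upₗ λ i e u -> closedₗ (inₗ i) e u , e }
   Sᵣ : Soc E Uᵣ x c m₂ t
   Sᵣ = record { E? = E? S ; Esym = Esym S ; irr = irr S ; U? = Uᵣ?
    ; un = All.tabulate (λ { (here refl) refl -> x∉xs S c∈X ; (there p) refl -> x∉xs S (B⊂X p) }) ∷ Unique-drop A unX
    ; x∈U = inl (inl refl)
    ; xs∈U = λ { (here e) -> inl (inr (inl e)) ; (there p) -> inr (inl p) }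
    ; cf = sub-cf (cf S) upᵣ (refl ∷ ⊆-≡ (sym eqX) (++⁺ˡ A ⊆-refl))
    ; sf = sub-sf (sf S) upᵣ λ i e u -> closedᵣ (inᵣ i) e u , e }

  W-join : ∀ {E : V -> V -> Set} {P : V -> Set} {u w} -> Link E P u w -> ∀ {Q} -> (∀ {v} -> P v -> Q v) -> Q w -> W E Q u w
  W-join (_ , p , e) f q = W-mono f p ∙ edge e q

  Link-rev : ∀ {E : V -> V -> Set} -> (∀ {u v} -> E u v -> E v u) -> ∀ {P u v} -> Link E P u v -> Link E P v u
  Link-rev {E} sy {P} (_ , ε , e) = _ , ε , sy e
  Link-rev {E} sy {P} {u} (w , step {w = w'} e s p , e') = w' , step (sy e') (W-end∈ s p) (W-rev sy s p) , sy e

  Link-mono : ∀ {E : V -> V -> Set} {P Q : V -> Set} -> (∀ {v} -> P v -> Q v) -> ∀ {u v} -> Link E P u v -> Link E Q u v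
  Link-mono f (w , p , e) = w , W-mono f p , e

  Link-∙ : ∀ {E : V -> V -> Set} {P u z v} -> Link E P u z -> P z -> Link E P z v -> Link E P u v
  Link-∙ (_ , p , e) pz (w , q , e') = w , p ∙ step e pz q , e'

  -- The cut follows `x`, `y`, `c`, so `y` becomes a boundary vertex of both sides. A crossing that
  -- ends at `y` must be refuted in the whole society, where `y` is an inner vertex: its link is
  -- continued through `y` to `b₀` or `a₀` on the other side. This is why a link from `y` to each
  -- arc is required.
  y-out : ∀ {E U x h m₁ c m₂ t} (S : Soc E U x h (m₁ ++ c ∷ m₂) t) -> ∀ y -> (y∈I : I S y) -> E x y -> ¬ E x c ->
      let open Cut S y (inr y∈I) in
      (∀ {u v} -> J u -> Touch u -> E u v -> v ∈ B -> ⊥) -> (∀ {a b} -> a ∈ A -> b ∈ B -> E a b -> ⊥) ->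
      (∃ λ a -> a ∈ A × Link E (λ v -> J v × Touch v) y a) -> (∃ λ b -> b ∈ B × Link E (λ v -> J v × ¬ Touch v) y b) ->
      (∀ {U' h m t} (S' : Soc E U' x h m t) -> size S' < size S -> Out E U' x h m t) -> Out E U x h (m₁ ++ c ∷ m₂) t
  y-out {E} {U} {x} {h} {m₁} {c} {m₂} {t} S y y∈I xy ¬xc straddle across (a₀ , a₀∈ , la) (b₀ , b₀∈ , lb) rec =
   split-out (m₁ ++ c ∷ m₂) (m₁ ++ [ c ]) (c ∷ m₂) base (xs⊂ S)
    (rec Sₗ (smaller (U? S) Uₗ? (I? S) (I? Sₗ) Uₗ⊂ upₗ t (xs∈U S (B⊂X t∈B)) (¬Uₗt t∈B))) (xs⊂ Sₗ)
    (rec Sᵣ (smaller (U? S) Uᵣ? (I? S) (I? Sᵣ) Uᵣ⊂ upᵣ h (xs∈U S (A⊂X (here refl))) (¬Uᵣh (here refl)))) (xs⊂ Sᵣ)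
    xy h≢t (¬Uᵣh (here refl)) (¬Uₗt t∈B) (λ a b ne -> [ (λ { refl -> inr ¬xc }) , inl ]′ (share a b ne))
    (λ { (a , b , ne) (a' , b' , ne') ab -> two (share a b ne) (share a' b' ne') ab })
    cov-U Uₗ⊂ Uᵣ⊂ (λ a b _ _ e -> edges a b e)
    Icov (λ i -> upₗ i , λ { (here refl) -> snd (fst (inₗ i)) refl }) (λ i -> upᵣ i , λ { (here refl) -> snd (fst (inᵣ i)) refl })
    (λ i j -> snd (inᵣ j) (snd (inₗ i))) (λ { (here refl) -> y∈I }) ([] ∷ [])
    (λ _ k -> (λ (a , b) -> Sum.map Consec-++ˡ Consec-++ˡ (conL± a b k)) , λ (a , b) -> Sum.map there there (conR± a b k))
    (λ { (inl (inl k)) -> cl k ; (inl (inr k)) -> Sum.map Con±-sym (Adj±-sym _) (cl k)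
      ; (inr (inl k)) -> cr k ; (inr (inr k)) -> Sum.map Con±-sym (Adj±-sym _) (cr k) })
    (λ { (here refl) -> (λ k -> snd y∈I (there (snd (Con±-∈ k)))) , (λ { refl -> snd y∈I (there c∈X) }) , con-cy }) ([] ∷ [])
   where
   open Cut S y (inr y∈I)
   open Sides straddle across
   t∈B : t ∈ B
   t∈B = ∈ʳ m₂ (here refl)
   base : Sh (h ∷ (m₁ ++ c ∷ m₂) ++ [ t ]) (h ∷ (m₁ ++ [ c ]) ++ y ∷ (c ∷ m₂) ++ [ t ]) [ y ] [ (c , y) ] []
   base = subst₂ (λ p q -> Sh p q [ y ] [ (c , y) ] []) (sym eqX) (sym (++-assoc A [ c ] (y ∷ c ∷ B))) (pend A c B y start)
   con-c : Consec ((A ++ [ c ]) ++ [ y ]) c y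
   con-c = Consec-≡ (sym (++-assoc A [ c ] [ y ])) (Consec-mid A)
   con-cy : Con± (h ∷ (m₁ ++ [ c ]) ++ [ y ]) c y × Con± (y ∷ c ∷ B) c y
   con-cy = inl con-c , inr here
   two : ∀ {a b} -> a ≡ c ⊎ a ≡ y -> b ≡ c ⊎ b ≡ y -> a ≢ b -> Con± (h ∷ (m₁ ++ [ c ]) ++ [ y ]) a b × Con± (y ∷ c ∷ B) a b
   two (inl refl) (inl refl) ne = absurd (ne refl)
   two (inl refl) (inr refl) ne = con-cy
   two (inr refl) (inl refl) ne = Con±-sym (fst con-cy) , Con±-sym (snd con-cy)
   two (inr refl) (inr refl) ne = absurd (ne refl)
   cl : ∀ {a b} -> Consec (h ∷ (m₁ ++ [ c ]) ++ [ y ]) a b -> Con± X a b ⊎ Adj± [ (c , y) ] a b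
   cl k with Consec-split A (Consec-≡ (++-assoc A [ c ] [ y ]) k)
   ... | inl k' = inl (inl (upL k'))
   ... | inr here = inr (inl (here refl))
   ... | inr (there (there ()))
   cr : ∀ {a b} -> Consec (y ∷ c ∷ B) a b -> Con± X a b ⊎ Adj± [ (c , y) ] a b
   cr here = inr (inr (here refl))
   cr (there k) = inl (inl (upR k))
   inₗ : ∀ {v} -> Inn Uₗ x (h ∷ (m₁ ++ [ c ]) ++ [ y ]) v -> J v × Touch v
   inₗ (inl (inl e) , v∉) = absurd (v∉ (here e))
   inₗ (inl (inr (inl e)) , v∉) = absurd (v∉ (there (∈ˡ {xs = A ++ [ c ]} (∈ʳ A (here e)))))
   inₗ (inl (inr (inr e)) , v∉) = absurd (v∉ (there (∈ʳ (A ++ [ c ]) (here e))))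
   inₗ (inr (inl p) , v∉) = absurd (v∉ (there (∈ˡ {xs = A ++ [ c ]} (∈ˡ p))))
   inₗ (inr (inr l) , v∉) = l
   inᵣ : ∀ {v} -> Inn Uᵣ x (y ∷ (c ∷ m₂) ++ [ t ]) v -> J v × ¬ Touch v
   inᵣ (inl (inl e) , v∉) = absurd (v∉ (here e))
   inᵣ (inl (inr (inl e)) , v∉) = absurd (v∉ (there (there (here e))))
   inᵣ (inl (inr (inr e)) , v∉) = absurd (v∉ (there (here e)))
   inᵣ (inr (inl p) , v∉) = absurd (v∉ (there (there (there p))))
   inᵣ (inr (inr l) , v∉) = l
   upₗ : ∀ {v} -> Inn Uₗ x (h ∷ (m₁ ++ [ c ]) ++ [ y ]) v -> I S v
   upₗ i = fst (fst (inₗ i))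
   upᵣ : ∀ {v} -> Inn Uᵣ x (y ∷ (c ∷ m₂) ++ [ t ]) v -> I S v
   upᵣ i = fst (fst (inᵣ i))
   inXl : ∀ {v} -> v ∈ (A ++ [ c ]) ++ [ y ] -> v ∈ X ⊎ v ≡ y
   inXl p with ∈⁻ (A ++ [ c ]) p
   ... | inr (here e) = inr e
   ... | inl q with ∈⁻ A q
   ... | inl r = inl (A⊂X r)
   ... | inr (here refl) = inl c∈X
   inXr : ∀ {v} -> v ∈ y ∷ c ∷ B -> v ∈ X ⊎ v ≡ y
   inXr (here e) = inr e
   inXr (there (here refl)) = inl c∈X
   inXr (there (there p)) = inl (B⊂X p)
   off : ∀ {v ys} -> I S v -> v ≢ y -> (v ∈ ys -> v ∈ X ⊎ v ≡ y) -> v ∉ x ∷ ys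
   off (_ , v∉) ne f (here e) = v∉ (here e)
   off (_ , v∉) ne f (there p) = [ (λ q -> v∉ (there q)) , ne ]′ (f p)
   Icov : ∀ {v} -> I S v -> Inn Uₗ x (h ∷ (m₁ ++ [ c ]) ++ [ y ]) v ⊎ Inn Uᵣ x (y ∷ (c ∷ m₂) ++ [ t ]) v ⊎ v ∈ [ y ]
   Icov {v} i with v ≟ y
   ... | yes e = inr (inr (here e))
   ... | no ne with Touch? v
   ... | yes τ = inl (inr (inr ((i , ne) , τ)) , off i ne inXl)
   ... | no ¬τ = inr (inl (inr (inr ((i , ne) , ¬τ)) , off i ne inXr))
   Q : (V -> Set) -> (V -> Set) -> V -> Set
   Q T R v = T v ⊎ v ≡ y ⊎ R v
   extend : ∀ (T R : V -> Set) {e b} -> Link E R y e -> Link E T b y -> Link E (Q T R) b e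
   extend T R l k = Link-∙ (Link-mono inl k) (inr (inl refl)) (Link-mono (λ r -> inr (inr r)) l)
   Lf Rt : V -> Set
   Lf v = J v × Touch v
   Rt v = J v × ¬ Touch v
   Q⊂ : ∀ (T R : V -> Set) -> (∀ {v} -> T v -> J v) -> (∀ {v} -> R v -> J v) -> ∀ {v} -> Q T R v -> I S v
   Q⊂ T R f g (inl t) = fst (f t)
   Q⊂ T R f g (inr (inl refl)) = y∈I
   Q⊂ T R f g (inr (inr r)) = fst (g r)
   Qdis : ∀ (T R T' : V -> Set) -> (∀ {v} -> T v -> T' v -> ⊥) -> (∀ {v} -> T' v -> J v) -> (∀ {v} -> R v -> T' v -> ⊥) -> ∀ {v} -> Q T R v -> T' v -> ⊥
   Qdis T R T' d f g (inl t) t' = d t t'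
   Qdis T R T' d f g (inr (inl refl)) t' = snd (f t') refl
   Qdis T R T' d f g (inr (inr r)) t' = g r t'
   cfₗ : CrossFree E Uₗ x ((A ++ [ c ]) ++ [ y ])
   cfₗ P T P⊂ T⊂ dis τ ac bd with ⊆-split (x ∷ A ++ [ c ]) τ
   ... | _ , [] , e , σ , _ = cf S P T (λ p -> upₗ (P⊂ p)) (λ t -> upₗ (T⊂ t)) dis
       (⊆-≡ (cong (x ∷_) (trans (++-assoc A [ c ] B) (sym eqX))) (++⁺ʳ B (⊆-trans (⊆-reflexive (trans e (++-identityʳ _))) σ))) ac bd
   ... | [] , _ ∷ [] , () , _ , _
   ... | _ ∷ [] , _ ∷ [] , () , _ , _
   ... | _ ∷ _ ∷ [] , _ ∷ [] , () , _ , _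
   -- The last of the four vertices is `y`; its link is prolonged to `b₀`.
   ... | _ ∷ _ ∷ _ ∷ [] , _ ∷ [] , refl , σ , (refl ∷ _) =
      cf S P (Q T Rt) (λ p -> upₗ (P⊂ p)) (Q⊂ T Rt (λ t -> fst (inₗ (T⊂ t))) fst)
       (λ p q -> Qdis T Rt P (λ t p -> dis p t) (λ p -> fst (inₗ (P⊂ p))) (λ (_ , ¬τ) p -> ¬τ (snd (inₗ (P⊂ p)))) q p)
       (⊆-≡ (cong (x ∷_) (trans (++-assoc A [ c ] B) (sym eqX))) (++⁺ σ (from∈ b₀∈))) ac (extend T Rt lb bd)
   ... | _ ∷ _ ∷ _ ∷ [] , _ ∷ [] , refl , σ , (_ ∷ʳ ())
   ... | _ ∷ _ ∷ _ ∷ _ ∷ [] , _ ∷ [] , () , _ , _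
   ... | _ ∷ _ ∷ _ ∷ _ ∷ _ ∷ _ , _ ∷ [] , () , _ , _
   ... | _ , _ ∷ _ ∷ _ , _ , _ , (_ ∷ʳ ())
   ... | _ , _ ∷ _ ∷ _ , _ , _ , (_ ∷ ())
   cfᵣ : CrossFree E Uᵣ x (y ∷ c ∷ B)
   cfᵣ P T P⊂ T⊂ dis τ ac bd = go τ ac bd
    where
    P⊂' : ∀ {v} -> P v -> Rt v
    P⊂' p = inᵣ (P⊂ p)
    T⊂' : ∀ {v} -> T v -> Rt v
    T⊂' p = inᵣ (T⊂ p)
    go : ∀ {a b c' d} -> a ∷ b ∷ c' ∷ d ∷ [] ⊆ x ∷ y ∷ c ∷ B -> Link E P a c' -> Link E T b d -> ⊥
    go (_ ∷ʳ (_ ∷ʳ τ)) ac bd = cf S P T (λ p -> upᵣ (P⊂ p)) (λ t -> upᵣ (T⊂ t)) dis (x ∷ʳ ⊆-≡ (sym eqX) (++⁺ˡ A τ)) ac bd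
    go (refl ∷ (_ ∷ʳ τ)) ac bd = cf S P T (λ p -> upᵣ (P⊂ p)) (λ t -> upᵣ (T⊂ t)) dis (refl ∷ ⊆-≡ (sym eqX) (++⁺ˡ A τ)) ac bd
    go (_ ∷ʳ (refl ∷ τ)) ac bd = cf S (Q P Lf) T (Q⊂ P Lf (λ p -> fst (P⊂' p)) fst) (λ t -> upᵣ (T⊂ t))
     (Qdis P Lf T dis (λ t -> fst (T⊂' t)) (λ (_ , τ) t -> snd (T⊂' t) τ))
     (x ∷ʳ ⊆-≡ (sym eqX) (++⁺ (from∈ a₀∈) τ)) (Link-rev (Esym S) (extend P Lf la (Link-rev (Esym S) ac))) bd
    go (refl ∷ (refl ∷ τ)) ac bd = cf S P (Q T Lf) (λ p -> upᵣ (P⊂ p)) (Q⊂ T Lf (λ t -> fst (T⊂' t)) fst)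
     (λ p q -> Qdis T Lf P (λ t p -> dis p t) (λ p -> fst (P⊂' p)) (λ (_ , τ) p -> snd (P⊂' p) τ) q p)
     (refl ∷ ⊆-≡ (sym eqX) (++⁺ (from∈ a₀∈) τ)) ac (Link-rev (Esym S) (extend T Lf la (Link-rev (Esym S) bd)))
   Sₗ : Soc E Uₗ x h (m₁ ++ [ c ]) y
   Sₗ = record { E? = E? S ; Esym = Esym S ; irr = irr S ; U? = Uₗ?
    ; un = All.tabulate (λ p e -> [ (λ q -> x∉xs S (subst (_∈ X) (sym e) q)) , (λ e' -> snd y∈I (here (sym (trans e e')))) ]′ (inXl p)) ∷
        ++-uniq (uniq-init (A ++ [ c ]) (subst Unique (sym (++-assoc A [ c ] B)) unX)) ([] ∷ [])
         λ { p (here refl) -> snd y∈I (there ([ A⊂X , (λ { (here refl) -> c∈X }) ]′ (∈⁻ A p))) }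
    ; x∈U = inl (inl refl)
    ; xs∈U = λ p -> [ (λ q -> [ (λ a -> inr (inl a)) , (λ { (here e) -> inl (inr (inl e)) }) ]′ (∈⁻ A q)) , (λ { (here e) -> inl (inr (inr e)) }) ]′ (∈⁻ (A ++ [ c ]) p)
    ; cf = cfₗ
    ; sf = sub-sf (sf S) upₗ λ i e u -> closedₗ (inₗ i) e u , e }
   Sᵣ : Soc E Uᵣ x y (c ∷ m₂) t
   Sᵣ = record { E? = E? S ; Esym = Esym S ; irr = irr S ; U? = Uᵣ?
    ; un = All.tabulate (λ p e -> [ (λ q -> x∉xs S (subst (_∈ X) (sym e) q)) , (λ e' -> snd y∈I (here (sym (trans e e')))) ]′ (inXr p)) ∷
        All.tabulate (λ p e -> snd y∈I (there (subst (_∈ X) (sym e) (toX (∈ʳ A p))))) ∷ Unique-drop A unX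
    ; x∈U = inl (inl refl)
    ; xs∈U = λ { (here e) -> inl (inr (inr e)) ; (there (here e)) -> inl (inr (inl e)) ; (there (there p)) -> inr (inl p) }
    ; cf = cfᵣ
    ; sf = sub-sf (sf S) upᵣ λ i e u -> closedᵣ (inᵣ i) e u , e }

 -- Vertices hidden behind two-vertex cuts

 module Hid {E : V -> V -> Set} {U : V -> Set} {x h : V} {m : List V} {t : V} (S : Soc E U x h m t) (y : V) where
  open Soc S

  Hd : (V -> Set) -> V -> Set
  Hd D v = U v × v ≢ x × v ≢ y × ¬ D v

  -- y together with the hidden vertices is contracted to x; a component of the hidden set joins its two attachments.
  Meets : (V -> Set) -> V -> V -> Set
  Meets D k v = ∃ λ z -> W E (Hd D) k z × E z v
  Virt He : (V -> Set) -> V -> V -> Set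
  Virt D u v = u ≢ v × ∃ λ k -> Hd D k × Meets D k u × Meets D k v
  He D u v = E u v ⊎ Virt D u v

  Virt-sym : ∀ {D u v} -> Virt D u v -> Virt D v u
  Virt-sym (ne , k , hk , a , b) = (λ e -> ne (sym e)) , k , hk , b , a
  He-sym : ∀ {D u v} -> He D u v -> He D v u
  He-sym = Sum.map Esym Virt-sym

  Comp : (V -> Set) -> V -> V -> Set
  Comp D k v = Hd D v × W E (Hd D) k v

  comp-walk : ∀ {D k z} -> Hd D k -> W E (Hd D) k z -> W E (Comp D k) k z
  comp-walk {D} {k} hk r = W-mono snd (W-keep (Comp D k) (λ (_ , r) e hv -> hv , r ∙ edge e hv) (hk , ε) r)
  comp-back : ∀ {D k z} -> Hd D k -> W E (Hd D) k z -> W E (Comp D k) z k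
  comp-back hk r = W-rev Esym (hk , ε) (comp-walk hk r)
  comp-end : ∀ {D k z} -> Hd D k -> W E (Hd D) k z -> Comp D k z
  comp-end hk r = W-end∈ hk r , r

  Minus : (V -> Set) -> V -> V -> V -> Set
  Minus D p q v = D v × v ≢ p × v ≢ q

  module _ {D : V -> Set} (D? : Dec₁ D) where
   Hd? : Dec₁ (Hd D)
   Hd? v = U? v ×? ¬? (v ≟ x) ×? ¬? (v ≟ y) ×? ¬? (D? v)
   Meets? : Dec₂ (Meets D)
   Meets? k v = any? λ z -> W? E? Hd? k z ×? E? z v
   He? : Dec₂ (He D)
   He? u v = E? u v ⊎? (¬? (u ≟ v) ×? any? λ k -> Hd? k ×? Meets? k u ×? Meets? k v)
   Minus? : ∀ p q -> Dec₁ (Minus D p q)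
   Minus? p q v = D? v ×? ¬? (v ≟ p) ×? ¬? (v ≟ q)
   To-frame : V -> V -> V -> Set
   To-frame p q w = ∃ λ ℓ -> ℓ ∈ xs × W (He D) (Minus D p q) w ℓ
   To-frame? : ∀ p q w -> Dec (To-frame p q w)
   To-frame? p q w = any? λ ℓ -> (ℓ ∈? xs) ×? W? He? (Minus? p q) w ℓ

  -- `D` is the part kept visible. A component of hidden vertices has at most two visible
  -- attachments, so a single virtual edge can stand for it.
  record Shrunk (D : V -> Set) : Set where
   field
    D?  : Dec₁ D
    D⊂  : ∀ {v} -> D v -> U v × v ≢ x × v ≢ y
    xs⊂D : ∀ {v} -> v ∈ xs -> D v
    two : ∀ k -> Hd D k -> ∃₂ λ p q -> ∀ {v} -> Meets D k v -> D v -> v ≡ p ⊎ v ≡ q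

  -- `rich` is three-connectedness towards the frame: with virtual edges included, no two vertices
  -- cut a third one of `D` off from `xs`. It later supplies three disjoint paths.
  record Core (D : V -> Set) : Set where
   field
    shrunk : Shrunk D
   open Shrunk shrunk public
   field
    rich : ∀ p q w -> D w -> w ≢ p -> w ≢ q -> To-frame D? p q w

  -- If `p` and `q` cut a part of `D` off from the frame, that part is hidden too. Hidden components
  -- touching it are merged into it and now attach to `p` and `q` only; the others keep their
  -- attachments.
  shrink : ∀ f {D} (Q : Shrunk D) -> cnt (Shrunk.D? Q) < f -> ∃ Core
  shrink zero Q lt = absurd (n≮0 lt)
  shrink (suc f) {D} Q lt with any? (λ p -> any? λ q -> any? λ w -> D? w ×? ¬? (w ≟ p) ×? ¬? (w ≟ q) ×? ¬? (To-frame? D? p q w))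
   where
    open Shrunk Q
  ... | no none = D , record { shrunk = Q ; rich = λ p q w dw wp wq ->
      stable (To-frame? D? p q w) λ ¬f -> none (p , q , w , dw , wp , wq , ¬f) }
   where
    open Shrunk Q
  ... | yes (p , q , w , dw , w≢p , w≢q , ¬f) = shrink f Q' (≤-trans (cnt-strict D'? D? fst w dw (λ (_ , ¬c) -> ¬c ε)) (≤-pred lt))
   where
   open Shrunk Q
   C D' : V -> Set
   C v = W (He D) (Minus D p q) w v
   C? : Dec₁ C
   C? = W? (He? D?) (Minus? D? p q) w
   D' v = D v × ¬ C v
   D'? : Dec₁ D'
   D'? v = D? v ×? ¬? (C? v)
   C⊂D : ∀ {v} -> C v -> D v
   C⊂D c = fst (W-end∈ (dw , w≢p , w≢q) c)
   exit : ∀ {u v} -> C u -> He D u v -> D' v -> v ≡ p ⊎ v ≡ q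
   exit {v = v} c e (dv , ¬cv) with v ≟ p | v ≟ q
   ... | yes a | _ = inl a
   ... | no _ | yes b = inr b
   ... | no a | no b = absurd (¬cv (c ∙ edge e (dv , a , b)))
   Near : V -> Set
   Near z = C z ⊎ (Hd D z × ∃ λ c -> C c × Meets D z c)
   Near? : Dec₁ Near
   Near? z = C? z ⊎? (Hd? D? z ×? any? λ c -> C? c ×? Meets? D? z c)
   Hd'-split : ∀ {v} -> Hd D' v -> C v ⊎ Hd D v
   Hd'-split {v} (u , nx , ny , ¬d') with D? v | C? v
   ... | _ | yes c = inl c
   ... | yes d | no ¬c = absurd (¬d' (d , ¬c))
   ... | no ¬d | no _ = inr (u , nx , ny , ¬d)
   near-step : ∀ {u v} -> Near u -> E u v -> Hd D' v -> Near v
   near-step nu e hv with Hd'-split hv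
   near-step nu e hv | inl c = inl c
   near-step (inl cu) e hv | inr hd = inr (hd , _ , cu , _ , ε , Esym e)
   near-step (inr (hu , c , cc , z , p , e')) e hv | inr hd = inr (hd , c , cc , z , step (Esym e) hu p , e')
   near-exit : ∀ {u v} -> Near u -> E u v -> D' v -> v ≡ p ⊎ v ≡ q
   near-exit (inl c) e d = exit c (inl e) d
   near-exit {u} {v} (inr (hu , c , cc , m)) e d = exit cc (inr ((λ { refl -> snd d cc }) , u , hu , m , u , ε , e)) d
   two' : ∀ k -> Hd D' k -> ∃₂ λ p q -> ∀ {v} -> Meets D' k v -> D' v -> v ≡ p ⊎ v ≡ q
   two' k hk with Near? k
   ... | yes nk = p , q , λ (z , r , e) d -> near-exit (W-ind Near near-step nk r) e d
   ... | no ¬nk with Hd'-split hk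
   ... | inl c = absurd (¬nk (inl c))
   ... | inr hdk with two k hdk
   ... | a , b , f = a , b , λ (z , r , e) d -> f (z , snd (W-ind Far far-step (¬nk , ε) r) , e) (fst d)
    where
    Far : V -> Set
    Far z = ¬ Near z × W E (Hd D) k z
    far-step : ∀ {u v} -> Far u -> E u v -> Hd D' v -> Far v
    far-step (¬nu , r) e hv with Hd'-split hv
    ... | inl c = absurd (¬nu (inr (W-end∈ hdk r , _ , c , _ , ε , e)))
    ... | inr hd = (λ { (inl c) -> snd (snd (snd hd)) (C⊂D c)
              ; (inr (_ , c , cc , z , r' , e')) -> ¬nu (inr (W-end∈ hdk r , c , cc , z , step e hd r' , e')) }) , r ∙ edge e hd
   Q' : Shrunk D'
   Q' = record { D? = D'? ; D⊂ = λ (d , _) -> D⊂ d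
         ; xs⊂D = λ {v} p -> xs⊂D p , λ c -> ¬f (v , p , c) ; two = two' }

  core : I y -> ∃ Core
  core (uy , y∉) = shrink _ {D = λ v -> U v × v ≢ x × v ≢ y} (record
   { D? = λ v -> U? v ×? ¬? (v ≟ x) ×? ¬? (v ≟ y)
   ; D⊂ = λ d -> d
   ; xs⊂D = λ p -> xs∈U p , (λ { refl -> x∉xs p }) , λ { refl -> y∉ (there p) }
   ; two = λ k (u , a , b , ¬d) -> absurd (¬d (u , a , b)) }) ≤-refl

  module Pieces {D : V -> Set} (C : Core D) where
   open Core C
   Hd⊂I : ∀ {v} -> Hd D v -> I v
   Hd⊂I (u , nx , ny , ¬d) = u , λ { (here e) -> nx e ; (there p) -> ¬d (xs⊂D p) }
   Hd-not : ∀ {v} -> Hd D v -> v ≢ y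
   Hd-not (_ , _ , ny , _) = ny
   class : ∀ {v} -> U v -> v ≡ x ⊎ v ≡ y ⊎ Hd D v ⊎ D v
   class {v} u with v ≟ x | v ≟ y | D? v
   ... | yes a | _ | _ = inl a
   ... | no _ | yes b | _ = inr (inl b)
   ... | no _ | no _ | yes d = inr (inr (inr d))
   ... | no a | no b | no ¬d = inr (inr (inl (u , a , b , ¬d)))
   -- Otherwise `y` and the at most two attachments in `D` would cut the component off, against
   -- `sf`.
   at-x : ∀ {k} -> Hd D k -> Meets D k x
   at-x {k} hk = stable (Meets? D? k x) λ ¬m -> let p , q , f = two k hk in
    sf (λ v -> Hd D v × W E (Hd D) k v) y p q k (hk , ε) (λ (a , _) -> Hd⊂I a) λ (a , r) e u -> go ¬m f a r e u
    where
    go : ∀ {p q u v} -> ¬ Meets D k x -> (∀ {v} -> Meets D k v -> D v -> v ≡ p ⊎ v ≡ q) -> Hd D u -> W E (Hd D) k u -> E u v -> U v ->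
       (Hd D v × W E (Hd D) k v) ⊎ one-of y p q v
    go ¬m f a r e u with class u
    ... | inl refl = absurd (¬m (_ , r , e))
    ... | inr (inl b) = inr (inl b)
    ... | inr (inr (inl hv)) = inl (hv , r ∙ edge e hv)
    ... | inr (inr (inr d)) = inr (inr (f (_ , r , e) d))
   at-y : ∀ {k} -> Hd D k -> Meets D k y
   at-y {k} hk = stable (Meets? D? k y) λ ¬m -> let p , q , f = two k hk in
    sf (λ v -> Hd D v × W E (Hd D) k v) x p q k (hk , ε) (λ (a , _) -> Hd⊂I a) λ (a , r) e u -> go ¬m f a r e u
    where
    go : ∀ {p q u v} -> ¬ Meets D k y -> (∀ {v} -> Meets D k v -> D v -> v ≡ p ⊎ v ≡ q) -> Hd D u -> W E (Hd D) k u -> E u v -> U v ->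
       (Hd D v × W E (Hd D) k v) ⊎ one-of x p q v
    go ¬m f a r e u with class u
    ... | inl b = inr (inl b)
    ... | inr (inl refl) = absurd (¬m (_ , r , e))
    ... | inr (inr (inl hv)) = inl (hv , r ∙ edge e hv)
    ... | inr (inr (inr d)) = inr (inr (f (_ , r , e) d))

 -- Here all inner vertices are `y` and hidden ones. By `sf` they touch at least three vertices of
 -- `xs`. The cut goes from `y` to the second of these, so that `y` keeps a link to either side.
 split-y : ∀ {E U x h m t} (S : Soc E U x h m t) -> (∀ {c} -> c ∈ m -> ¬ E x c) -> ∀ {y} -> Soc.I S y -> E x y ->
      ∀ {D} (C : Hid.Core S y D) -> (∀ {v} -> D v -> v ∈ Soc.xs S) ->
      (∀ {U' h m t} (S' : Soc E U' x h m t) -> Soc.size S' < Soc.size S -> Out E U' x h m t) -> Out E U x h m t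
 split-y {E} {U} {x} {h} {m} {t} S nochord {y} y∈I xy {D} C D⊂xs rec = start₁ (first-such Tch? xs)
  where
  open Soc S
  open Hid S y
  open Core C
  open Pieces C
  Tch : V -> Set
  Tch ℓ = E y ℓ ⊎ ∃ λ k -> Hd D k × E k ℓ
  Tch? : Dec₁ Tch
  Tch? ℓ = E? y ℓ ⊎? any? λ k -> Hd? D? k ×? E? k ℓ
  I→ : ∀ {v} -> I v -> v ≢ y -> Hd D v
  I→ (u , v∉) ne with class u
  ... | inl e = absurd (v∉ (here e))
  ... | inr (inl e) = absurd (ne e)
  ... | inr (inr (inl hd)) = hd
  ... | inr (inr (inr d)) = absurd (v∉ (there (D⊂xs d)))
  cut₃ : ∀ p q -> (∀ {v} -> v ∈ xs -> Tch v -> v ≡ p ⊎ v ≡ q) -> ⊥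
  cut₃ p q f = sf I x p q y y∈I (λ i -> i) λ i e u -> go i e u
   where
   go : ∀ {u v} -> I u -> E u v -> U v -> I v ⊎ one-of x p q v
   go {u} {v} i e uv with v ∈? (x ∷ xs)
   ... | no v∉ = inl (uv , v∉)
   ... | yes (here e) = inr (inl e)
   ... | yes (there v∈) with u ≟ y
   ... | yes refl = inr (inr (f v∈ (inl e)))
   ... | no ne = inr (inr (f v∈ (inr (u , I→ i ne , e))))
  start₃ : ∀ {l₁ j l₃ c l₄} -> xs ≡ (l₁ ++ j ∷ l₃) ++ c ∷ l₄ -> Tch j -> Tch c -> (∃ λ b -> b ∈ l₄ × Tch b) -> Out E U x h m t
  start₃ {l₁} {j} {l₃} {c} {[]} e tj tc (_ , () , _)
  start₃ {l₁} {j} {l₃} {c} {b₀ ∷ B'} e tj tc tb = nonempty (l₁ ++ j ∷ l₃) (∈-mid l₁) e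
   where
   nonempty : ∀ A -> j ∈ A -> xs ≡ A ++ c ∷ b₀ ∷ B' -> Out E U x h m t
   nonempty (a₀ ∷ A') j∈ e with inner-split a₀ e
   ... | m₁ , m₂ , refl , refl , eB = y-out S y y∈I xy (nochord (∈-mid m₁)) straddle across (left tj) (right tb) rec
    where
    open Cut S y (inr y∈I) using (A; B; J; Touch; X; eqX)
    J→ : ∀ {v} -> J v -> Hd D v
    J→ (i , ne) = I→ i ne
    →J : ∀ {v} -> Hd D v -> J v
    →J hd = Hd⊂I hd , Hd-not hd
    b∈ : ∀ {b} -> b ∈ b₀ ∷ B' -> b ∈ B
    b∈ = ∈-≡ eB
    -- `c` is touched by `y` or by a hidden component, and in both cases `x` has a link to `c`. A
    -- link from `A` to `B` disjoint from it is a forbidden crossing.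
    block : ∀ {a b} -> a ∈ A -> b ∈ B -> ∀ (T : V -> Set) -> (∀ {v} -> T v -> Hd D v) -> (∀ {k} -> T k -> E k c -> ⊥) -> (∀ {u v} -> T u -> E u v -> Hd D v -> T v) ->
        Link E T a b -> ⊥
    block a∈ b∈ T T⊂ T-c T-cl l = go tc
     where
     τ : _ ∷ _ ∷ _ ∷ _ ∷ [] ⊆ x ∷ xs
     τ = refl ∷ ⊆-≡ (sym eqX) (++⁺ (from∈ a∈) (refl ∷ from∈ b∈))
     go : Tch c -> ⊥
     go (inl yc) = cf (_≡ y) T (λ { refl -> y∈I }) (λ t -> Hd⊂I (T⊂ t)) (λ { refl t -> Hd-not (T⊂ t) refl }) τ (y , edge xy refl , yc) l
     go (inr (k , hk , kc)) = let z , r , e = at-x hk in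
      cf (λ v -> Hd D v × W E (Hd D) k v) T (λ (a , _) -> Hd⊂I a) (λ t -> Hd⊂I (T⊂ t))
        (λ (_ , r) t -> T-c (W-ind T T-cl t (W-rev Esym hk r)) kc) τ
        (k , step (Esym e) (comp-end hk r) (comp-back hk r) , kc) l
    straddle : ∀ {u v} -> J u -> Touch u -> E u v -> v ∈ B -> ⊥
    straddle {u} {v} ju (z , r , w , zw , w∈) uv v∈ =
     block w∈ v∈ (Comp D u) fst noc (λ (_ , p) e hv -> hv , p ∙ edge e hv)
      (u , step (Esym zw) (comp-end hu r') (comp-back hu r') , uv)
     where
     hu : Hd D u
     hu = J→ ju
     r' : W E (Hd D) u z
     r' = W-mono J→ r
     uX : Unique (A ++ c ∷ B)
     uX = subst Unique eqX (Unique-drop [ x ] un)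
     -- By `two`, a component that attaches to `w` in `A` and to `v` in `B` does not attach to `c`
     -- as well.
     noc : ∀ {k} -> Comp D u k -> E k c -> ⊥
     noc (hk , p) kc with two u hu
     ... | a , b , f with f (_ , p , kc) (xs⊂D (∈-≡ (sym eqX) (∈-mid A))) | f (_ , r' , zw) (xs⊂D (∈-≡ (sym eqX) (∈ˡ w∈))) | f (_ , ε , uv) (xs⊂D (∈-≡ (sym eqX) (∈ʳ A (there v∈))))
     ... | inl refl | inl refl | _ = uniq-dis A uX w∈ (here refl)
     ... | inr refl | inr refl | _ = uniq-dis A uX w∈ (here refl)
     ... | inl refl | inr _ | inl refl = Unique-∉ (Unique-drop A uX) v∈
     ... | inr refl | inl _ | inr refl = Unique-∉ (Unique-drop A uX) v∈
     ... | inl _ | inr refl | inr refl = uniq-dis A uX w∈ (there v∈)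
     ... | inr _ | inl refl | inl refl = uniq-dis A uX w∈ (there v∈)
    across : ∀ {a b} -> a ∈ A -> b ∈ B -> E a b -> ⊥
    across a∈ b∈ e = block a∈ b∈ (λ _ -> ⊥) (λ ()) (λ ()) (λ ()) (_ , ε , e)
    inside : ∀ {P : V -> Set} {k ℓ} -> Hd D k -> E k ℓ -> (∀ {v} -> Comp D k v -> P v) -> Link E P y ℓ
    inside {k = k} hk kℓ f = let z , r , e = at-y hk in
     k , step (Esym e) (f (comp-end hk r)) (W-mono f (comp-back hk r)) , kℓ
    left : Tch j -> ∃ λ a -> a ∈ A × Link E (λ v -> J v × Touch v) y a
    left (inl e) = j , j∈ , y , ε , e
    left (inr (k , hk , e)) = j , j∈ , inside hk e λ (hv , p) -> →J hv , k , W-mono →J (W-rev Esym hk p) , j , e , j∈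
    right : (∃ λ b -> b ∈ b₀ ∷ B' × Tch b) -> ∃ λ b -> b ∈ B × Link E (λ v -> J v × ¬ Touch v) y b
    right (b , bm , inl e) = b , b∈ bm , y , ε , e
    right (b , bm , inr (k , hk , e)) = b , b∈ bm , inside hk e λ (hv , p) -> →J hv , λ (z , r , w , zw , w∈) ->
      straddle (→J hk) (z , W-mono →J p ∙ r , w , zw , w∈) e (b∈ bm)
  start₂ : ∀ {l₁ j l₂} -> xs ≡ l₁ ++ j ∷ l₂ -> Tch j -> (∀ {z} -> z ∈ l₁ -> ¬ Tch z) ->
       (∃ λ l -> ∃₂ λ j r -> l₂ ≡ l ++ j ∷ r × Tch j × (∀ {z} -> z ∈ l -> ¬ Tch z)) ⊎ (∀ {z} -> z ∈ l₂ -> ¬ Tch z) -> Out E U x h m t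
  start₂ {l₁} {j} {l₂} e tj f (inr g) = absurd (cut₃ j j λ v∈ tv -> inl (only (∈⁻ l₁ (∈-≡ e v∈)) tv))
   where
   only : ∀ {v} -> v ∈ l₁ ⊎ v ∈ j ∷ l₂ -> Tch v -> v ≡ j
   only (inl p) tv = absurd (f p tv)
   only (inr (here e)) tv = e
   only (inr (there p)) tv = absurd (g p tv)
  start₂ {l₁} {j} e tj f (inl (l₃ , c , l₄ , refl , tc , g)) with any? (λ b -> (b ∈? l₄) ×? Tch? b)
  ... | yes tb = start₃ {l₁} {j} {l₃} (trans e (sym (++-assoc l₁ (j ∷ l₃) (c ∷ l₄)))) tj tc tb
  ... | no none = absurd (cut₃ j c λ v∈ tv -> only (∈⁻ l₁ (∈-≡ e v∈)) tv)
   where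
   only : ∀ {v} -> v ∈ l₁ ⊎ v ∈ j ∷ l₃ ++ c ∷ l₄ -> Tch v -> v ≡ j ⊎ v ≡ c
   only (inl p) tv = absurd (f p tv)
   only (inr (here e)) tv = inl e
   only (inr (there p)) tv with ∈⁻ l₃ p
   ... | inl q = absurd (g q tv)
   ... | inr (here e) = inr e
   ... | inr (there q) = absurd (none (_ , q , tv))
  start₁ : (∃ λ l -> ∃₂ λ j r -> xs ≡ l ++ j ∷ r × Tch j × (∀ {z} -> z ∈ l -> ¬ Tch z)) ⊎ (∀ {z} -> z ∈ xs -> ¬ Tch z) -> Out E U x h m t
  start₁ (inr none) = absurd (cut₃ y y λ v∈ tv -> absurd (none v∈ tv))
  start₁ (inl (l₁ , j , l₂ , e , tj , f)) = start₂ e tj f (first-such Tch? l₂)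

-- Order along the boundary of a strip

open SubP using (++⁺; ++⁺ˡ; ++⁺ʳ)

-- The sets in `CrossFree` and `SepFree` are arbitrary predicates, but what is to be derived from
-- them is a contradiction, so case distinctions on them remain available.
em : ∀ {P : Set} -> ((P ⊎ ¬ P) -> ⊥) -> ⊥
em k = k (inr λ p -> k (inl p))

module _ {n : ℕ} where
 open Society {n}
 open Shell {n} hiding (V)

 -- A path shelled from its last vertex has a boundary walk that runs back along the path and forth
 -- again. Put below a strip, it yields a map grown from a single vertex, to which `nc` applies.
 path-walk : ∀ (z : V) (zs : List V) -> ∃ λ (v₀ : V) -> ∃₂ λ Ws Es -> Sh [ v₀ ] (reverse zs ++ z ∷ zs) Ws Es [] ×
       (∀ {v} -> v ∈ Ws ++ [ v₀ ] -> v ∈ z ∷ zs) × (Unique (z ∷ zs) -> Unique (Ws ++ [ v₀ ])) ×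
       (∀ {a b} -> (a , b) ∈ Es -> Con± (z ∷ zs) a b) × (∀ {a b} -> Consec (z ∷ zs) a b -> Adj± Es a b) × v₀ ∈ z ∷ zs
 path-walk z [] = z , [] , [] , start , (λ p -> p) , (λ u -> u) , (λ ()) , (λ { (there ()) }) , here refl
 path-walk z (z' ∷ zs) with path-walk z' zs
 ... | v₀ , Ws , Es , s , ⊂ , un , e⁻ , e⁺ , v₀∈ = v₀ , z ∷ Ws , (z' , z) ∷ Es
  , subst (λ l -> Sh [ v₀ ] l (z ∷ Ws) ((z' , z) ∷ Es) []) (trans (sym (++-assoc (reverse zs) [ z' ] (z ∷ z' ∷ zs))) (cong (_++ z ∷ z' ∷ zs) (sym (unfold-reverse z' zs))))
    (pend (reverse zs) z' zs z s)
  , (λ { (here e) -> here e ; (there p) -> there (⊂ p) })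
  , (λ { u@(_ ∷ u') -> All.tabulate (λ { p refl -> Unique-∉ u (⊂ p) }) ∷ un u' })
  , (λ { (here refl) -> inr here ; (there p) -> Sum.map there there (e⁻ p) })
  , (λ { here -> inr (here refl) ; (there c) -> Sum.map there there (e⁺ c) })
  , there v₀∈

 order : ∀ {xs : List V} {a b} -> a ∈ xs -> b ∈ xs -> a ≢ b -> a ∷ b ∷ [] ⊆ xs ⊎ b ∷ a ∷ [] ⊆ xs
 order (here refl) (here refl) ne = absurd (ne refl)
 order (here refl) (there q) ne = inl (refl ∷ from∈ q)
 order (there p) (here refl) ne = inr (refl ∷ from∈ p)
 order (there p) (there q) ne = Sum.map (_ ∷ʳ_) (_ ∷ʳ_) (order p q ne)

 order₃ : ∀ {xs : List V} {a b c} -> Unique xs -> a ∷ b ∷ [] ⊆ xs -> b ∷ c ∷ [] ⊆ xs -> a ∷ b ∷ c ∷ [] ⊆ xs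
 order₃ (_ ∷ u) (_ ∷ʳ τ) (_ ∷ʳ σ) = _ ∷ʳ order₃ u τ σ
 order₃ un (_ ∷ʳ τ) (refl ∷ σ) = absurd (Unique-∉ un (snd (⊆-pair-∈ τ)))
 order₃ (_ ∷ u) (refl ∷ τ) (_ ∷ʳ σ) = refl ∷ σ
 order₃ un (refl ∷ τ) (refl ∷ σ) = absurd (Unique-∉ un (to∈ τ))

 module Strip {E : V -> V -> Set} {U : V -> Set} {x h : V} {m : List V} {t : V} (un : Unique (h ∷ m ++ [ t ]))
        (xs⊂ : ∀ {v} -> v ∈ h ∷ m ++ [ t ] -> U v × v ≢ x) (O : Out E U x h m t) where
  open Out O
  private
   P = path-walk h (m ++ [ t ])
   v₀ = fst P
   Wp = fst (snd P)
   Ep = fst (snd (snd P))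
   sp = fst (snd (snd (snd P)))
   p⊂ = fst (snd (snd (snd (snd P))))
   pun = fst (snd (snd (snd (snd (snd P)))))
   pe⁺ = fst (snd (snd (snd (snd (snd (snd (snd P)))))))
   full : Sh [ v₀ ] (reverse (m ++ [ t ]) ++ μ) (Ws ++ Wp) (Es ++ Ep) (Ts ++ [])
   full = sp ⨾ subst₂ (λ a b -> Sh (reverse (m ++ [ t ]) ++ a) (reverse (m ++ [ t ]) ++ b) Ws Es Ts) (++-identityʳ _) (++-identityʳ _) (ctx (reverse (m ++ [ t ])) [] sh)
   unW : Unique ((Ws ++ Wp) ++ [ v₀ ])
   unW = subst Unique (sym (++-assoc Ws Wp [ v₀ ])) (++-uniq Ws-uniq (pun un) λ p q -> snd (Ws⊂I p) (there (p⊂ q)))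
  Nbr : V -> V -> Set
  Nbr = Adj± (Es ++ Ep)
  Nbr-sym : ∀ {u v} -> Nbr u v -> Nbr v u
  Nbr-sym = Adj±-sym (Es ++ Ep)
  to-Nbr : ∀ {u v} -> Adj± Es u v ⊎ Con± xs u v -> Nbr u v
  to-Nbr (inl e) = Sum.map ∈ˡ ∈ˡ e
  to-Nbr (inr (inl c)) = Sum.map (∈ʳ Es) (∈ʳ Es) (pe⁺ c)
  to-Nbr (inr (inr c)) = Nbr-sym (Sum.map (∈ʳ Es) (∈ʳ Es) (pe⁺ c))
  -- The strip and the path below it form one map, whose boundary runs back along `xs` and then
  -- along `μ`. Since `h` ends the one and begins the other, `destutter` removes its second copy.
  alternation : Alternates Nbr (reverse xs ++ μ)
  alternation P Q dis {a} {b} {c} {d} pa qb τ ac bd = nc full unW P Q dis pa qb (destutter (reverse (m ++ [ t ])) alt (⊆-≡ eq τ)) ac bd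
   where
   eq : reverse xs ++ μ ≡ reverse (m ++ [ t ]) ++ h ∷ μ
   eq = trans (cong (_++ μ) (unfold-reverse h (m ++ [ t ]))) (++-assoc (reverse (m ++ [ t ])) [ h ] μ)
   ne : ∀ {x y} -> P x -> Q y -> x ≢ y
   ne p q refl = dis p q
   pc = W-end∈ pa ac
   qd = W-end∈ qb bd
   alt : Linked _≢_ (a ∷ b ∷ c ∷ d ∷ [])
   alt = ne pa qb ∷ (λ e -> ne pc qb (sym e)) ∷ ne pc qd ∷ [-]
  -- An edge `a b` passing over a vertex `c` of `μ` would shut `c` off from the frame, whereas the
  -- hypothesis leads from `c` to the frame without `a` and `b`.
  chordless : (∀ {c a b} -> c ∈ μ -> c ≢ a -> c ≢ b -> ∃ λ ℓ -> ℓ ∈ xs × W Nbr (λ v -> v ≢ a × v ≢ b) c ℓ × ℓ ≢ a × ℓ ≢ b) ->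
        ∀ {a b} -> a ∈ μ -> b ∈ μ -> a ≢ b -> Adj± Es a b ⊎ Con± xs a b -> Con± μ a b
  chordless rich {a} {b} a∈ b∈ ne e = [ (λ τ -> inl (go μ-uniq (λ z -> z) ⊆-refl τ ab)) , (λ τ -> inr (go μ-uniq (λ z -> z) ⊆-refl τ (Nbr-sym ab))) ]′ (order a∈ b∈ ne)
   where
   ab : Nbr a b
   ab = to-Nbr e
   go : ∀ {ys a b} -> Unique ys -> (∀ {v} -> v ∈ ys -> v ∈ μ) -> ys ⊆ μ -> a ∷ b ∷ [] ⊆ ys -> Nbr a b -> Consec ys a b
   go (_ ∷ u) f σ (_ ∷ʳ τ) ab = there (go u (λ p -> f (there p)) (⊆-trans (_ ∷ʳ ⊆-refl) σ) τ ab)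
   go u f σ (refl ∷ (refl ∷ τ)) ab = here
   go {ys = a ∷ c ∷ ys} {b = b} u@(_ ∷ u') f σ (refl ∷ (_ ∷ʳ τ)) ab with rich (f (there (here refl))) (λ { refl -> Unique-∉ u (here refl) }) (λ { refl -> Unique-∉ u' (to∈ τ) })
   ... | ℓ , ℓ∈ , w , ℓa , ℓb = absurd (alternation (λ v -> v ≢ a × v ≢ b) (λ v -> v ≡ a ⊎ v ≡ b)
     (λ { (p , _) (inl q) -> p q ; (_ , p) (inr q) -> p q }) (ℓa , ℓb) (inl refl)
     (++⁺ (from∈ (reverse⁺ ℓ∈)) (⊆-trans (refl ∷ refl ∷ τ) σ))
     (W-rev Nbr-sym ((λ { refl -> Unique-∉ u (here refl) }) , (λ { refl -> Unique-∉ u' (to∈ τ) })) w)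
     (edge ab (inr refl)))
  -- If disjoint connections from `μ` down to `xs` changed their order, their four ends would
  -- alternate along the boundary.
  keep-order : ∀ (P Q : V -> Set) -> (∀ {v} -> P v -> Q v -> ⊥) -> ∀ {b c p q} -> b ∷ c ∷ [] ⊆ μ -> P p -> Q q -> p ∈ xs -> q ∈ xs ->
         W Nbr P p b -> W Nbr Q q c -> p ∷ q ∷ [] ⊆ xs
  keep-order P Q dis τ pp qq p∈ q∈ pb qc with order p∈ q∈ (λ { refl -> dis pp qq })
  ... | inl σ = σ
  ... | inr σ = absurd (alternation P Q dis pp qq (++⁺ (SubP.reverse⁺ σ) τ) pb qc)

 -- Contraction to the apex

 module Contract {E : V -> V -> Set} {U : V -> Set} {x h : V} {m : List V} {t : V} (S : Soc E U x h m t) {y : V} (y∈I : Soc.I S y) (xy : E x y)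
         {D : V -> Set} (C : Hid.Core S y D) where
  open Soc S
  open Hid S y
  open Core C
  open Pieces C

  HdD : ∀ {v} -> Hd D v -> D v -> ⊥
  HdD (_ , _ , _ , ¬d) d = ¬d d
  D≢x : ∀ {v} -> D v -> v ≢ x
  D≢x d = fst (snd (D⊂ d))
  D≢y : ∀ {v} -> D v -> v ≢ y
  D≢y d = snd (snd (D⊂ d))

  -- Hidden vertices whose component has all its visible attachments in `F`. The component must have
  -- at least one, so that disjoint `F` and `G` own disjoint sets.
  Own : (V -> Set) -> V -> Set
  Own F k = Hd D k × (∃ λ v -> D v × Meets D k v) × (∀ v -> Meets D k v -> D v -> F v)
  Own? : ∀ {F} -> Dec₁ F -> Dec₁ (Own F)
  Own? F? k = Hd? D? k ×? (any? λ v -> D? v ×? Meets? D? k v) ×? all? λ v -> Meets? D? k v →? (D? v →? F? v)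
  Own-mono : ∀ {F G} -> (∀ {v} -> F v -> G v) -> ∀ {k} -> Own F k -> Own G k
  Own-mono f (a , b , c) = a , b , λ v m d -> f (c v m d)
  Own-comp : ∀ {F k k'} -> Own F k -> W E (Hd D) k k' -> Own F k'
  Own-comp (hk , (v , d , z , p , e) , f) r = W-end∈ hk r , (v , d , z , W-rev Esym hk r ∙ p , e) , λ v (z , p , e) d -> f v (z , r ∙ p , e) d

  -- A virtual edge is realised inside its component. By `two` the component attaches in `D` to `u`
  -- and `v` only, so it is owned by every `F` containing both.
  He-walk : ∀ {F u v} -> D u -> D v -> F u -> F v -> He D u v -> ∃ λ w -> W E (Own F) u w × E w v
  He-walk du dv fu fv (inl e) = _ , ε , e
  He-walk {F} {u} {v} du dv fu fv (inr (ne , k , hk , (z₀ , p₀ , e₀) , mv@(z₁ , p₁ , e₁))) =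
   z₁ , step (Esym e₀) (Own-comp ok p₀) (W-mono (λ (_ , r) -> Own-comp ok r) (comp-back hk p₀ ∙ comp-walk hk p₁)) , e₁
   where
   ok : Own F k
   ok = hk , (u , du , z₀ , p₀ , e₀) , only
    where
    only : ∀ w -> Meets D k w -> D w -> F w
    only w mw dw with two k hk
    ... | p , q , f with f (z₀ , p₀ , e₀) du | f mv dv | f mw dw
    ... | inl refl | _ | inl refl = fu
    ... | inr refl | _ | inr refl = fu
    ... | _ | inl refl | inl refl = fv
    ... | _ | inr refl | inr refl = fv
    ... | inl refl | inl refl | inr refl = absurd (ne refl)
    ... | inr refl | inr refl | inl refl = absurd (ne refl)

  He-real : ∀ {F P u v} -> (∀ {v} -> P v -> D v × F v) -> D u -> F u -> W (He D) P u v -> W E (λ z -> P z ⊎ Own F z) u v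
  He-real f du fu ε = ε
  He-real f du fu (step e s p) = let dw , fw = f s ; _ , q , e' = He-walk du dw fu fw e in
   W-mono inr q ∙ step e' (inl s) (He-real f dw fw p)

  He-link : ∀ {F P u v} -> (∀ {v} -> P v -> D v × F v) -> D u -> F u -> D v -> F v -> Link (He D) P u v -> Link E (λ z -> P z ⊎ Own F z) u v
  He-link f du fu dv fv (w , p , e) = let dw , fw = [ (λ { refl -> du , fu }) , f ]′ (W-end p) ; w' , q , e' = He-walk dw dv fw fv e in
   w' , He-real f du fu p ∙ W-mono inr q , e'

  Xn : V -> Set
  Xn v = E x v ⊎ E y v ⊎ ∃ λ k -> Hd D k × E k v
  Xn? : Dec₁ Xn
  Xn? v = E? x v ⊎? (E? y v ⊎? any? λ k -> Hd? D? k ×? E? k v)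

  E₂ : V -> V -> Set
  E₂ u v = (D u × D v × He D u v) ⊎ (u ≡ x × D v × Xn v) ⊎ (v ≡ x × D u × Xn u)
  U₂ : V -> Set
  U₂ v = v ≡ x ⊎ D v
  U₂⊂ : ∀ {v} -> U₂ v -> U v
  U₂⊂ (inl refl) = x∈U
  U₂⊂ (inr d) = fst (D⊂ d)

  I₂ : ∀ {v} -> Inn U₂ x xs v -> D v × v ∉ xs
  I₂ (inl e , v∉) = absurd (v∉ (here e))
  I₂ (inr d , v∉) = d , λ p -> v∉ (there p)
  I₂⊂ : ∀ {v} -> Inn U₂ x xs v -> I v
  I₂⊂ (u , v∉) = U₂⊂ u , v∉

  He-E₂ : ∀ {u v} -> D u -> E₂ u v -> D v -> He D u v
  He-E₂ du (inl (_ , _ , e)) dv = e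
  He-E₂ du (inr (inl (refl , _))) dv = absurd (D≢x du refl)
  He-E₂ du (inr (inr (refl , _))) dv = absurd (D≢x dv refl)
  Xn-E₂ : ∀ {v} -> E₂ x v -> Xn v
  Xn-E₂ (inl (d , _)) = absurd (D≢x d refl)
  Xn-E₂ (inr (inl (_ , _ , e))) = e
  Xn-E₂ (inr (inr (_ , d , _))) = absurd (D≢x d refl)

  -- `rich` applies to vertices outside `L`, while `p` or `q` may lie in `L`. Such a vertex is no
  -- exit at all and is traded for the other one, or for `h`, which is outside `L`.
  not-cut : ∀ (L : V -> Set) p q {w} -> L w -> (∀ {v} -> L v -> D v × v ∉ xs) -> (∀ {u v} -> L u -> He D u v -> D v -> L v ⊎ (v ≡ p ⊎ v ≡ q)) -> ⊥
  not-cut L p q {w} lw L⊂ cl = em {L p} λ lp -> em {L q} λ lq -> go lp lq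
   where
   avoid : ∀ p' q' -> ¬ L p' -> ¬ L q' -> (∀ {v} -> v ≡ p ⊎ v ≡ q -> L v ⊎ (v ≡ p' ⊎ v ≡ q')) -> ⊥
   avoid p' q' ¬p ¬q f = let ℓ , ℓ∈ , r = rich p' q' w (fst (L⊂ lw)) (λ { refl -> ¬p lw }) (λ { refl -> ¬q lw }) in
    snd (L⊂ (W-ind L (λ lu e (dv , a , b) -> [ (λ l -> l) , (λ o -> [ (λ l -> l) , [ (λ e -> absurd (a e)) , (λ e -> absurd (b e)) ]′ ]′ (f o)) ]′ (cl lu e dv)) lw r)) ℓ∈
   go : L p ⊎ ¬ L p -> L q ⊎ ¬ L q -> ⊥
   go (inr ¬p) (inr ¬q) = avoid p q ¬p ¬q inr
   go (inl lp) (inr ¬q) = avoid q q ¬q ¬q [ (λ { refl -> inl lp }) , (λ e -> inr (inl e)) ]′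
   go (inr ¬p) (inl lq) = avoid p p ¬p ¬p [ (λ e -> inr (inl e)) , (λ { refl -> inl lq }) ]′
   go (inl lp) (inl lq) = avoid h h (λ l -> snd (L⊂ l) (here refl)) (λ l -> snd (L⊂ l) (here refl)) [ (λ { refl -> inl lp }) , (λ { refl -> inl lq }) ]′

  -- If `L` has a vertex seen by the contracted apex, then `x` is one of the three attachments, and
  -- the remaining two contradict `rich`. Otherwise `L` touches neither `y` nor hidden vertices and
  -- is already closed in the original society.
  sf₂ : SepFree E₂ U₂ x xs
  sf₂ L p q r w lw L⊂ cl = em {∃ λ u -> L u × Xn u} λ { (inl (u , lu , xu)) -> touching u lu xu ; (inr none) -> apart λ lu xu -> none (_ , lu , xu) }
   where
   L⊂D : ∀ {v} -> L v -> D v × v ∉ xs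
   L⊂D l = I₂ (L⊂ l)
   clD : ∀ {u v} -> L u -> He D u v -> D v -> L v ⊎ one-of p q r v
   clD lu e dv = cl lu (inl (fst (L⊂D lu) , dv , e)) (inr dv)
   apart : (∀ {u} -> L u -> Xn u -> ⊥) -> ⊥
   apart none = sf L p q r w lw (λ l -> I₂⊂ (L⊂ l)) λ lu e uv -> go lu e (class uv)
    where
    go : ∀ {u v} -> L u -> E u v -> v ≡ x ⊎ v ≡ y ⊎ Hd D v ⊎ D v -> L v ⊎ one-of p q r v
    go lu e (inl refl) = absurd (none lu (inl (Esym e)))
    go lu e (inr (inl refl)) = absurd (none lu (inr (inl (Esym e))))
    go lu e (inr (inr (inl hd))) = absurd (none lu (inr (inr (_ , hd , Esym e))))
    go lu e (inr (inr (inr d))) = clD lu (inl e) d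
   touching : ∀ u -> L u -> Xn u -> ⊥
   touching u lu xu with cl lu (inr (inr (refl , fst (L⊂D lu) , xu))) (inl refl)
   ... | inl lx = D≢x (fst (L⊂D lx)) refl
   ... | inr (inl refl) = not-cut L q r lw L⊂D λ lu e dv -> Sum.map₂ [ (λ e -> absurd (D≢x dv e)) , (λ o -> o) ]′ (clD lu e dv)
   ... | inr (inr (inl refl)) = not-cut L p r lw L⊂D λ lu e dv -> Sum.map₂ [ inl , [ (λ e -> absurd (D≢x dv e)) , inr ]′ ]′ (clD lu e dv)
   ... | inr (inr (inr refl)) = not-cut L p q lw L⊂D λ lu e dv -> Sum.map₂ [ inl , [ inr , (λ e -> absurd (D≢x dv e)) ]′ ]′ (clD lu e dv)

  -- A link from the contracted apex may enter through a component that also attaches elsewhere, so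
  -- one attachment in `F` must do. This is still disjoint from `Own G` when `F` and `G` are
  -- disjoint.
  OwnX : (V -> Set) -> V -> Set
  OwnX F k = Hd D k × ∃ λ v -> D v × Meets D k v × F v
  Own-X : ∀ {F k} -> Own F k -> OwnX F k
  Own-X (hk , (v , d , mv) , f) = hk , v , d , mv , f v mv d
  Reach : (V -> Set) -> (V -> Set) -> V -> Set
  Reach P F z = P z ⊎ z ≡ y ⊎ OwnX F z

  from-x : ∀ {P F v} -> F v -> D v -> Xn v -> Link E (Reach P F) x v
  from-x fv dv (inl e) = _ , ε , e
  from-x fv dv (inr (inl e)) = y , edge xy (inr (inl refl)) , e
  from-x {P} {F} {v} fv dv (inr (inr (k , hk , kv))) = let z , r , e = at-x hk in
   k , step (Esym e) (mk (comp-end hk r)) (W-mono mk (comp-back hk r)) , kv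
   where
   mk : ∀ {k'} -> Comp D k k' -> Reach P F k'
   mk (hk' , r) = inr (inr (hk' , v , dv , (k , W-rev Esym hk r , kv) , fv))

  link₂ : ∀ {P a c} -> (∀ {v} -> P v -> D v) -> U₂ a -> D c -> Link E₂ P a c -> Link E (Reach P (λ z -> P z ⊎ D a × z ≡ a ⊎ z ≡ c)) a c
  link₂ {P} {a} {c} P⊂ ua dc (w , p , e) = go ua p e
   where
   F : V -> Set
   F z = P z ⊎ D a × z ≡ a ⊎ z ≡ c
   toHe : ∀ {u v} -> D u -> W E₂ P u v -> W (He D) P u v
   toHe du ε = ε
   toHe du (step e s p) = step (He-E₂ du e (P⊂ s)) s (toHe (P⊂ s) p)
   fin : ∀ {u w} -> D u -> F u -> W E₂ P u w -> E₂ w c -> Link E (Reach P F) u c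
   fin du fu p e = Link-mono [ inl , (λ o -> inr (inr (Own-X o))) ]′
    (He-link (λ p -> P⊂ p , inl p) du fu dc (inr (inr refl)) (_ , toHe du p , He-E₂ ([ (λ { refl -> du }) , P⊂ ]′ (W-end p)) e dc))
   go : ∀ {w} -> U₂ a -> W E₂ P a w -> E₂ w c -> Link E (Reach P F) a c
   go (inr da) p e = fin da (inr (inl (da , refl))) p e
   go (inl refl) ε e = from-x (inr (inr refl)) dc (Xn-E₂ e)
   go (inl refl) (step e s p) e' = Link-∙ (from-x (inl s) (P⊂ s) (Xn-E₂ e)) (inl s) (fin (P⊂ s) (inl s) p e')

  link₂' : ∀ {P a c} -> (∀ {v} -> P v -> D v) -> D a -> D c -> Link E₂ P a c -> Link E (λ z -> P z ⊎ Own (λ z -> P z ⊎ z ≡ a ⊎ z ≡ c) z) a c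
  link₂' {P} P⊂ da dc (w , p , e) = He-link (λ p -> P⊂ p , inl p) da (inr (inl refl)) dc (inr (inr refl))
    (w , toHe da p , He-E₂ ([ (λ { refl -> da }) , P⊂ ]′ (W-end p)) e dc)
   where
   toHe : ∀ {u v} -> D u -> W E₂ P u v -> W (He D) P u v
   toHe du ε = ε
   toHe du (step e s p) = step (He-E₂ du e (P⊂ s)) s (toHe (P⊂ s) p)

  frame∈ : ∀ {a b c d} -> a ∷ b ∷ c ∷ d ∷ [] ⊆ x ∷ xs -> (a ≡ x ⊎ a ∈ xs) × b ∈ xs × c ∈ xs × d ∈ xs
  frame∈ (_ ∷ʳ τ) = inr (to∈ (⊆-trans (refl ∷ minimum _) τ)) , to∈ (⊆-trans (_ ∷ʳ refl ∷ minimum _) τ) , to∈ (⊆-trans (_ ∷ʳ _ ∷ʳ refl ∷ minimum _) τ) , to∈ (⊆-trans (_ ∷ʳ _ ∷ʳ _ ∷ʳ ⊆-refl) τ)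
  frame∈ (refl ∷ τ) = inl refl , to∈ (⊆-trans (refl ∷ minimum _) τ) , to∈ (⊆-trans (_ ∷ʳ refl ∷ minimum _) τ) , to∈ (⊆-trans (_ ∷ʳ _ ∷ʳ ⊆-refl) τ)

  ⊆-uniq : ∀ {as bs : List V} -> Unique bs -> as ⊆ bs -> Unique as
  ⊆-uniq u [] = []
  ⊆-uniq (_ ∷ u) (_ ∷ʳ τ) = ⊆-uniq u τ
  ⊆-uniq u@(_ ∷ u') (refl ∷ τ) = All.tabulate (λ p e -> Unique-∉ u (SubLookup τ (subst (_∈ _) (sym e) p))) ∷ ⊆-uniq u' τ
   where
   SubLookup : ∀ {as bs : List V} {z} -> as ⊆ bs -> z ∈ as -> z ∈ bs
   SubLookup τ p = to∈ (⊆-trans (from∈ p) τ)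

  -- Crossing links of the contracted society expand to crossing links of the original one. Only the
  -- first of the four ends can be `x`, so only one link is in need of `y` and of components it does
  -- not fully own.
  cf₂ : CrossFree E₂ U₂ x xs
  cf₂ P T P⊂ T⊂ dis {a} {b} {c} {d} τ ac bd = cf PX TX PX⊂ TX⊂ dd τ (link₂ P⊂D ua (xs⊂D c∈) ac) (link₂' T⊂D (xs⊂D b∈) (xs⊂D d∈) bd)
   where
   fr = frame∈ τ
   b∈ = fst (snd fr)
   c∈ = fst (snd (snd fr))
   d∈ = snd (snd (snd fr))
   ua : U₂ a
   ua = Sum.map₂ xs⊂D (fst fr)
   P⊂D : ∀ {v} -> P v -> D v
   P⊂D p = fst (I₂ (P⊂ p))
   T⊂D : ∀ {v} -> T v -> D v
   T⊂D p = fst (I₂ (T⊂ p))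
   F G PX TX : V -> Set
   F z = P z ⊎ D a × z ≡ a ⊎ z ≡ c
   G z = T z ⊎ z ≡ b ⊎ z ≡ d
   PX = Reach P F
   TX z = T z ⊎ Own G z
   PX⊂ : ∀ {v} -> PX v -> I v
   PX⊂ (inl p) = I₂⊂ (P⊂ p)
   PX⊂ (inr (inl refl)) = y∈I
   PX⊂ (inr (inr (hk , _))) = Hd⊂I hk
   TX⊂ : ∀ {v} -> TX v -> I v
   TX⊂ (inl p) = I₂⊂ (T⊂ p)
   TX⊂ (inr (hk , _)) = Hd⊂I hk
   nP : ∀ {v} -> v ∈ xs -> P v -> ⊥
   nP p q = snd (I₂ (P⊂ q)) p
   nT : ∀ {v} -> v ∈ xs -> T v -> ⊥
   nT p q = snd (I₂ (T⊂ q)) p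
   FG : ∀ {v} -> F v -> G v -> ⊥
   FG f g with ⊆-uniq un τ
   FG (inl p) (inl q) | _ = dis p q
   FG (inl p) (inr (inl refl)) | _ = nP b∈ p
   FG (inl p) (inr (inr refl)) | _ = nP d∈ p
   FG (inr (inl (da , refl))) (inl q) | _ = [ (λ e -> D≢x da e) , (λ m -> nT m q) ]′ (fst fr)
   FG (inr (inl (_ , refl))) (inr (inl refl)) | ((ne ∷ _) ∷ _) = ne refl
   FG (inr (inl (_ , refl))) (inr (inr refl)) | ((_ ∷ _ ∷ ne ∷ _) ∷ _) = ne refl
   FG (inr (inr refl)) (inl q) | _ = nT c∈ q
   FG (inr (inr refl)) (inr (inl refl)) | (_ ∷ (ne ∷ _) ∷ _) = ne refl
   FG (inr (inr refl)) (inr (inr refl)) | (_ ∷ _ ∷ (ne ∷ _) ∷ _) = ne refl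
   dd : ∀ {v} -> PX v -> TX v -> ⊥
   dd (inl p) (inl q) = dis p q
   dd (inl p) (inr (hk , _)) = HdD hk (P⊂D p)
   dd (inr (inl refl)) (inl q) = D≢y (T⊂D q) refl
   dd (inr (inl refl)) (inr (hk , _)) = Hd-not hk refl
   dd (inr (inr (hk , _))) (inl q) = HdD hk (T⊂D q)
   dd (inr (inr (hk , v , dv , mv , fv))) (inr (_ , _ , g)) = FG fv (g v mv dv)

  S₂ : Soc E₂ U₂ x h m t
  S₂ = record
   { E? = λ u v -> (D? u ×? D? v ×? He? D? u v) ⊎? ((u ≟ x) ×? D? v ×? Xn? v) ⊎? ((v ≟ x) ×? D? u ×? Xn? u)
   ; Esym = λ { (inl (a , b , e)) -> inl (b , a , He-sym e) ; (inr (inl e)) -> inr (inr e) ; (inr (inr e)) -> inr (inl e) }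
   ; irr = λ { (inl (a , b , inl e)) -> irr e ; (inl (a , b , inr (ne , _))) -> ne
        ; (inr (inl (refl , d , _))) e -> D≢x d (sym e) ; (inr (inr (refl , d , _))) e -> D≢x d e }
   ; U? = λ v -> (v ≟ x) ⊎? D? v ; un = un ; x∈U = inl refl ; xs∈U = λ p -> inr (xs⊂D p)
   ; cf = cf₂ ; sf = sf₂ }

  S₂-smaller : Soc.size S₂ < size
  S₂-smaller = smaller U? (Soc.U? S₂) I? (Soc.I? S₂) U₂⊂ I₂⊂ y (fst y∈I) λ { (inl e) -> snd y∈I (here e) ; (inr d) -> D≢y d refl }

 open Menger {n} using (Arc; Pth; Sep; Three; menger; hit; walk)

 -- The zone between the apex and the visible part

 module Zone {E : V -> V -> Set} {U : V -> Set} {x h : V} {m : List V} {t : V} (S : Soc E U x h m t) {y : V} (y∈I : Soc.I S y) (xy : E x y)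
       {D : V -> Set} (C : Hid.Core S y D)
       (O : Out (Contract.E₂ S y∈I xy C) (Contract.U₂ S y∈I xy C) x h m t) where
  open Soc S
  open Hid S y
  open Core C
  open Pieces C
  open Contract S y∈I xy C
  module O = Out O
  open Strip (Unique-drop [ x ] un) (Soc.xs⊂ S₂) O using (Nbr; Nbr-sym; to-Nbr; chordless; keep-order)
  open O using (μ)

  μ-D : ∀ {v} -> v ∈ μ -> D v
  μ-D p = [ (λ e -> absurd (snd q e)) , (λ d -> d) ]′ (fst q)
   where
    q = μ⊂ (Soc.xs⊂ S₂) O p

  He-Nbr : ∀ {u v} -> D u -> D v -> He D u v -> Nbr u v
  He-Nbr du dv e = to-Nbr (O.cover (inr du) (inr dv) (D≢x du) (D≢x dv) (inl (du , dv , e)))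

  Z : V -> Set
  Z v = v ≡ y ⊎ Hd D v
  Z⊂I : ∀ {v} -> Z v -> I v
  Z⊂I (inl refl) = y∈I
  Z⊂I (inr hd) = Hd⊂I hd
  ZD : ∀ {v} -> Z v -> D v -> ⊥
  ZD (inl e) d = D≢y d e
  ZD (inr hd) d = HdD hd d

  -- Edges between two vertices of `μ` are accounted for by the lower strip and must not be drawn
  -- again.
  Ez : V -> V -> Set
  Ez u v = E u v × ¬ (u ∈ μ × v ∈ μ)
  Uz : V -> Set
  Uz v = v ≡ x ⊎ Z v ⊎ v ∈ μ
  Ez-sym : ∀ {u v} -> Ez u v -> Ez v u
  Ez-sym (e , f) = Esym e , λ (a , b) -> f (b , a)

  Iz : ∀ {v} -> Inn Uz x μ v -> Z v
  Iz (inl e , v∉) = absurd (v∉ (here e))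
  Iz (inr (inl z) , v∉) = z
  Iz (inr (inr p) , v∉) = absurd (v∉ (there p))
  Uz⊂ : ∀ {v} -> Uz v -> U v
  Uz⊂ (inl refl) = x∈U
  Uz⊂ (inr (inl z)) = fst (Z⊂I z)
  Uz⊂ (inr (inr p)) = fst (D⊂ (μ-D p))

  cls : ∀ {v} -> U v -> v ≡ x ⊎ Z v ⊎ D v
  cls u = [ inl , [ (λ e -> inr (inl (inl e))) , [ (λ hd -> inr (inl (inr hd))) , (λ d -> inr (inr d)) ]′ ]′ ]′ (class u)

  Xn-μ : ∀ {v} -> D v -> Xn v -> v ∈ μ
  Xn-μ d xn = O.N⊂μ (inr d) (inr (inl (refl , d , xn)))
  Z-nbr : ∀ {u v} -> Z u -> E u v -> U v -> Uz v
  Z-nbr z e u with cls u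
  ... | inl p = inl p
  ... | inr (inl z') = inr (inl z')
  Z-nbr (inl refl) e u | inr (inr d) = inr (inr (Xn-μ d (inr (inl e))))
  Z-nbr (inr hd) e u | inr (inr d) = inr (inr (Xn-μ d (inr (inr (_ , hd , e)))))
  Z∉μ : ∀ {v} -> Z v -> v ∉ μ
  Z∉μ z p = ZD z (μ-D p)
  x∉μ : x ∉ μ
  x∉μ p = D≢x (μ-D p) refl

  xs-D : ∀ {v} -> v ∈ xs -> D v
  xs-D = xs⊂D

  E-arcs : List (V × V)
  E-arcs = filter (λ e -> D? (fst e) ×? D? (snd e) ×? He? D? (fst e) (snd e)) (cartesianProduct (allFin n) (allFin n))
  arc⁺ : ∀ {u v} -> D u -> D v -> He D u v -> Arc E-arcs u v
  arc⁺ {u} {v} du dv e = ∈-filter⁺ _ (∈-cartesianProduct⁺ (∈-allFin u) (∈-allFin v)) (du , dv , e)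
  arc⁻ : ∀ {u v} -> Arc E-arcs u v -> D u × D v × He D u v
  arc⁻ p = snd (∈-filter⁻ (λ e -> D? (fst e) ×? D? (snd e) ×? He? D? (fst e) (snd e)) {xs = cartesianProduct (allFin n) (allFin n)} p)

  -- Of three distinct vertices one differs from both `s` and `t`, and by `rich` it reaches the
  -- frame without them; so two vertices never separate.
  three : ∀ {p q r} -> p ∈ μ -> q ∈ μ -> r ∈ μ -> p ≢ q -> p ≢ r -> q ≢ r -> Three E-arcs (one-of p q r) (_∈ xs)
  three {p} {q} {r} p∈ q∈ r∈ pq pr qr with menger x E-arcs {A = one-of p q r} {B = _∈ xs} (λ v -> (v ≟ p) ⊎? ((v ≟ q) ⊎? (v ≟ r))) (_∈? xs)
  ... | inr T = T
  ... | inl (s , t , sep) = absurd (pick third)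
   where
   third : ∃ λ w -> one-of p q r w × w ≢ s × w ≢ t
   third with p ≟ s | p ≟ t | q ≟ s | q ≟ t
   ... | no a | no b | _ | _ = p , inl refl , a , b
   ... | _ | _ | no a | no b = q , inr (inl refl) , a , b
   ... | yes refl | _ | yes e | _ = absurd (pq (sym e))
   ... | yes refl | _ | no _ | yes refl = r , inr (inr refl) , (λ e -> pr (sym e)) , λ e -> qr (sym e)
   ... | no _ | yes refl | yes refl | _ = r , inr (inr refl) , (λ e -> qr (sym e)) , λ e -> pr (sym e)
   ... | no _ | yes refl | no _ | yes e = absurd (pq (sym e))
   pick : (∃ λ w -> one-of p q r w × w ≢ s × w ≢ t) -> ⊥
   pick (w , o , w≢s , w≢t) = let ℓ , ℓ∈ , r = rich s t w dw w≢s w≢t in sep o ℓ∈ w≢s w≢t (conv dw r)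
    where
    dw : D w
    dw = [ (λ { refl -> μ-D p∈ }) , [ (λ { refl -> μ-D q∈ }) , (λ { refl -> μ-D r∈ }) ]′ ]′ o
    conv : ∀ {u v} -> D u -> W (He D) (Minus D s t) u v -> W (Arc E-arcs) (λ v -> v ≢ s × v ≢ t) u v
    conv du ε = ε
    conv du (step e (dv , a) p) = step (arc⁺ du dv e) a (conv dv p)

  record Route (u : V) : Set where
   field
    F    : List V
    F⊂D  : ∀ {v} -> v ∈ F -> D v
    u∈F  : u ∈ F
    ℓ    : V
    ℓ∈F  : ℓ ∈ F
    ℓ∈xs : ℓ ∈ xs
    link : u ≡ ℓ ⊎ (u ∉ xs × Link (He D) (λ v -> v ∈ F × v ∉ xs) u ℓ)
   to-foot : W Nbr (_∈ F) ℓ u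
   to-foot with link
   ... | inl e = subst (λ z -> W Nbr (_∈ F) z u) e ε
   ... | inr (_ , w , p , e) = W-rev Nbr-sym u∈F (conv u∈F p ∙ edge (He-Nbr (F⊂D (W-end∈ u∈F (W-mono fst p))) (F⊂D ℓ∈F) e) ℓ∈F)
    where
    conv : ∀ {a b} -> a ∈ F -> W (He D) (λ v -> v ∈ F × v ∉ xs) a b -> W Nbr (_∈ F) a b
    conv a∈ ε = ε
    conv a∈ (step e (s , _) p) = step (He-Nbr (F⊂D a∈) (F⊂D s) e) s (conv s p)

  route : ∀ {u v l} -> D u -> Pth E-arcs u v l -> v ∈ xs -> Σ (Route u) λ R -> ∀ {z} -> z ∈ Route.F R -> z ∈ u ∷ l
  route {u} {v} {l} du p v∈ = go (W-first (_∈? xs) (walk p (here refl)) v∈)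
   where
   ⊂D : ∀ {u v l z} -> D u -> Pth E-arcs u v l -> z ∈ u ∷ l -> D z
   ⊂D du _ (here refl) = du
   ⊂D du (Menger.cons e _ p) (there m) = ⊂D (fst (snd (arc⁻ e))) p m
   go : (∃ λ w -> w ∈ xs × (u ≡ w ⊎ (¬ u ∈ xs × ∃ λ w' -> W (Arc E-arcs) (λ y -> y ∈ l × ¬ y ∈ xs) u w' × Arc E-arcs w' w × w ∈ l))) ->
      Σ (Route u) λ R -> ∀ {z} -> z ∈ Route.F R -> z ∈ u ∷ l
   go (ℓ , ℓ∈ , inl e) = record { F = u ∷ l ; F⊂D = ⊂D du p ; u∈F = here refl ; ℓ = ℓ ; ℓ∈F = here (sym e) ; ℓ∈xs = ℓ∈ ; link = inl e } , λ z -> z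
   go (ℓ , ℓ∈ , inr (u∉ , w , q , e , ℓ∈l)) = record { F = u ∷ l ; F⊂D = ⊂D du p ; u∈F = here refl ; ℓ = ℓ ; ℓ∈F = there ℓ∈l ; ℓ∈xs = ℓ∈
    ; link = inr (u∉ , w , W-map (λ e -> snd (snd (arc⁻ e))) (λ (a , b) -> there a , b) q , snd (snd (arc⁻ e))) } , λ z -> z

  Disj : ∀ {u v} -> Route u -> Route v -> Set
  Disj R R' = ∀ {z} -> z ∈ Route.F R -> z ∈ Route.F R' -> ⊥

  routes : ∀ {p q r} -> p ∈ μ -> q ∈ μ -> r ∈ μ -> p ≢ q -> p ≢ r -> q ≢ r ->
       Σ (Route p) λ P -> Σ (Route q) λ Q -> Σ (Route r) λ R -> Disj P Q × Disj Q R × Disj P R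
  routes {p} {q} {r} p∈ q∈ r∈ pq pr qr = pack (at h₁) (at h₂) (at h₃)
    (λ e -> pq (trans (sym (snd h₁)) (trans (cong T.a e) (snd h₂)))) (λ e -> qr (trans (sym (snd h₂)) (trans (cong T.a e) (snd h₃))))
    (λ e -> pr (trans (sym (snd h₁)) (trans (cong T.a e) (snd h₃))))
   where
   module T = Three (three p∈ q∈ r∈ pq pr qr)
   inj : ∀ {i j} -> T.a i ≡ T.a j -> i ≡ j
   inj e = T.dis (here refl) (here e)
   h₁ : ∃ λ i -> T.a i ≡ p
   h₁ = fst (hit T.a inj T.a∈)
   h₂ : ∃ λ i -> T.a i ≡ q
   h₂ = fst (hit T.a inj {q} {p} {r} λ i -> [ (λ e -> inr (inl e)) , [ inl , (λ e -> inr (inr e)) ]′ ]′ (T.a∈ i))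
   h₃ : ∃ λ i -> T.a i ≡ r
   h₃ = fst (hit T.a inj {r} {p} {q} λ i -> [ (λ e -> inr (inl e)) , [ (λ e -> inr (inr e)) , inl ]′ ]′ (T.a∈ i))
   dp : ∀ i -> D (T.a i)
   dp i = [ (λ { e -> subst D (sym e) (μ-D p∈) }) , [ (λ e -> subst D (sym e) (μ-D q∈)) , (λ e -> subst D (sym e) (μ-D r∈)) ]′ ]′ (T.a∈ i)
   At : ∀ u -> Fin 3 -> Set
   At u i = Σ (Route u) λ Q -> ∀ {z} -> z ∈ Route.F Q -> z ∈ T.a i ∷ T.l i
   at : ∀ {u} (p : ∃ λ i -> T.a i ≡ u) -> At u (fst p)
   at (i , refl) = route (dp i) (T.pth i) (T.b∈ i)
   pack : ∀ {i j k} -> At p i -> At q j -> At r k -> i ≢ j -> j ≢ k -> i ≢ k ->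
       Σ (Route p) λ P -> Σ (Route q) λ Q -> Σ (Route r) λ R -> Disj P Q × Disj Q R × Disj P R
   pack (P , f) (Q , g) (R , h) ij jk ik = P , Q , R , (λ a b -> ij (T.dis (f a) (g b))) , (λ a b -> jk (T.dis (g a) (h b))) , λ a b -> ik (T.dis (f a) (h b))

  W-target : ∀ {P K : V -> Set} {u d} -> u ≢ d -> W E (λ v -> (P v ⊎ v ≡ d) × ¬ K v) u d -> Link E (λ v -> P v × ¬ K v) u d
  W-target ne ε = absurd (ne refl)
  W-target {d = d} ne (step {w = w} e (s , ¬k) p) with w ≟ d
  ... | yes refl = _ , ε , e
  ... | no w≢d with W-target w≢d p
  ... | z , q , e' = z , step e ([ (λ p -> p) , (λ e -> absurd (w≢d e)) ]′ s , ¬k) q , e'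

  to-E : ∀ {P u v} -> W Ez P u v -> W E P u v
  to-E = W-map fst (λ s -> s)

  -- A union of hidden components meets the rest of the zone in `y` only. A link that strays into it
  -- can therefore be resumed at `y`.
  bypass : ∀ {P K : V -> Set} (K? : Dec₁ K) -> (∀ {k} -> K k -> Hd D k) -> (∀ {k k'} -> K k -> W E (Hd D) k k' -> K k') ->
       (∀ {v} -> P v -> Z v) -> ∀ {u d} -> u ≢ d -> ¬ Hd D u -> ¬ Hd D d -> D d -> (∀ {k} -> K k -> E k d -> ⊥) ->
       (∀ {k} -> K k -> E u k -> u ≡ y ⊎ E u y) -> Link Ez P u d -> Link E (λ v -> P v × ¬ K v) u d
  bypass {P} {K} K? K⊂ Kc P⊂ {u} {d} u≢d ¬hu ¬hd dd Kd Ku (w , p , e , _) = W-target u≢d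
   (fst (W-detour K? {z = y} (λ k -> ¬hd (K⊂ k)) ex (λ s ¬k k e -> ex s ¬k k (Esym e)) (W-mono inl (to-E p) ∙ edge e (inr refl))) (λ k -> ¬hu (K⊂ k)) Ku)
   where
   ex : ∀ {o k} -> P o ⊎ o ≡ d -> ¬ K o -> K k -> E k o -> o ≡ y
   ex (inr refl) ¬k k e = absurd (Kd k e)
   ex (inl po) ¬k k e with P⊂ po
   ... | inl o≡y = o≡y
   ... | inr ho = absurd (¬k (Kc k (edge e ho)))

  -- The zone links are prolonged along the three routes to `xs`, which arrive in the order of `μ`.
  -- Virtual edges of the routes run through hidden components; each zone link gives up the
  -- components owned by the routes of the other side, so that the prolonged links are disjoint.
  cross-routes : ∀ {P T : V -> Set} -> (∀ {v} -> P v -> Z v) -> (∀ {v} -> T v -> Z v) -> (∀ {v} -> P v -> T v -> ⊥) ->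
       ∀ {b c d} -> b ∷ c ∷ d ∷ [] ⊆ μ -> b ≢ d -> Link Ez P x c -> Link Ez T b d ->
       (Rb : Route b) (Rc : Route c) (Rd : Route d) -> Disj Rb Rc -> Disj Rc Rd -> ⊥
  cross-routes {P} {T} P⊂ T⊂ dis {b} {c} {d} τ b≢d xc bd Rb Rc Rd bc cd =
    cf 𝒜 ℬ 𝒜⊂ ℬ⊂ 𝒜ℬ (refl ∷ order₃ (Unique-drop [ x ] un) ord₁ ord₂) link-𝒜 link-ℬ
   where
   module b = Route Rb
   module c = Route Rc
   module d = Route Rd
   b∈ = to∈ (⊆-trans (refl ∷ minimum _) τ)
   c∈ = to∈ (⊆-trans (_ ∷ʳ refl ∷ minimum _) τ)
   d∈ = to∈ (⊆-trans (_ ∷ʳ _ ∷ʳ ⊆-refl) τ)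
   ord₁ : b.ℓ ∷ c.ℓ ∷ [] ⊆ xs
   ord₁ = keep-order (_∈ b.F) (_∈ c.F) bc (⊆-trans (refl ∷ refl ∷ minimum _) τ) b.ℓ∈F c.ℓ∈F b.ℓ∈xs c.ℓ∈xs b.to-foot c.to-foot
   ord₂ : c.ℓ ∷ d.ℓ ∷ [] ⊆ xs
   ord₂ = keep-order (_∈ c.F) (_∈ d.F) cd (⊆-trans (_ ∷ʳ ⊆-refl) τ) c.ℓ∈F d.ℓ∈F c.ℓ∈xs d.ℓ∈xs c.to-foot d.to-foot
   FB : V -> Set
   FB v = v ∈ b.F ⊎ v ∈ d.F
   KA KB 𝒜 ℬ : V -> Set
   KA = Own (_∈ c.F)
   KB = Own FB
   KA? : Dec₁ KA
   KA? = Own? (_∈? c.F)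
   KB? : Dec₁ KB
   KB? = Own? λ v -> (v ∈? b.F) ⊎? (v ∈? d.F)
   𝒜 v = (P v × ¬ KB v) ⊎ (v ∈ c.F × v ∉ xs) ⊎ KA v
   ℬ v = (T v × ¬ KA v) ⊎ (FB v × v ∉ xs) ⊎ KB v
   inD : ∀ {v} -> D v -> v ∉ xs -> I v
   inD d v∉ = fst (D⊂ d) , λ { (here e) -> D≢x d e ; (there p) -> v∉ p }
   FB-D : ∀ {v} -> FB v -> D v
   FB-D = [ b.F⊂D , d.F⊂D ]′
   cFB : ∀ {v} -> v ∈ c.F -> FB v -> ⊥
   cFB p = [ (λ q -> bc q p) , cd p ]′
   𝒜⊂ : ∀ {v} -> 𝒜 v -> I v
   𝒜⊂ (inl (p , _)) = Z⊂I (P⊂ p)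
   𝒜⊂ (inr (inl (p , q))) = inD (c.F⊂D p) q
   𝒜⊂ (inr (inr (hk , _))) = Hd⊂I hk
   ℬ⊂ : ∀ {v} -> ℬ v -> I v
   ℬ⊂ (inl (p , _)) = Z⊂I (T⊂ p)
   ℬ⊂ (inr (inl (p , q))) = inD (FB-D p) q
   ℬ⊂ (inr (inr (hk , _))) = Hd⊂I hk
   𝒜ℬ : ∀ {v} -> 𝒜 v -> ℬ v -> ⊥
   𝒜ℬ (inl (p , _)) (inl (q , _)) = dis p q
   𝒜ℬ (inl (p , _)) (inr (inl (q , _))) = ZD (P⊂ p) (FB-D q)
   𝒜ℬ (inl (_ , ¬k)) (inr (inr k)) = ¬k k
   𝒜ℬ (inr (inl (p , _))) (inl (q , _)) = ZD (T⊂ q) (c.F⊂D p)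
   𝒜ℬ (inr (inl (p , _))) (inr (inl (q , _))) = cFB p q
   𝒜ℬ (inr (inl (p , _))) (inr (inr (hk , _))) = HdD hk (c.F⊂D p)
   𝒜ℬ (inr (inr k)) (inl (_ , ¬k)) = ¬k k
   𝒜ℬ (inr (inr (hk , _))) (inr (inl (q , _))) = HdD hk (FB-D q)
   𝒜ℬ (inr (inr (_ , (v , dv , mv) , f))) (inr (inr (_ , _ , g))) = cFB (f v mv dv) (g v mv dv)
   notHd : ∀ {v} -> D v -> ¬ Hd D v
   notHd d hd = HdD hd d
   Ku : ∀ {F} -> ∀ {k v} -> D v -> (F v -> ⊥) -> Own F k -> E k v -> ⊥
   Ku dv ¬f (hk , _ , g) e = ¬f (g _ (_ , ε , e) dv)
   foot : ∀ {u} (R : Route u) -> D u -> ∀ {G 𝒮 : V -> Set} -> (∀ {v} -> v ∈ Route.F R -> v ∉ xs -> 𝒮 v) -> (∀ {v} -> v ∈ Route.F R -> G v) -> (∀ {v} -> Own G v -> 𝒮 v) ->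
       u ≡ Route.ℓ R ⊎ (𝒮 u × Link E 𝒮 u (Route.ℓ R))
   foot R du f g o with Route.link R
   ... | inl e = inl e
   ... | inr (u∉ , l) = inr (f (Route.u∈F R) u∉ , Link-mono [ (λ (a , b) -> f a b) , o ]′
       (He-link (λ (a , _) -> Route.F⊂D R a , g a) du (g (Route.u∈F R)) (Route.F⊂D R (Route.ℓ∈F R)) (g (Route.ℓ∈F R)) l))
   link-𝒜 : Link E 𝒜 x c.ℓ
   link-𝒜 with foot Rc (μ-D c∈) {G = _∈ c.F} {𝒮 = 𝒜} (λ a b -> inr (inl (a , b))) (λ p -> p) (λ o -> inr (inr o))
         | bypass KB? fst Own-comp P⊂ (λ { refl -> x∉μ c∈ }) (λ (_ , ne , _) -> ne refl) (notHd (μ-D c∈)) (μ-D c∈)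
           (Ku (μ-D c∈) (λ f -> cFB c.u∈F f)) (λ _ _ -> inr xy) xc
   ... | inl e | l = subst (Link E 𝒜 x) e (Link-mono inl l)
   ... | inr (cs , l') | l = Link-∙ (Link-mono inl l) cs l'
   link-ℬ : Link E ℬ b.ℓ d.ℓ
   link-ℬ with foot Rb (μ-D b∈) {G = FB} {𝒮 = ℬ} (λ a b -> inr (inl (inl a , b))) inl (λ o -> inr (inr o))
         | foot Rd (μ-D d∈) {G = FB} {𝒮 = ℬ} (λ a b -> inr (inl (inr a , b))) inr (λ o -> inr (inr o))
         | Link-mono {Q = ℬ} inl (bypass KA? fst Own-comp T⊂ b≢d (notHd (μ-D b∈)) (notHd (μ-D d∈)) (μ-D d∈)
           (Ku (μ-D d∈) (λ f -> cd f d.u∈F)) (λ k e -> absurd (Ku (μ-D b∈) (λ f -> bc b.u∈F f) k (Esym e))) bd)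
   ... | inl e | inl e' | l = subst (λ z -> Link E ℬ z d.ℓ) e (subst (Link E ℬ b) e' l)
   ... | inl e | inr (ds , l') | l = subst (λ z -> Link E ℬ z d.ℓ) e (Link-∙ l ds l')
   ... | inr (bs , l') | inl e' | l = subst (Link E ℬ b.ℓ) e' (Link-∙ (Link-rev Esym l') bs l)
   ... | inr (bs , l') | inr (ds , l'') | l = Link-∙ (Link-rev Esym l') bs (Link-∙ l ds l'')

  cross₁ : ∀ {P T : V -> Set} -> (∀ {v} -> P v -> Z v) -> (∀ {v} -> T v -> Z v) -> (∀ {v} -> P v -> T v -> ⊥) ->
       ∀ {b c d} -> b ∷ c ∷ d ∷ [] ⊆ μ -> Link Ez P x c -> Link Ez T b d -> ⊥
  cross₁ P⊂ T⊂ dis {b} {c} {d} τ xc bd = dist (⊆-uniq O.μ-uniq τ)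
   where
   b∈ = to∈ (⊆-trans (refl ∷ minimum _) τ)
   c∈ = to∈ (⊆-trans (_ ∷ʳ refl ∷ minimum _) τ)
   d∈ = to∈ (⊆-trans (_ ∷ʳ _ ∷ʳ ⊆-refl) τ)
   go : b ≢ d -> (Σ (Route b) λ P -> Σ (Route c) λ Q -> Σ (Route d) λ R -> Disj P Q × Disj Q R × Disj P R) -> ⊥
   go b≢d (Rb , Rc , Rd , bc , cd , _) = cross-routes P⊂ T⊂ dis τ b≢d xc bd Rb Rc Rd bc cd
   dist : Unique (b ∷ c ∷ d ∷ []) -> ⊥
   dist ((b≢c ∷ b≢d ∷ []) ∷ (c≢d ∷ []) ∷ _) = go b≢d (routes b∈ c∈ d∈ b≢c b≢d c≢d)

  -- Only the part of `P` that still leads to `c` is kept, so whichever of its vertices is met on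
  -- the way from `x` can be continued to `c`.
  Trim : (V -> Set) -> V -> V -> Set
  Trim P c z = P z × Link Ez P z c
  trim : ∀ {P a c} -> Link Ez P a c -> Link Ez (Trim P c) a c
  trim {P} {a} {c} (w , p , e) = w , go p e , e
   where
   go : ∀ {u w} -> W Ez P u w -> Ez w c -> W Ez (Trim P c) u w
   go ε e = ε
   go (step e' s p) e = step e' (s , _ , p , e) (go p e)
  trim-self : ∀ {P c z} -> Trim P c z -> Link Ez (Trim P c) z c
  trim-self (_ , l) = trim l

  -- Two crossing links between vertices of μ: connect x to the one met first.
  cross₂ : ∀ {P T : V -> Set} -> (∀ {v} -> P v -> Z v) -> (∀ {v} -> T v -> Z v) -> (∀ {v} -> P v -> T v -> ⊥) ->
       ∀ {a b c d} -> a ∷ b ∷ c ∷ d ∷ [] ⊆ μ -> Link Ez P a c -> Link Ez T b d -> ⊥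
  cross₂ {P} {T} P⊂ T⊂ dis {a} {b} {c} {d} τ ac bd = begin ac
   where
   a∈ = to∈ (⊆-trans (refl ∷ minimum _) τ)
   c∈ = to∈ (⊆-trans (_ ∷ʳ _ ∷ʳ refl ∷ minimum _) τ)
   P* T* : V -> Set
   P* = Trim P c
   T* = Trim T b
   T-link : Link Ez T* b d
   T-link = Link-rev Ez-sym (trim (Link-rev Ez-sym bd))
   P-link : Link Ez P* a c
   P-link = trim ac
   Off : V -> Set
   Off v = Z v × ¬ P* v × ¬ T* v
   x-step : ∀ {u v} -> Link Ez Off x u -> Off u -> Ez u v -> Link Ez Off x v
   x-step l o e = Link-∙ l o (_ , ε , e)
   hitP : ∀ {v} -> P* v -> Link Ez Off x v -> ⊥
   hitP {v} pv l = cross₁ {P = λ z -> Off z ⊎ P* z} {T = T*} [ fst , (λ p -> P⊂ (fst p)) ]′ (λ t -> T⊂ (fst t))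
    (λ { (inl (_ , _ , ¬t)) t -> ¬t t ; (inr p) t -> dis (fst p) (fst t) })
    (⊆-trans (_ ∷ʳ ⊆-refl) τ) (Link-∙ (Link-mono inl l) (inr pv) (Link-mono inr (trim-self pv))) T-link
   hitT : ∀ {v} -> T* v -> Link Ez Off x v -> ⊥
   hitT {v} tv l = cross₁ {P = λ z -> Off z ⊎ T* z} {T = P*} [ fst , (λ p -> T⊂ (fst p)) ]′ (λ t -> P⊂ (fst t))
    (λ { (inl (_ , ¬p , _)) p -> ¬p p ; (inr t) p -> dis (fst p) (fst t) })
    (⊆-trans (refl ∷ refl ∷ refl ∷ minimum _) τ) (Link-∙ (Link-mono inl l) (inr tv) (Link-mono inr (trim-self tv))) P-link
   hook : ∀ {u v} -> Link Ez Off x u -> Z u -> W Ez Z u v -> P* v -> ⊥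
   hook {u} l zu p pv = em {P* u} λ { (inl pu) -> hitP pu l ; (inr ¬pu) -> em {T* u} λ { (inl tu) -> hitT tu l ; (inr ¬tu) -> next ¬pu ¬tu p pv } }
    where
    next : ∀ {v} -> ¬ P* u -> ¬ T* u -> W Ez Z u v -> P* v -> ⊥
    next ¬pu ¬tu ε pv = ¬pu pv
    next ¬pu ¬tu (step e z p) pv = hook (x-step l (zu , ¬pu , ¬tu) e) z p pv
   ez : ∀ {u v} -> Z v -> E u v -> Ez u v
   ez z e = e , λ (_ , q) -> Z∉μ z q
   ezx : ∀ {v} -> E x v -> Ez x v
   ezx e = e , λ (q , _) -> x∉μ q
   -- Every zone vertex is joined to `x` inside the zone, `y` by an edge and a hidden vertex by
   -- `at-x`. The walk from `x` has a first vertex in one of the trimmed links, and there `hook`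
   -- finds the crossing of `cross₁`.
   from : ∀ {v} -> P* v -> ⊥
   from {v} pv with P⊂ (fst pv)
   ... | inl refl = hook (x , ε , ezx xy) (inl refl) ε pv
   ... | inr hv = let z , r , e = at-x hv in
    hook (x , ε , ezx (Esym e)) (inr (W-end∈ hv r)) (W-map (λ e -> e) inr (zwalk (comp-back hv r))) pv
    where
    zwalk : ∀ {u w} -> W E (Comp D v) u w -> W Ez (Hd D) u w
    zwalk ε = ε
    zwalk (step e s p) = step (ez (inr (fst s)) e) (fst s) (zwalk p)
   begin : Link Ez P a c -> ⊥
   -- A direct edge between two vertices of `μ` is not in `Ez`.
   begin (_ , ε , (_ , ¬e)) = ¬e (a∈ , c∈)
   begin (w , step {w = v} e s p , e') = from (s , w , p , e')

  cf-z : CrossFree Ez Uz x μ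
  cf-z P T P⊂ T⊂ dis (_ ∷ʳ τ) ac bd = cross₂ (λ p -> Iz (P⊂ p)) (λ t -> Iz (T⊂ t)) dis τ ac bd
  cf-z P T P⊂ T⊂ dis (refl ∷ τ) ac bd = cross₁ (λ p -> Iz (P⊂ p)) (λ t -> Iz (T⊂ t)) dis τ ac bd

  Z? : Dec₁ Z
  Z? v = (v ≟ y) ⊎? Hd? D? v

  Sz : Soc Ez Uz x h O.k t
  Sz = record
   { E? = λ u v -> E? u v ×? ¬? ((u ∈? μ) ×? (v ∈? μ))
   ; Esym = Ez-sym ; irr = λ (e , _) -> irr e
   ; U? = λ v -> (v ≟ x) ⊎? (Z? v ⊎? (v ∈? μ))
   ; un = All.tabulate (λ { p refl -> x∉μ p }) ∷ O.μ-uniq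
   ; x∈U = inl refl ; xs∈U = λ p -> inr (inr p)
   ; cf = cf-z
   ; sf = sub-sf sf (λ i -> Z⊂I (Iz i)) λ i e u -> Z-nbr (Iz i) e u , e , λ (p , _) -> Z∉μ (Iz i) p }

  Sz-smaller : ∀ {d} -> D d -> d ∉ xs -> Soc.size Sz < size
  Sz-smaller {d} dd d∉ = +-mono-≤-< (cnt-mono (Soc.U? Sz) U? Uz⊂)
   (cnt-strict (Soc.I? Sz) I? (λ i -> Z⊂I (Iz i)) d (fst (D⊂ dd) , λ { (here e) -> D≢x dd e ; (there p) -> d∉ p }) λ i -> ZD (Iz i) dd)

  zone-out : Out Ez Uz x h O.k t -> Out E U x h m t
  zone-out Oz = seq-out (Soc.xs⊂ S₂) O Oz (Soc.xs⊂ Sz) fst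
   (λ {v} u e -> let uz = nx u e in uz , e , λ (p , _) -> x∉μ p)
   (λ { {v} (u , v∉) -> [ (λ e -> absurd (v∉ (here e))) , [ (λ z -> inr (inr (inl z) , λ { (here e) -> v∉ (here e) ; (there p) -> Z∉μ z p }))
                            , (λ d -> inl (inr d , v∉)) ]′ ]′ (cls u) })
   U₂⊂ Uz⊂
   (λ { (inl e) _ ne -> absurd (ne e) ; (inr d) (inl e) ne -> absurd (ne e) ; (inr d) (inr (inl z)) _ -> absurd (ZD z d) ; (inr d) (inr (inr p)) _ -> p })
   (λ uu uv nu nv e -> edg nu nv (cls uu) (cls uv) uu uv e)
   (chordless λ {c} {a} {b} c∈ ca cb -> let ℓ , ℓ∈ , r = rich a b c (μ-D c∈) ca cb ; (_ , la , lb) = W-end∈ (μ-D c∈ , ca , cb) r in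
     ℓ , ℓ∈ , conv (μ-D c∈) r , la , lb)
   where
   nx : ∀ {v} -> U v -> E x v -> Uz v
   nx u e with cls u
   ... | inl refl = absurd (irr e refl)
   ... | inr (inl z) = inr (inl z)
   ... | inr (inr d) = inr (inr (Xn-μ d (inl e)))
   conv : ∀ {a b u v} -> D u -> W (He D) (Minus D a b) u v -> W Nbr (λ v -> v ≢ a × v ≢ b) u v
   conv du ε = ε
   conv du (step e (dv , s) p) = step (He-Nbr du dv e) s (conv dv p)
   edg : ∀ {u v} -> u ≢ x -> v ≢ x -> u ≡ x ⊎ Z u ⊎ D u -> v ≡ x ⊎ Z v ⊎ D v -> U u -> U v -> E u v -> (U₂ u × U₂ v × E₂ u v) ⊎ (Uz u × Uz v × Ez u v)
   edg nu nv (inl e) _ _ _ _ = absurd (nu e)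
   edg nu nv _ (inl e) _ _ _ = absurd (nv e)
   edg nu nv (inr (inr d)) (inr (inr d')) _ _ e = inl (inr d , inr d' , inl (d , d' , inl e))
   edg nu nv (inr (inl z)) (inr _) uu uv e = inr (inr (inl z) , Z-nbr z e uv , e , λ (p , _) -> Z∉μ z p)
   edg nu nv (inr (inr d)) (inr (inl z)) uu uv e = inr (Z-nbr z (Esym e) uu , inr (inl z) , e , λ (_ , p) -> Z∉μ z p)

 -- Besides a chord or an inner neighbour of `x` there is the case that `x` sees at most `h` and
 -- `t`. Then `x` is dropped and `h` becomes the apex. With only three boundary vertices in that
 -- case, `sf` leaves no inner vertex.
 web : ∀ f {E U x h m t} (S : Soc E U x h m t) -> Soc.size S < f -> Out E U x h m t
 web zero S lt = absurd (n≮0 lt)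
 web (suc f) {E} {U} {x} {h} {m} {t} S lt = chord (any? λ c -> (c ∈? m) ×? E? x c)
  where
  open Soc S
  below : ∀ {E' U' h' m' t'} (S' : Soc E' U' x h' m' t') -> Soc.size S' < size -> Out E' U' x h' m' t'
  below S' lt' = web f S' (≤-trans lt' (≤-pred lt))
  inside : ∀ {y} {D : V -> Set} (y∈I : I y) (xy : E x y) (C : Hid.Core S y D) -> (∀ {c} -> c ∈ m -> ¬ E x c) ->
       Dec (∃ λ d -> D d × d ∉ xs) -> Out E U x h m t
  inside y∈I xy C nc (no none) = split-y S nc y∈I xy C (λ {v} d -> [ (λ p -> p) , (λ v∉ -> absurd (none (v , d , v∉))) ]′ (dec v)) below
   where
   dec : ∀ v -> v ∈ xs ⊎ v ∉ xs
   dec v with v ∈? xs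
   ... | yes p = inl p
   ... | no p = inr p
  inside y∈I xy C nc (yes (d , dd , d∉)) = zone-out (below Sz (Sz-smaller dd d∉))
   where
   open Contract S y∈I xy C using (S₂; S₂-smaller)
   open Zone S y∈I xy C (below S₂ S₂-smaller)
  nbr : (∀ {c} -> c ∈ m -> ¬ E x c) -> Dec (∃ λ y -> I y × E x y) -> Out E U x h m t
  nbr nc (yes (y , y∈I , xy)) = let D , C = Hid.core S y y∈I in
   inside y∈I xy C nc (any? λ d -> Hid.Shrunk.D? (Hid.Core.shrunk C) d ×? ¬? (d ∈? xs))
  nbr nc (no none) = ears S nc (λ i e -> none (_ , i , e)) (≤-pred lt)
   where
   ears : ∀ {E U x h m t} (S : Soc E U x h m t) -> (∀ {c} -> c ∈ m -> ¬ E x c) -> (∀ {v} -> Soc.I S v -> E x v -> ⊥) -> Soc.size S ≤ f -> Out E U x h m t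
   ears {m = []} S nc ni le = base-out (Soc.irr S) (Soc.un S) λ {v} u -> all v u
    where
    all : ∀ v -> _ -> one-of _ _ _ v
    all v u with v ∈? (_ ∷ _ ∷ [ _ ])
    ... | yes (here e) = inl e
    ... | yes (there (here e)) = inr (inl e)
    ... | yes (there (there (here e))) = inr (inr e)
    ... | no v∉ = absurd (Soc.sf S (Soc.I S) _ _ _ v (u , v∉) (λ i -> i) λ {u'} {v'} i e u -> fin v' u)
     where
     fin : ∀ v' -> _ -> Soc.I S v' ⊎ one-of _ _ _ v'
     fin v' u with v' ∈? (_ ∷ _ ∷ [ _ ])
     ... | yes (here e) = inr (inl e)
     ... | yes (there (here e)) = inr (inr (inl e))
     ... | yes (there (there (here e))) = inr (inr (inr e))
     ... | no v∉ = inl (u , v∉)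
   ears {E} {U} {x} {h} {h' ∷ m} {t} S nc ni le = ear-out (Soc.Esym S) (Soc.un S) (Soc.xs⊂ S) N (web f S' (≤-trans small le))
    where
    S' : Soc E (λ v -> U v × v ≢ x) h h' m t
    S' = ear S ni
    small : Soc.size S' < Soc.size S
    small = smaller (Soc.U? S) (Soc.U? S') (Soc.I? S) (Soc.I? S') fst (λ { ((u , ne) , v∉) -> u , λ { (here e) -> ne e ; (there p) -> v∉ p } })
     x (Soc.x∈U S) (λ (_ , ne) -> ne refl)
    N : ∀ {v} -> U v -> E x v -> v ≡ h ⊎ v ≡ t
    N {v} u e with v ∈? (x ∷ h ∷ h' ∷ m ++ [ t ])
    ... | no v∉ = absurd (ni (u , v∉) e)
    ... | yes (here refl) = absurd (Soc.irr S e refl)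
    ... | yes (there (here e')) = inl e'
    ... | yes (there (there p)) with ∈⁻ (h' ∷ m) p
    ... | inl q = absurd (nc q e)
    ... | inr (here e') = inr e'
  chord : Dec (∃ λ c -> c ∈ m × E x c) -> Out E U x h m t
  chord (no none) = nbr (λ c∈ e -> none (_ , c∈ , e)) (any? λ y -> I? y ×? E? x y)
  chord (yes (c , c∈ , e)) = go S (≤-pred lt) c∈ e
   where
   go : ∀ {m} (S : Soc E U x h m t) -> Soc.size S ≤ f -> c ∈ m -> E x c -> Out E U x h m t
   go S le c∈ e with ∈-∃++ c∈
   ... | m₁ , m₂ , refl = chord-out S e λ S' lt' -> web f S' (≤-trans lt' le)

-- Plane quadrangles

⌊⌋⁺ : ∀ {P : Set} (d : Dec P) -> P -> ⌊ d ⌋ ≡ true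
⌊⌋⁺ (yes _) _ = refl
⌊⌋⁺ (no ¬p) p = absurd (¬p p)

⌊⌋⁻ : ∀ {P : Set} (d : Dec P) -> ⌊ d ⌋ ≡ true -> P
⌊⌋⁻ (yes p) _ = p

⌊⌋-false : ∀ {P : Set} (d : Dec P) -> ¬ P -> ⌊ d ⌋ ≡ false
⌊⌋-false (yes p) ¬p = absurd (¬p p)
⌊⌋-false (no _) _ = refl

module _ {A : Set} where
 ∈-concat-index : ∀ {B : Set} (g : A -> List B) xs {y} -> y ∈ concatMap g xs -> ∃ λ i -> y ∈ g (lookup xs i)
 ∈-concat-index g (x ∷ xs) p with ∈⁻ (g x) p
 ... | inl q = zero , q
 ... | inr q = let i , r = ∈-concat-index g xs q in suc i , r

 ∈-concat-lookup : ∀ {B : Set} (g : A -> List B) xs {y} i -> y ∈ g (lookup xs i) -> y ∈ concatMap g xs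
 ∈-concat-lookup g (x ∷ xs) zero p = ∈ˡ p
 ∈-concat-lookup g (x ∷ xs) (suc i) p = ∈ʳ (g x) (∈-concat-lookup g xs i p)

 concat-unique : ∀ {B : Set} (g : A -> List B) xs -> Unique (concatMap g xs) -> ∀ {y} i j -> y ∈ g (lookup xs i) -> y ∈ g (lookup xs j) -> i ≡ j
 concat-unique g (x ∷ xs) u zero zero p q = refl
 concat-unique g (x ∷ xs) u (suc i) (suc j) p q = cong suc (concat-unique g xs (Unique-drop (g x) u) i j p q)
 concat-unique g (x ∷ xs) u zero (suc j) p q = absurd (uniq-dis (g x) u p (∈-concat-lookup g xs j q))
 concat-unique g (x ∷ xs) u (suc i) zero p q = absurd (uniq-dis (g x) u q (∈-concat-lookup g xs i p))

 twice : A × A -> List (A × A)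
 twice (a , b) = (a , b) ∷ (b , a) ∷ []

 both-∈ : ∀ Es {u v : A} -> (u , v) ∈ concatMap twice Es -> (u , v) ∈ Es ⊎ (v , u) ∈ Es
 both-∈ (e ∷ Es) (here refl) = inl (here refl)
 both-∈ (e ∷ Es) (there (here refl)) = inr (here refl)
 both-∈ (e ∷ Es) (there (there p)) = Sum.map there there (both-∈ Es p)

 ∈-both : ∀ Es {u v : A} -> (u , v) ∈ Es ⊎ (v , u) ∈ Es -> (u , v) ∈ concatMap twice Es
 ∈-both (e ∷ Es) (inl (here refl)) = here refl
 ∈-both (e ∷ Es) (inr (here refl)) = there (here refl)
 ∈-both (e ∷ Es) (inl (there p)) = there (there (∈-both Es (inl p)))
 ∈-both (e ∷ Es) (inr (there p)) = there (there (∈-both Es (inr p)))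

 both-unique : ∀ Es -> AllPairs Diff Es -> (∀ {a b : A} -> (a , b) ∈ Es -> a ≢ b) -> Unique (concatMap twice Es)
 both-unique [] _ _ = []
 both-unique ((a , b) ∷ Es) (d ∷ u) nl =
  ((λ e -> nl (here refl) (cong fst e)) ∷ All.tabulate (λ { p refl -> fresh (both-∈ Es p) })) ∷
  All.tabulate (λ { p refl -> fresh (Sum.swap (both-∈ Es p)) }) ∷ both-unique Es u (λ m -> nl (there m))
  where
  fresh : (a , b) ∈ Es ⊎ (b , a) ∈ Es -> ⊥
  fresh (inl m) = All.lookup d m (inl (refl , refl))
  fresh (inr m) = All.lookup d m (inr (refl , refl))

 pairs : List A -> List (A × A)
 pairs [] = []
 pairs (a ∷ []) = []
 pairs (a ∷ b ∷ r) = (a , b) ∷ pairs (b ∷ r)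

 pairs-++ : ∀ l (a : A) r -> pairs (l ++ a ∷ r) ≡ pairs (l ++ [ a ]) ++ pairs (a ∷ r)
 pairs-++ [] a r = refl
 pairs-++ (x ∷ []) a r = refl
 pairs-++ (x ∷ y ∷ l) a r = cong ((x , y) ∷_) (pairs-++ (y ∷ l) a r)

 Unique-↭ : ∀ {xs ys : List A} -> xs ↭ ys -> Unique xs -> Unique ys
 Unique-↭ ↭.refl u = u
 Unique-↭ (↭.prep x p) (a ∷ u) = ↭P.All-resp-↭ p a ∷ Unique-↭ p u
 Unique-↭ (↭.swap x y p) ((d ∷ a) ∷ b ∷ u) = ((λ e -> d (sym e)) ∷ ↭P.All-resp-↭ p b) ∷ ↭P.All-resp-↭ p a ∷ Unique-↭ p u
 Unique-↭ (↭.trans p q) u = Unique-↭ q (Unique-↭ p u)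

 tdarts : A × A × A -> List (A × A)
 tdarts (a , b , c) = (a , b) ∷ (b , c) ∷ (c , a) ∷ []

 shift₂ : ∀ (x y : A × A) xs ys -> xs ++ x ∷ y ∷ ys ↭ x ∷ y ∷ xs ++ ys
 shift₂ x y xs ys = ↭P.shifts xs (x ∷ y ∷ [])

-- A pendant vertex puts both darts of its edge on the boundary. A covering step moves `a b` and
-- `b c` from the boundary to the new face, and adds `a c` to the boundary and `c a` to the face.
-- With distinct edges, every dart therefore lies on exactly one face.
darts-↭ : ∀ {n} {v₀ : Fin n} {u Ws Es Ts} -> Sh [ v₀ ] u Ws Es Ts -> pairs u ++ concatMap tdarts Ts ↭ concatMap twice Es
darts-↭ start = ↭-refl
darts-↭ (pend {Es = Es} {Ts} l p r v s) = begin
 pairs (l ++ p ∷ v ∷ p ∷ r) ++ F            ≡⟨ cong (_++ F) (pairs-++ l p (v ∷ p ∷ r)) ⟩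
 (X ++ (p , v) ∷ (v , p) ∷ pairs (p ∷ r)) ++ F ↭⟨ ↭P.++⁺ʳ F (shift₂ (p , v) (v , p) X (pairs (p ∷ r))) ⟩
 (p , v) ∷ (v , p) ∷ (X ++ pairs (p ∷ r)) ++ F ≡⟨ cong (λ z -> (p , v) ∷ (v , p) ∷ z ++ F) (sym (pairs-++ l p r)) ⟩
 (p , v) ∷ (v , p) ∷ pairs (l ++ p ∷ r) ++ F   ↭⟨ prep _ (prep _ (darts-↭ s)) ⟩
 (p , v) ∷ (v , p) ∷ concatMap twice Es ∎
 where
 open PermutationReasoning
 F = concatMap tdarts Ts
 X = pairs (l ++ [ p ])
darts-↭ (cov {Es = Es} {Ts} l a b c r s) = begin
 pairs (l ++ a ∷ c ∷ r) ++ (a , b) ∷ (b , c) ∷ (c , a) ∷ F ≡⟨ cong (_++ (a , b) ∷ (b , c) ∷ (c , a) ∷ F) (pairs-++ l a (c ∷ r)) ⟩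
 (X ++ (a , c) ∷ Y) ++ (a , b) ∷ (b , c) ∷ (c , a) ∷ F     ↭⟨ ↭P.++⁺ʳ _ (↭P.shift (a , c) X Y) ⟩
 (a , c) ∷ (X ++ Y) ++ (a , b) ∷ (b , c) ∷ (c , a) ∷ F     ↭⟨ prep _ (↭P.++⁺ˡ (X ++ Y) (shift₂' (a , b) (b , c) (c , a) F)) ⟩
 (a , c) ∷ (X ++ Y) ++ (c , a) ∷ (a , b) ∷ (b , c) ∷ F     ↭⟨ prep _ (↭P.shift (c , a) (X ++ Y) _) ⟩
 (a , c) ∷ (c , a) ∷ (X ++ Y) ++ (a , b) ∷ (b , c) ∷ F     ↭⟨ prep _ (prep _ (shift₂ (a , b) (b , c) (X ++ Y) F)) ⟩
 (a , c) ∷ (c , a) ∷ (a , b) ∷ (b , c) ∷ (X ++ Y) ++ F     ↭⟨ prep _ (prep _ (↭P.++⁺ʳ F (↭-sym (shift₂ (a , b) (b , c) X Y)))) ⟩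
 (a , c) ∷ (c , a) ∷ (X ++ (a , b) ∷ (b , c) ∷ Y) ++ F     ≡⟨ cong (λ z -> (a , c) ∷ (c , a) ∷ z ++ F) (sym (pairs-++ l a (b ∷ c ∷ r))) ⟩
 (a , c) ∷ (c , a) ∷ pairs (l ++ a ∷ b ∷ c ∷ r) ++ F       ↭⟨ prep _ (prep _ (darts-↭ s)) ⟩
 (a , c) ∷ (c , a) ∷ concatMap twice Es ∎
 where
 open PermutationReasoning
 F = concatMap tdarts Ts
 X = pairs (l ++ [ a ])
 Y = pairs (c ∷ r)
 shift₂' : ∀ x y z F -> x ∷ y ∷ z ∷ F ↭ z ∷ x ∷ y ∷ F
 shift₂' x y z F = ↭P.shift z (x ∷ y ∷ []) F

-- `Ws` omits the first vertex and `Ts` the outer face; these two account for the 2 in Euler's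
-- formula.
Sh-euler : ∀ {n} {v₀ : Fin n} {u Ws Es Ts} -> Sh [ v₀ ] u Ws Es Ts -> length Ws + length Ts ≡ length Es
Sh-euler start = refl
Sh-euler (pend l p r v s) = cong suc (Sh-euler s)
Sh-euler (cov {Ws} {Es} {Ts} l a b c r s) = trans (+-suc (length Ws) (length Ts)) (cong suc (Sh-euler s))

module _ {n : ℕ} where
 open Shell {n} using (Sh-⊂; Sh-linked; Adj-there)

 Adj±-∷ : ∀ {Es e} {a b : Fin n} -> Adj± Es a b -> Adj± (e ∷ Es) a b
 Adj±-∷ = Sum.map there there

 Sh-tri : ∀ {v₀ : Fin n} {u Ws Es Ts} -> Sh [ v₀ ] u Ws Es Ts -> ∀ {a b c} -> (a , b , c) ∈ Ts -> Adj± Es a b × Adj± Es b c × Adj± Es a c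
 Sh-tri (pend l p r v s) m = let a , b , c = Sh-tri s m in Adj±-∷ a , Adj±-∷ b , Adj±-∷ c
 Sh-tri (cov l a b c r s) (there m) = let a , b , c = Sh-tri s m in Adj±-∷ a , Adj±-∷ b , Adj±-∷ c
 Sh-tri (cov l a b c r s) (here refl) with Linked-drop l (Sh-linked (λ _ _ -> ⊥) [-] s)
 ... | inr e ∷ inr e' ∷ _ = Sum.map there there e , Sum.map there there e' , inl (here refl)

 Sh-connected : ∀ {v₀ : Fin n} {u Ws Es Ts} -> Sh [ v₀ ] u Ws Es Ts -> ∀ {v} -> v ∈ Ws ++ [ v₀ ] -> Star (Adj± Es) v₀ v
 Sh-connected start (here refl) = ε
 Sh-connected (pend {Es = Es} l p r v s) (here refl) = up (Sh-connected s (Sh-⊂ s (∈-mid l))) ◅◅ inl (here refl) ◅ ε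
  where
  up : ∀ {a b} -> Star (Adj± Es) a b -> Star (Adj± ((p , v) ∷ Es)) a b
  up ε = ε
  up (e ◅ q) = Sum.map there there e ◅ up q
 Sh-connected (pend {Es = Es} l p r v s) (there m) = up (Sh-connected s m)
  where
  up : ∀ {a b} -> Star (Adj± Es) a b -> Star (Adj± ((p , v) ∷ Es)) a b
  up ε = ε
  up (e ◅ q) = Sum.map there there e ◅ up q
 Sh-connected (cov {Es = Es} l a b c r s) m = up (Sh-connected s m)
  where
  up : ∀ {x y} -> Star (Adj± Es) x y -> Star (Adj± ((a , c) ∷ Es)) x y
  up ε = ε
  up (e ◅ q) = Sum.map there there e ◅ up q

 Adj±? : ∀ (Es : List (Fin n × Fin n)) u v -> Dec (Adj± Es u v)
 Adj±? Es u v = mem (u , v) ⊎? mem (v , u)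
  where
  mem : ∀ e -> Dec (e ∈ Es)
  mem e = Any.any? (≡-dec _≟_ _≟_ e) Es

 b2n : Bool -> ℕ
 b2n b = if b then 1 else 0

 sum-+ : ∀ {A : Set} (f g : A -> ℕ) xs -> sum (map (λ x -> f x + g x) xs) ≡ sum (map f xs) + sum (map g xs)
 sum-+ f g [] = refl
 sum-+ f g (x ∷ xs) = trans (cong (f x + g x +_) (sum-+ f g xs)) (interchange (f x) (g x) (sum (map f xs)) (sum (map g xs)))

 sum-cong : ∀ {A : Set} {f g : A -> ℕ} -> (∀ x -> f x ≡ g x) -> ∀ xs -> sum (map f xs) ≡ sum (map g xs)
 sum-cong h [] = refl
 sum-cong h (x ∷ xs) = cong₂ _+_ (h x) (sum-cong h xs)

 sum-0 : ∀ {A : Set} {f : A -> ℕ} xs -> (∀ {x} -> x ∈ xs -> f x ≡ 0) -> sum (map f xs) ≡ 0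
 sum-0 [] h = refl
 sum-0 (x ∷ xs) h = cong₂ _+_ (h (here refl)) (sum-0 xs (λ m -> h (there m)))

 sum-single : ∀ {A : Set} {f : A -> ℕ} {a} xs -> Unique xs -> a ∈ xs -> (∀ x -> x ≢ a -> f x ≡ 0) -> sum (map f xs) ≡ f a
 sum-single {f = f} (x ∷ xs) u (here refl) h = trans (cong (f x +_) (sum-0 xs λ {y} m -> h y λ { refl -> Unique-∉ u m })) (+-identityʳ _)
 sum-single {f = f} (x ∷ xs) u@(_ ∷ u') (there m) h = trans (cong (_+ sum (map f xs)) (h x λ { refl -> Unique-∉ u m })) (sum-single xs u' m h)

 Σ² : (Fin n -> Fin n -> Bool) -> ℕ
 Σ² f = sum (map (λ i -> sum (map (λ j -> b2n (f i j)) (allFin n))) (allFin n))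

 Σ²-+ : ∀ {f g h} -> (∀ i j -> b2n (f i j) ≡ b2n (g i j) + b2n (h i j)) -> Σ² f ≡ Σ² g + Σ² h
 Σ²-+ {f} {g} {h} eq = trans (sum-cong (λ i -> trans (sum-cong (eq i) (allFin n)) (sum-+ _ _ (allFin n))) (allFin n)) (sum-+ _ _ (allFin n))

 Σ²-single : ∀ {f : Fin n -> Fin n -> Bool} {a b} -> f a b ≡ true -> (∀ i j -> f i j ≡ true -> i ≡ a × j ≡ b) -> Σ² f ≡ 1
 Σ²-single {f} {a} {b} t only = trans (sum-single (allFin n) (allFin⁺ n) (∈-allFin a) λ i ne -> sum-0 (allFin n) λ {j} _ -> zer i j λ (e , _) -> ne e)
  (trans (sum-single (allFin n) (allFin⁺ n) (∈-allFin b) λ j ne -> zer a j λ (_ , e) -> ne e) (cong b2n t))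
  where
  zer : ∀ i j -> ¬ (i ≡ a × j ≡ b) -> b2n (f i j) ≡ 0
  zer i j ne with f i j in eq
  ... | true = absurd (ne (only i j eq))
  ... | false = refl

 lt : Fin n -> Fin n -> Bool
 lt i j = toℕ i <ᵇ toℕ j

 lt⁺ : ∀ {i j} -> toℕ i < toℕ j -> lt i j ≡ true
 lt⁺ p = Equivalence.to Bool.T-≡ (<⇒<ᵇ p)
 lt⁻ : ∀ {i j} -> lt i j ≡ true -> toℕ i < toℕ j
 lt⁻ {i} p = <ᵇ⇒< (toℕ i) _ (Equivalence.from Bool.T-≡ p)

 count-edges : ∀ (Es : List (Fin n × Fin n)) -> AllPairs Diff Es -> (∀ {a b} -> (a , b) ∈ Es -> a ≢ b) ->
        Σ² (λ i j -> ⌊ Adj±? Es i j ⌋ ∧ lt i j) ≡ length Es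
 count-edges [] _ _ = sum-0 (allFin n) λ _ -> sum-0 (allFin n) λ _ -> refl
 count-edges ((a , b) ∷ Es) (d ∷ u) nl = trans (Σ²-+ {g = λ i j -> ⌊ Adj±? [ (a , b) ] i j ⌋ ∧ lt i j} split)
   (cong₂ _+_ one (count-edges Es u (λ m -> nl (there m))))
  where
  new : ∀ i j -> Adj± [ (a , b) ] i j -> Adj± Es i j -> ⊥
  new i j (inl (here refl)) (inl m) = All.lookup d m (inl (refl , refl))
  new i j (inl (here refl)) (inr m) = All.lookup d m (inr (refl , refl))
  new i j (inr (here refl)) (inl m) = All.lookup d m (inr (refl , refl))
  new i j (inr (here refl)) (inr m) = All.lookup d m (inl (refl , refl))
  split : ∀ i j -> b2n (⌊ Adj±? ((a , b) ∷ Es) i j ⌋ ∧ lt i j) ≡ b2n (⌊ Adj±? [ (a , b) ] i j ⌋ ∧ lt i j) + b2n (⌊ Adj±? Es i j ⌋ ∧ lt i j)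
  split i j = go (Adj±? ((a , b) ∷ Es) i j) (Adj±? [ (a , b) ] i j) (Adj±? Es i j) (lt i j)
   where
   go : ∀ (x : Dec (Adj± ((a , b) ∷ Es) i j)) (y : Dec (Adj± [ (a , b) ] i j)) (z : Dec (Adj± Es i j)) w ->
      b2n (⌊ x ⌋ ∧ w) ≡ b2n (⌊ y ⌋ ∧ w) + b2n (⌊ z ⌋ ∧ w)
   go _ (yes p) (yes q) w = absurd (new i j p q)
   go (yes _) (yes p) (no _) w = sym (+-identityʳ _)
   go (yes _) (no _) (yes _) w = refl
   go (yes (inl (here e))) (no ¬p) (no ¬q) w = absurd (¬p (inl (here e)))
   go (yes (inl (there m))) (no ¬p) (no ¬q) w = absurd (¬q (inl m))
   go (yes (inr (here e))) (no ¬p) (no ¬q) w = absurd (¬p (inr (here e)))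
   go (yes (inr (there m))) (no ¬p) (no ¬q) w = absurd (¬q (inr m))
   go (no ¬p) (yes (inl (here e))) _ w = absurd (¬p (inl (here e)))
   go (no ¬p) (yes (inr (here e))) _ w = absurd (¬p (inr (here e)))
   go (no ¬p) (no _) (yes q) w = absurd (¬p (Sum.map there there q))
   go (no ¬p) (no _) (no _) w = refl
  ∧-both : ∀ {x y} -> x ∧ y ≡ true -> x ≡ true × y ≡ true
  ∧-both {true} {true} _ = refl , refl
  one : Σ² (λ i j -> ⌊ Adj±? [ (a , b) ] i j ⌋ ∧ lt i j) ≡ 1
  one with <-cmp (toℕ a) (toℕ b)
  ... | tri≈ _ e _ = absurd (nl (here refl) (toℕ-injective e))
  ... | tri< p _ ¬q = Σ²-single {a = a} {b} (cong₂ _∧_ (⌊⌋⁺ (Adj±? [ (a , b) ] a b) (inl (here refl))) (lt⁺ {a} {b} p)) λ i j e ->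
     let x , y = ∧-both e in only i j (⌊⌋⁻ (Adj±? [ (a , b) ] i j) x) (lt⁻ {i} {j} y)
   where
   only : ∀ i j -> Adj± [ (a , b) ] i j -> toℕ i < toℕ j -> i ≡ a × j ≡ b
   only i j (inl (here refl)) _ = refl , refl
   only i j (inr (here refl)) q = absurd (¬q q)
  ... | tri> ¬p _ q = Σ²-single {a = b} {a} (cong₂ _∧_ (⌊⌋⁺ (Adj±? [ (a , b) ] b a) (inr (here refl))) (lt⁺ {b} {a} q)) λ i j e ->
     let x , y = ∧-both e in only i j (⌊⌋⁻ (Adj±? [ (a , b) ] i j) x) (lt⁻ {i} {j} y)
   where
   only : ∀ i j -> Adj± [ (a , b) ] i j -> toℕ i < toℕ j -> i ≡ b × j ≡ a
   only i j (inr (here refl)) _ = refl , refl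
   only i j (inl (here refl)) p = absurd (¬p p)

 data Trip : List (Fin n) -> Fin n -> Fin n -> Fin n -> Set where
  here  : ∀ {a v b r} -> Trip (a ∷ v ∷ b ∷ r) a v b
  there : ∀ {x xs a v b} -> Trip xs a v b -> Trip (x ∷ xs) a v b

 TCorner : Fin n × Fin n × Fin n -> Fin n -> Fin n -> Fin n -> Set
 TCorner (p , q , r) a v b = (a ≡ p × v ≡ q × b ≡ r) ⊎ (a ≡ q × v ≡ r × b ≡ p) ⊎ (a ≡ r × v ≡ p × b ≡ q)

 Corner : List (Fin n) -> List (Fin n × Fin n × Fin n) -> Fin n -> Fin n -> Fin n -> Set
 Corner L Ts v a b = Trip L a v b ⊎ Any (λ t -> TCorner t a v b) Ts

 Rot : List (Fin n) -> List (Fin n × Fin n) -> List (Fin n × Fin n × Fin n) -> Set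
 Rot L Es Ts = ∀ v {a b} -> Adj± Es v a -> Adj± Es v b -> Star (Corner L Ts v) a b

 Star-bind : ∀ {R R' : Fin n -> Fin n -> Set} -> (∀ {a b} -> R a b -> Star R' a b) -> ∀ {a b} -> Star R a b -> Star R' a b
 Star-bind f ε = ε
 Star-bind f (r ◅ p) = f r ◅◅ Star-bind f p

 Trip-pend : ∀ l {w p v y r a z b} -> Trip (l ++ w ∷ p ∷ y ∷ r) a z b -> Trip (l ++ w ∷ p ∷ v ∷ p ∷ y ∷ r) a z b ⊎ (a ≡ w × z ≡ p × b ≡ y)
 Trip-pend [] here = inr (refl , refl , refl)
 Trip-pend [] (there t) = inl (there (there (there t)))
 Trip-pend (x ∷ []) here = inl here
 Trip-pend (x ∷ y ∷ []) here = inl here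
 Trip-pend (x ∷ y ∷ z ∷ l) here = inl here
 Trip-pend (x ∷ l) (there t) = Sum.map₁ there (Trip-pend l t)

 Trip-cov : ∀ l {w a b c y r d z e} -> Trip (l ++ w ∷ a ∷ b ∷ c ∷ y ∷ r) d z e ->
       Trip (l ++ w ∷ a ∷ c ∷ y ∷ r) d z e ⊎ (d ≡ w × z ≡ a × e ≡ b) ⊎ (d ≡ a × z ≡ b × e ≡ c) ⊎ (d ≡ b × z ≡ c × e ≡ y)
 Trip-cov [] here = inr (inl (refl , refl , refl))
 Trip-cov [] (there here) = inr (inr (inl (refl , refl , refl)))
 Trip-cov [] (there (there here)) = inr (inr (inr (refl , refl , refl)))
 Trip-cov [] (there (there (there t))) = inl (there (there t))
 Trip-cov (x ∷ []) here = inl here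
 Trip-cov (x ∷ y ∷ []) here = inl here
 Trip-cov (x ∷ y ∷ z ∷ l) here = inl here
 Trip-cov (x ∷ l) (there t) = Sum.map₁ there (Trip-cov l t)

 Trip-++ : ∀ l {xs a v b} -> Trip xs a v b -> Trip (l ++ xs) a v b
 Trip-++ [] t = t
 Trip-++ (x ∷ l) t = there (Trip-++ l t)

 -- The corner `w p y` is opened to receive `v`, and every other corner persists, so a chain of
 -- corners around a vertex survives with `v` inserted. A covering step inserts its new edge at `a`
 -- and at `c` in the same manner.
 rot-pend : ∀ l w p v y r {Es Ts} -> v ≢ p -> (∀ {z} -> Adj± Es v z -> ⊥) -> Adj± Es p w -> Adj± Es p y ->
       Rot (l ++ w ∷ p ∷ y ∷ r) Es Ts -> Rot (l ++ w ∷ p ∷ v ∷ p ∷ y ∷ r) ((p , v) ∷ Es) Ts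
 rot-pend l w p v y r {Es} {Ts} v≢p fresh pw py R z ea eb = go (old ea) (old eb)
  where
  old : ∀ {z a} -> Adj± ((p , v) ∷ Es) z a -> Adj± Es z a ⊎ (z ≡ p × a ≡ v) ⊎ (z ≡ v × a ≡ p)
  old (inl (here refl)) = inr (inl (refl , refl))
  old (inl (there m)) = inl (inl m)
  old (inr (here refl)) = inr (inr (refl , refl))
  old (inr (there m)) = inl (inr m)
  L' = l ++ w ∷ p ∷ v ∷ p ∷ y ∷ r
  wv : Corner L' Ts p w v
  wv = inl (Trip-++ l here)
  vy : Corner L' Ts p v y
  vy = inl (Trip-++ l (there (there here)))
  lift : ∀ {z a b} -> Corner (l ++ w ∷ p ∷ y ∷ r) Ts z a b -> Star (Corner L' Ts z) a b
  lift (inr t) = inr t ◅ ε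
  lift (inl t) with Trip-pend l t
  ... | inl t' = inl t' ◅ ε
  ... | inr (refl , refl , refl) = wv ◅ vy ◅ ε
  go : ∀ {z a b} -> Adj± Es z a ⊎ (z ≡ p × a ≡ v) ⊎ (z ≡ v × a ≡ p) -> Adj± Es z b ⊎ (z ≡ p × b ≡ v) ⊎ (z ≡ v × b ≡ p) -> Star (Corner L' Ts z) a b
  go (inl e) (inl e') = Star-bind lift (R _ e e')
  go (inl e) (inr (inl (refl , refl))) = Star-bind lift (R _ e pw) ◅◅ wv ◅ ε
  go (inl e) (inr (inr (refl , refl))) = absurd (fresh e)
  go (inr (inl (refl , refl))) (inl e) = vy ◅ Star-bind lift (R _ py e)
  go (inr (inr (refl , refl))) (inl e) = absurd (fresh e)
  go (inr (inl (refl , refl))) (inr (inl (_ , refl))) = ε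
  go (inr (inl (refl , _))) (inr (inr (e , _))) = absurd (v≢p (sym e))
  go (inr (inr (refl , _))) (inr (inl (e , _))) = absurd (v≢p e)
  go (inr (inr (refl , refl))) (inr (inr (_ , refl))) = ε

 rot-cov : ∀ l w a b c y r {Es Ts} -> a ≢ c -> Adj± Es a w -> Adj± Es a b -> Adj± Es c b -> Adj± Es c y ->
      Rot (l ++ w ∷ a ∷ b ∷ c ∷ y ∷ r) Es Ts -> Rot (l ++ w ∷ a ∷ c ∷ y ∷ r) ((a , c) ∷ Es) ((a , b , c) ∷ Ts)
 rot-cov l w a b c y r {Es} {Ts} a≢c aw ab cb cy R z ea eb = go (old ea) (old eb)
  where
  old : ∀ {z d} -> Adj± ((a , c) ∷ Es) z d -> Adj± Es z d ⊎ (z ≡ a × d ≡ c) ⊎ (z ≡ c × d ≡ a)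
  old (inl (here refl)) = inr (inl (refl , refl))
  old (inl (there m)) = inl (inl m)
  old (inr (here refl)) = inr (inr (refl , refl))
  old (inr (there m)) = inl (inr m)
  L' = l ++ w ∷ a ∷ c ∷ y ∷ r
  Ts' = (a , b , c) ∷ Ts
  wc : Corner L' Ts' a w c
  wc = inl (Trip-++ l here)
  cb' : Corner L' Ts' a c b
  cb' = inr (here (inr (inr (refl , refl , refl))))
  ba : Corner L' Ts' c b a
  ba = inr (here (inr (inl (refl , refl , refl))))
  ay : Corner L' Ts' c a y
  ay = inl (Trip-++ l (there here))
  lift : ∀ {z d e} -> Corner (l ++ w ∷ a ∷ b ∷ c ∷ y ∷ r) Ts z d e -> Star (Corner L' Ts' z) d e
  lift (inr t) = inr (there t) ◅ ε
  lift (inl t) with Trip-cov l t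
  ... | inl t' = inl t' ◅ ε
  ... | inr (inl (refl , refl , refl)) = wc ◅ cb' ◅ ε
  ... | inr (inr (inl (refl , refl , refl))) = inr (here (inl (refl , refl , refl))) ◅ ε
  ... | inr (inr (inr (refl , refl , refl))) = ba ◅ ay ◅ ε
  go : ∀ {z d e} -> Adj± Es z d ⊎ (z ≡ a × d ≡ c) ⊎ (z ≡ c × d ≡ a) -> Adj± Es z e ⊎ (z ≡ a × e ≡ c) ⊎ (z ≡ c × e ≡ a) -> Star (Corner L' Ts' z) d e
  go (inl e) (inl e') = Star-bind lift (R _ e e')
  go (inl e) (inr (inl (refl , refl))) = Star-bind lift (R _ e aw) ◅◅ wc ◅ ε
  go (inl e) (inr (inr (refl , refl))) = Star-bind lift (R _ e cb) ◅◅ ba ◅ ε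
  go (inr (inl (refl , refl))) (inl e) = cb' ◅ Star-bind lift (R _ ab e)
  go (inr (inr (refl , refl))) (inl e) = ay ◅ Star-bind lift (R _ cy e)
  go (inr (inl (refl , refl))) (inr (inl (_ , refl))) = ε
  go (inr (inl (refl , _))) (inr (inr (e , _))) = absurd (a≢c e)
  go (inr (inr (refl , _))) (inr (inl (e , _))) = absurd (a≢c (sym e))
  go (inr (inr (refl , refl))) (inr (inr (_ , refl))) = ε

 graph : (Es : List (Fin n × Fin n)) -> (∀ {a b} -> (a , b) ∈ Es -> a ≢ b) -> Graph n
 graph Es nl = record
  { adj = λ i j -> ⌊ Adj±? Es i j ⌋
  ; sym = λ x y -> flip (Adj±? Es x y) (Adj±? Es y x)
  ; irrefl = λ x -> ⌊⌋-false (Adj±? Es x x) λ { (inl m) -> nl m refl ; (inr m) -> nl m refl } }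
  where
  flip : ∀ {x y} (d : Dec (Adj± Es x y)) (e : Dec (Adj± Es y x)) -> ⌊ d ⌋ ≡ ⌊ e ⌋
  flip (yes p) e = sym (⌊⌋⁺ e (Sum.swap p))
  flip (no ¬p) e = sym (⌊⌋-false e λ p -> ¬p (Sum.swap p))

 quad : ∀ {c h x t : Fin n} {Ws Es Ts} -> Sh [ c ] (c ∷ h ∷ x ∷ t ∷ c ∷ []) Ws Es Ts -> (nl : ∀ {a b} -> (a , b) ∈ Es -> a ≢ b) ->
     AllPairs Diff Es -> n ≡ suc (length Ws) -> (∀ v -> v ∈ Ws ++ [ c ]) -> Rot (c ∷ h ∷ x ∷ t ∷ c ∷ h ∷ []) Es Ts -> c ≢ x -> h ≢ t ->
     (∀ {u v w} -> Adj± Es u v -> Adj± Es v w -> Adj± Es u w -> ∃ λ t -> t ∈ Ts × Shell.Same u v w t) ->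
     PlaneQuad (graph Es nl) c h x t
 quad {c} {h} {x} {t} {Ws} {Es} {Ts} sh nl du n≡ all rot c≢x h≢t tf = record
  { k = length Ts ; tri = lookup Ts
  ; pq = adj⁺ (fst bd) ; qr = adj⁺ (fst (snd bd)) ; rs = adj⁺ (fst (snd (snd bd))) ; sp = adj⁺ (snd (snd (snd bd)))
  ; p≢r = c≢x ; q≢s = h≢t
  ; triOK = λ i -> let a , b , d = Sh-tri sh (∈-lookup {xs = Ts} i) in adj⁺ a , adj⁺ b , adj⁺ d
  ; dartFace = λ u v e -> df (∈⁻ (pairs (c ∷ h ∷ x ∷ t ∷ c ∷ [])) (↭P.∈-resp-↭ (↭-sym (darts-↭ sh)) (∈-both Es (adj⁻ e))))
  ; dartUniq = dq
  ; rotation = λ v u u' e e' -> Star-map (rot v (adj⁻ e) (adj⁻ e'))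
  ; connected = λ u v -> rev (conn (all u)) ◅◅ conn (all v)
  ; euler = trans (cong (_+ suc (length Ts)) n≡) (cong suc (trans (+-suc (length Ws) (length Ts)) (cong suc (trans (Sh-euler sh) (sym (count-edges Es du nl))))))
  ; trianglesAreFaces = λ { (u , v , w) (a , b , d) -> tr (tf (adj⁻ a) (adj⁻ b) (adj⁻ d)) } }
  where
  adj⁺ : ∀ {u v} -> Adj± Es u v -> ⌊ Adj±? Es u v ⌋ ≡ true
  adj⁺ {u} {v} = ⌊⌋⁺ (Adj±? Es u v)
  adj⁻ : ∀ {u v} -> ⌊ Adj±? Es u v ⌋ ≡ true -> Adj± Es u v
  adj⁻ {u} {v} = ⌊⌋⁻ (Adj±? Es u v)
  bd : Adj± Es c h × Adj± Es h x × Adj± Es x t × Adj± Es t c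
  bd with Sh-linked (λ _ _ -> ⊥) [-] sh
  ... | inr a ∷ inr b ∷ inr d ∷ inr e ∷ _ = a , b , d , e
  fs = faces c h x t (lookup Ts)
  df : ∀ {u v} -> (u , v) ∈ pairs (c ∷ h ∷ x ∷ t ∷ c ∷ []) ⊎ (u , v) ∈ concatMap tdarts Ts -> ∃ λ i -> (u , v) ∈ cpairs (fs i)
  df (inl p) = zero , p
  df (inr p) = let i , q = ∈-concat-index tdarts Ts p in suc i , q
  uq : Unique (pairs (c ∷ h ∷ x ∷ t ∷ c ∷ []) ++ concatMap tdarts Ts)
  uq = Unique-↭ (↭-sym (darts-↭ sh)) (both-unique Es du nl)
  dq : ∀ u v i j -> (u , v) ∈ cpairs (fs i) -> (u , v) ∈ cpairs (fs j) -> i ≡ j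
  dq u v zero zero p q = refl
  dq u v zero (suc j) p q = absurd (uniq-dis (pairs (c ∷ h ∷ x ∷ t ∷ c ∷ [])) uq p (∈-concat-lookup tdarts Ts j q))
  dq u v (suc i) zero p q = absurd (uniq-dis (pairs (c ∷ h ∷ x ∷ t ∷ c ∷ [])) uq q (∈-concat-lookup tdarts Ts i p))
  dq u v (suc i) (suc j) p q = cong suc (concat-unique tdarts Ts (Unique-drop (pairs (c ∷ h ∷ x ∷ t ∷ c ∷ [])) uq) i j p q)
  turn : ∀ {v a b} -> Corner (c ∷ h ∷ x ∷ t ∷ c ∷ h ∷ []) Ts v a b -> Turn fs v a b
  turn (inl here) = zero , here refl , there (here refl)
  turn (inl (there here)) = zero , there (here refl) , there (there (here refl))
  turn (inl (there (there here))) = zero , there (there (here refl)) , there (there (there (here refl)))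
  turn (inl (there (there (there here)))) = zero , there (there (there (here refl))) , here refl
  turn (inl (there (there (there (there (there (there ())))))))
  turn (inr p) = let i , q = ix p in suc i , q
   where
   ix : ∀ {Ts v a b} -> Any (λ t -> TCorner t v a b) Ts -> ∃ λ i -> (v , a) ∈ cpairs (triList (lookup Ts i)) × (a , b) ∈ cpairs (triList (lookup Ts i))
   ix (here (inl (refl , refl , refl))) = zero , here refl , there (here refl)
   ix (here (inr (inl (refl , refl , refl)))) = zero , there (here refl) , there (there (here refl))
   ix (here (inr (inr (refl , refl , refl)))) = zero , there (there (here refl)) , here refl
   ix (there p) = let i , q = ix p in suc i , q
  Star-map : ∀ {v a b} -> Star (Corner (c ∷ h ∷ x ∷ t ∷ c ∷ h ∷ []) Ts v) a b -> Star (Turn fs v) a b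
  Star-map ε = ε
  Star-map (r ◅ p) = turn r ◅ Star-map p
  conn : ∀ {v} -> v ∈ Ws ++ [ c ] -> Star (λ u w -> ⌊ Adj±? Es u w ⌋ ≡ true) c v
  conn m = Star-bind (λ e -> adj⁺ e ◅ ε) (Sh-connected sh m)
  rev : ∀ {u v} -> Star (λ u w -> ⌊ Adj±? Es u w ⌋ ≡ true) u v -> Star (λ u w -> ⌊ Adj±? Es u w ⌋ ≡ true) v u
  rev ε = ε
  rev (e ◅ p) = rev p ◅◅ adj⁺ (Sum.swap (adj⁻ e)) ◅ ε
  tr : ∀ {u v w} -> (∃ λ t -> t ∈ Ts × Shell.Same u v w t) -> ∃ λ i -> ∀ h -> (h ∈₃ (u , v , w)) ⇔ (h ∈₃ lookup Ts i)
  tr (t , m , f , g) = ix m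
   where
   ix : ∀ {Ts} -> t ∈ Ts -> ∃ λ i -> ∀ h -> (h ∈₃ _) ⇔ (h ∈₃ lookup Ts i)
   ix (here refl) = zero , λ h -> mk⇔ g f
   ix (there m) = let i , q = ix m in suc i , q

 Linked-mid : ∀ {R : Fin n -> Fin n -> Set} l {a b r} -> Linked R (l ++ a ∷ b ∷ r) -> R a b
 Linked-mid l k with Linked-drop l k
 ... | r ∷ _ = r

 lastOf : ∀ (c : Fin n) l -> ∃₂ λ l' w -> c ∷ l ≡ l' ++ [ w ]
 lastOf c [] = [] , c , refl
 lastOf c (x ∷ l) = let l' , w , e = lastOf x l in c ∷ l' , w , cong (c ∷_) e

 headOf : ∀ (r : List (Fin n)) d s -> ∃₂ λ y r' -> r ++ d ∷ s ≡ y ∷ r'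
 headOf [] d s = d , s , refl
 headOf (x ∷ r) d s = x , r ++ d ∷ s , refl

 module Rotation {c h : Fin n} {u₁ W₀ E₀ T₀} (B : Sh [ c ] (c ∷ u₁ ++ [ c ]) W₀ E₀ T₀) (ch : Adj± E₀ c h) where
  -- The closed boundary walk continued by one more vertex, so that its corner at `c` is a
  -- consecutive triple too.
  around : List (Fin n) -> List (Fin n)
  around u = c ∷ u ++ c ∷ h ∷ []

  focus : ∀ l r -> ∃₂ λ l' w -> ∃₂ λ y r' -> ∀ ys -> around (l ++ ys ++ r) ≡ l' ++ w ∷ ys ++ y ∷ r'
  focus l r with lastOf c l | headOf r c (h ∷ [])
  ... | l' , w , e | y , r' , e' = l' , w , y , r' , λ ys -> trans (cong (c ∷_) (trans (++-assoc l (ys ++ r) _) (cong (l ++_) (trans (++-assoc ys r _) (cong (ys ++_) e')))))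
    (trans (cong (_++ ys ++ y ∷ r') e) (++-assoc l' [ w ] (ys ++ y ∷ r')))

  whole : ∀ {u Ws Es Ts} -> Sh u₁ u Ws Es Ts -> Sh [ c ] (c ∷ u ++ [ c ]) (Ws ++ W₀) (Es ++ E₀) (Ts ++ T₀)
  whole s = B ⨾ ctx [ c ] [ c ] s

  linked : ∀ {u Ws Es Ts} -> Sh u₁ u Ws Es Ts -> Linked (Adj± (Es ++ E₀)) (around u)
  linked {u} {Es = Es} s = lk (c ∷ u) (Linked-map (λ { (inr e) -> e }) (Sh-linked (λ _ _ -> ⊥) [-] (whole s)))
   where
   up : Adj± (Es ++ E₀) c h
   up = Sum.map (∈ʳ Es) (∈ʳ Es) ch
   lk : ∀ l -> Linked (Adj± (Es ++ E₀)) (l ++ [ c ]) -> Linked (Adj± (Es ++ E₀)) (l ++ c ∷ h ∷ [])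
   lk [] _ = up ∷ [-]
   lk (a ∷ []) (e ∷ k) = e ∷ lk [] k
   lk (a ∷ b ∷ l) (e ∷ k) = e ∷ lk (b ∷ l) k

  rot : ∀ {u Ws Es Ts} -> Sh u₁ u Ws Es Ts -> Unique (Ws ++ W₀ ++ [ c ]) -> (∀ {a b} -> (a , b) ∈ Es -> a ≢ b) ->
     Rot (around u₁) E₀ T₀ -> Rot (around u) (Es ++ E₀) (Ts ++ T₀)
  rot start un nl R = R
  rot (pend {Ws} {Es} {Ts} l p r v s) un@(_ ∷ un') nl R with focus l r
  ... | l' , w , y , r' , eq = subst (λ z -> Rot z ((p , v) ∷ Es ++ E₀) (Ts ++ T₀)) (sym (eq (p ∷ v ∷ p ∷ [])))
    (rot-pend l' w p v y r' (λ e -> nl (here refl) (sym e)) fresh (Sum.swap (Linked-mid l' lk)) (Linked-mid (l' ++ [ w ]) (subst (Linked _) (sym (++-assoc l' [ w ] _)) lk))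
     (subst (λ z -> Rot z (Es ++ E₀) (Ts ++ T₀)) (eq [ p ]) (rot s un' (λ m -> nl (there m)) R)))
   where
   lk = subst (Linked (Adj± (Es ++ E₀))) (eq [ p ]) (linked s)
   v∉ : v ∉ (Ws ++ W₀) ++ [ c ]
   v∉ m = Unique-∉ un (subst (v ∈_) (++-assoc Ws W₀ [ c ]) m)
   fresh : ∀ {z} -> Adj± (Es ++ E₀) v z -> ⊥
   fresh (inl m) = v∉ (fst (Shell.Sh-ends (whole s) m))
   fresh (inr m) = v∉ (snd (Shell.Sh-ends (whole s) m))
  rot (cov {Ws} {Es} {Ts} l a b d r s) un nl R with focus l r
  ... | l' , w , y , r' , eq = subst (λ z -> Rot z ((a , d) ∷ Es ++ E₀) ((a , b , d) ∷ Ts ++ T₀)) (sym (eq (a ∷ d ∷ [])))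
    (rot-cov l' w a b d y r' (nl (here refl)) (Sum.swap (Linked-mid l' lk)) (at [ w ] refl) (Sum.swap (at (w ∷ a ∷ []) refl)) (at (w ∷ a ∷ b ∷ []) refl)
     (subst (λ z -> Rot z (Es ++ E₀) (Ts ++ T₀)) (eq (a ∷ b ∷ d ∷ [])) (rot s un (λ m -> nl (there m)) R)))
   where
   lk = subst (Linked (Adj± (Es ++ E₀))) (eq (a ∷ b ∷ d ∷ [])) (linked s)
   at : ∀ ys {i j zs} -> w ∷ a ∷ b ∷ d ∷ y ∷ r' ≡ ys ++ i ∷ j ∷ zs -> Adj± (Es ++ E₀) i j
   at ys e = Linked-mid (l' ++ ys) (subst (Linked _) (trans (cong (l' ++_) e) (sym (++-assoc l' ys _))) lk)

module _ {n m : ℕ} (f : Fin n -> Fin m) where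
 on₂ : Fin n × Fin n -> Fin m × Fin m
 on₂ (a , b) = f a , f b
 on₃ : Fin n × Fin n × Fin n -> Fin m × Fin m × Fin m
 on₃ (a , b , c) = f a , f b , f c

 Sh-map : ∀ {u₀ u Ws Es Ts} -> Sh u₀ u Ws Es Ts -> Sh (map f u₀) (map f u) (map f Ws) (map on₂ Es) (map on₃ Ts)
 Sh-map start = start
 Sh-map {u₀} (pend l p r v s) = subst (λ z -> Sh (map f u₀) z _ _ _) (sym (map-++ f l (p ∷ v ∷ p ∷ r)))
  (pend (map f l) (f p) (map f r) (f v) (subst (λ z -> Sh (map f u₀) z _ _ _) (map-++ f l (p ∷ r)) (Sh-map s)))
 Sh-map {u₀} (cov l a b c r s) = subst (λ z -> Sh (map f u₀) z _ _ _) (sym (map-++ f l (a ∷ c ∷ r)))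
  (cov (map f l) (f a) (f b) (f c) (map f r) (subst (λ z -> Sh (map f u₀) z _ _ _) (map-++ f l (a ∷ b ∷ c ∷ r)) (Sh-map s)))

module Index {n : ℕ} where
 pos : ∀ (c : Fin n) l -> Fin n -> Fin (suc (length l))
 pos c [] v = zero
 pos c (w ∷ l) v with v ≟ c
 ... | yes _ = zero
 ... | no _ = suc (pos w l v)

 lookup-pos : ∀ c l {v} -> v ∈ c ∷ l -> lookup (c ∷ l) (pos c l v) ≡ v
 lookup-pos c [] (here refl) = refl
 lookup-pos c (w ∷ l) {v} p with v ≟ c
 ... | yes e = sym e
 lookup-pos c (w ∷ l) (here e) | no ne = absurd (ne e)
 lookup-pos c (w ∷ l) (there p) | no ne = lookup-pos w l p

 pos-lookup : ∀ c l -> Unique (c ∷ l) -> ∀ i -> pos c l (lookup (c ∷ l) i) ≡ i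
 pos-lookup c [] u zero = refl
 pos-lookup c (w ∷ l) u zero with c ≟ c
 ... | yes _ = refl
 ... | no ne = absurd (ne refl)
 pos-lookup c (w ∷ l) u (suc i) with lookup (w ∷ l) i ≟ c
 ... | yes e = absurd (Unique-∉ u (subst (_∈ w ∷ l) e (∈-lookup {xs = w ∷ l} i)))
 pos-lookup c (w ∷ l) (_ ∷ u) (suc i) | no _ = cong suc (pos-lookup w l u i)

-- From a society with four boundary vertices to a plane quadrangle

module _ {n : ℕ} where
 open Society {n}
 open Shell {n} using (Same; Hidden; Sh-⊂; Sh-ends; triangles)

 record Disk (E : V -> V -> Set) (U : V -> Set) (p q r s : V) : Set where
  field
   m     : ℕ
   P     : Graph m
   f     : V -> Fin m
   g     : Fin m -> V
   plane : PlaneQuad P (f p) (f q) (f r) (f s)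
   gf    : ∀ {v} -> U v -> g (f v) ≡ v
   fg    : ∀ i -> f (g i) ≡ i
   g∈U   : ∀ i -> U (g i)
   edges : ∀ {u v} -> U u -> U v -> E u v -> f u ∼[ adj P ] f v

 -- The strip is built on the path `h c t` and closed by a fan from `x`. All four sides of the
 -- quadrangle get drawn this way, whether or not they are edges of `E`.
 out-disk : ∀ {E U c h x t} -> Soc E U x h [ c ] t -> Out E U x h [ c ] t -> Disk E U c h x t
 out-disk {E} {U} {c} {h} {x} {t} S O = record
  { m = suc (length Ws) ; P = graph Es' nl' ; f = f ; g = g
  ; plane = quad sh' nl' du' (cong suc (sym (length-map f Ws))) all'
    rot' (λ e -> c≢x (finj c∈U (Soc.x∈U S) e)) (λ e -> h≢t (finj (xs∈ (here refl)) (xs∈ (there (there (here refl)))) e)) tri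
  ; gf = λ u -> lookup-pos c Ws (mem u) ; fg = pos-lookup c Ws unc
  ; g∈U = g∈U ; edges = λ uu uv e -> ⌊⌋⁺ (Adj±? Es' _ _) (Adj-map (E⇒ uu uv e)) }
  where
  open Index {n}
  module O = Out O
  xs = h ∷ c ∷ [ t ]
  un₃ = Unique-drop [ x ] (Soc.un S)
  x∉ = Soc.x∉xs S
  xs∈ = λ {v} (p : v ∈ xs) -> Soc.xs∈U S p
  c∈U = xs∈ (there (here refl))
  c≢x : c ≢ x
  c≢x refl = x∉ (there (here refl))
  h≢t : h ≢ t
  h≢t refl = Unique-∉ un₃ (there (here refl))
  h≢c : h ≢ c
  h≢c refl = Unique-∉ un₃ (here refl)
  c≢t : c ≢ t
  c≢t refl = Unique-∉ (Unique-drop [ h ] un₃) (here refl)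
  F = fan x h O.k t
  Fs = fst F
  f⁺ = fst (snd (snd (snd F)))
  f⁻ = fst (snd (snd (snd (snd F))))
  fu = snd (snd (snd (snd (snd F))))
  -- The path `h c t` as the closed walk `c h c t c`; `upper` replaces its stretch from `h` to `t`.
  base : Sh [ c ] (c ∷ xs ++ [ c ]) (t ∷ h ∷ []) ((c , t) ∷ (c , h) ∷ []) []
  base = pend (c ∷ h ∷ []) c [] t (pend [] c [] h start)
  upper : Sh xs (h ∷ x ∷ t ∷ []) (x ∷ O.Ws) (Fs ++ (h , x) ∷ O.Es) (fst (snd F) ++ O.Ts)
  upper = pend [] h (O.k ++ [ t ]) x O.sh ⨾ subst₂ (λ a b -> Sh (h ∷ x ∷ h ∷ a) (h ∷ b) [] Fs (fst (snd F))) (++-identityʳ _) refl (ctx [ h ] [] (fst (snd (snd F))))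
  Ws = (x ∷ O.Ws) ++ t ∷ h ∷ []
  Es = (Fs ++ (h , x) ∷ O.Es) ++ (c , t) ∷ (c , h) ∷ []
  Ts = (fst (snd F) ++ O.Ts) ++ []
  sh : Sh [ c ] (c ∷ h ∷ x ∷ t ∷ c ∷ []) Ws Es Ts
  sh = base ⨾ ctx [ c ] [ c ] upper
  μ⊂' : ∀ {v} -> v ∈ O.k ++ [ t ] -> U v × v ≢ x
  μ⊂' p = μ⊂ (Soc.xs⊂ S) O (there p)
  oends : ∀ {a b} -> (a , b) ∈ O.Es -> (U a × a ≢ x) × (U b × b ≢ x)
  oends = ends⊂ (Soc.xs⊂ S) O
  x∉F : x ∉ O.k ++ [ t ]
  x∉F p = snd (μ⊂' p) refl
  h∉F : h ∉ O.k ++ [ t ]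
  h∉F = Unique-∉ O.μ-uniq
  data Kind : V × V -> Set where
   kF : ∀ {v} -> v ∈ O.k ++ [ t ] -> Kind (x , v)
   kh : Kind (h , x)
   kO : ∀ {e} -> e ∈ O.Es -> Kind e
   kt : Kind (c , t)
   kc : Kind (c , h)
  kind : ∀ {e} -> e ∈ Es -> Kind e
  kind p with ∈⁻ (Fs ++ (h , x) ∷ O.Es) p
  ... | inr (here refl) = kt
  ... | inr (there (here refl)) = kc
  ... | inl q with ∈⁻ Fs q
  ... | inl r with f⁻ r
  ... | refl , r' = kF r'
  kind p | inl q | inr (here refl) = kh
  kind p | inl q | inr (there r) = kO r
  nlk : ∀ {a b} -> Kind (a , b) -> a ≢ b
  nlk (kF p) refl = x∉F p
  nlk kh refl = x∉ (here refl)
  nlk (kO p) = O.noloop p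
  nlk kt = c≢t
  nlk kc = λ e -> h≢c (sym e)
  nl : ∀ {a b} -> (a , b) ∈ Es -> a ≢ b
  nl p = nlk (kind p)
  du : AllPairs Diff Es
  du = AllPairs-++ (AllPairs-++ (fu x∉F (Unique-drop [ h ] O.μ-uniq)) (All.tabulate (λ p -> dh p) ∷ O.Es-uniq) dF)
   (((λ { (inl (_ , e)) -> h≢t (sym e) ; (inr (e , _)) -> h≢c (sym e) }) ∷ []) ∷ [] ∷ []) dB
   where
   dh : ∀ {f} -> f ∈ O.Es -> Diff (h , x) f
   dh p (inl (refl , refl)) = snd (snd (oends p)) refl
   dh p (inr (refl , refl)) = snd (fst (oends p)) refl
   dF : ∀ {e f} -> e ∈ Fs -> f ∈ (h , x) ∷ O.Es -> Diff e f
   dF p q d with f⁻ p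
   dF p (here refl) (inl (refl , refl)) | refl , r = x∉ (here refl)
   dF p (here refl) (inr (refl , refl)) | refl , r = h∉F r
   dF p (there q) (inl (refl , refl)) | refl , r = snd (fst (oends q)) refl
   dF p (there q) (inr (refl , refl)) | refl , r = snd (snd (oends q)) refl
   dB : ∀ {e f} -> e ∈ Fs ++ (h , x) ∷ O.Es -> f ∈ (c , t) ∷ (c , h) ∷ [] -> Diff e f
   dB p q d with ∈⁻ Fs p
   dB p q d | inl r with f⁻ r
   dB p (here refl) (inl (e , _)) | inl r | refl , _ = c≢x (sym e)
   dB p (here refl) (inr (e , _)) | inl r | refl , _ = x∉ (there (there (here e)))
   dB p (there (here refl)) (inl (e , _)) | inl r | refl , _ = c≢x (sym e)
   dB p (there (here refl)) (inr (e , _)) | inl r | refl , _ = x∉ (here e)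
   dB p (here refl) (inl (e , _)) | inr (here refl) = h≢c e
   dB p (here refl) (inr (e , _)) | inr (here refl) = h≢t e
   dB p (there (here refl)) (inl (e , _)) | inr (here refl) = h≢c e
   dB p (there (here refl)) (inr (_ , e)) | inr (here refl) = c≢x (sym e)
   dB p (here refl) d | inr (there r) = O.new r (bad d)
    where
    bad : ∀ {a b} -> (a ≡ c × b ≡ t) ⊎ (a ≡ t × b ≡ c) -> Con± xs a b
    bad (inl (refl , refl)) = inl (there here)
    bad (inr (refl , refl)) = inr (there here)
   dB p (there (here refl)) d | inr (there r) = O.new r (bad d)
    where
    bad : ∀ {a b} -> (a ≡ c × b ≡ h) ⊎ (a ≡ h × b ≡ c) -> Con± xs a b
    bad (inl (refl , refl)) = inr here
    bad (inr (refl , refl)) = inl here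
  unw : Unique (Ws ++ [ c ])
  unw = ++-uniq {xs = Ws} (++-uniq {xs = x ∷ O.Ws} (All.tabulate (λ { p refl -> snd (O.Ws⊂I p) (here refl) }) ∷ O.Ws-uniq)
    (((λ e -> h≢t (sym e)) ∷ []) ∷ [] ∷ []) d₁) ([] ∷ []) d₂
   where
   d₁ : ∀ {z} -> z ∈ x ∷ O.Ws -> z ∈ t ∷ h ∷ [] -> ⊥
   d₁ (here refl) (here refl) = x∉ (there (there (here refl)))
   d₁ (here refl) (there (here refl)) = x∉ (here refl)
   d₁ (there p) (here refl) = snd (O.Ws⊂I p) (there (there (there (here refl))))
   d₁ (there p) (there (here refl)) = snd (O.Ws⊂I p) (there (here refl))
   d₂ : ∀ {z} -> z ∈ Ws -> z ∈ [ c ] -> ⊥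
   d₂ p (here refl) with ∈⁻ (x ∷ O.Ws) p
   ... | inl (here e) = c≢x e
   ... | inl (there q) = snd (O.Ws⊂I q) (there (there (here refl)))
   ... | inr (here e) = c≢t e
   ... | inr (there (here e)) = h≢c (sym e)
  unc : Unique (c ∷ Ws)
  unc = All.tabulate (λ { p refl -> uniq-dis Ws unw p (here refl) }) ∷ uniq-init Ws unw
  mem : ∀ {v} -> U v -> v ∈ c ∷ Ws
  mem {v} u with v ≟ x | v ∈? xs
  ... | yes refl | _ = there (here refl)
  ... | no _ | yes (here refl) = there (∈ʳ (x ∷ O.Ws) (there (here refl)))
  ... | no _ | yes (there (here e)) = here e
  ... | no _ | yes (there (there (here refl))) = there (∈ʳ (x ∷ O.Ws) (here refl))
  ... | no ne | no v∉ = there (there (∈ˡ (O.I⊂Ws (u , λ { (here e) -> ne e ; (there p) -> v∉ p }))))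
  inU : ∀ {v} -> v ∈ Ws ++ [ c ] -> U v
  inU p with ∈⁻ Ws p
  ... | inr (here refl) = c∈U
  ... | inl q with ∈⁻ (x ∷ O.Ws) q
  ... | inl (here refl) = Soc.x∈U S
  ... | inl (there r) = fst (O.Ws⊂I r)
  ... | inr (here refl) = xs∈ (there (there (here refl)))
  ... | inr (there (here refl)) = xs∈ (here refl)
  f : V -> Fin (suc (length Ws))
  f = pos c Ws
  g : Fin (suc (length Ws)) -> V
  g = lookup (c ∷ Ws)
  rotate : ∀ {v} -> v ∈ c ∷ Ws -> v ∈ Ws ++ [ c ]
  rotate (here e) = ∈ʳ Ws (here e)
  rotate (there p) = ∈ˡ p
  g∈U : ∀ i -> U (g i)
  g∈U i = inU (rotate (∈-lookup {xs = c ∷ Ws} i))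
  gf' : ∀ {v} -> U v -> g (f v) ≡ v
  gf' u = lookup-pos c Ws (mem u)
  finj : ∀ {u v} -> U u -> U v -> f u ≡ f v -> u ≡ v
  finj p q e = trans (sym (gf' p)) (trans (cong g e) (gf' q))
  Es' = map (on₂ f) Es
  Ts' = map (on₃ f) Ts
  Adj-map : ∀ {u v} -> Adj± Es u v -> Adj± Es' (f u) (f v)
  Adj-map = Sum.map (∈-map⁺ (on₂ f)) (∈-map⁺ (on₂ f))
  eU : ∀ {a b} -> (a , b) ∈ Es -> U a × U b
  eU p = let a , b = Sh-ends sh p in inU a , inU b
  unmap : ∀ {i j} -> (i , j) ∈ Es' -> (g i , g j) ∈ Es
  unmap p with ∈-map⁻ (on₂ f) p
  ... | (a , b) , q , refl = subst₂ (λ y z -> (y , z) ∈ Es) (sym (gf' (fst (eU q)))) (sym (gf' (snd (eU q)))) q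
  Adj-unmap : ∀ {i j} -> Adj± Es' i j -> Adj± Es (g i) (g j)
  Adj-unmap = Sum.map unmap unmap
  nl' : ∀ {a b} -> (a , b) ∈ Es' -> a ≢ b
  nl' p e = nl (unmap p) (cong g e)
  du' : AllPairs Diff Es'
  du' = APP.map⁺ (go Es (λ p -> p) du)
   where
   go : ∀ es -> (∀ {e} -> e ∈ es -> e ∈ Es) -> AllPairs Diff es -> AllPairs (λ e e' -> Diff (on₂ f e) (on₂ f e')) es
   go [] _ _ = []
   go (e ∷ es) s (a ∷ ap) = All.tabulate (λ p d -> All.lookup a p (dn (eU (s (here refl))) (eU (s (there p))) d)) ∷ go es (λ p -> s (there p)) ap
    where
    dn : ∀ {a b a' b'} -> U a × U b -> U a' × U b' -> (f a ≡ f a' × f b ≡ f b') ⊎ (f a ≡ f b' × f b ≡ f a') -> (a ≡ a' × b ≡ b') ⊎ (a ≡ b' × b ≡ a')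
    dn (p , q) (p' , q') (inl (d , e)) = inl (finj p p' d , finj q q' e)
    dn (p , q) (p' , q') (inr (d , e)) = inr (finj p q' d , finj q p' e)
  sh' : Sh [ f c ] (f c ∷ f h ∷ f x ∷ f t ∷ f c ∷ []) (map f Ws) Es' Ts'
  sh' = Sh-map f sh
  unmap-u : ∀ {ws} -> Unique ws -> (∀ {v} -> v ∈ ws -> U v) -> Unique (map f ws)
  unmap-u [] s = []
  unmap-u (_∷_ {x = w} {xs = ws} a u) s = All.tabulate (λ p e -> let v , q , e' = ∈-map⁻ f p in All.lookup a q (finj (s (here refl)) (s (there q)) (trans e e'))) ∷ unmap-u u (λ p -> s (there p))
  unw' : Unique (map f (Ws ++ [ c ]))
  unw' = unmap-u unw inU
  all' : ∀ i -> i ∈ map f Ws ++ [ f c ]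
  all' i = subst (i ∈_) (map-++ f Ws [ c ]) (subst (_∈ map f (Ws ++ [ c ])) (pos-lookup c Ws unc i) (∈-map⁺ f (rotate (∈-lookup {xs = c ∷ Ws} i))))
  rot' : Rot (f c ∷ f h ∷ f x ∷ f t ∷ f c ∷ f h ∷ []) Es' Ts'
  rot' = subst₂ (Rot _) (sym (map-++ (on₂ f) (Fs ++ (h , x) ∷ O.Es) ((c , t) ∷ (c , h) ∷ []))) (sym (map-++ (on₃ f) (fst (snd F) ++ O.Ts) []))
   (Rotation.rot (Sh-map f base) (inl (there (here refl))) (Sh-map f upper)
    (subst Unique (trans (cong (map f) (++-assoc (x ∷ O.Ws) (t ∷ h ∷ []) [ c ])) (map-++ f (x ∷ O.Ws) (t ∷ h ∷ c ∷ []))) unw')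
    (λ p -> nl' (subst (_ ∈_) (sym (map-++ (on₂ f) (Fs ++ (h , x) ∷ O.Es) _)) (∈ˡ p))) rot₀)
   where
   R₀ = λ v -> Star (Corner (f c ∷ f h ∷ f c ∷ f t ∷ f c ∷ f h ∷ []) [] v)
   ht : R₀ (f c) (f h) (f t)
   ht = inl (there here) ◅ ε
   th : R₀ (f c) (f t) (f h)
   th = inl (there (there (there here))) ◅ ε
   B₀ = (f c , f t) ∷ (f c , f h) ∷ []
   nf : ∀ {u v} -> U u -> U v -> u ≢ v -> f u ≡ f v -> ⊥
   nf p q ne e = ne (finj p q e)
   T∈ = xs∈ (there (there (here refl)))
   H∈ = xs∈ (here refl)
   nb : ∀ {v a} -> Adj± B₀ v a -> (v ≡ f c × (a ≡ f t ⊎ a ≡ f h)) ⊎ (a ≡ f c × v ≢ f c)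
   nb (inl (here refl)) = inl (refl , inl refl)
   nb (inl (there (here refl))) = inl (refl , inr refl)
   nb (inr (here refl)) = inr (refl , nf T∈ c∈U λ e -> c≢t (sym e))
   nb (inr (there (here refl))) = inr (refl , nf H∈ c∈U h≢c)
   rot₀ : Rot (f c ∷ f h ∷ f c ∷ f t ∷ f c ∷ f h ∷ []) B₀ []
   rot₀ v ea eb with nb ea | nb eb
   ... | inr (refl , _) | inr (refl , _) = ε
   ... | inl (refl , _) | inr (_ , ne) = absurd (ne refl)
   ... | inr (_ , ne) | inl (refl , _) = absurd (ne refl)
   ... | inl (refl , inl refl) | inl (_ , inl refl) = ε
   ... | inl (refl , inl refl) | inl (_ , inr refl) = th
   ... | inl (refl , inr refl) | inl (_ , inl refl) = ht
   ... | inl (refl , inr refl) | inl (_ , inr refl) = ε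
  inEs : ∀ {a b} -> Adj± O.Es a b -> Adj± Es a b
  inEs = Sum.map up up
   where
   up : ∀ {e} -> e ∈ O.Es -> e ∈ Es
   up p = ∈ˡ (∈ʳ Fs (there p))
  toE : ∀ {v} -> v ∈ h ∷ O.k ++ [ t ] -> Adj± Es x v
  toE (here refl) = inr (∈ˡ (∈ʳ Fs (here refl)))
  toE (there p) = inl (∈ˡ (∈ˡ (f⁺ p)))
  con : ∀ {a b} -> Consec xs a b -> Adj± Es a b
  con here = inr (∈ʳ (Fs ++ (h , x) ∷ O.Es) (there (here refl)))
  con (there here) = inl (∈ʳ (Fs ++ (h , x) ∷ O.Es) (here refl))
  con (there (there (there ())))
  E⇒ : ∀ {u v} -> U u -> U v -> E u v -> Adj± Es u v
  E⇒ {u} {v} uu uv e with u ≟ x | v ≟ x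
  ... | yes refl | _ = toE (O.N⊂μ uv e)
  ... | no _ | yes refl = Sum.swap (toE (O.N⊂μ uu (Soc.Esym S e)))
  ... | no nu | no nv with O.cover uu uv nu nv e
  ... | inl p = inEs p
  ... | inr (inl p) = con p
  ... | inr (inr p) = Sum.swap (con p)
  tri₀ : ∀ {y z w} -> Adj± Es y z -> Adj± Es z w -> Adj± Es y w -> ∃ λ t -> t ∈ Ts × Same y z w t
  tri₀ a b d with triangles sh nl unw a b d (ne a) (ne b) (ne d)
   where
   ne : ∀ {a b} -> Adj± Es a b -> a ≢ b
   ne (inl p) = nl p
   ne (inr p) e = nl p (sym e)
  ... | inl r = r
  -- The inside of a triangle that is not a face would be cut off by its three corners.
  ... | inr H = absurd (Soc.sf S L _ _ _ wit wit∈ inn λ l e u -> closed l (E⇒ (inU (in-Ws l)) u e))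
   where
   open Hidden H
   inn : ∀ {v} -> L v -> Inn U x xs v
   inn l = inU (in-Ws l) , λ
    { (here refl) -> off-u l (there (there (here refl)))
    ; (there (here refl)) -> off-u l (there (here refl))
    ; (there (there (here refl))) -> off-u l (here refl)
    ; (there (there (there (here refl)))) -> off-u l (there (there (there (here refl)))) }
  tri : ∀ {y z w} -> Adj± Es' y z -> Adj± Es' z w -> Adj± Es' y w -> ∃ λ t -> t ∈ Ts' × Shell.Same y z w t
  tri {y} {z} {w} a b d with tri₀ (Adj-unmap a) (Adj-unmap b) (Adj-unmap d)
  ... | t' , p , i , j = _ , ∈-map⁺ (on₃ f) p , (λ q -> dn (i (gs q))) , λ q -> gt (j (dn' q))
   where
   fgi = pos-lookup c Ws unc
   tU : ∀ {t'} -> t' ∈ Ts -> U (fst t') × U (fst (snd t')) × U (snd (snd t'))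
   tU p = let a , b , _ = Sh-tri sh p in endU a , endU (Sum.swap a) , endU (Sum.swap b)
    where
    endU : ∀ {a b} -> Adj± Es a b -> U a
    endU (inl p) = fst (eU p)
    endU (inr p) = snd (eU p)
   back : ∀ {i v} -> U v -> i ≡ f v -> g i ≡ v
   back u e = trans (cong g e) (gf' u)
   gs : ∀ {h} -> h ≡ f (fst t') ⊎ h ≡ f (fst (snd t')) ⊎ h ≡ f (snd (snd t')) -> g h ≡ fst t' ⊎ g h ≡ fst (snd t') ⊎ g h ≡ snd (snd t')
   gs = Sum.map (back (fst (tU p))) (Sum.map (back (fst (snd (tU p)))) (back (snd (snd (tU p)))))
   ginj : ∀ {i j} -> g i ≡ g j -> i ≡ j
   ginj e = trans (sym (fgi _)) (trans (cong f e) (fgi _))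
   dn : ∀ {h} -> g h ≡ g y ⊎ g h ≡ g z ⊎ g h ≡ g w -> h ≡ y ⊎ h ≡ z ⊎ h ≡ w
   dn = Sum.map ginj (Sum.map ginj ginj)
   dn' : ∀ {h} -> h ≡ y ⊎ h ≡ z ⊎ h ≡ w -> g h ≡ g y ⊎ g h ≡ g z ⊎ g h ≡ g w
   dn' = Sum.map (cong g) (Sum.map (cong g) (cong g))
   ft : ∀ {h v} -> g h ≡ v -> h ≡ f v
   ft e = trans (sym (fgi _)) (cong f e)
   gt : ∀ {h} -> g h ≡ fst t' ⊎ g h ≡ fst (snd t') ⊎ g h ≡ snd (snd t') -> h ≡ f (fst t') ⊎ h ≡ f (fst (snd t')) ⊎ h ≡ f (snd (snd t'))
   gt = Sum.map ft (Sum.map ft ft)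

 web-disk : ∀ {E U c h x t} -> Soc E U x h [ c ] t -> Disk E U c h x t
 web-disk S = out-disk S (web (suc (Soc.size S)) S ≤-refl)

-- Rooted minors

data Part : Set where
 rt    : Fin 4 -> Part
 aux fr : Part

_≟ₚ_ : (c d : Part) -> Dec (c ≡ d)
rt i ≟ₚ rt j = map′ (cong rt) (λ { refl -> refl }) (i ≟ j)
rt i ≟ₚ aux = no λ ()
rt i ≟ₚ fr = no λ ()
aux ≟ₚ rt j = no λ ()
aux ≟ₚ aux = yes refl
aux ≟ₚ fr = no λ ()
fr ≟ₚ rt j = no λ ()
fr ≟ₚ aux = no λ ()
fr ≟ₚ fr = yes refl

rt-inj : ∀ {i j} -> rt i ≡ rt j -> i ≡ j
rt-inj refl = refl

record Four (i j k l : Fin 4) : Set where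
 field
  ij : i ≢ j
  ik : i ≢ k
  il : i ≢ l
  jk : j ≢ k
  jl : j ≢ l
  kl : k ≢ l
  all : ∀ x -> x ≡ i ⊎ x ≡ j ⊎ x ≡ k ⊎ x ≡ l

module _ {i j k l : Fin 4} (F : Four i j k l) where
 open Four F
 swap₁₂ : Four j i k l
 swap₁₂ = record { ij = λ e -> ij (sym e) ; ik = jk ; il = jl ; jk = ik ; jl = il ; kl = kl
  ; all = λ x -> [ (λ e -> inr (inl e)) , [ inl , (λ e -> inr (inr e)) ]′ ]′ (all x) }
 swap₂₃ : Four i k j l
 swap₂₃ = record { ij = ik ; ik = ij ; il = il ; jk = λ e -> jk (sym e) ; jl = kl ; kl = jl
  ; all = λ x -> Sum.map₂ [ (λ e -> inr (inl e)) , [ inl , (λ e -> inr (inr e)) ]′ ]′ (all x) }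
 swap₃₄ : Four i j l k
 swap₃₄ = record { ij = ij ; ik = il ; il = ik ; jk = jl ; jl = jk ; kl = λ e -> kl (sym e)
  ; all = λ x -> Sum.map₂ (Sum.map₂ Sum.swap) (all x) }

Four-inj : ∀ {A : Set} {i j k l} -> Four i j k l -> (f : Fin 4 -> A) -> f i ≢ f j -> f i ≢ f k -> f i ≢ f l -> f j ≢ f k -> f j ≢ f l -> f k ≢ f l -> ∀ {x y} -> f x ≡ f y -> x ≡ y
Four-inj {i = i} {j} {k} {l} F f ij ik il jk jl kl e = go (Four.all F _) (Four.all F _) e
 where
 go : ∀ {x y} -> x ≡ i ⊎ x ≡ j ⊎ x ≡ k ⊎ x ≡ l -> y ≡ i ⊎ y ≡ j ⊎ y ≡ k ⊎ y ≡ l -> f x ≡ f y -> x ≡ y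
 go (inl refl) (inl refl) e = refl
 go (inl refl) (inr (inl refl)) e = absurd (ij e)
 go (inl refl) (inr (inr (inl refl))) e = absurd (ik e)
 go (inl refl) (inr (inr (inr refl))) e = absurd (il e)
 go (inr (inl refl)) (inr (inl refl)) e = refl
 go (inr (inl refl)) (inr (inr (inl refl))) e = absurd (jk e)
 go (inr (inl refl)) (inr (inr (inr refl))) e = absurd (jl e)
 go (inr (inr (inl refl))) (inr (inr (inl refl))) e = refl
 go (inr (inr (inl refl))) (inr (inr (inr refl))) e = absurd (kl e)
 go (inr (inr (inr refl))) (inr (inr (inr refl))) e = refl
 go (inr (inl refl)) (inl refl) e = absurd (ij (sym e))
 go (inr (inr (inl refl))) (inl refl) e = absurd (ik (sym e))
 go (inr (inr (inr refl))) (inl refl) e = absurd (il (sym e))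
 go (inr (inr (inl refl))) (inr (inl refl)) e = absurd (jk (sym e))
 go (inr (inr (inr refl))) (inr (inl refl)) e = absurd (jl (sym e))
 go (inr (inr (inr refl))) (inr (inr (inl refl))) e = absurd (kl (sym e))

module Paint {n : ℕ} where
 V = Fin n

 paint : ∀ {X : V -> Set} -> Dec₁ X -> Part -> (V -> Part) -> V -> Part
 paint X? c φ v with X? v
 ... | yes _ = c
 ... | no _ = φ v

 module _ {X : V -> Set} (X? : Dec₁ X) {c : Part} {φ : V -> Part} where
  paint-in : ∀ {v} -> X v -> paint X? c φ v ≡ c
  paint-in {v} x with X? v
  ... | yes _ = refl
  ... | no ¬x = absurd (¬x x)

  paint-out : ∀ {v} -> ¬ X v -> paint X? c φ v ≡ φ v
  paint-out {v} ¬x with X? v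
  ... | yes x = absurd (¬x x)
  ... | no _ = refl

  paint-inv : ∀ {v d} -> paint X? c φ v ≡ d -> (X v × c ≡ d) ⊎ (¬ X v × φ v ≡ d)
  paint-inv {v} e with X? v
  ... | yes x = inl (x , e)
  ... | no ¬x = inr (¬x , e)

  stay : ∀ {v d} -> φ v ≡ d -> (X v -> c ≡ d) -> paint X? c φ v ≡ d
  stay {v} e f with X? v
  ... | yes x = f x
  ... | no _ = e

module Minors {n : ℕ} (E : Fin n -> Fin n -> Set) (E? : Dec₂ E) (Esym : ∀ {u v} -> E u v -> E v u)
       (U : Fin n -> Set) (r : Fin 4 -> Fin n) where
 open Paint {n} public

 record Rooted (D : V -> Set) (z : V) : Set where
  field
   base  : D z
   reach : ∀ {v} -> D v -> W E D z v
 open Rooted public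

 Rooted-≃ : ∀ {D D' : V -> Set} {z} -> (∀ {v} -> D v -> D' v) -> (∀ {v} -> D' v -> D v) -> Rooted D z -> Rooted D' z
 Rooted-≃ f g R = record { base = f (base R) ; reach = λ d -> W-mono f (reach R (g d)) }

 grow : ∀ {D X : V -> Set} {z x u} -> Rooted D z -> Rooted X x -> D u -> E u x -> Rooted (λ v -> X v ⊎ D v) z
 grow R Q du e = record { base = inr (base R)
  ; reach = [ (λ x -> W-mono inr (reach R du) ∙ step e (inl (base Q)) (W-mono inl (reach Q x))) , (λ d -> W-mono inr (reach R d)) ]′ }

 reroot : ∀ {D : V -> Set} {z w} -> Rooted D z -> D w -> Rooted D w
 reroot R dw = record { base = dw ; reach = λ d -> W-rev Esym (base R) (reach R dw) ∙ reach R d }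

 comp : ∀ {D : V -> Set} {z} -> D z -> Rooted (W E D z) z
 comp dz = record { base = ε ; reach = λ p -> W-mono snd (W-keep (W E _ _) (λ q e s -> q ∙ edge e s) ε p) }

 Cl : (V -> Part) -> Part -> V -> Set
 Cl φ c v = φ v ≡ c

 Touch : (V -> Part) -> Part -> Part -> Set
 Touch φ c d = ∃₂ λ u v -> φ u ≡ c × φ v ≡ d × E u v

 Touch-sym : ∀ {φ c d} -> Touch φ c d -> Touch φ d c
 Touch-sym (u , v , p , q , e) = v , u , q , p , Esym e

 Touch? : ∀ φ c d -> Dec (Touch φ c d)
 Touch? φ c d = any? λ u -> any? λ v -> (φ u ≟ₚ c) ×? ((φ v ≟ₚ d) ×? E? u v)

 record Model (φ : V -> Part) : Set where
  field
   conn  : ∀ i -> Rooted (Cl φ (rt i)) (r i)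
   alive : ∀ {v} -> φ v ≢ fr -> U v
 open Model public

 record K4 : Set where
  field
   φ     : V -> Part
   model : Model φ
   touch : ∀ i j -> i ≢ j -> Touch φ (rt i) (rt j)

 -- A branch set and the fifth set, each touching the other three branch sets. This is the shape of
 -- class A, with the root of `h` as nominated hub.
 record ACore (φ : V -> Part) (h i j k : Fin 4) : Set where
  field
   four  : Four h i j k
   model : Model φ
   s     : V
   spare : Rooted (Cl φ aux) s
   hi : Touch φ (rt h) (rt i)
   hj : Touch φ (rt h) (rt j)
   hk : Touch φ (rt h) (rt k)
   si : Touch φ aux (rt i)
   sj : Touch φ aux (rt j)
   sk : Touch φ aux (rt k)

 k4 : ∀ {φ i j k l} -> Four i j k l -> Model φ -> Touch φ (rt i) (rt j) -> Touch φ (rt i) (rt k) -> Touch φ (rt i) (rt l) ->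
    Touch φ (rt j) (rt k) -> Touch φ (rt j) (rt l) -> Touch φ (rt k) (rt l) -> K4
 k4 {φ} {i} {j} {k} {l} F M ij ik il jk jl kl = record { φ = φ ; model = M ; touch = λ x y ne -> go (Four.all F x) (Four.all F y) ne }
  where
  go : ∀ {x y} -> x ≡ i ⊎ x ≡ j ⊎ x ≡ k ⊎ x ≡ l -> y ≡ i ⊎ y ≡ j ⊎ y ≡ k ⊎ y ≡ l -> x ≢ y -> Touch φ (rt x) (rt y)
  go (inl refl) (inl refl) ne = absurd (ne refl)
  go (inl refl) (inr (inl refl)) _ = ij
  go (inl refl) (inr (inr (inl refl))) _ = ik
  go (inl refl) (inr (inr (inr refl))) _ = il
  go (inr (inl refl)) (inl refl) _ = Touch-sym ij
  go (inr (inl refl)) (inr (inl refl)) ne = absurd (ne refl)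
  go (inr (inl refl)) (inr (inr (inl refl))) _ = jk
  go (inr (inl refl)) (inr (inr (inr refl))) _ = jl
  go (inr (inr (inl refl))) (inl refl) _ = Touch-sym ik
  go (inr (inr (inl refl))) (inr (inl refl)) _ = Touch-sym jk
  go (inr (inr (inl refl))) (inr (inr (inl refl))) ne = absurd (ne refl)
  go (inr (inr (inl refl))) (inr (inr (inr refl))) _ = kl
  go (inr (inr (inr refl))) (inl refl) _ = Touch-sym il
  go (inr (inr (inr refl))) (inr (inl refl)) _ = Touch-sym jl
  go (inr (inr (inr refl))) (inr (inr (inl refl))) _ = Touch-sym kl
  go (inr (inr (inr refl))) (inr (inr (inr refl))) ne = absurd (ne refl)

 module _ {X : V -> Set} (X? : Dec₁ X) {φ : V -> Part} where
  keep : ∀ {e c d} -> Touch φ c d -> (∀ {w} -> X w -> φ w ≡ c -> e ≡ c) -> (∀ {w} -> X w -> φ w ≡ d -> e ≡ d) -> Touch (paint X? e φ) c d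
  keep (u , v , p , q , uv) f g = u , v , stay X? p (λ x -> f x p) , stay X? q (λ x -> g x q) , uv

  untouched : ∀ {c z} -> Rooted (Cl φ c) z -> (∀ {w} -> X w -> φ w ≢ c) -> Rooted (λ w -> φ w ≡ c × ¬ X w) z
  untouched R f = Rooted-≃ (λ e -> e , λ x -> f x e) fst R

  leave : ∀ {e c z} -> e ≢ c -> Rooted (λ w -> φ w ≡ c × ¬ X w) z -> Rooted (Cl (paint X? e φ) c) z
  leave ne R = Rooted-≃ (λ (p , ¬x) -> trans (paint-out X? ¬x) p) (λ p -> [ (λ (_ , q) -> absurd (ne q)) , (λ (¬x , q) -> q , ¬x) ]′ (paint-inv X? p)) R

  enter : ∀ {c z x u} -> Rooted (Cl φ c) z -> Rooted X x -> φ u ≡ c -> E u x -> Rooted (Cl (paint X? c φ) c) z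
  enter R Q p e = Rooted-≃ [ paint-in X? , (λ q -> stay X? q λ _ -> refl) ]′
   (λ q -> [ (λ (x , _) -> inl x) , (λ (_ , q) -> inr q) ]′ (paint-inv X? q)) (grow R Q p e)

  alive' : ∀ {e} -> Model φ -> (∀ {w} -> X w -> U w) -> ∀ {v} -> paint X? e φ v ≢ fr -> U v
  alive' M f {v} ne with X? v
  ... | yes x = f x
  ... | no _ = alive M ne

  repaint : Model φ -> (∀ {w} -> X w -> U w) -> ∀ i {x u} -> Rooted X x -> φ u ≡ rt i -> E u x ->
       (∀ j -> j ≢ i -> Rooted (λ w -> φ w ≡ rt j × ¬ X w) (r j)) -> Model (paint X? (rt i) φ)
  repaint M XU i R p e f = record { conn = cn ; alive = alive' M XU }
   where
   cn : ∀ j -> Rooted (Cl (paint X? (rt i) φ) (rt j)) (r j)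
   cn j with j ≟ i
   ... | yes refl = enter (conn M i) R p e
   ... | no ne = leave (λ { refl -> ne refl }) (f j ne)

  erase : ∀ {e} -> Model φ -> (∀ {w} -> X w -> U w) -> (∀ j -> e ≢ rt j) -> (∀ j -> Rooted (λ w -> φ w ≡ rt j × ¬ X w) (r j)) -> Model (paint X? e φ)
  erase M XU ne f = record { conn = λ j -> leave (ne j) (f j) ; alive = alive' M XU }

 -- When the piece `p` is taken out of a connected set, the component `°` of the root stays and
 -- everything else hangs on `p`. So both `°` and `X` are connected, and edges from `X` to `°` start
 -- in `p`.
 module Peel {D p : V -> Set} (D? : Dec₁ D) (p? : Dec₁ p) {z v : V} (RD : Rooted D z) (Rp : Rooted p v)
       (p⊂D : ∀ {w} -> p w -> D w) (z∉p : ¬ p z) where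
  Dp ° X : V -> Set
  Dp w = D w × ¬ p w
  ° = W E Dp z
  X w = D w × ¬ ° w
  °? : Dec₁ °
  °? = W? E? (λ w -> D? w ×? ¬? (p? w)) z
  X? : Dec₁ X
  X? w = D? w ×? ¬? (°? w)
  °⊂ : ∀ {w} -> ° w -> Dp w
  °⊂ = W-end∈ (base RD , z∉p)
  p⊂X : ∀ {w} -> p w -> X w
  p⊂X q = p⊂D q , λ o -> snd (°⊂ o) q
  R° : Rooted ° z
  R° = comp (base RD , z∉p)
  ends : ∀ {x y} -> X x -> ° y -> E x y -> p x
  ends {x} (dx , ¬o) o e = stable (p? x) λ ¬p -> ¬o (o ∙ edge (Esym e) (dx , ¬p))
  RX : Rooted X v
  RX = record { base = p⊂X (base Rp) ; reach = λ {x} (d , ¬o) -> go d ¬o (W-first (λ w -> p? w ⊎? °? w) (W-rev Esym (base RD) (reach RD d)) (inr ε)) }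
   where
   back : ∀ {x w} -> D x -> ¬ p x -> W E (λ y -> D y × ¬ (p y ⊎ ° y)) x w -> ° w -> ° x
   back dx ¬px q o = o ∙ W-mono (λ { (d , np) -> d , np }) (W-rev Esym (dx , ¬px) (W-mono (λ (d , n) -> d , λ p -> n (inl p)) q))
   go : ∀ {x} -> D x -> ¬ ° x -> (∃ λ w -> (p w ⊎ ° w) × (x ≡ w ⊎ (¬ (p x ⊎ ° x) × ∃ λ w' -> W E (λ y -> D y × ¬ (p y ⊎ ° y)) x w' × E w' w × D w))) -> W E X v x
   go dx ¬o (w , inl pw , inl refl) = W-mono p⊂X (reach Rp pw)
   go dx ¬o (w , inr o , inl refl) = absurd (¬o o)
   go dx ¬o (w , inl pw , inr (n , w' , q , e , _)) = W-mono p⊂X (reach Rp pw) ∙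
    step (Esym e) (W-end∈ (dx , ¬o) xq) (W-rev Esym (dx , ¬o) xq)
    where
    xq : W E X _ w'
    xq = W-mono (λ (d , m) -> d , λ o -> m (inr o)) q
   go dx ¬o (w , inr o , inr (n , w' , q , e , _)) = absurd (¬o (back dx (λ p -> n (inl p)) q
    (o ∙ edge (Esym e) (W-end∈ (dx , λ p -> n (inl p)) (W-mono (λ (d , m) -> d , λ p -> m (inl p)) q)))))
  link : ∃₂ λ a b -> X a × ° b × E a b
  link with W-first °? (W-rev Esym (base RD) (reach RD (p⊂D (base Rp)))) ε
  ... | w , o , inl refl = absurd (snd (°⊂ o) (base Rp))
  ... | w , o , inr (n , w' , q , e , _) = w' , w , W-end∈ (p⊂X (base Rp)) (W-mono (λ y -> y) q) , o , e

 -- M relates vertices lying on a common path of the linkage.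
 module Cycle (M : V -> V -> Set) (M? : Dec₂ M) (Msym : ∀ {u v} -> M u v -> M v u) where
  Goal : Set
  Goal = K4 ⊎ (∃ λ φ -> ∃₂ λ h i -> ∃₂ λ j k -> ACore φ h i j k)

  Bad : (V -> Part) -> V × V -> Set
  Bad φ (u , v) = M u v × E u v × φ u ≢ φ v
  Bad? : ∀ φ -> Dec₁ (Bad φ)
  Bad? φ (u , v) = M? u v ×? (E? u v ×? ¬? (φ u ≟ₚ φ v))

  -- The potential of the uncrossing: ordered adjacent pairs within one of the two linked sets whose
  -- colours differ. Each recolouring that is used makes such a pair monochromatic and creates none.
  μ : (V -> Part) -> ℕ
  μ φ = cntL (Bad? φ) (cartesianProduct (allFin n) (allFin n))

  μ-drop : ∀ {X : V -> Set} (X? : Dec₁ X) {φ i s u v} -> (∀ {w} -> X w -> φ w ≡ s) -> s ≢ rt i -> X v -> φ u ≡ rt i -> E u v -> M u v ->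
       (∀ {x y} -> X x -> φ y ≡ s -> ¬ X y -> E x y -> M x y -> ⊥) -> μ (paint X? (rt i) φ) < μ φ
  μ-drop {X} X? {φ} {i} {s} {u} {v} Xs s≢ xv pu e m f =
   cntL-strict (Bad? φ') (Bad? φ) sub {u , v} (m , e , λ q -> s≢ (trans (sym (Xs xv)) (trans (sym q) pu)))
    (λ (_ , _ , ne) -> ne (trans (stay X? pu λ _ -> refl) (sym (paint-in X? xv)))) (∈-cartesianProduct⁺ (∈-allFin u) (∈-allFin v))
   where
   φ' = paint X? (rt i) φ
   sub : ∀ {x} -> Bad φ' x -> Bad φ x
   sub {a , b} (m , e , ne) = m , e , λ eq -> go eq (X? a) (X? b)
    where
    go : φ a ≡ φ b -> Dec (X a) -> Dec (X b) -> ⊥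
    go eq (yes xa) (yes xb) = ne (trans (paint-in X? xa) (sym (paint-in X? xb)))
    go eq (no ¬a) (no ¬b) = ne (trans (paint-out X? ¬a) (trans eq (sym (paint-out X? ¬b))))
    go eq (yes xa) (no ¬b) = f xa (trans (sym eq) (Xs xa)) ¬b e m
    go eq (no ¬a) (yes xb) = f xb (trans eq (Xs xb)) ¬a (Esym e) (Msym m)

  -- A model of the 4-cycle `i j k l`, and disjoint connected sets `P` and `Q` that join its
  -- opposite corners. The recolourings change the model but keep `P` and `Q`.
  record Cyc (φ : V -> Part) (P Q : V -> Set) (i j k l : Fin 4) : Set where
   field
    four  : Four i j k l
    model : Model φ
    nosp  : ∀ {v} -> φ v ≢ aux
    tij : Touch φ (rt i) (rt j)
    tjk : Touch φ (rt j) (rt k)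
    tkl : Touch φ (rt k) (rt l)
    tli : Touch φ (rt l) (rt i)
    P?  : Dec₁ P
    Q?  : Dec₁ Q
    P⊂U : ∀ {v} -> P v -> U v
    Q⊂U : ∀ {v} -> Q v -> U v
    dis : ∀ {v} -> P v -> Q v -> ⊥
    Pi  : Rooted P (r i)
    Pk  : P (r k)
    Qj  : Rooted Q (r j)
    Ql  : Q (r l)
    PM  : ∀ {u v} -> P u -> P v -> M u v
    QM  : ∀ {u v} -> Q u -> Q v -> M u v
    M⁻  : ∀ {u v} -> M u v -> (P u × P v) ⊎ (Q u × Q v)

  flip : ∀ {φ P Q i j k l} -> Cyc φ P Q i j k l -> Cyc φ Q P j i l k
  flip C = record { four = swap₃₄ (swap₁₂ four) ; model = model ; nosp = nosp
   ; tij = Touch-sym tij ; tjk = Touch-sym tli ; tkl = Touch-sym tkl ; tli = Touch-sym tjk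
   ; P? = Q? ; Q? = P? ; P⊂U = Q⊂U ; Q⊂U = P⊂U ; dis = λ q p -> dis p q ; Pi = Qj ; Pk = Ql ; Qj = Pi ; Ql = Pk
   ; PM = QM ; QM = PM ; M⁻ = λ m -> Sum.swap (M⁻ m) }
   where
    open Cyc C

  mirror : ∀ {φ P Q i j k l} -> Cyc φ P Q i j k l -> Cyc φ P Q i l k j
  mirror C = record { four = swap₂₃ (swap₃₄ (swap₂₃ four)) ; model = model ; nosp = nosp
   ; tij = Touch-sym tli ; tjk = Touch-sym tkl ; tkl = Touch-sym tjk ; tli = Touch-sym tij
   ; P? = P? ; Q? = Q? ; P⊂U = P⊂U ; Q⊂U = Q⊂U ; dis = dis ; Pi = Pi ; Pk = Pk ; Qj = reroot Qj Ql ; Ql = base Qj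
   ; PM = PM ; QM = QM ; M⁻ = M⁻ }
   where
    open Cyc C

  Exit : (φ : V -> Part) (P : V -> Set) (i : Fin 4) (u v : V) -> Set
  Exit φ P i u v = W E (λ w -> P w × φ w ≡ rt i) (r i) u × E u v × P v × φ v ≢ rt i

  exit : ∀ {φ P Q i j k l} -> Cyc φ P Q i j k l -> ∃₂ (Exit φ P i)
  exit {φ} {P} {i = i} C with W-first (λ w -> ¬? (φ w ≟ₚ rt i)) (reach (Cyc.Pi C) (Cyc.Pk C))
              (λ e -> Four.ik (Cyc.four C) (rt-inj (trans (sym e) (base (conn (Cyc.model C) _)))))
  ... | v , ne , inl refl = absurd (ne (base (conn (Cyc.model C) _)))
  ... | v , ne , inr (_ , u , q , e , pv) = u , v , W-mono (λ (p , nn) -> p , stable (φ _ ≟ₚ rt i) nn) q , e , pv , ne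

  module _ {φ : V -> Part} (rec : ∀ {φ'} -> μ φ' < μ φ -> ∀ {P Q i j k l} -> Cyc φ' P Q i j k l -> Goal) where

   -- The whole free component of `P` at `v` is handed to `i`. As no free vertex of `P` next to it
   -- is left over, no new bad pair arises.
   stray : ∀ {P Q i j k l u v} -> Cyc φ P Q i j k l -> Exit φ P i u v -> φ v ≡ fr -> Goal
   stray {P} {Q} {i} {j} {k} {l} {u} {v} C (p0 , e , pv , _) nv = rec
    (μ-drop X? Xno (λ ()) ε pu e (PM (fst pu') pv) λ { x y ¬x e' m -> ¬x (x ∙ edge e' (side x m , y)) }) record
    { four = four ; model = repaint X? model (λ x -> P⊂U (fst (X⊂ x))) i (comp (pv , nv)) pu e
      λ x _ -> untouched X? (conn model x) λ w e -> no≢ (trans (sym (Xno w)) e)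
    ; nosp = λ q -> [ (λ ()) , (λ (_ , q) -> nosp q) ]′ (paint-inv X? q)
    ; tij = kp tij ; tjk = kp tjk ; tkl = kp tkl ; tli = kp tli
    ; P? = P? ; Q? = Q? ; P⊂U = P⊂U ; Q⊂U = Q⊂U ; dis = dis ; Pi = Pi ; Pk = Pk ; Qj = Qj ; Ql = Ql ; PM = PM ; QM = QM ; M⁻ = M⁻ }
    where
    open Cyc C
    X : V -> Set
    X = W E (λ w -> P w × φ w ≡ fr) v
    X? : Dec₁ X
    X? = W? E? (λ w -> P? w ×? (φ w ≟ₚ fr)) v
    X⊂ : ∀ {w} -> X w -> P w × φ w ≡ fr
    X⊂ = W-end∈ (pv , nv)
    Xno : ∀ {w} -> X w -> φ w ≡ fr
    Xno x = snd (X⊂ x)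
    no≢ : ∀ {i} -> fr ≢ rt i
    no≢ ()
    pu' = W-end∈ (base Pi , base (conn model i)) p0
    pu = snd pu'
    side : ∀ {x y} -> X x -> M x y -> P y
    side x m = [ snd , (λ (q , _) -> absurd (dis (fst (X⊂ x)) q)) ]′ (M⁻ m)
    kp : ∀ {a b} -> Touch φ (rt a) (rt b) -> Touch (paint X? (rt i) φ) (rt a) (rt b)
    kp t = keep X? t (λ x e -> absurd (no≢ (trans (sym (Xno x)) e))) (λ x e -> absurd (no≢ (trans (sym (Xno x)) e)))

   module Near {P Q i j k l u v} (C : Cyc φ P Q i j k l) (ex : Exit φ P i u v) (vj : φ v ≡ rt j) where
    open Cyc C public
    open Four four public
    p0 = fst ex
    uv = fst (snd ex)
    pv = fst (snd (snd ex))
    pu' = W-end∈ (base Pi , base (conn model i)) p0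
    pu = snd pu'
    p : V -> Set
    p = W E (λ w -> P w × φ w ≡ rt j) v
    p⊂ : ∀ {w} -> p w -> P w × φ w ≡ rt j
    p⊂ = W-end∈ (pv , vj)
    open Peel (λ w -> φ w ≟ₚ rt j) (W? E? (λ w -> P? w ×? (φ w ≟ₚ rt j)) v) (conn model j) (comp (pv , vj)) (λ q -> snd (p⊂ q))
     (λ q -> dis (fst (p⊂ q)) (base Qj)) public
    v∈X : X v
    v∈X = p⊂X ε
    XU : ∀ {w} -> X w -> U w
    XU (e , _) = alive model λ q -> nr (trans (sym e) q)
     where
     nr : ∀ {i} -> rt i ≢ fr
     nr ()
    °U : ∀ {w} -> ° w -> φ w ≡ rt j × ¬ X w
    °U o = fst (°⊂ o) , λ (_ , n) -> n o
    rest : ∀ x -> Rooted (λ w -> φ w ≡ rt x × ¬ X w) (r x)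
    rest x with x ≟ j
    ... | yes refl = Rooted-≃ °U (λ {w} (e , n) -> stable (°? w) λ ¬o -> n (e , ¬o)) R°
    ... | no ne = untouched X? (conn model x) λ { (e , _) q -> ne (rt-inj (trans (sym q) e)) }
    off : ∀ {e x} -> x ≢ j -> ∀ {w} -> X w -> φ w ≡ rt x -> e ≡ rt x
    off ne (e , _) q with trans (sym e) q
    ... | refl = absurd (ne refl)
    Meets : Fin 4 -> Set
    Meets x = ∃₂ λ a b -> ° a × φ b ≡ rt x × E a b
    Meets? : ∀ x -> Dec (Meets x)
    Meets? x = any? λ a -> any? λ b -> °? a ×? ((φ b ≟ₚ rt x) ×? E? a b)
    out : ∀ {e w} -> ° w -> paint X? e φ w ≡ rt j
    out o = let a , b = °U o in trans (paint-out X? b) a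
    away : ∀ {e x w} -> x ≢ j -> φ w ≡ rt x -> paint X? e φ w ≡ rt x
    away ne q = stay X? q λ x -> off ne x q
    seesX : ∀ {x} -> Touch φ (rt j) (rt x) -> ¬ Meets x -> ∃₂ λ a b -> X a × φ b ≡ rt x × E a b
    seesX (a , b , pa , pb , e) n = a , b , (pa , λ o -> n (a , b , o , pb , e)) , pb , e

    -- `j` keeps `°`, which still touches `k` and, through `link`, the part handed over to `i`. So
    -- the cycle survives with a smaller potential.
    shift : Meets k -> Goal
    shift (a , b , o , pb , e) = rec
     (μ-drop X? {i = i} {s = rt j} fst (λ { refl -> ij refl }) v∈X pu uv (PM (fst pu') pv)
      λ {x} {y} xx yj ¬x e m -> let p' = ends xx (stable (°? y) λ ¬o -> ¬x (yj , ¬o)) e in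
       ¬x (p⊂X (p' ∙ edge e ([ snd , (λ (q , _) -> absurd (dis (fst (p⊂ p')) q)) ]′ (M⁻ m) , yj)))) record
     { four = four ; model = repaint X? model XU i RX pu uv λ x _ -> rest x
     ; nosp = λ q -> [ (λ ()) , (λ (_ , q) -> nosp q) ]′ (paint-inv X? q)
     ; tij = let a , b , xa , ob , e = link in a , b , paint-in X? xa , out ob , e
     ; tjk = a , b , out o , away (λ e -> jk (sym e)) pb , e
     ; tkl = keep X? tkl (off (λ e -> jk (sym e))) (off (λ e -> jl (sym e)))
     ; tli = keep X? tli (off (λ e -> jl (sym e))) (off ij)
     ; P? = P? ; Q? = Q? ; P⊂U = P⊂U ; Q⊂U = Q⊂U ; dis = dis ; Pi = Pi ; Pk = Pk ; Qj = Qj ; Ql = Ql ; PM = PM ; QM = QM ; M⁻ = M⁻ }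

    -- `X` becomes the fifth set: it touches `i` at `v`, `j` at `°`, and `k` because `°` does not.
    -- The hub is `l`, which touches `i` and `k` in the cycle and `j` by hypothesis.
    core : ¬ Meets k -> Meets l -> Goal
    core ¬k (a , b , o , pb , e) = inr (paint X? aux φ , l , i , j , k , record
     { four = swap₁₂ (swap₂₃ (swap₃₄ four)) ; model = erase X? model XU (λ _ ()) rest ; s = v
     ; spare = Rooted-≃ (paint-in X?) (λ q -> [ fst , (λ (_ , q) -> absurd (nosp q)) ]′ (paint-inv X? q)) RX
     ; hi = keep X? tli (off (λ e -> jl (sym e))) (off ij)
     ; hj = b , a , away (λ e -> jl (sym e)) pb , out o , Esym e
     ; hk = Touch-sym (keep X? tkl (off (λ e -> jk (sym e))) (off (λ e -> jl (sym e))))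
     ; si = v , u , paint-in X? v∈X , away ij pu , Esym uv
     ; sj = let a , b , xa , ob , e = link in a , b , paint-in X? xa , out ob , e
     ; sk = let a , b , xa , pb , e = seesX tjk ¬k in a , b , paint-in X? xa , away (λ e -> jk (sym e)) pb , e })

   -- If what is left of `j` touches neither `k` nor `l`, then `Q` is followed from `j`. It can
   -- leave `j` only to a free vertex, which is progress, or to `i`, to which the same dissection is
   -- then applied. If that leads nowhere either, the part cut from `i` goes to `l` and the part cut
   -- from `j` becomes the fifth set, with hub `l`.
   near : ∀ {P Q i j k l u v} -> Cyc φ P Q i j k l -> Exit φ P i u v -> φ v ≡ rt j -> Goal
   near {P} {Q} {i} {j} {k} {l} {u} {v} C ex vj = c₁ (A.Meets? k)
    where
    module A = Near C ex vj
    C' = flip C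
    c₃ : ¬ A.Meets k -> ¬ A.Meets l -> ∀ {u' w} -> Exit φ Q j u' w -> A.° u' -> φ w ≡ rt i -> Goal
    c₃ ¬k ¬l {u'} {w} ex' o wi = d₁ (B.Meets? l)
     where
     module B = Near C' ex' wi
     d₃ : ¬ B.Meets l -> ¬ B.Meets k -> Goal
     d₃ ¬l' ¬k' = inr (φ₂ , l , i , j , k , record
      { four = swap₁₂ (swap₂₃ (swap₃₄ A.four))
      ; model = repaint B.X? m₁ B.XU l {u = fst (snd sl)} (reroot B.RX (fst (snd (snd sl))))
        (A.away (λ e -> A.jl (sym e)) (fst (snd (snd (snd sl))))) (Esym (snd (snd (snd (snd sl))))) rest₂
      ; s = v
      ; spare = Rooted-≃ (λ x -> trans (paint-out B.X? (XB x)) (paint-in A.X? x))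
        (λ q -> [ (λ ()) , (λ (_ , q) -> [ fst , (λ (_ , q) -> absurd (A.nosp q)) ]′ (paint-inv A.X? q)) ]′ (paint-inv B.X? q)) A.RX
      ; hi = let a , b , xa , ob , e = B.link in a , b , paint-in B.X? xa , ini ob , e
      ; hj = w , u' , paint-in B.X? B.v∈X , inj' o , Esym (fst (snd ex'))
      ; hk = let b , a , pb , pa , e = A.tkl in a , b , at (λ e -> A.jl (sym e)) (λ e -> A.il (sym e)) pa , at (λ e -> A.jk (sym e)) (λ e -> A.ik (sym e)) pb , Esym e
      ; si = v , u , insp A.v∈X , ini (u∈ (A.p0)) , Esym A.uv
      ; sj = let a , b , xa , ob , e = A.link in a , b , insp xa , inj' ob , e
      ; sk = let a , b , xa , pb , e = A.seesX A.tjk ¬k in a , b , insp xa , at (λ e -> A.jk (sym e)) (λ e -> A.ik (sym e)) pb , e })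
      where
      φ₁ = paint A.X? aux φ
      φ₂ = paint B.X? (rt l) φ₁
      sl = B.seesX (Touch-sym A.tli) ¬l'
      m₁ : Model φ₁
      m₁ = erase A.X? A.model A.XU (λ _ ()) A.rest
      XB : ∀ {w} -> A.X w -> ¬ B.X w
      XB (e , _) (e' , _) = A.ij (rt-inj (trans (sym e') e))
      rest₂ : ∀ x -> x ≢ l -> Rooted (λ w -> φ₁ w ≡ rt x × ¬ B.X w) (r x)
      rest₂ x ne with x ≟ i
      ... | yes refl = Rooted-≃ (λ (e , n) -> A.away A.ij e , n)
         (λ (e , n) -> [ (λ ()) , (λ (_ , q) -> q) ]′ (paint-inv A.X? e) , n) (B.rest x)
      ... | no x≢i = untouched B.X? (conn m₁ x) λ { (e , _) q -> x≢i (rt-inj (trans (sym q) (A.away A.ij e))) }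
      ini : ∀ {y} -> B.° y -> φ₂ y ≡ rt i
      ini o = let a , b = B.°U o in trans (paint-out B.X? b) (A.away A.ij a)
      inj' : ∀ {y} -> A.° y -> φ₂ y ≡ rt j
      inj' o = trans (paint-out B.X? λ (e , _) -> A.ij (rt-inj (trans (sym e) (fst (A.°⊂ o))))) (A.out o)
      insp : ∀ {y} -> A.X y -> φ₂ y ≡ aux
      insp x = trans (paint-out B.X? (XB x)) (paint-in A.X? x)
      at : ∀ {x y} -> x ≢ j -> x ≢ i -> φ y ≡ rt x -> φ₂ y ≡ rt x
      at nj ni q = trans (paint-out B.X? λ (e , _) -> ni (rt-inj (trans (sym q) e))) (A.away nj q)
      u∈ : ∀ {y} -> W E (λ w -> P w × φ w ≡ rt i) (r i) y -> B.° y
      u∈ = W-mono λ (p , e) -> e , λ q -> A.dis p (fst (B.p⊂ q))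
     d₂ : ¬ B.Meets l -> Dec (B.Meets k) -> Goal
     d₂ ¬l' (yes mk) = B.core ¬l' mk
     d₂ ¬l' (no ¬k') = d₃ ¬l' ¬k'
     d₁ : Dec (B.Meets l) -> Goal
     d₁ (yes ml) = B.shift ml
     d₁ (no ¬l') = d₂ ¬l' (B.Meets? k)
    c₂ : ¬ A.Meets k -> ¬ A.Meets l -> Goal
    c₂ ¬k ¬l with exit C'
    ... | u' , w , ex'@(q0 , e , qw , ne) = go (φ w) refl
     where
     o : A.° u'
     o = W-mono (λ (q , e) -> e , λ p -> A.dis (fst (A.p⊂ p)) q) q0
     go : ∀ c -> φ w ≡ c -> Goal
     go aux eq = absurd (A.nosp eq)
     go fr eq = stray C' ex' eq
     go (rt x) eq with A.all x
     ... | inl refl = c₃ ¬k ¬l ex' o eq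
     ... | inr (inl refl) = absurd (ne eq)
     ... | inr (inr (inl refl)) = absurd (¬k (u' , w , o , eq , e))
     ... | inr (inr (inr refl)) = absurd (¬l (u' , w , o , eq , e))
    c₁' : ¬ A.Meets k -> Dec (A.Meets l) -> Goal
    c₁' ¬k (yes ml) = A.core ¬k ml
    c₁' ¬k (no ¬l) = c₂ ¬k ¬l
    c₁ : Dec (A.Meets k) -> Goal
    c₁ (yes mk) = A.shift mk
    c₁ (no ¬k) = c₁' ¬k (A.Meets? l)

   settle : ∀ {P Q i j k l} -> Cyc φ P Q i j k l -> Goal ⊎ Touch φ (rt i) (rt k)
   settle {i = i} C with exit C
   ... | u , v , ex = go (φ v) refl
    where
    open Cyc C
    pu = snd (W-end∈ (base Pi , base (conn model i)) (fst ex))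
    go : ∀ c -> φ v ≡ c -> Goal ⊎ Touch φ (rt _) (rt _)
    go aux eq = absurd (nosp eq)
    go fr eq = inl (stray C ex eq)
    go (rt x) eq with Four.all four x
    ... | inl refl = absurd (snd (snd (snd ex)) eq)
    ... | inr (inl refl) = inl (near C ex eq)
    ... | inr (inr (inl refl)) = inr (u , v , pu , eq , fst (snd ex))
    ... | inr (inr (inr refl)) = inl (near (mirror C) ex eq)

  cycle : ∀ f {φ P Q i j k l} -> μ φ < f -> Cyc φ P Q i j k l -> Goal
  cycle zero lt C = absurd (n≮0 lt)
  cycle (suc f) {φ} lt C = both (settle rec C) (settle rec (flip C))
   where
   open Cyc C
   rec : ∀ {φ'} -> μ φ' < μ φ -> ∀ {P Q i j k l} -> Cyc φ' P Q i j k l -> Goal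
   rec lt' = cycle f (≤-trans lt' (≤-pred lt))
   both : Goal ⊎ Touch φ (rt _) (rt _) -> Goal ⊎ Touch φ (rt _) (rt _) -> Goal
   both (inl g) _ = g
   both (inr _) (inl g) = g
   both (inr ik) (inr jl) = inl (k4 four model tij ik (Touch-sym tli) tjk jl tkl)

abstract
 fourth : ∀ i j k -> i ≢ j -> i ≢ k -> j ≢ k -> ∃ λ l -> Four i j k l
 fourth i j k ij ik jk = let l , il , jl , kl , a = tbl i j k ij ik jk in l , record { ij = ij ; ik = ik ; il = il ; jk = jk ; jl = jl ; kl = kl ; all = a }
  where
  tbl : ∀ (i j k : Fin 4) -> i ≢ j -> i ≢ k -> j ≢ k -> ∃ λ l -> i ≢ l × j ≢ l × k ≢ l × ∀ x -> x ≡ i ⊎ x ≡ j ⊎ x ≡ k ⊎ x ≡ l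
  dec : Dec (∀ (i j k : Fin 4) -> i ≢ j -> i ≢ k -> j ≢ k -> ∃ λ l -> i ≢ l × j ≢ l × k ≢ l × ∀ x -> x ≡ i ⊎ x ≡ j ⊎ x ≡ k ⊎ x ≡ l)
  dec = all? λ i -> all? λ j -> all? λ k -> ¬? (i ≟ j) →? (¬? (i ≟ k) →? (¬? (j ≟ k) →?
   any? λ l -> ¬? (i ≟ l) ×? (¬? (j ≟ l) ×? (¬? (k ≟ l) ×? all? λ x -> (x ≟ i) ⊎? ((x ≟ j) ⊎? ((x ≟ k) ⊎? (x ≟ l)))))))
  tbl = toWitness {a? = dec} _

-- Reducing the class A pattern

module Shrink {n : ℕ} (E : Fin n -> Fin n -> Set) (E? : Dec₂ E) (Esym : ∀ {u v} -> E u v -> E v u)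
       (U : Fin n -> Set) (U? : Dec₁ U) (r : Fin 4 -> Fin n) where
 open Minors E E? Esym U r public

 avoid : ∀ {S : V -> Set} {z w x} -> ¬ W E S z w -> W E S z x -> W E (S ∖ w) z x
 avoid {S} {z} {w} n p = W-mono (λ (s , q) -> s , λ { refl -> n q }) (W-keep (W E S z) (λ q e s -> q ∙ edge e s) ε p)

 approach : ∀ {D : V -> Set} {z v} -> Rooted D z -> D v -> v ≢ z -> ∃ λ w -> W E (D ∖ v) z w × D w × w ≢ v × E w v
 approach {D} {z} {v} R dv ne with W-first (_≟ v) (reach R dv) refl
 ... | _ , refl , inl e = absurd (ne (sym e))
 ... | _ , refl , inr (_ , w , q , e , _) = let d , m = W-end∈ (base R , λ e -> ne (sym e)) q in w , q , d , m , e

 -- If deleting `v` cuts `w` off from the root, pass to `w`. Whatever reached the root without `v`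
 -- still does so without `w`, and `v` now does as well, so fewer vertices are lost.
 noncut : ∀ {D : V -> Set} -> Dec₁ D -> ∀ {z w} -> Rooted D z -> D w -> w ≢ z -> ∃ λ v -> D v × v ≢ z × Rooted (D ∖ v) z
 noncut {D} D? {z} {w} R dw ne = go _ w dw ne ≤-refl
  where
  open import Data.Nat.Properties using (≤-refl)
  Lost : V -> V -> Set
  Lost v x = (D ∖ v) x × ¬ W E (D ∖ v) z x
  Lost? : ∀ v -> Dec₁ (Lost v)
  Lost? v x = ∖? D? v x ×? ¬? (W? E? (∖? D? v) z x)
  go : ∀ f v -> D v -> v ≢ z -> cnt (Lost? v) < f -> ∃ λ v -> D v × v ≢ z × Rooted (D ∖ v) z
  go zero v dv ne lt = absurd (n≮0 lt)
  go (suc f) v dv ne lt with any? (Lost? v)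
  ... | no none = v , dv , ne , record { base = base R , λ e -> ne (sym e) ; reach = λ {x} d -> stable (W? E? (∖? D? v) z x) λ q -> none (x , d , q) }
  ... | yes (w , (dw , w≢v) , lw) = go f w dw (λ { refl -> lw ε })
      (≤-trans (cnt-strict (Lost? w) (Lost? v) sub w ((dw , w≢v) , lw) λ ((_ , n) , _) -> n refl) (≤-pred lt))
   where
   up : ∀ {x} -> W E (D ∖ v) z x -> W E (D ∖ w) z x
   up q = W-mono (λ ((d , _) , m) -> d , m) (avoid lw q)
   zv : W E (D ∖ w) z v
   zv = let a , q , _ , _ , e = approach R dv ne in up q ∙ edge e (dv , λ e -> w≢v (sym e))
   sub : ∀ {x} -> Lost w x -> Lost v x
   sub {x} ((dx , x≢w) , lx) = (dx , λ { refl -> lx zv }) , λ q -> lx (up q)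

 -- The fifth set and the set of the hub `h`; the other three branch sets are the leaves of the
 -- pattern.
 Thick : Fin 4 -> Part -> Set
 Thick h c = c ≡ aux ⊎ c ≡ rt h

 record Core (φ : V -> Part) (h : Fin 4) : Set where
  field
   model : Model φ
   s     : V
   spare : Rooted (Cl φ aux) s
   meet  : ∀ {c x} -> Thick h c -> x ≢ h -> Touch φ c (rt x)

 fromA : ∀ {φ h i j k} -> ACore φ h i j k -> Core φ h
 fromA {φ} {h} C = record { model = model ; s = s ; spare = spare ; meet = λ { (inl refl) ne -> go₁ (Four.all four _) ne ; (inr refl) ne -> go₂ (Four.all four _) ne } }
  where
  open ACore C
  go₁ : ∀ {x} -> x ≡ h ⊎ x ≡ _ ⊎ x ≡ _ ⊎ x ≡ _ -> x ≢ h -> Touch φ aux (rt x)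
  go₁ (inl e) ne = absurd (ne e)
  go₁ (inr (inl refl)) _ = si
  go₁ (inr (inr (inl refl))) _ = sj
  go₁ (inr (inr (inr refl))) _ = sk
  go₂ : ∀ {x} -> x ≡ h ⊎ x ≡ _ ⊎ x ≡ _ ⊎ x ≡ _ -> x ≢ h -> Touch φ (rt h) (rt x)
  go₂ (inl e) ne = absurd (ne e)
  go₂ (inr (inl refl)) _ = hi
  go₂ (inr (inr (inl refl))) _ = hj
  go₂ (inr (inr (inr refl))) _ = hk

 Closed : (V -> Part) -> Fin 4 -> V -> V -> Set
 Closed φ x v s = ∀ {u w} -> φ u ≡ rt x -> E u w -> U w -> φ w ≡ rt x ⊎ w ≡ v ⊎ w ≡ s

 record StarCore (φ : V -> Part) (h : Fin 4) (s : V) : Set where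
  field
   model  : Model φ
   s-sp   : φ s ≡ aux
   closed : ∀ {x} -> x ≢ h -> Closed φ x (r h) s

 -- The sets of the roots `x` and `y` are cut off by `v` and `s`. As `v` is not the root of `h`,
 -- class A need not hold, and the cut is used instead.
 record Cut (φ : V -> Part) (h x y k : Fin 4) (v s : V) : Set where
  field
   four  : Four h x y k
   model : Model φ
   s-sp  : φ s ≡ aux
   v-h   : φ v ≡ rt h
   v≢    : v ≢ r h
   cx    : Closed φ x v s
   cy    : Closed φ y v s
   xv    : ∃ λ b -> φ b ≡ rt x × E v b
   xs    : ∃ λ b -> φ b ≡ rt x × E s b
   yv    : ∃ λ b -> φ b ≡ rt y × E v b
   ys    : ∃ λ b -> φ b ≡ rt y × E s b

 data Res : Set where
  k4!  : K4 -> Res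
  star : ∀ {φ h s} -> StarCore φ h s -> Res
  cut  : ∀ {φ h x y k v s} -> Cut φ h x y k v s -> Res

 module Hub {φ : V -> Part} {h : Fin 4} (C : Core φ h) where
  open Core C

  leaf≢ : ∀ {c x} -> Thick h c -> x ≢ h -> c ≢ rt x
  leaf≢ (inl refl) _ ()
  leaf≢ (inr refl) ne refl = ne refl

  -- Give the fifth set to the remaining leaf `k`. Then `k` touches the other leaves through it, and
  -- the hub touches all three.
  joined : ∀ {x y} -> x ≢ h -> y ≢ h -> x ≢ y -> Touch φ (rt x) (rt y) -> K4
  joined {x} {y} xh yh xy t = k4 {φ = paint S? (rt k) φ} F (repaint S? model (λ e -> alive model λ q -> sp≢fr (trans (sym e) q)) k {x = fst skt} (reroot spare (fst (snd (snd skt))))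
      (fst (snd (snd (snd skt)))) (Esym (snd (snd (snd (snd skt))))) λ j _ -> untouched S? (conn model j) λ e q -> sp≢rt (trans (sym e) q))
     (kp (meet (inr refl) xh)) (kp (meet (inr refl) yh)) (kp (meet (inr refl) λ e -> Four.il F (sym e))) (kp t) (into (meet (inl refl) xh)) (into (meet (inl refl) yh))
   where
   K = fourth h x y (λ e -> xh (sym e)) (λ e -> yh (sym e)) xy
   k = fst K
   F = snd K
   sp≢rt : ∀ {j} -> aux ≢ rt j
   sp≢rt ()
   sp≢fr : aux ≢ fr
   sp≢fr ()
   S? : Dec₁ (λ w -> φ w ≡ aux)
   S? w = φ w ≟ₚ aux
   skt : ∃₂ λ u v -> φ u ≡ aux × φ v ≡ rt k × E u v
   skt = meet (inl refl) λ e -> Four.il F (sym e)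
   kp : ∀ {a b} -> Touch φ (rt a) (rt b) -> Touch (paint S? (rt k) φ) (rt a) (rt b)
   kp t = keep S? t (λ e q -> absurd (sp≢rt (trans (sym e) q))) (λ e q -> absurd (sp≢rt (trans (sym e) q)))
   into : ∀ {a} -> Touch φ aux (rt a) -> Touch (paint S? (rt k) φ) (rt a) (rt k)
   into (u , v , p , q , e) = v , u , stay S? q (λ e -> absurd (sp≢rt (trans (sym e) q))) , paint-in S? p , Esym e

  Meets : Part -> V -> Fin 4 -> Set
  Meets c v x = ∃₂ λ a b -> (φ a ≡ c × a ≢ v) × φ b ≡ rt x × E a b
  Meets? : ∀ c v x -> Dec (Meets c v x)
  Meets? c v x = any? λ a -> any? λ b -> ((φ a ≟ₚ c) ×? ¬? (a ≟ v)) ×? ((φ b ≟ₚ rt x) ×? E? a b)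

  only : ∀ {c v x} -> Thick h c -> x ≢ h -> ¬ Meets c v x -> ∃ λ b -> φ b ≡ rt x × E v b
  only {c} {v} {x} t xh n = go (meet t xh)
   where
   go : Touch φ c (rt x) -> ∃ λ b -> φ b ≡ rt x × E v b
   go (a , b , pa , pb , e) with a ≟ v
   ... | yes refl = b , pb , e
   ... | no ne = absurd (n (a , b , (pa , ne) , pb , e))

 wtA : Fin 4 -> (V -> Part) -> V -> Set
 wtA h ψ v = ψ v ≡ fr ⊎ Thick h (ψ v)
 wtA? : ∀ h ψ -> Dec₁ (wtA h ψ)
 wtA? h ψ v = (ψ v ≟ₚ fr) ⊎? ((ψ v ≟ₚ aux) ⊎? (ψ v ≟ₚ rt h))
 wtB : Fin 4 -> (V -> Part) -> V -> Set
 wtB h ψ v = Thick h (ψ v)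
 wtB? : ∀ h ψ -> Dec₁ (wtB h ψ)
 wtB? h ψ v = (ψ v ≟ₚ aux) ⊎? (ψ v ≟ₚ rt h)

 -- A vertex weighs two in a thick set, one if free and nothing in a leaf, so freeing a thick vertex
 -- or feeding any vertex to a leaf is progress.
 wt : Fin 4 -> (V -> Part) -> ℕ
 wt h ψ = cnt (wtA? h ψ) + cnt (wtB? h ψ)

 unThick : ∀ {h x} -> x ≢ h -> ¬ Thick h (rt x)
 unThick ne (inl ())
 unThick ne (inr refl) = ne refl

 module _ {X : V -> Set} (X? : Dec₁ X) {φ : V -> Part} {h : Fin 4} where
  wt-leaf : ∀ {x v} -> x ≢ h -> X v -> wtA h φ v -> wt h (paint X? (rt x) φ) < wt h φ
  wt-leaf {x} {v} ne xv av = +-mono-<-≤ (cnt-strict (wtA? h φ') (wtA? h φ) a v av (λ q -> nA (subst (λ c -> c ≡ fr ⊎ Thick h c) (paint-in X? xv) q)))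
                     (cnt-mono (wtB? h φ') (wtB? h φ) b)
   where
   φ' = paint X? (rt x) φ
   nA : ¬ (rt x ≡ fr ⊎ Thick h (rt x))
   nA (inr t) = unThick ne t
   a : ∀ {w} -> wtA h φ' w -> wtA h φ w
   a {w} q with X? w
   ... | yes _ = absurd (nA q)
   ... | no _ = q
   b : ∀ {w} -> Thick h (φ' w) -> Thick h (φ w)
   b {w} q with X? w
   ... | yes _ = absurd (unThick ne q)
   ... | no _ = q

  wt-free : ∀ {v} -> X v -> (∀ {w} -> X w -> Thick h (φ w)) -> wt h (paint X? fr φ) < wt h φ
  wt-free {v} xv f = +-mono-≤-< (cnt-mono (wtA? h φ') (wtA? h φ) a) (cnt-strict (wtB? h φ') (wtB? h φ) b v (f xv) λ q -> nB (subst (Thick h) (paint-in X? xv) q))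
   where
   φ' = paint X? fr φ
   nB : ¬ Thick h fr
   nB (inl ())
   nB (inr ())
   a : ∀ {w} -> wtA h φ' w -> wtA h φ w
   a {w} q with X? w
   ... | yes x = inr (f x)
   ... | no _ = q
   b : ∀ {w} -> Thick h (φ' w) -> Thick h (φ w)
   b {w} q with X? w
   ... | yes _ = absurd (nB q)
   ... | no _ = q

 single : ∀ v -> Rooted (_≡ v) v
 single v = record { base = refl ; reach = λ { refl -> ε } }

 module _ {φ : V -> Part} {h : Fin 4} (C : Core φ h) (rec : ∀ {φ'} -> wt h φ' < wt h φ -> Core φ' h -> Res) where
  open Core C
  open Hub C

  absorb : ∀ {x u v} -> x ≢ h -> φ u ≡ rt x -> E u v -> U v -> φ v ≡ fr -> Res
  absorb {x} {u} {v} xh pu e uv pv = rec (wt-leaf (_≟ v) xh refl (inl pv)) record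
   { model = repaint (_≟ v) model (λ { refl -> uv }) x (single v) pu e λ j _ -> untouched (_≟ v) (conn model j) λ { refl q -> no! (trans (sym pv) q) }
   ; s = s ; spare = leave (_≟ v) (λ ()) (untouched (_≟ v) spare λ { refl q -> nosp (trans (sym pv) q) })
   ; meet = λ { t ne -> keep (_≟ v) (meet t ne) (λ { refl q -> absurd (nt t (trans (sym pv) q)) }) (λ { refl q -> absurd (no! (trans (sym pv) q)) }) } }
   where
   no! : ∀ {j} -> fr ≢ rt j
   no! ()
   nosp : fr ≢ aux
   nosp ()
   nt : ∀ {c} -> Thick h c -> fr ≢ c
   nt (inl refl) ()
   nt (inr refl) ()

  module Thin {c z v} (t : Thick h c) (R : Rooted (Cl φ c) z) (pv : φ v ≡ c) (v≢z : v ≢ z) (R' : Rooted (Cl φ c ∖ v) z)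
        (roots : ∀ j -> c ≡ rt j -> z ≡ r j) (spares : c ≡ aux -> z ≡ s) where
   v∉ : ∀ {d} -> d ≢ c -> ∀ {w} -> w ≡ v -> φ w ≢ d
   v∉ ne refl q = ne (trans (sym q) pv)
   vU : ∀ {w} -> w ≡ v -> U w
   vU refl = alive model λ q -> nt t (trans (sym q) pv)
    where
    nt : Thick h c -> fr ≢ c
    nt (inl refl) ()
    nt (inr refl) ()
   rootsR : ∀ j -> Rooted (λ w -> φ w ≡ rt j × ¬ (w ≡ v)) (r j)
   rootsR j with c ≟ₚ rt j
   ... | yes refl = subst (Rooted _) (roots j refl) R'
   ... | no ne = untouched (_≟ v) (conn model j) (v∉ λ q -> ne (sym q))
   spareR : Rooted (λ w -> φ w ≡ aux × ¬ (w ≡ v)) s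
   spareR with c ≟ₚ aux
   ... | yes refl = subst (Rooted _) (spares refl) R'
   ... | no ne = untouched (_≟ v) spare (v∉ λ q -> ne (sym q))

   build : ∀ {e} -> (∀ {d} -> Thick h d -> e ≢ d) -> Model (paint (_≟ v) e φ) -> (∀ y -> y ≢ h -> Meets c v y ⊎ e ≡ rt y) -> Core (paint (_≟ v) e φ) h
   build {e} ne m ms = record { model = m ; s = s ; spare = leave (_≟ v) (ne (inl refl)) spareR ; meet = mt }
    where
    mt : ∀ {d y} -> Thick h d -> y ≢ h -> Touch (paint (_≟ v) e φ) d (rt y)
    mt {d} {y} td yh with d ≟ₚ c
    ... | no d≢c = keep (_≟ v) (meet td yh) (λ { refl q -> absurd (d≢c (trans (sym q) pv)) }) (λ { refl q -> absurd (leaf≢ t yh (trans (sym pv) q)) })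
    ... | yes refl with ms y yh
    ... | inl (a , b , (pa , av) , pb , ab) = a , b , trans (paint-out (_≟ v) av) pa , stay (_≟ v) {φ = φ} {v = b} pb (λ { refl -> absurd (leaf≢ t yh (trans (sym pv) pb)) }) , ab
    ... | inr refl = let w , _ , pw , wv , e' = approach R pv v≢z in w , v , trans (paint-out (_≟ v) wv) pw , paint-in (_≟ v) refl , e'

   drop : (∀ y -> y ≢ h -> Meets c v y) -> Res
   drop ms = rec (wt-free (_≟ v) refl λ { refl -> subst (Thick h) (sym pv) t }) (build ne (erase (_≟ v) model vU (λ _ ()) rootsR) λ y yh -> inl (ms y yh))
    where
    ne : ∀ {d} -> Thick h d -> fr ≢ d
    ne (inl refl) ()
    ne (inr refl) ()

   give : ∀ {x} -> x ≢ h -> ¬ Meets c v x -> (∀ y -> y ≢ h -> y ≢ x -> Meets c v y) -> Res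
   give {x} xh nm ms = rec (wt-leaf (_≟ v) xh refl (inr (subst (Thick h) (sym pv) t)))
    (build (λ td q -> leaf≢ td xh (sym q)) (let b , pb , e = only t xh nm in repaint (_≟ v) model vU x (single v) pb (Esym e) λ j _ -> rootsR j) mm)
    where
    mm : ∀ y -> y ≢ h -> Meets c v y ⊎ rt x ≡ rt y
    mm y yh with y ≟ x
    ... | yes refl = inr refl
    ... | no ne = inl (ms y yh ne)

   -- If every leaf still sees the thick set without `v`, then `v` is freed; if exactly one leaf
   -- depends on `v`, it receives `v`. Only two dependent leaves need another treatment.
   thin : (∀ {x y} -> x ≢ h -> y ≢ h -> x ≢ y -> ¬ Meets c v x -> ¬ Meets c v y -> Res) -> Res
   thin two with any? (λ x -> ¬? (x ≟ h) ×? ¬? (Meets? c v x))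
   ... | no none = drop λ y yh -> stable (Meets? c v y) λ q -> none (y , yh , q)
   ... | yes (x , xh , nx) with any? (λ y -> (¬? (y ≟ h) ×? ¬? (y ≟ x)) ×? ¬? (Meets? c v y))
   ... | no none = give xh nx λ y yh yx -> stable (Meets? c v y) λ q -> none (y , (yh , yx) , q)
   ... | yes (y , (yh , yx) , ny) = two xh yh (λ e -> yx (sym e)) nx ny

  -- With two leaves depending on `v`, the vertex `v` alone takes over as the fifth set. The rest
  -- goes to the third leaf `k`, or is freed if `k` depends on `v` as well. The hub allows no such
  -- move, since it has to keep its root; there the outcome is a cut.
  pinch : ∀ {v x y} -> φ v ≡ aux -> v ≢ s -> Rooted (Cl φ aux ∖ v) s -> x ≢ h -> y ≢ h -> x ≢ y -> ¬ Meets aux v x -> ¬ Meets aux v y -> Res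
  pinch {v} {x} {y} pv vs R' xh yh xy nx ny = go (fourth h x y (λ e -> xh (sym e)) (λ e -> yh (sym e)) xy)
   where
   X : V -> Set
   X = Cl φ aux ∖ v
   X? : Dec₁ X
   X? = ∖? (λ w -> φ w ≟ₚ aux) v
   XU : ∀ {w} -> X w -> U w
   XU (e , _) = alive model λ q -> no! (trans (sym e) q)
    where
    no! : aux ≢ fr
    no! ()
   cl : ∀ {d} -> d ≢ aux -> ∀ {w} -> X w -> φ w ≢ d
   cl ne (e , _) q = ne (trans (sym q) e)
   vX : ¬ X v
   vX (_ , n) = n refl
   build : ∀ {e} -> (∀ {d} -> Thick h d -> e ≢ d) -> Model (paint X? e φ) -> (∀ y -> y ≢ h -> (∃ λ b -> φ b ≡ rt y × E v b) ⊎ e ≡ rt y) -> Core (paint X? e φ) h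
   build {e} ne m ms = record { model = m ; s = v
    ; spare = Rooted-≃ (λ { refl -> trans (paint-out X? vX) pv })
      (λ {w} q -> [ (λ (_ , q) -> absurd (ne (inl refl) q)) , (λ (nx , q) -> stable (w ≟ v) λ n -> nx (q , n)) ]′ (paint-inv X? q)) (single v)
    ; meet = mt }
    where
    mt : ∀ {d y} -> Thick h d -> y ≢ h -> Touch (paint X? e φ) d (rt y)
    mt (inr refl) yh = keep X? (meet (inr refl) yh) (λ x q -> absurd (cl (λ ()) x q)) (λ x q -> absurd (cl (λ ()) x q))
    mt {y = y} (inl refl) yh with ms y yh
    ... | inl (b , pb , e') = v , b , trans (paint-out X? vX) pv , stay X? {φ = φ} {v = b} pb (λ x -> absurd (cl (λ ()) x pb)) , e'
    ... | inr refl = let w , _ , pw , wv , e' = approach spare pv vs in v , w , trans (paint-out X? vX) pv , paint-in X? (pw , wv) , Esym e'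
   go : (∃ λ k -> Four h x y k) -> Res
   go (k , F) with Meets? aux v k
   ... | no nk = rec (wt-free X? (base R') λ (e , _) -> inl e)
       (build (λ { (inl refl) () ; (inr refl) () }) (erase X? model XU (λ _ ()) λ j -> untouched X? (conn model j) (cl λ ())) mm)
    where
    mm : ∀ z -> z ≢ h -> (∃ λ b -> φ b ≡ rt z × E v b) ⊎ fr ≡ rt z
    mm z zh with Four.all F z
    ... | inl e = absurd (zh e)
    ... | inr (inl refl) = inl (only (inl refl) zh nx)
    ... | inr (inr (inl refl)) = inl (only (inl refl) zh ny)
    ... | inr (inr (inr refl)) = inl (only (inl refl) zh nk)
   ... | yes (a , b , (pa , av) , pb , e) = rec (wt-leaf X? (λ q -> Four.il F (sym q)) (base R') (inr (inl (fst (base R')))))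
       (build (λ td q -> leaf≢ td (λ q -> Four.il F (sym q)) (sym q)) (repaint X? model XU k (reroot R' (pa , av)) pb (Esym e) λ j _ -> untouched X? (conn model j) (cl λ ())) mm)
    where
    mm : ∀ z -> z ≢ h -> (∃ λ b -> φ b ≡ rt z × E v b) ⊎ rt k ≡ rt z
    mm z zh with Four.all F z
    ... | inl e = absurd (zh e)
    ... | inr (inl refl) = inl (only (inl refl) zh nx)
    ... | inr (inr (inl refl)) = inl (only (inl refl) zh ny)
    ... | inr (inr (inr refl)) = inr refl

  module _ (nt : ∀ {x y} -> x ≢ h -> y ≢ h -> x ≢ y -> ¬ Touch φ (rt x) (rt y))
       (nf : ∀ {x u v} -> x ≢ h -> φ u ≡ rt x -> E u v -> U v -> φ v ≢ fr) where
   closure : ∀ {x v s'} -> x ≢ h -> (∀ {u w} -> φ u ≡ rt x -> E u w -> φ w ≡ rt h -> w ≡ v) -> (∀ {w} -> φ w ≡ aux -> w ≡ s') -> Closed φ x v s'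
   closure {x} {v} {s'} xh fh fs {u} {w} pu e uw = go (φ w) refl
    where
    go : ∀ c -> φ w ≡ c -> φ w ≡ rt x ⊎ w ≡ v ⊎ w ≡ s'
    go aux q = inr (inr (fs q))
    go fr q = absurd (nf xh pu e uw q)
    go (rt y) q with y ≟ x | y ≟ h
    ... | yes refl | _ = inl q
    ... | no _ | yes refl = inr (inl (fh pu e q))
    ... | no yx | no yh = absurd (nt xh yh (λ q -> yx (sym q)) (u , w , pu , q , e))

   thicks : Res
   thicks with any? (λ w -> (φ w ≟ₚ aux) ×? ¬? (w ≟ s))
   ... | yes (w , pw , ws) = let v , pv , vs , R' = noncut (λ w -> φ w ≟ₚ aux) spare pw ws in
       Thin.thin (inl refl) spare pv vs R' (λ _ ()) (λ _ -> refl) (pinch pv vs R')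
   ... | no none = hub (any? λ w -> (φ w ≟ₚ rt h) ×? ¬? (w ≟ r h))
    where
    sp⊂s : ∀ {w} -> φ w ≡ aux -> w ≡ s
    sp⊂s {w} q = stable (w ≟ s) λ n -> none (w , q , n)
    hub : Dec (∃ λ w -> φ w ≡ rt h × w ≢ r h) -> Res
    hub (no none') = star record { model = model ; s-sp = base spare
     ; closed = λ xh -> closure xh (λ {_} {w} _ _ q -> stable (w ≟ r h) λ n -> none' (w , q , n)) sp⊂s }
    hub (yes (w , pw , wh)) = let v , pv , vh , R' = noncut (λ w -> φ w ≟ₚ rt h) (conn model h) pw wh in
     Thin.thin (inr refl) (conn model h) pv vh R' (λ { _ refl -> refl }) (λ ()) (two pv vh)
     where
     two : ∀ {v x y} -> φ v ≡ rt h -> v ≢ r h -> x ≢ h -> y ≢ h -> x ≢ y -> ¬ Meets (rt h) v x -> ¬ Meets (rt h) v y -> Res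
     two {v} {x} {y} pv vh xh yh xy nx ny = let k , F = fourth h x y (λ e -> xh (sym e)) (λ e -> yh (sym e)) xy in cut {k = k} record
      { four = F ; model = model ; s-sp = base spare ; v-h = pv ; v≢ = vh
      ; cx = closure xh (λ {u} {w} pu e q -> stable (w ≟ v) λ n -> nx (w , u , (q , n) , pu , Esym e)) sp⊂s
      ; cy = closure yh (λ {u} {w} pu e q -> stable (w ≟ v) λ n -> ny (w , u , (q , n) , pu , Esym e)) sp⊂s
      ; xv = only (inr refl) xh nx ; yv = only (inr refl) yh ny
      ; xs = sees xh ; ys = sees yh }
      where
      sees : ∀ {x} -> x ≢ h -> ∃ λ b -> φ b ≡ rt x × E s b
      sees {x} xh with meet (inl refl) xh
      ... | a , b , pa , pb , e with sp⊂s pa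
      ... | refl = b , pb , e

  core-step : Res
  core-step with any? (λ x -> any? λ y -> (¬? (x ≟ h) ×? (¬? (y ≟ h) ×? ¬? (x ≟ y))) ×? Touch? φ (rt x) (rt y))
  ... | yes (x , y , (xh , yh , xy) , t) = k4! (joined xh yh xy t)
  ... | no nt with any? (λ x -> any? λ u -> any? λ v -> (¬? (x ≟ h) ×? (φ u ≟ₚ rt x)) ×? (E? u v ×? (U? v ×? (φ v ≟ₚ fr))))
  ... | yes (x , u , v , (xh , pu) , e , uv , pv) = absorb xh pu e uv pv
  ... | no nf = thicks (λ xh yh xy t -> nt (_ , _ , (xh , yh , xy) , t)) (λ xh pu e uv q -> nf (_ , _ , _ , (xh , pu) , e , uv , q))

 core : ∀ f {φ h} -> wt h φ < f -> Core φ h -> Res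
 core zero lt C = absurd (n≮0 lt)
 core (suc f) lt C = core-step C λ lt' C' -> core f (≤-trans lt' (≤-pred lt)) C'

-- Labelling vertices by vertices and triangles of `H`

Label : ℕ -> Set
Label m = Fin m ⊎ Tri m

Sym : ∀ {m} -> Adj m -> Set
Sym A = ∀ x y -> A x y ≡ A y x

LAdj-sym : ∀ {m} {A : Adj m} -> Sym A -> ∀ k l -> LAdj A k l -> LAdj A l k
LAdj-sym S (inl i) (inl j) e = trans (S j i) e
LAdj-sym S (inl i) (inr t) e = e
LAdj-sym S (inr t) (inl i) e = e
LAdj-sym S (inr t) (inr u) e h = ⇔-sym (e h)

module _ {m} {P : Graph m} {p q r s : Fin m} (Q : PlaneQuad P p q r s) where
 open PlaneQuad Q

 private
  A = adj P
  noloop : ∀ {x} -> ¬ (x ∼[ A ] x)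
  noloop {x} e with trans (sym (Graph.irrefl P x)) e
  ... | ()
  face : ∀ {i j} -> i ∼[ A ] j -> (∃ λ T -> IsTriangle A T × i ∈₃ T × j ∈₃ T) ⊎ (i , j) ∈ cpairs (p ∷ q ∷ r ∷ s ∷ [])
  face {i} {j} e with dartFace i j e
  ... | zero , m = inr m
  ... | suc k , m = inl (tri k , triOK k , go m)
   where
   go : (i , j) ∈ cpairs (triList (tri k)) -> i ∈₃ tri k × j ∈₃ tri k
   go (here refl) = inl refl , inr (inl refl)
   go (there (here refl)) = inr (inl refl) , inr (inr refl)
   go (there (there (here refl))) = inr (inr refl) , inl refl
  outer : ∀ {i j} -> i ∼[ A ] j -> (i , j) ∈ cpairs (p ∷ q ∷ r ∷ s ∷ []) -> (j , i) ∈ cpairs (p ∷ q ∷ r ∷ s ∷ []) -> ⊥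
  outer e (here refl) (here refl) = noloop e
  outer e (here refl) (there (here refl)) = p≢r refl
  outer e (here refl) (there (there (here refl))) = noloop qr
  outer e (here refl) (there (there (there (here refl)))) = q≢s refl
  outer e (there (here refl)) (here refl) = p≢r refl
  outer e (there (here refl)) (there (here refl)) = noloop e
  outer e (there (here refl)) (there (there (here refl))) = q≢s refl
  outer e (there (here refl)) (there (there (there (here refl)))) = noloop rs
  outer e (there (there (here refl))) (here refl) = noloop qr
  outer e (there (there (here refl))) (there (here refl)) = q≢s refl
  outer e (there (there (here refl))) (there (there (here refl))) = noloop e
  outer e (there (there (here refl))) (there (there (there (here refl)))) = p≢r refl
  outer e (there (there (there (here refl)))) (here refl) = q≢s refl
  outer e (there (there (there (here refl)))) (there (here refl)) = noloop rs
  outer e (there (there (there (here refl)))) (there (there (here refl))) = p≢r refl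
  outer e (there (there (there (here refl)))) (there (there (there (here refl)))) = noloop e

 -- The two darts of an edge cannot both lie on the outer 4-cycle, whose vertices are distinct.
 edge-tri : ∀ {i j} -> i ∼[ A ] j -> ∃ λ T -> IsTriangle A T × i ∈₃ T × j ∈₃ T
 edge-tri {i} {j} e with face e | face (trans (Graph.sym P j i) e)
 ... | inl t | _ = t
 ... | inr _ | inl (T , t , a , b) = T , t , b , a
 ... | inr m | inr m' = absurd (outer e m m')

 vertex-tri : ∀ i -> ∃ λ T -> IsTriangle A T × i ∈₃ T
 vertex-tri i with i ≟ p
 ... | yes refl = let T , t , a , _ = edge-tri pq in T , t , a
 ... | no ne = go (connected i p)
  where
  go : Star (λ u w -> u ∼[ A ] w) i p -> ∃ λ T -> IsTriangle A T × i ∈₃ T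
  go ε = absurd (ne refl)
  go (e ◅ _) = let T , t , a , _ = edge-tri e in T , t , a

 -- If one of the labels is itself a triangle, the others are equal or adjacent to it. Otherwise
 -- they are at most three vertices, forming a vertex, an edge or a triangle of the plane graph.
 -- This is how a deleted set finds its `X_T`.
 clique-tri : ∀ (ls : List (Label m)) -> length ls ≤ 3 -> (∀ {k l} -> k ∈ ls -> l ∈ ls -> k ≡ l ⊎ LAdj A k l) -> (∀ {t} -> inr t ∈ ls -> IsTriangle A t) ->
        ∃ λ T -> IsTriangle A T × (∀ {l} -> l ∈ ls -> LAdj A l (inr T))
 clique-tri ls le adj ok = common (hasTri ls)
  where
  hasTri : ∀ (ls : List (Label m)) -> (∃ λ t -> inr t ∈ ls) ⊎ (∃ λ is -> ls ≡ map inl is)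
  hasTri [] = inr ([] , refl)
  hasTri (inr t ∷ ls) = inl (t , here refl)
  hasTri (inl i ∷ ls) with hasTri ls
  ... | inl (t , m) = inl (t , there m)
  ... | inr (is , refl) = inr (i ∷ is , refl)
  go : ∀ is -> length (map inl is) ≤ 3 -> (∀ {k l} -> k ∈ map inl is -> l ∈ map inl is -> k ≡ l ⊎ LAdj A k l) ->
     ∃ λ T -> IsTriangle A T × (∀ {l} -> l ∈ map inl is -> LAdj A l (inr T))
  go [] _ _ = let T , t , _ = vertex-tri p in T , t , λ ()
  go (i ∷ []) _ _ = let T , t , a = vertex-tri i in T , t , λ { (here refl) -> a }
  go (i ∷ j ∷ []) _ f with f (here refl) (there (here refl))
  ... | inl refl = let T , t , a = vertex-tri i in T , t , λ { (here refl) -> a ; (there (here refl)) -> a }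
  ... | inr e = let T , t , a , b = edge-tri e in T , t , λ { (here refl) -> a ; (there (here refl)) -> b }
  go (i ∷ j ∷ k ∷ []) _ f with f (here refl) (there (here refl)) | f (there (here refl)) (there (there (here refl))) | f (here refl) (there (there (here refl)))
  ... | inr a | inr b | inr c = (i , j , k) , (a , b , c) , λ { (here refl) -> inl refl ; (there (here refl)) -> inr (inl refl) ; (there (there (here refl))) -> inr (inr refl) }
  ... | inl refl | inl refl | _ = let T , t , a = vertex-tri i in T , t , λ { (here refl) -> a ; (there (here refl)) -> a ; (there (there (here refl))) -> a }
  ... | inl refl | inr e | _ = let T , t , a , b = edge-tri e in T , t , λ { (here refl) -> a ; (there (here refl)) -> a ; (there (there (here refl))) -> b }
  ... | inr e | inl refl | _ = let T , t , a , b = edge-tri e in T , t , λ { (here refl) -> a ; (there (here refl)) -> b ; (there (there (here refl))) -> b }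
  ... | inr e | inr _ | inl refl = let T , t , a , b = edge-tri e in T , t , λ { (here refl) -> a ; (there (here refl)) -> b ; (there (there (here refl))) -> a }
  go (_ ∷ _ ∷ _ ∷ _ ∷ _) (s≤s (s≤s (s≤s ()))) _
  common : ((∃ λ t -> inr t ∈ ls) ⊎ (∃ λ is -> ls ≡ map inl is)) -> ∃ λ T -> IsTriangle A T × (∀ {l} -> l ∈ ls -> LAdj A l (inr T))
  common (inl (t , m)) = t , ok m , λ {l} m' -> [ (λ { refl -> λ h -> ⇔-id _ }) , (λ e -> e) ]′ (adj m' m)
  common (inr (is , refl)) = go is le adj

-- A labelling of the vertices in U exhibits E, restricted to U, as a spanning subgraph of some H⁺.
record Lab {n} (E : Fin n -> Fin n -> Set) (U : Fin n -> Set) {m} (A : Adj m) : Set where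
 field
  lab   : Fin n -> Label m
  onto  : ∀ i -> ∃ λ v -> U v × lab v ≡ inl i
  inj   : ∀ {u v i} -> U u -> U v -> lab u ≡ inl i -> lab v ≡ inl i -> u ≡ v
  triOK : ∀ {v t} -> U v -> lab v ≡ inr t -> IsTriangle A t
  edges : ∀ {u v} -> U u -> U v -> E u v -> LAdj A (lab u) (lab v)

-- The two paths theorem

module _ {n : ℕ} where
 open Society {n}

 -- Deleted vertices are put back into one clique X_T.
 module Fill {E E' : V -> V -> Set} {U L : V -> Set} {m} {A : Adj m} (S : Sym A) (Es : ∀ {u v} -> E u v -> E v u) (L? : Dec₁ L) (EE' : ∀ {u v} -> E u v -> E' u v)
     (ℓ : Lab E' (λ v -> U v × ¬ L v) A) (T : Tri m) (t : IsTriangle A T)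
     (nb : ∀ {u v} -> U u -> ¬ L u -> L v -> E u v -> LAdj A (Lab.lab ℓ u) (inr T)) where
  open Lab ℓ
  lab' : V -> Label m
  lab' v with L? v
  ... | yes _ = inr T
  ... | no _ = lab v
  out : ∀ {v} -> ¬ L v -> lab' v ≡ lab v
  out {v} n with L? v
  ... | yes l = absurd (n l)
  ... | no _ = refl
  ins : ∀ {v} -> L v -> lab' v ≡ inr T
  ins {v} l with L? v
  ... | yes _ = refl
  ... | no n = absurd (n l)
  1≢2 : ∀ {a b} -> _≡_ {A = Label m} (inl a) (inr b) -> ⊥
  1≢2 ()
  inj' : ∀ {u v i} -> Dec (L u) -> Dec (L v) -> U u -> U v -> lab' u ≡ inl i -> lab' v ≡ inl i -> u ≡ v
  inj' (yes l) _ _ _ p _ = absurd (1≢2 (trans (sym p) (ins l)))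
  inj' (no _) (yes l) _ _ _ q = absurd (1≢2 (trans (sym q) (ins l)))
  inj' (no a) (no b) uu uv p q = inj (uu , a) (uv , b) (trans (sym (out a)) p) (trans (sym (out b)) q)
  ok : ∀ {v t} -> Dec (L v) -> U v -> lab' v ≡ inr t -> IsTriangle A t
  ok (yes l) u e with trans (sym (ins l)) e
  ... | refl = t
  ok (no n) u e = triOK (u , n) (trans (sym (out n)) e)
  cast : ∀ {u v k l} -> lab' u ≡ k -> lab' v ≡ l -> LAdj A k l -> LAdj A (lab' u) (lab' v)
  cast p q e = subst (λ z -> LAdj A z (lab' _)) (sym p) (subst (LAdj A _) (sym q) e)
  ed : ∀ {u v} -> Dec (L u) -> Dec (L v) -> U u -> U v -> E u v -> LAdj A (lab' u) (lab' v)
  ed (yes a) (yes b) _ _ _ = cast (ins a) (ins b) λ h -> ⇔-id _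
  ed (no a) (yes b) uu uv e = cast (out a) (ins b) (nb uu a b e)
  ed {u} {v} (yes a) (no b) uu uv e = cast (ins a) (out b) (LAdj-sym S (lab v) (inr T) (nb uv b a (Es e)))
  ed (no a) (no b) uu uv e = cast (out a) (out b) (edges (uu , a) (uv , b) (EE' e))
  fill : Lab E U A
  fill = record
   { lab = lab' ; onto = λ i -> let v , (u , ¬l) , e = onto i in v , u , trans (out ¬l) e
   ; inj = λ {u} {v} uu uv p q -> inj' (L? u) (L? v) uu uv p q
   ; triOK = λ {v} u e -> ok (L? v) u e
   ; edges = λ {u} {v} uu uv e -> ed (L? u) (L? v) uu uv e }

 NoLink : (V -> V -> Set) -> (V -> Set) -> V -> V -> V -> V -> Set₁
 NoLink E U x c h t = ∀ (P Q : V -> Set) -> (∀ {v} -> P v -> U v) -> (∀ {v} -> Q v -> U v) -> (∀ {v} -> P v -> Q v -> ⊥) ->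
            P x -> Q h -> W E P x c -> W E Q h t -> ⊥

 record Plane (E : V -> V -> Set) (U : V -> Set) (p q r s : V) : Set where
  field
   m  : ℕ
   P  : Graph m
   p' q' r' s' : Fin m
   plane : PlaneQuad P p' q' r' s'
   ℓ  : Lab E U (adj P)
   lp : Lab.lab ℓ p ≡ inl p'
   lq : Lab.lab ℓ q ≡ inl q'
   lr : Lab.lab ℓ r ≡ inl r'
   ls : Lab.lab ℓ s ≡ inl s'

 disk-plane : ∀ {E U p q r s} -> Disk E U p q r s -> Plane E U p q r s
 disk-plane D = record { m = m ; P = P ; plane = plane
  ; ℓ = record { lab = λ v -> inl (f v) ; onto = λ i -> g i , g∈U i , cong inl (fg i)
         ; inj = λ { uu uv p q -> trans (sym (gf uu)) (trans (cong g (inl-inj (trans p (sym q)))) (gf uv)) }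
         ; triOK = λ _ () ; edges = edges }
  ; lp = refl ; lq = refl ; lr = refl ; ls = refl }
  where
  open Disk D
  inl-inj : ∀ {m} {a b : Fin m} -> _≡_ {A = Label m} (inl a) (inl b) -> a ≡ b
  inl-inj refl = refl

 one-of-rest : ∀ {p q r u} -> one-of p q r u -> ∃₂ λ y z -> ∀ w -> w ≢ u -> one-of p q r w -> w ≡ y ⊎ w ≡ z
 one-of-rest {p} {q} {r} (inl refl) = q , r , λ { w ne (inl e) -> absurd (ne e) ; w ne (inr e) -> e }
 one-of-rest {p} {q} {r} (inr (inl refl)) = p , r , λ { w ne (inl e) -> inl e ; w ne (inr (inl e)) -> absurd (ne e) ; w ne (inr (inr e)) -> inr e }
 one-of-rest {p} {q} {r} (inr (inr refl)) = p , q , λ { w ne (inl e) -> inl e ; w ne (inr (inl e)) -> inr e ; w ne (inr (inr e)) -> absurd (ne e) }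

 no-four : ∀ {p q r u v a b} -> one-of p q r u -> one-of p q r v -> one-of p q r a -> one-of p q r b ->
      u ≢ v -> a ≢ b -> a ≢ u -> a ≢ v -> b ≢ u -> b ≢ v -> ⊥
 no-four {p} {q} {r} {u} {v} {a} {b} ou ov oa ob uv ab au av bu bv with one-of-rest ou
 ... | y , z , f with f v (λ e -> uv (sym e)) ov | f a au oa | f b bu ob
 ... | inl refl | inl e | _ = av e
 ... | inl refl | inr _ | inl e = bv e
 ... | inl refl | inr refl | inr refl = ab refl
 ... | inr refl | inr e | _ = av e
 ... | inr refl | inl _ | inr e = bv e
 ... | inr refl | inl refl | inl refl = ab refl

 crossFree : ∀ {E U x h c t} -> (∀ {v} -> v ∈ x ∷ h ∷ c ∷ [ t ] -> U v) -> Unique (x ∷ h ∷ c ∷ [ t ]) -> NoLink E U x c h t -> CrossFree E U x (h ∷ c ∷ [ t ])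
 crossFree {E} {U} {x} {h} {c} {t} inU ((xh ∷ xc ∷ xt ∷ []) ∷ (hc ∷ ht ∷ []) ∷ (ct ∷ []) ∷ _) nl S T S⊂ T⊂ dis τ (w , p , e) (w' , p' , e') with Pointwise-≡⇒≡ (toPointwise refl τ)
 ... | refl = nl (λ v -> S v ⊎ v ≡ x ⊎ v ≡ c) (λ v -> T v ⊎ v ≡ h ⊎ v ≡ t)
   [ (λ s -> fst (S⊂ s)) , [ (λ { refl -> inU (here refl) }) , (λ { refl -> inU (there (there (here refl))) }) ]′ ]′
   [ (λ s -> fst (T⊂ s)) , [ (λ { refl -> inU (there (here refl)) }) , (λ { refl -> inU (there (there (there (here refl)))) }) ]′ ]′
   d (inr (inl refl)) (inr (inl refl))
   (W-mono inl p ∙ edge e (inr (inr refl))) (W-mono inl p' ∙ edge e' (inr (inr refl)))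
   where
   d : ∀ {v} -> S v ⊎ v ≡ x ⊎ v ≡ c -> T v ⊎ v ≡ h ⊎ v ≡ t -> ⊥
   d (inl s) (inl t) = dis s t
   d (inl s) (inr (inl refl)) = snd (S⊂ s) (there (here refl))
   d (inl s) (inr (inr refl)) = snd (S⊂ s) (there (there (there (here refl))))
   d (inr (inl refl)) (inl t) = snd (T⊂ t) (here refl)
   d (inr (inr refl)) (inl t) = snd (T⊂ t) (there (there (here refl)))
   d (inr (inl refl)) (inr (inl e)) = xh e
   d (inr (inl refl)) (inr (inr e)) = xt e
   d (inr (inr refl)) (inr (inl e)) = hc (sym e)
   d (inr (inr refl)) (inr (inr e)) = ct e

 -- A set of inner vertices with at most three attachments is deleted and its attachments are made
 -- pairwise adjacent. They then lie in a common triangle of the plane graph, where the set is put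
 -- back. If there is no such set, the society is solved directly.
 planar : ∀ f {E : V -> V -> Set} {U : V -> Set} {x h c t} -> Dec₂ E -> (∀ {u v} -> E u v -> E v u) -> (∀ {u v} -> E u v -> u ≢ v) ->
      (U? : Dec₁ U) -> cnt U? < f -> Unique (x ∷ h ∷ c ∷ [ t ]) -> (∀ {v} -> v ∈ x ∷ h ∷ c ∷ [ t ] -> U v) ->
      NoLink E U x c h t -> Plane E U c h x t
 planar zero _ _ _ _ lt _ _ _ = absurd (n≮0 lt)
 planar (suc f) {E} {U} {x} {h} {c} {t} E? Esym irr U? lt un inU nl = go (any? λ p -> any? λ q -> any? λ r -> any? λ w -> I? w ×? closed? p q r w)
  where
  xs = h ∷ c ∷ [ t ]
  I : V -> Set
  I = Inn U x xs
  I? : Dec₁ I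
  I? = Inn? U? x xs
  one? : ∀ p q r -> Dec₁ (one-of p q r)
  one? p q r v = (v ≟ p) ⊎? ((v ≟ q) ⊎? (v ≟ r))
  Away : V -> V -> V -> V -> Set
  Away p q r v = I v × ¬ one-of p q r v
  Away? : ∀ p q r -> Dec₁ (Away p q r)
  Away? p q r v = I? v ×? ¬? (one? p q r v)
  Lo : V -> V -> V -> V -> V -> Set
  Lo p q r w = W E (Away p q r) w
  Lo? : ∀ p q r w -> Dec₁ (Lo p q r w)
  Lo? p q r w = W? E? (Away? p q r) w
  Closed : V -> V -> V -> V -> Set
  Closed p q r w = ∀ y u -> Lo p q r w y -> E y u -> U u -> Lo p q r w u ⊎ one-of p q r u
  closed? : ∀ p q r w -> Dec (Closed p q r w)
  closed? p q r w = all? λ y -> all? λ u -> Lo? p q r w y →? (E? y u →? (U? u →? (Lo? p q r w u ⊎? one? p q r u)))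
  sepFree : ¬ (∃ λ p -> ∃ λ q -> ∃ λ r -> ∃ λ w -> I w × Closed p q r w) -> SepFree E U x xs
  sepFree none L p q r w lw L⊂ cl = none (p , q , r , w , L⊂ lw , λ y u ly e uu -> fin ly e (cl (inL ly) e uu))
   where
   inL : ∀ {y} -> Lo p q r w y -> L y
   inL = W-ind L (λ l e (i , away) -> [ (λ z -> z) , (λ o -> absurd (away o)) ]′ (cl l e (fst i))) lw
   fin : ∀ {y u} -> Lo p q r w y -> E y u -> L u ⊎ one-of p q r u -> Lo p q r w u ⊎ one-of p q r u
   fin ly e (inr o) = inr o
   fin {u = u} ly e (inl l) with one? p q r u
   ... | yes o = inr o
   ... | no o = inl (ly ∙ edge e (L⊂ l , o))
  go : Dec (∃ λ p -> ∃ λ q -> ∃ λ r -> ∃ λ w -> I w × Closed p q r w) -> Plane E U c h x t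
  go (no none) = disk-plane (web-disk (record { E? = E? ; Esym = Esym ; irr = irr ; U? = U? ; un = un ; x∈U = inU (here refl) ; xs∈U = λ p -> inU (there p)
         ; cf = crossFree inU un nl ; sf = sepFree none }))
  go (yes (p , q , r , w , iw , cl)) = put (filter K? (p ∷ q ∷ r ∷ [])) (length-filter K? (p ∷ q ∷ r ∷ [])) k∈ isK (planar f {E'} {U'} (λ u v -> E? u v ⊎? (K? u ×? (K? v ×? ¬? (u ≟ v))))
    [ (λ e -> inl (Esym e)) , (λ (a , b , n) -> inr (b , a , λ e -> n (sym e))) ]′
    [ irr , (λ (_ , _ , n) -> n) ]′ U'? (≤-trans (cnt-strict U'? U? fst w (fst iw) λ (_ , n) -> n ε) (≤-pred lt)) un (λ m -> inU m , frame m) nl')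
   where
   L : V -> Set
   L = Lo p q r w
   L? : Dec₁ L
   L? = Lo? p q r w
   LI : ∀ {v} -> L v -> I v
   LI ε = iw
   LI (step e s p) = fst (W-end∈ s p)
   K : V -> Set
   K v = (one-of p q r v × U v × ¬ L v) × ∃ λ l -> L l × E l v
   K? : Dec₁ K
   K? v = (one? p q r v ×? (U? v ×? ¬? (L? v))) ×? any? λ l -> L? l ×? E? l v
   nbr : ∀ {u v} -> U u -> ¬ L u -> L v -> E u v -> K u
   nbr uu ¬l l e = ([ (λ z -> absurd (¬l z)) , (λ o -> o) ]′ (cl _ _ l (Esym e) uu) , uu , ¬l) , _ , l , Esym e
   E' : V -> V -> Set
   E' u v = E u v ⊎ (K u × K v × u ≢ v)
   U' : V -> Set
   U' v = U v × ¬ L v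
   reachL : ∀ {v} -> L v -> W E L w v
   reachL p = W-mono snd (W-keep L (λ q e s -> q ∙ edge e s) ε p)
   bridge : ∀ {P : V -> Set} {u v} -> K u -> K v -> P v -> W E (λ y -> P y ⊎ L y) u v
   bridge (_ , l , ll , e) (_ , l' , ll' , e') pv = step (Esym e) (inr ll) (W-mono inr (W-rev Esym ε (reachL ll)) ∙ W-mono inr (reachL ll') ∙ edge e' (inl pv))
   bridged : ∀ {P : V -> Set} {u v} -> W E' P u v -> W E (λ y -> P y ⊎ L y) u v
   bridged ε = ε
   bridged (step (inl e) s p) = step e (inl s) (bridged p)
   bridged (step (inr (ku , kv , _)) s p) = bridge ku kv s ∙ bridged p
   direct : ∀ {P : V -> Set} -> ¬ (∃₂ λ u v -> P u × P v × K u × K v × u ≢ v) -> ∀ {u v} -> P u -> W E' P u v -> W E P u v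
   direct n pu ε = ε
   direct n pu (step (inl e) s p) = step e s (direct n s p)
   direct n pu (step (inr (ku , kv , ne)) s p) = absurd (n (_ , _ , pu , s , ku , kv , ne))
   nl' : NoLink E' U' x c h t
   -- A path over a new edge is rerouted through the deleted set `L`. Only one of the two paths can
   -- need this, since four distinct attachments do not exist.
   nl' P Q P⊂ Q⊂ dis px qh wp wq = em {∃₂ λ u v -> P u × P v × K u × K v × u ≢ v} λ
    { (inl (u , v , pu , pv , ku , kv , ne)) ->
      nl (λ y -> P y ⊎ L y) Q [ (λ p -> fst (P⊂ p)) , (λ l -> fst (LI l)) ]′ (λ q -> fst (Q⊂ q)) [ dis , (λ l q -> snd (Q⊂ q) l) ]′ (inl px) qh
        (bridged wp) (direct (λ (a , b , qa , qb , ka , kb , ab) -> no-four (fst (fst ku)) (fst (fst kv)) (fst (fst ka)) (fst (fst kb)) ne ab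
         (λ { refl -> dis pu qa }) (λ { refl -> dis pv qa }) (λ { refl -> dis pu qb }) (λ { refl -> dis pv qb })) qh wq)
    ; (inr n) -> nl P (λ y -> Q y ⊎ L y) (λ p -> fst (P⊂ p)) [ (λ q -> fst (Q⊂ q)) , (λ l -> fst (LI l)) ]′ (λ p -> [ dis p , snd (P⊂ p) ]′) px (inl qh)
        (direct n px wp) (bridged wq) }
   U'? : Dec₁ U'
   U'? v = U? v ×? ¬? (L? v)
   frame : ∀ {v} -> v ∈ x ∷ xs -> ¬ L v
   frame m l = snd (LI l) m
   k∈ : ∀ {u} -> K u -> u ∈ filter K? (p ∷ q ∷ r ∷ [])
   k∈ {u} k@((o , _) , _) = ∈-filter⁺ K? (ins o) k
    where
    ins : one-of p q r u -> u ∈ p ∷ q ∷ r ∷ []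
    ins (inl e) = here e
    ins (inr (inl e)) = there (here e)
    ins (inr (inr e)) = there (there (here e))
   isK : ∀ {u} -> u ∈ filter K? (p ∷ q ∷ r ∷ []) -> K u
   isK m = snd (∈-filter⁻ K? {xs = p ∷ q ∷ r ∷ []} m)
   KU : ∀ {u} -> K u -> U' u
   KU ((_ , u) , _) = u
   put : (ks : List V) -> length ks ≤ 3 -> (∀ {u} -> K u -> u ∈ ks) -> (∀ {u} -> u ∈ ks -> K u) -> Plane E' U' c h x t -> Plane E U c h x t
   put ks ks≤3 k∈ isK R = place (clique-tri R.plane (map ℓ'.lab ks) le cliq tri)
    where
    module R = Plane R
    module ℓ' = Lab R.ℓ
    le : length (map ℓ'.lab ks) ≤ 3
    le = subst (_≤ 3) (sym (length-map ℓ'.lab ks)) ks≤3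
    cliq : ∀ {k l} -> k ∈ map ℓ'.lab ks -> l ∈ map ℓ'.lab ks -> k ≡ l ⊎ LAdj (adj R.P) k l
    cliq m m' with ∈-map⁻ ℓ'.lab m | ∈-map⁻ ℓ'.lab m'
    ... | u , mu , refl | v , mv , refl with u ≟ v
    ... | yes refl = inl refl
    ... | no ne = inr (ℓ'.edges (KU (isK mu)) (KU (isK mv)) (inr (isK mu , isK mv , ne)))
    tri : ∀ {t} -> inr t ∈ map ℓ'.lab ks -> IsTriangle (adj R.P) t
    tri m with ∈-map⁻ ℓ'.lab m
    ... | u , mu , e = ℓ'.triOK (KU (isK mu)) (sym e)
    place : (∃ λ T -> IsTriangle (adj R.P) T × (∀ {l} -> l ∈ map ℓ'.lab ks -> LAdj (adj R.P) l (inr T))) -> Plane E U c h x t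
    place (T , isT , near) = record { m = R.m ; P = R.P ; plane = R.plane ; ℓ = F.fill
     ; lp = trans (F.out (frame (there (there (here refl))))) R.lp ; lq = trans (F.out (frame (there (here refl)))) R.lq
     ; lr = trans (F.out (frame (here refl))) R.lr ; ls = trans (F.out (frame (there (there (there (here refl)))))) R.ls }
     where
     module F = Fill (Graph.sym R.P) Esym L? inl R.ℓ T isT (λ uu ¬l l e -> near (∈-map⁺ ℓ'.lab (k∈ (nbr uu ¬l l e))))

-- Certificates for the classes

private
 variable
  n m : ℕ

1≢2 : ∀ {A B : Set} {a : A} {b : B} -> inl a ≢ inr b
1≢2 ()

inl-inj : ∀ {A B : Set} {a b : A} -> _≡_ {A = A ⊎ B} (inl a) (inl b) -> a ≡ b
inl-inj refl = refl

tri-adj : ∀ {A : Adj m} -> Sym A -> ∀ {t c d} -> IsTriangle A t -> c ∈₃ t -> d ∈₃ t -> c ≡ d ⊎ c ∼[ A ] d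
tri-adj S (a , b , e) (inl refl) (inl refl) = inl refl
tri-adj S (a , b , e) (inl refl) (inr (inl refl)) = inr a
tri-adj S (a , b , e) (inl refl) (inr (inr refl)) = inr e
tri-adj S (a , b , e) (inr (inl refl)) (inl refl) = inr (trans (S _ _) a)
tri-adj S (a , b , e) (inr (inl refl)) (inr (inl refl)) = inl refl
tri-adj S (a , b , e) (inr (inl refl)) (inr (inr refl)) = inr b
tri-adj S (a , b , e) (inr (inr refl)) (inl refl) = inr (trans (S _ _) e)
tri-adj S (a , b , e) (inr (inr refl)) (inr (inl refl)) = inr (trans (S _ _) b)
tri-adj S (a , b , e) (inr (inr refl)) (inr (inr refl)) = inl refl

-- Walks in H⁺ are shortcut to walks in H: a vertex of X_T is skipped, since T is a triangle.
module Project {E : Fin n -> Fin n -> Set} {U : Fin n -> Set} {A : Adj m} (SA : Sym A) (ℓ : Lab E U A) {S : Fin n -> Set} (S⊂U : ∀ {v} -> S v -> U v) where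
 open Lab ℓ
 Im : Fin m -> Set
 Im i = ∃ λ z -> S z × lab z ≡ inl i

 At : Label m -> Fin m -> Set
 At (inl d) c = d ≡ c
 At (inr t) c = c ∈₃ t

 step-At : ∀ k l c -> LAdj A k l -> At k c -> (∀ {t} -> k ≡ inr t -> IsTriangle A t) ->
      At l c ⊎ (∃ λ d -> l ≡ inl d × (c ≡ d ⊎ c ∼[ A ] d))
 step-At (inl d) (inl d') c e refl ok = inr (d' , refl , inr e)
 step-At (inl d) (inr t) c e refl ok = inl e
 step-At (inr t) (inl d) c e a ok = inr (d , refl , tri-adj SA (ok refl) a e)
 step-At (inr t) (inr s) c e a ok = inl (Equivalence.to (e c) a)

 go : ∀ {z v c j} -> S z -> At (lab z) c -> W E S z v -> lab v ≡ inl j -> W (λ a b -> a ∼[ A ] b) Im c j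
 go {z} sz a ε eq = subst (W _ Im _) (back (lab z) a eq) ε
  where
  back : ∀ k {c j} -> At k c -> k ≡ inl j -> c ≡ j
  back (inl d) refl refl = refl
  back (inr t) a ()
 go {z} {c = c} sz a (step {w = w} e s p) eq = next (step-At (lab z) (lab w) c (edges (S⊂U sz) (S⊂U s) e) a (triOK (S⊂U sz)))
  where
  next : (At (lab w) c ⊎ (∃ λ d -> lab w ≡ inl d × (c ≡ d ⊎ c ∼[ A ] d))) -> W (λ a b -> a ∼[ A ] b) Im c _
  next (inl a') = go s a' p eq
  next (inr (d , l , inl refl)) = go s (subst (λ k -> At k d) (sym l) refl) p eq
  next (inr (d , l , inr ad)) = step ad (w , s , l) (go s (subst (λ k -> At k d) (sym l) refl) p eq)

 project : ∀ {u v i j} -> S u -> lab u ≡ inl i -> W E S u v -> lab v ≡ inl j -> W (λ a b -> a ∼[ A ] b) Im i j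
 project {i = i} su l p eq = go su (subst (λ k -> At k i) (sym l) refl) p eq

record Cert (E : Fin n -> Fin n -> Set) (U : Fin n -> Set) (r : Fin 4 -> Fin n) : Set where
 field
  w   : ClassWitness
  ℓ   : Lab E U (graphH w)
  κ   : Fin 4 -> Fin 4
  nom : ∀ i -> Lab.lab ℓ (r i) ≡ inl (nominated w (κ i))

Lab-mono : ∀ {E E' : Fin n -> Fin n -> Set} {U : Fin n -> Set} {A : Adj m} -> (∀ {u v} -> E u v -> E' u v) -> Lab E' U A -> Lab E U A
Lab-mono f ℓ = record { lab = lab ; onto = onto ; inj = inj ; triOK = triOK ; edges = λ a b e -> edges a b (f e) }
 where
  open Lab ℓ

Cert-mono : ∀ {E E' : Fin n -> Fin n -> Set} {U : Fin n -> Set} {r} -> (∀ {u v} -> E u v -> E' u v) -> Cert E' U r -> Cert E U r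
Cert-mono f C = record { w = Cert.w C ; ℓ = Lab-mono f (Cert.ℓ C) ; κ = Cert.κ C ; nom = Cert.nom C }

-- Serves classes A and B: `P` and `Q` are the adjacent hubs, and `κ` sorts the remaining vertices
-- by leaf. A vertex of `Rep` becomes its leaf; the others of its group go to the clique at the
-- triangle of that leaf.
module Hubs {E : Fin n -> Fin n -> Set} {U : Fin n -> Set} {A : Adj m} (SA : Sym A) (Esym : ∀ {u v} -> E u v -> E v u) (irr : ∀ {u v} -> E u v -> u ≢ v)
      (P Q : Fin m) (P≢Q : P ≢ Q) (PQ : P ∼[ A ] Q) (p q : Fin n) (p≢q : p ≢ q) (pU : U p) (qU : U q) (κ : Fin n -> Fin m)
      (κtri : ∀ v -> IsTriangle A (P , Q , κ v)) (κP : ∀ v -> κ v ≢ P) (κQ : ∀ v -> κ v ≢ Q)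
      {Rep : Fin n -> Set} (Rep? : Dec₁ Rep) (uniq : ∀ {u v} -> Rep u -> Rep v -> κ u ≡ κ v -> u ≡ v)
      (reps : ∀ i -> i ≡ P ⊎ i ≡ Q ⊎ ∃ λ v -> U v × v ≢ p × v ≢ q × Rep v × κ v ≡ i)
      (closed : ∀ {u v} -> U u -> U v -> u ≢ p -> u ≢ q -> v ≢ p -> v ≢ q -> E u v -> κ u ≡ κ v) where
 data Kind (v : Fin n) : Label m -> Set where
  isP : v ≡ p -> Kind v (inl P)
  isQ : v ≡ q -> Kind v (inl Q)
  rep : v ≢ p -> v ≢ q -> Rep v -> Kind v (inl (κ v))
  oth : v ≢ p -> v ≢ q -> Kind v (inr (P , Q , κ v))

 label : ∀ v -> ∃ (Kind v)
 label v with v ≟ p | v ≟ q | Rep? v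
 ... | yes e | _ | _ = _ , isP e
 ... | no _ | yes e | _ = _ , isQ e
 ... | no a | no b | yes r = _ , rep a b r
 ... | no a | no b | no _ = _ , oth a b

 lab-p : fst (label p) ≡ inl P
 lab-p with p ≟ p
 ... | yes _ = refl
 ... | no n = absurd (n refl)

 lab-q : fst (label q) ≡ inl Q
 lab-q with q ≟ p | q ≟ q
 ... | yes e | _ = absurd (p≢q (sym e))
 ... | no _ | yes _ = refl
 ... | no _ | no n = absurd (n refl)

 lab-rep : ∀ {v} -> v ≢ p -> v ≢ q -> Rep v -> fst (label v) ≡ inl (κ v)
 lab-rep {v} a b r with v ≟ p | v ≟ q | Rep? v
 ... | yes e | _ | _ = absurd (a e)
 ... | no _ | yes e | _ = absurd (b e)
 ... | no _ | no _ | yes _ = refl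
 ... | no _ | no _ | no n = absurd (n r)

 lab : Lab E U A
 lab = record
  { lab = λ v -> fst (label v)
  ; onto = λ i -> on i (reps i)
  ; inj = λ {u} {v} _ _ a b -> ij (snd (label u)) (snd (label v)) a b
  ; triOK = λ {v} _ e -> ok (snd (label v)) e
  ; edges = λ {u} {v} uu uv e -> ed (snd (label u)) (snd (label v)) uu uv e }
  where
  on : ∀ i -> i ≡ P ⊎ i ≡ Q ⊎ (∃ λ v -> U v × v ≢ p × v ≢ q × Rep v × κ v ≡ i) -> ∃ λ v -> U v × fst (label v) ≡ inl i
  on i (inl refl) = p , pU , lab-p
  on i (inr (inl refl)) = q , qU , lab-q
  on i (inr (inr (v , u , a , b , r , refl))) = v , u , lab-rep a b r
  ok : ∀ {v k t} -> Kind v k -> k ≡ inr t -> IsTriangle A t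
  ok {v} (oth _ _) refl = κtri v
  ij : ∀ {u v k l i} -> Kind u k -> Kind v l -> k ≡ inl i -> l ≡ inl i -> u ≡ v
  ij (isP refl) (isP refl) _ _ = refl
  ij (isP _) (isQ _) refl e = absurd (P≢Q (sym (inl-inj e)))
  ij (isP _) (rep _ _ _) refl e = absurd (κP _ (inl-inj e))
  ij (isQ _) (isP _) refl e = absurd (P≢Q (inl-inj e))
  ij (isQ refl) (isQ refl) _ _ = refl
  ij (isQ _) (rep _ _ _) refl e = absurd (κQ _ (inl-inj e))
  ij (rep _ _ _) (isP _) refl e = absurd (κP _ (sym (inl-inj e)))
  ij (rep _ _ _) (isQ _) refl e = absurd (κQ _ (sym (inl-inj e)))
  ij (rep _ _ a) (rep _ _ b) refl e = uniq a b (sym (inl-inj e))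
  t₁ = λ v -> snd (snd (κtri v))
  t₂ = λ v -> fst (snd (κtri v))
  ed : ∀ {u v k l} -> Kind u k -> Kind v l -> U u -> U v -> E u v -> LAdj A k l
  ed (isP refl) (isP refl) _ _ e = absurd (irr e refl)
  ed (isP refl) (isQ refl) _ _ e = PQ
  ed {v = v} (isP refl) (rep _ _ _) _ _ e = t₁ v
  ed (isP refl) (oth _ _) _ _ e = inl refl
  ed (isQ refl) (isP refl) _ _ e = trans (SA Q P) PQ
  ed (isQ refl) (isQ refl) _ _ e = absurd (irr e refl)
  ed {v = v} (isQ refl) (rep _ _ _) _ _ e = t₂ v
  ed (isQ refl) (oth _ _) _ _ e = inr (inl refl)
  ed {u} (rep _ _ _) (isP refl) _ _ e = trans (SA _ _) (t₁ u)
  ed {u} (rep _ _ _) (isQ refl) _ _ e = trans (SA _ _) (t₂ u)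
  ed (rep a b r) (rep c d r') uu uv e = absurd (irr e (uniq r r' (closed uu uv a b c d e)))
  ed (rep a b r) (oth c d) uu uv e = inr (inr (closed uu uv a b c d e))
  ed (oth _ _) (isP refl) _ _ e = inl refl
  ed (oth _ _) (isQ refl) _ _ e = inr (inl refl)
  ed (oth a b) (rep c d r) uu uv e = inr (inr (sym (closed uu uv a b c d e)))
  ed (oth a b) (oth c d) uu uv e h = subst (λ z -> (h ∈₃ (P , Q , κ _)) ⇔ (h ∈₃ (P , Q , z))) (closed uu uv a b c d e) (⇔-id _)

ext-sym : ∀ {A : Adj m} -> Sym A -> ∀ x y -> Sym (ext A x y)
ext-sym S x y zero zero = refl
ext-sym S x y zero (suc j) = refl
ext-sym S x y (suc i) zero = refl
ext-sym S x y (suc i) (suc j) = S i j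

ext-x : ∀ {A : Adj m} x y -> zero ∼[ ext A x y ] suc x
ext-x x y rewrite ⌊⌋⁺ (x ≟ x) refl = refl

ext-y : ∀ {A : Adj m} x y -> zero ∼[ ext A x y ] suc y
ext-y x y rewrite ⌊⌋⁺ (y ≟ y) refl = Bool.∨-zeroʳ ⌊ y ≟ x ⌋

lift : Label m -> Label (suc m)
lift = Sum.map suc λ (a , b , c) -> suc a , suc b , suc c

lift-LAdj : ∀ {A : Adj m} {x y} k l -> LAdj A k l -> LAdj (ext A x y) (lift k) (lift l)
lift-LAdj (inl i) (inl j) e = e
lift-LAdj (inl i) (inr t) e = Sum.map (cong suc) (Sum.map (cong suc) (cong suc)) e
lift-LAdj (inr t) (inl i) e = Sum.map (cong suc) (Sum.map (cong suc) (cong suc)) e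
lift-LAdj (inr t) (inr s) e zero = mk⇔ (λ { (inl ()) ; (inr (inl ())) ; (inr (inr ())) }) (λ { (inl ()) ; (inr (inl ())) ; (inr (inr ())) })
lift-LAdj (inr t) (inr s) e (suc h) = mk⇔ (λ q -> up (Equivalence.to (e h) (dn q))) (λ q -> up (Equivalence.from (e h) (dn q)))
 where
 dn : ∀ {a b c} -> suc h ≡ suc a ⊎ suc h ≡ suc b ⊎ suc h ≡ suc c -> h ≡ a ⊎ h ≡ b ⊎ h ≡ c
 dn = Sum.map suc-injective (Sum.map suc-injective suc-injective)
 up : ∀ {a b c} -> h ≡ a ⊎ h ≡ b ⊎ h ≡ c -> suc h ≡ suc a ⊎ suc h ≡ suc b ⊎ suc h ≡ suc c
 up = Sum.map (cong suc) (Sum.map (cong suc) (cong suc))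

-- A piece X seeing only the adjacent vertices labelled R, S becomes a new vertex x₀ of H, and a clique X_T with T = x₀ R S.
module Attach {E E' : Fin n -> Fin n -> Set} {U X : Fin n -> Set} {A : Adj m} (SA : Sym A) (Esym : ∀ {u v} -> E u v -> E v u) (irr : ∀ {u v} -> E u v -> u ≢ v)
       (EE' : ∀ {u v} -> E u v -> E' u v) (X? : Dec₁ X) (x₀ : Fin n) (x₀∈ : X x₀) (x₀U : U x₀) (R S : Fin m) (RS : R ∼[ A ] S)
       (ℓ : Lab E' (λ v -> U v × ¬ X v) A) (nb : ∀ {u v} -> U u -> ¬ X u -> X v -> E u v -> Lab.lab ℓ u ≡ inl R ⊎ Lab.lab ℓ u ≡ inl S) where
 open Lab ℓ
 T : Tri (suc _)
 T = zero , suc R , suc S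

 data Kind (v : Fin n) : Label (suc m) -> Set where
  new : v ≡ x₀ -> Kind v (inl zero)
  ins : X v -> v ≢ x₀ -> Kind v (inr T)
  old : ¬ X v -> Kind v (lift (lab v))

 label : ∀ v -> ∃ (Kind v)
 label v with v ≟ x₀ | X? v
 ... | yes e | _ = _ , new e
 ... | no ne | yes x = _ , ins x ne
 ... | no _ | no nx = _ , old nx

 lab-new : fst (label x₀) ≡ inl zero
 lab-new with x₀ ≟ x₀
 ... | yes _ = refl
 ... | no n = absurd (n refl)

 lab-old : ∀ {v} -> ¬ X v -> fst (label v) ≡ lift (lab v)
 lab-old {v} nx with v ≟ x₀ | X? v
 ... | yes refl | _ = absurd (nx x₀∈)
 ... | no _ | yes x = absurd (nx x)
 ... | no _ | no _ = refl

 attach : Lab E U (ext A R S)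
 attach = record
  { lab = λ v -> fst (label v)
  ; onto = on
  ; inj = λ {u} {v} uu uv a b -> ij (snd (label u)) (snd (label v)) uu uv a b
  ; triOK = λ {v} uv e -> ok (snd (label v)) uv e
  ; edges = λ {u} {v} uu uv e -> ed (snd (label u)) (snd (label v)) uu uv e }
  where
  SE = ext-sym SA R S
  on : ∀ i -> ∃ λ v -> U v × fst (label v) ≡ inl i
  on zero = x₀ , x₀U , lab-new
  on (suc i) = let v , (u , nx) , e = onto i in v , u , trans (lab-old nx) (cong lift e)
  lift₁ : ∀ k {i} -> lift k ≡ inl i -> ∃ λ j -> k ≡ inl j × i ≡ suc j
  lift₁ (inl j) refl = j , refl , refl
  ij : ∀ {u v k l i} -> Kind u k -> Kind v l -> U u -> U v -> k ≡ inl i -> l ≡ inl i -> u ≡ v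
  ij (new refl) (new refl) _ _ _ _ = refl
  ij {v = v} (new _) (old _) _ _ refl e with lift₁ (lab v) e
  ... | _ , _ , ()
  ij {u} (old _) (new _) _ _ e refl with lift₁ (lab u) e
  ... | _ , _ , ()
  ij {u} {v} (old nu) (old nv) uu uv e e' with lift₁ (lab u) e | lift₁ (lab v) e'
  ... | j , p , refl | _ , q , refl = inj (uu , nu) (uv , nv) p q
  ok : ∀ {v k t} -> Kind v k -> U v -> k ≡ inr t -> IsTriangle (ext A R S) t
  ok (ins _ _) _ refl = ext-x {A = A} R S , RS , ext-y {A = A} R S
  ok {v} (old nx) u e = go (lab v) refl e
   where
   go : ∀ k {t} -> lab v ≡ k -> lift k ≡ inr t -> IsTriangle (ext A R S) t
   go (inr t) eq refl = triOK (u , nx) eq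
  meet : ∀ {u v k} -> U u -> ¬ X u -> X v -> E u v -> Kind v k -> (k ≡ inl zero ⊎ k ≡ inr T) -> LAdj (ext A R S) k (lift (lab u))
  meet {u} uu nu xv e _ (inl refl) with lab u | nb uu nu xv e
  ... | _ | inl refl = ext-x {A = A} R S
  ... | _ | inr refl = ext-y {A = A} R S
  meet {u} uu nu xv e _ (inr refl) with lab u | nb uu nu xv e
  ... | _ | inl refl = inr (inl refl)
  ... | _ | inr refl = inr (inr refl)
  ed : ∀ {u v k l} -> Kind u k -> Kind v l -> U u -> U v -> E u v -> LAdj (ext A R S) k l
  ed (new refl) (new refl) _ _ e = absurd (irr e refl)
  ed (new _) (ins _ _) _ _ e = inl refl
  ed (ins _ _) (new _) _ _ e = inl refl
  ed (ins _ _) (ins _ _) _ _ e = λ h -> ⇔-id _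
  ed κ@(new refl) (old nv) uu uv e = meet uv nv x₀∈ (Esym e) κ (inl refl)
  ed κ@(ins x _) (old nv) uu uv e = meet uv nv x (Esym e) κ (inr refl)
  ed {u} (old nu) κ@(new refl) uu uv e = LAdj-sym SE (inl zero) (lift (lab u)) (meet uu nu x₀∈ e κ (inl refl))
  ed {u} (old nu) κ@(ins x _) uu uv e = LAdj-sym SE (inr T) (lift (lab u)) (meet uu nu x e κ (inr refl))
  ed {u} {v} (old nu) (old nv) uu uv e = lift-LAdj (lab u) (lab v) (edges (uu , nu) (uv , nv) (EE' e))

module Relabel {m'} {E : Fin n -> Fin n -> Set} {U : Fin n -> Set} {A : Adj m} {B : Adj m'} (f : Fin m -> Fin m') (g : Fin m' -> Fin m)
        (fg : ∀ j -> f (g j) ≡ j) (gf : ∀ i -> g (f i) ≡ i) (hom : ∀ i j -> i ∼[ A ] j -> f i ∼[ B ] f j) (ℓ : Lab E U A) where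
 open Lab ℓ
 relabel : Lab E U B
 relabel = record
  { lab = λ v -> Sum.map f (on₃ f) (lab v)
  ; onto = λ i -> let v , u , e = onto (g i) in v , u , trans (cong (Sum.map f (on₃ f)) e) (cong inl (fg i))
  ; inj = λ {u} {v} uu uv p q -> ij (lab u) (lab v) refl refl uu uv p q
  ; triOK = λ {v} u e -> ok (lab v) refl u e
  ; edges = λ {u} {v} uu uv e -> ed (lab u) (lab v) (edges uu uv e) }
  where
  f-inj : ∀ {a b} -> f a ≡ f b -> a ≡ b
  f-inj e = trans (sym (gf _)) (trans (cong g e) (gf _))
  ij : ∀ {u v} k l {i} -> lab u ≡ k -> lab v ≡ l -> U u -> U v -> Sum.map f (on₃ f) k ≡ inl i -> Sum.map f (on₃ f) l ≡ inl i -> u ≡ v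
  ij (inl a) (inl b) p q uu uv refl e = inj uu uv p (trans q (cong inl (f-inj (inl-inj e))))
  ok : ∀ {v} k {t} -> lab v ≡ k -> U v -> Sum.map f (on₃ f) k ≡ inr t -> IsTriangle B t
  ok (inr (a , b , c)) p u refl = let x , y , z = triOK u p in hom _ _ x , hom _ _ y , hom _ _ z
  up : ∀ {h t} -> h ∈₃ t -> f h ∈₃ on₃ f t
  up = Sum.map (cong f) (Sum.map (cong f) (cong f))
  dn : ∀ {h t} -> h ∈₃ on₃ f t -> g h ∈₃ t
  dn = Sum.map d (Sum.map d d)
   where
   d : ∀ {h a} -> h ≡ f a -> g h ≡ a
   d refl = gf _
  ed : ∀ k l -> LAdj A k l -> LAdj B (Sum.map f (on₃ f) k) (Sum.map f (on₃ f) l)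
  ed (inl a) (inl b) e = hom a b e
  ed (inl a) (inr t) e = up e
  ed (inr t) (inl a) e = up e
  ed (inr t) (inr s) e h = mk⇔ (λ q -> subst (_∈₃ on₃ f s) (fg h) (up (Equivalence.to (e (g h)) (dn q)))) (λ q -> subst (_∈₃ on₃ f t) (fg h) (up (Equivalence.from (e (g h)) (dn q))))

-- The Jordan property

module _ {A : Set} where
 cntL-mono-∈ : {P Q : A -> Set} (P? : Dec₁ P) (Q? : Dec₁ Q) -> ∀ xs -> (∀ {x} -> x ∈ xs -> P x -> Q x) -> cntL P? xs ≤ cntL Q? xs
 cntL-mono-∈ P? Q? [] f = z≤n
 cntL-mono-∈ P? Q? (x ∷ xs) f with P? x | Q? x
 ... | yes p | yes q = s≤s (cntL-mono-∈ P? Q? xs (λ m -> f (there m)))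
 ... | yes p | no ¬q = absurd (¬q (f (here refl) p))
 ... | no _ | yes q = m≤n⇒m≤1+n (cntL-mono-∈ P? Q? xs (λ m -> f (there m)))
 ... | no _ | no _ = cntL-mono-∈ P? Q? xs (λ m -> f (there m))

 cntL-one : {P Q : A -> Set} (P? : Dec₁ P) (Q? : Dec₁ Q) {z : A} -> (∀ {x} -> P x -> x ≢ z -> Q x) -> ∀ {xs} -> Unique xs -> cntL P? xs ≤ suc (cntL Q? xs)
 cntL-one P? Q? f {[]} u = z≤n
 cntL-one P? Q? {z} f {x ∷ xs} (a ∷ u) with P? x | Q? x
 ... | no _ | no _ = cntL-one P? Q? f u
 ... | no _ | yes _ = m≤n⇒m≤1+n (cntL-one P? Q? f u)
 ... | yes p | yes _ = s≤s (cntL-one P? Q? f u)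
 ... | yes p | no ¬q = s≤s (cntL-mono-∈ P? Q? xs λ { m py -> f py λ { refl -> ¬q (f p λ { refl -> All.lookup a m refl }) } })

 filter-length : {P : A -> Set} (P? : Dec₁ P) -> ∀ xs -> length (filter P? xs) ≡ cntL P? xs
 filter-length P? [] = refl
 filter-length P? (x ∷ xs) with P? x
 ... | yes _ = cong suc (filter-length P? xs)
 ... | no _ = filter-length P? xs

 cntL-cover : {P Q R : A -> Set} (P? : Dec₁ P) (Q? : Dec₁ Q) (R? : Dec₁ R) -> (∀ x -> P x ⊎ Q x ⊎ R x) ->
        ∀ xs -> length xs ≤ cntL P? xs + (cntL Q? xs + cntL R? xs)
 cntL-cover P? Q? R? f [] = z≤n
 cntL-cover P? Q? R? f (x ∷ xs) with P? x | Q? x | R? x | cntL-cover P? Q? R? f xs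
 ... | no a | no b | no c | _ = absurd ([ a , [ b , c ]′ ]′ (f x))
 ... | yes _ | yes _ | yes _ | ih = s≤s (≤-trans ih (+-monoʳ-≤ (cntL P? xs) (+-mono-≤ (n≤1+n _) (n≤1+n _))))
 ... | yes _ | yes _ | no _ | ih = s≤s (≤-trans ih (+-monoʳ-≤ (cntL P? xs) (n≤1+n _)))
 ... | yes _ | no _ | yes _ | ih = s≤s (≤-trans ih (+-monoʳ-≤ (cntL P? xs) (+-monoʳ-≤ (cntL Q? xs) (n≤1+n _))))
 ... | yes _ | no _ | no _ | ih = s≤s ih
 ... | no _ | yes _ | no _ | ih = subst (suc (length xs) ≤_) (sym (+-suc (cntL P? xs) _)) (s≤s ih)
 ... | no _ | no _ | yes _ | ih = subst (suc (length xs) ≤_) (sym (trans (cong (cntL P? xs +_) (+-suc (cntL Q? xs) _)) (+-suc (cntL P? xs) _))) (s≤s ih)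
 ... | no _ | yes _ | yes _ | ih = subst (suc (length xs) ≤_) (sym (+-suc (cntL P? xs) _)) (s≤s (≤-trans ih (+-monoʳ-≤ (cntL P? xs) (+-monoʳ-≤ (cntL Q? xs) (n≤1+n _)))))

cnt-one : ∀ {n} {P Q : Fin n -> Set} (P? : Dec₁ P) (Q? : Dec₁ Q) z -> (∀ {x} -> P x -> x ≢ z -> Q x) -> cnt P? ≤ suc (cnt Q?)
cnt-one {n} P? Q? z f = cntL-one P? Q? {z} f (allFin⁺ n)

module _ {n : ℕ} where
 sum-≤ : ∀ {A : Set} {f g : A -> ℕ} -> (∀ x -> f x ≤ g x) -> ∀ xs -> sum (map f xs) ≤ sum (map g xs)
 sum-≤ h [] = z≤n
 sum-≤ h (x ∷ xs) = +-mono-≤ (h x) (sum-≤ h xs)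

 sum-< : ∀ {A : Set} {f g : A -> ℕ} -> (∀ x -> f x ≤ g x) -> ∀ {z} -> f z < g z -> ∀ {xs} -> z ∈ xs -> sum (map f xs) < sum (map g xs)
 sum-< h lt {x ∷ xs} (here refl) = +-mono-<-≤ lt (sum-≤ h xs)
 sum-< h lt {x ∷ xs} (there m) = +-mono-≤-< (h x) (sum-< h lt m)

 Σ²-< : ∀ {f g : Fin n -> Fin n -> Bool} -> (∀ i j -> f i j ≡ true -> g i j ≡ true) -> ∀ a b -> g a b ≡ true -> f a b ≡ false -> Σ² f < Σ² g
 Σ²-< {f} {g} h a b gt ff = sum-< (λ i -> sum-≤ (λ j -> le i j) (allFin n)) {a} (sum-< (le a) {b} one (∈-allFin b)) (∈-allFin a)
  where
  le : ∀ i j -> b2n {n} (f i j) ≤ b2n {n} (g i j)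
  le i j with f i j in eq
  ... | false = z≤n
  ... | true rewrite h i j eq = ≤-refl
  one : b2n {n} (f a b) < b2n {n} (g a b)
  one rewrite gt | ff = s≤s z≤n

 ec : {R : Fin n -> Fin n -> Set} -> Dec₂ R -> ℕ
 ec R? = Σ² λ i j -> ⌊ R? i j ⌋ ∧ lt i j

 ∧⁻ : ∀ {x y} -> x ∧ y ≡ true -> x ≡ true × y ≡ true
 ∧⁻ {true} {true} _ = refl , refl

 ∧ˡ : ∀ {x y} -> x ≡ false -> x ∧ y ≡ false
 ∧ˡ refl = refl

 ec-< : ∀ {R R' : Fin n -> Fin n -> Set} (R? : Dec₂ R) (R'? : Dec₂ R') -> (∀ {i j} -> R i j -> R' i j) -> ∀ {a b} -> a ≢ b -> R' a b -> R' b a -> ¬ R a b -> ¬ R b a -> ec R? < ec R'?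
 ec-< R? R'? f {a} {b} ne ab ba nab nba with <-cmp (toℕ a) (toℕ b)
 ... | tri≈ _ e _ = absurd (ne (toℕ-injective e))
 ... | tri< l _ _ = Σ²-< (λ i j e -> let x , y = ∧⁻ e in cong₂ _∧_ (⌊⌋⁺ (R'? i j) (f (⌊⌋⁻ (R? i j) x))) y) a b
           (cong₂ _∧_ (⌊⌋⁺ (R'? a b) ab) (lt⁺ {i = a} {b} l)) (∧ˡ (⌊⌋-false (R? a b) nab))
 ... | tri> _ _ l = Σ²-< (λ i j e -> let x , y = ∧⁻ e in cong₂ _∧_ (⌊⌋⁺ (R'? i j) (f (⌊⌋⁻ (R? i j) x))) y) b a
           (cong₂ _∧_ (⌊⌋⁺ (R'? b a) ba) (lt⁺ {i = b} {a} l)) (∧ˡ (⌊⌋-false (R? b a) nba))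

 uniq-Σ² : ∀ (L : List (Fin n × Fin n)) {f} -> Unique L -> (∀ {i j} -> (i , j) ∈ L -> f i j ≡ true) -> length L ≤ Σ² f
 uniq-Σ² [] u h = z≤n
 uniq-Σ² ((a , b) ∷ L) {f} (q ∷ u) h = ≤-trans (s≤s (uniq-Σ² L {f'} u h')) (Σ²-< (λ i j e -> fst (∧⁻ e)) a b (h (here refl)) (out a b refl))
  where
  same : ∀ i j -> Dec ((i , j) ≡ (a , b))
  same i j = ≡-dec _≟_ _≟_ (i , j) (a , b)
  f' : Fin n -> Fin n -> Bool
  f' i j = f i j ∧ ⌊ ¬? (same i j) ⌋
  out : ∀ i j -> (i , j) ≡ (a , b) -> f' i j ≡ false
  out i j e with f i j | same i j
  ... | false | _ = refl
  ... | true | yes _ = refl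
  ... | true | no ne = absurd (ne e)
  h' : ∀ {i j} -> (i , j) ∈ L -> f' i j ≡ true
  h' {i} {j} m = cong₂ _∧_ (h (there m)) (⌊⌋⁺ (¬? (same i j)) λ { refl -> All.lookup q m refl })

 Conn : (Fin n -> Fin n -> Set) -> (Fin n -> Set) -> Fin n -> Set
 Conn F D z = D z × (∀ {v} -> D v -> W F D z v)

 module _ where
  narrow : ∀ {F F' : Fin n -> Fin n -> Set} {D : Fin n -> Set} -> (∀ {u v} -> D u -> D v -> F u v -> F' u v) -> ∀ {u v} -> D u -> W F D u v -> W F' D u v
  narrow f du ε = ε
  narrow f du (step e s p) = step (f du s e) s (narrow f s p)

 -- A connected set on n vertices has at least n - 1 edges: remove a vertex that does not cut, which
 -- loses at least one edge.
 tree : ∀ f {F : Fin n -> Fin n -> Set} (F? : Dec₂ F) -> (∀ {u v} -> F u v -> F v u) -> (∀ {u v} -> F u v -> u ≢ v) -> {D : Fin n -> Set} (D? : Dec₁ D) -> ∀ {z} -> Conn F D z ->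
     cnt D? < f -> cnt D? ≤ suc (ec F?)
 tree zero _ _ _ _ _ lt = absurd (n≮0 lt)
 tree (suc f) {F} F? Fs Fi {D} D? {z} (dz , R) lt = go (any? λ w -> D? w ×? ¬? (w ≟ z))
  where
  open Shrink F F? Fs (λ _ -> ⊤) (λ _ -> yes tt) (λ _ -> z) using (noncut; approach; Rooted; base; reach)
  go : Dec (∃ λ w -> D w × w ≢ z) -> cnt D? ≤ suc (ec F?)
  go (no none) = ≤-trans (cnt-one D? none? z λ {x} dx ne -> none (x , dx , ne)) (s≤s (≤-trans (≤-reflexive (zero-cnt (allFin n))) z≤n))
   where
   none? : Dec₁ {A = Fin n} (λ _ -> ⊥)
   none? _ = no λ ()
   zero-cnt : ∀ xs -> cntL none? xs ≡ 0
   zero-cnt [] = refl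
   zero-cnt (x ∷ xs) = zero-cnt xs
  go (yes (w , dw , ne)) = cut (noncut D? (record { base = dz ; reach = R }) dw ne)
   where
   cut : (∃ λ v -> D v × v ≢ z × Rooted (D ∖ v) z) -> cnt D? ≤ suc (ec F?)
   cut (v , dv , vz , R') = ≤-trans (cnt-one D? (∖? D? v) v λ d n -> d , n) (s≤s (≤-trans
     (tree f F'? (λ (e , a , b) -> Fs e , b , a) (λ (e , _) -> Fi e) (∖? D? v) {z} (base R' , λ d -> narrow (λ (_ , a) (_ , b) e -> e , a , b) (base R') (reach R' d))
       (≤-trans (cnt-strict (∖? D? v) D? fst v dv λ (_ , n) -> n refl) (≤-pred lt)))
     (let w , _ , _ , wv , e = approach (record { base = dz ; reach = R }) dv vz in
      ec-< F'? F? fst (λ q -> wv q) e (Fs e) (λ (_ , _ , n) -> n refl) (λ (_ , n , _) -> n refl))))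
    where
    F' : Fin n -> Fin n -> Set
    F' i j = F i j × i ≢ v × j ≢ v
    F'? : Dec₂ F'
    F'? i j = F? i j ×? (¬? (i ≟ v) ×? ¬? (j ≟ v))

module Jordan {m} {P : Graph m} {p q r s : Fin m} (Q : PlaneQuad P p q r s) where
 open PlaneQuad Q

 private
  _~_ : Fin m -> Fin m -> Set
  i ~ j = i ∼[ adj P ] j
  ~-sym : ∀ {i j} -> i ~ j -> j ~ i
  ~-sym {i} {j} e = trans (Graph.sym P j i) e
  ~-irr : ∀ {i j} -> i ~ j -> i ≢ j
  ~-irr {i} e refl with trans (sym e) (Graph.irrefl P i)
  ... | ()
  fs = faces p q r s tri

 darts~ : ∀ t {u v} -> (u , v) ∈ cpairs (triList (tri t)) -> u ~ v
 darts~ t (here refl) = fst (triOK t)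
 darts~ t (there (here refl)) = fst (snd (triOK t))
 darts~ t (there (there (here refl))) = ~-sym (snd (snd (triOK t)))

 third : ∀ (t : Tri m) {u v} -> (u , v) ∈ cpairs (triList t) -> ∃ λ w -> (v , w) ∈ cpairs (triList t) × (w , u) ∈ cpairs (triList t)
 third (x , y , z) (here refl) = z , there (here refl) , there (there (here refl))
 third (x , y , z) (there (here refl)) = x , there (there (here refl)) , here refl
 third (x , y , z) (there (there (here refl))) = y , here refl , there (here refl)

 -- A nonempty set of triangles has an edge on its border, since it does not contain the outer face.
 border : {𝒯 : Fin k -> Set} (𝒯? : Dec₁ 𝒯) -> ∀ {t} -> 𝒯 t -> ∃ λ t -> 𝒯 t × ∃₂ λ u v -> (u , v) ∈ cpairs (triList (tri t)) × ∀ t' -> 𝒯 t' -> (v , u) ∉ cpairs (triList (tri t'))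
 border {𝒯} 𝒯? {t} tt' with any? (λ t -> 𝒯? t ×? any? λ u -> any? λ v -> dart? u v (cpairs (triList (tri t))) ×? all? λ t' -> ¬? (𝒯? t' ×? dart? v u (cpairs (triList (tri t')))))
  where
  dart? : ∀ (u v : Fin m) ds -> Dec ((u , v) ∈ ds)
  dart? u v ds = Any.any? (≡-dec _≟_ _≟_ (u , v)) ds
 ... | yes (t , a , u , v , d , n) = t , a , u , v , d , λ t' b c -> n t' (b , c)
 ... | no none = absurd (outer (all-in p q pq))
  where
  On : Fin m -> Fin m -> Set
  On u v = ∃ λ t -> 𝒯 t × (u , v) ∈ cpairs (triList (tri t))
  On? : Dec₂ On
  On? u v = any? λ t -> 𝒯? t ×? Any.any? (≡-dec _≟_ _≟_ (u , v)) (cpairs (triList (tri t)))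
  rev : ∀ {u v} -> On u v -> On v u
  rev {u} {v} (t , a , d) = stable (On? v u) λ n -> none (t , a , u , v , d , λ t' (b , c) -> n (t' , b , c))
  turn : ∀ {v u w} -> On u v -> Turn fs v u w -> On w v
  turn {v} {u} (t , a , d) (i , x , y) with dartUniq u v i (suc t) x d
  ... | refl = rev (t , a , y)
  turns : ∀ {v u w} -> On u v -> Star (Turn fs v) u w -> On w v
  turns o ε = o
  turns o (t ◅ p) = turns (turn o t) p
  around : ∀ {v u w} -> On u v -> v ~ u -> v ~ w -> On w v
  around o a b = turns o (rotation _ _ _ a b)
  spread : ∀ {v u w} -> On u v -> v ~ u -> Star _~_ v w -> ∃ λ u -> On u w × w ~ u
  spread o a ε = _ , o , a
  spread o a (e ◅ p) = spread (rev (around o a e)) (~-sym e) p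
  first : On (fst (tri t)) (fst (snd (tri t)))
  first = t , tt' , here refl
  all-in : ∀ u v -> u ~ v -> On v u
  all-in u v e = let x , o , a = spread first (~-sym (fst (triOK t))) (connected _ u) in around o a e
  outer : On q p -> ⊥
  outer o with rev o
  ... | t , _ , d with dartUniq p q zero (suc t) (here refl) d
  ... | ()

 -- A triangle is removed together with one edge on the border of the set. The other two sides of
 -- the triangle replace that edge in walks, so connectivity persists, and in the end the bound for
 -- trees remains.
 collapse : ∀ f {𝒯 : Fin k -> Set} (𝒯? : Dec₁ 𝒯) -> cnt 𝒯? < f -> {F : Fin m -> Fin m -> Set} (F? : Dec₂ F) -> (∀ {u v} -> F u v -> F v u) -> (∀ {u v} -> F u v -> u ≢ v) ->
       {D : Fin m -> Set} (D? : Dec₁ D) -> ∀ {z} -> Conn F D z -> (∀ {u v} -> F u v -> D v) -> (∀ {t u v} -> 𝒯 t -> (u , v) ∈ cpairs (triList (tri t)) -> F u v) ->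
       cnt 𝒯? + cnt D? ≤ suc (ec F?)
 collapse zero 𝒯? lt _ _ _ _ _ _ _ = absurd (n≮0 lt)
 collapse (suc f) {𝒯} 𝒯? lt {F} F? Fs Fi {D} D? {z} R FD inF with any? 𝒯?
 ... | no none = ≤-trans (+-monoˡ-≤ (cnt D?) (≤-reflexive (none-cnt (allFin k)))) (tree _ F? Fs Fi D? R ≤-refl)
  where
  none-cnt : ∀ xs -> cntL 𝒯? xs ≡ 0
  none-cnt [] = refl
  none-cnt (x ∷ xs) with 𝒯? x
  ... | yes a = absurd (none (x , a))
  ... | no _ = none-cnt xs
 ... | yes (t₀ , a₀) with border 𝒯? a₀
 ... | t , a , u , v , d , free = ≤-trans (+-monoˡ-≤ (cnt D?) (cnt-one 𝒯? (∖? 𝒯? t) t λ x n -> x , n))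
     (s≤s (≤-trans (collapse f (∖? 𝒯? t) (≤-trans (cnt-strict (∖? 𝒯? t) 𝒯? fst t a λ (_ , n) -> n refl) (≤-pred lt))
         F'? flip (λ (e , _) -> Fi e) D? {z} (fst R , λ dv -> reroute (snd R dv)) (λ (e , _) -> FD e) inF')
        (ec-< F'? F? fst (Fi uv) uv (Fs uv) (λ (_ , n , _) -> n (refl , refl)) (λ (_ , _ , n) -> n (refl , refl)))))
  where
  uv = inF a d
  F' : Fin m -> Fin m -> Set
  F' i j = F i j × ¬ (i ≡ u × j ≡ v) × ¬ (i ≡ v × j ≡ u)
  F'? : Dec₂ F'
  F'? i j = F? i j ×? (¬? ((i ≟ u) ×? (j ≟ v)) ×? ¬? ((i ≟ v) ×? (j ≟ u)))
  inF' : ∀ {t' x y} -> (𝒯 ∖ t) t' -> (x , y) ∈ cpairs (triList (tri t')) -> F' x y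
  inF' {t'} (b , ne) c = inF b c , (λ { (refl , refl) -> ne (same (dartUniq u v (suc t') (suc t) c d)) }) , λ { (refl , refl) -> free t' b c }
   where
   same : suc t' ≡ suc t -> t' ≡ t
   same refl = refl
  T = third (tri t) d
  w = fst T
  vw = inF a (fst (snd T))
  wu = inF a (snd (snd T))
  vw' : F' v w
  vw' = vw , (λ (e , _) -> Fi uv (sym e)) , λ (_ , e) -> Fi wu e
  wu' : F' w u
  wu' = wu , (λ (e , _) -> Fi wu e) , λ (e , _) -> Fi vw (sym e)
  flip : ∀ {i j} -> F' i j -> F' j i
  flip (e , x , y) = Fs e , (λ (a , b) -> y (b , a)) , λ (a , b) -> x (b , a)
  hop : ∀ {i j} -> F i j -> D j -> W F' D i j
  hop {i} {j} e dj with (i ≟ u) ×? (j ≟ v) | (i ≟ v) ×? (j ≟ u)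
  ... | yes (refl , refl) | _ = step (flip wu') (FD vw) (edge (flip vw') dj)
  ... | no _ | yes (refl , refl) = step vw' (FD vw) (edge wu' dj)
  ... | no x | no y = edge (e , x , y) dj
  reroute : ∀ {i j} -> W F D i j -> W F' D i j
  reroute ε = ε
  reroute (step e s p) = hop e s ∙ reroute p

 module _ {A : Fin m -> Set} (A? : Dec₁ A) (Ap : Conn _~_ A p) (Ar : A r) (Bq : ¬ A q) (Bs : W _~_ (λ i -> ¬ A i) q s) where
  private
   B C : Fin m -> Set
   B = W _~_ (λ i -> ¬ A i) q
   C i = ¬ B i
   ~? : Dec₂ _~_
   ~? i j = adj P i j Bool.≟ true
   B? : Dec₁ B
   B? = W? ~? (λ i -> ¬? (A? i)) q
   C? : Dec₁ C
   C? i = ¬? (B? i)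
   B⊂ : ∀ {i} -> B i -> ¬ A i
   B⊂ = W-end∈ Bq
   A⊂C : ∀ {i} -> A i -> C i
   A⊂C a b = B⊂ b a
   connB : Conn _~_ B q
   connB = ε , λ b -> W-mono snd (W-keep B (λ x e n -> x ∙ edge e n) ε b)
   walk : ∀ i j -> W _~_ (λ _ -> ⊤) i j
   walk i j = conv (connected i j)
    where
    conv : ∀ {i j} -> Star _~_ i j -> W _~_ (λ _ -> ⊤) i j
    conv ε = ε
    conv (e ◅ p) = step e tt (conv p)
   -- A walk from `C` towards `A` does not enter `B` before it meets `A`, because `B` is a whole
   -- component of the complement of `A`.
   connC : Conn _~_ C p
   connC = A⊂C (fst Ap) , λ {v} c -> go c (W-first A? (walk v p) (fst Ap))
    where
    go : ∀ {v} -> C v -> (∃ λ w -> A w × (v ≡ w ⊎ (¬ A v × ∃ λ w' -> W _~_ (λ y -> ⊤ × ¬ A y) v w' × (w' ~ w) × ⊤))) -> W _~_ C p v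
    go c (w , a , inl refl) = W-mono A⊂C (snd Ap a)
    go {v} c (w , a , inr (na , w' , y , e , _)) = W-mono A⊂C (snd Ap a) ∙ step (~-sym e) (W-end∈ c yc) (W-rev ~-sym c yc)
     where
     yc : W _~_ C v w'
     yc = W-mono (λ (_ , c , _) -> c) (W-keep (λ i -> C i × ¬ A i) (λ (ci , ni) e (_ , nj) -> (λ bj -> ci (bj ∙ edge (~-sym e) ni)) , nj) (c , na) y)
   Inside : (Fin m -> Set) -> Fin k -> Set
   Inside D t = D (fst (tri t)) × D (fst (snd (tri t))) × D (snd (snd (tri t)))
   Inside? : ∀ {D : Fin m -> Set} -> Dec₁ D -> Dec₁ (Inside D)
   Inside? D? t = D? _ ×? (D? _ ×? D? _)
   Mixed : Fin k -> Set
   Mixed t = ¬ Inside C t × ¬ Inside B t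
   Mixed? : Dec₁ (Mixed)
   Mixed? t = ¬? (Inside? C? t) ×? ¬? (Inside? B? t)
   FC FB X : Fin m -> Fin m -> Set
   FC i j = (i ~ j) × C i × C j
   FB i j = (i ~ j) × B i × B j
   X i j = (i ~ j) × ((C i × B j) ⊎ (B i × C j))
   FC? : Dec₂ FC
   FC? i j = ~? i j ×? (C? i ×? C? j)
   FB? : Dec₂ FB
   FB? i j = ~? i j ×? (B? i ×? B? j)
   X? : Dec₂ X
   X? i j = ~? i j ×? ((C? i ×? B? j) ⊎? (B? i ×? C? j))
   H? : Dec₂ (λ i j -> FB i j ⊎ X i j)
   H? i j = FB? i j ⊎? X? i j
   split : ∀ {R R₁ R₂ : Fin m -> Fin m -> Set} (R? : Dec₂ R) (R₁? : Dec₂ R₁) (R₂? : Dec₂ R₂) -> (∀ {i j} -> R i j -> R₁ i j ⊎ R₂ i j) -> (∀ {i j} -> R₁ i j -> R i j) -> (∀ {i j} -> R₂ i j -> R i j) ->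
       (∀ {i j} -> R₁ i j -> R₂ i j -> ⊥) -> ec R? ≡ ec R₁? + ec R₂?
   split {R} {R₁} {R₂} R? R₁? R₂? f g h d = Σ²-+ {g = λ i j -> ⌊ R₁? i j ⌋ ∧ lt i j} {λ i j -> ⌊ R₂? i j ⌋ ∧ lt i j} λ i j -> go (R? i j) (R₁? i j) (R₂? i j) (lt i j)
    where
    go : ∀ {i j} (x : Dec (R i j)) (y : Dec (R₁ i j)) (z : Dec (R₂ i j)) w -> b2n {m} (⌊ x ⌋ ∧ w) ≡ b2n {m} (⌊ y ⌋ ∧ w) + b2n {m} (⌊ z ⌋ ∧ w)
    go _ (yes a) (yes b) w = absurd (d a b)
    go (yes _) (yes _) (no _) w = sym (+-identityʳ _)
    go (yes _) (no _) (yes _) w = refl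
    go (yes x) (no a) (no b) w = absurd ([ a , b ]′ (f x))
    go (no x) (yes a) _ w = absurd (x (g a))
    go (no x) (no _) (yes b) w = absurd (x (h b))
    go (no _) (no _) (no _) w = refl
   total : edgeCount P ≡ ec FC? + (ec FB? + ec X?)
   total = trans (sum-cong {n = m} (λ i -> sum-cong {n = m} (λ j -> cong (λ b -> b2n {m} (b ∧ lt i j)) (flat (adj P i j))) (allFin m)) (allFin m))
    (trans (split ~? FC? H? cls fst [ fst , fst ]′ λ { (_ , a , b) (inl (_ , c , _)) -> a c ; (_ , a , b) (inr (_ , inl (_ , c))) -> b c ; (_ , a , b) (inr (_ , inr (c , _))) -> a c })
     (cong (ec FC? +_) (split H? FB? X? (λ h -> h) inl inr λ { (_ , a , b) (_ , inl (c , _)) -> c a ; (_ , a , b) (_ , inr (_ , c)) -> c b })))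
    where
    flat : ∀ b -> b ≡ ⌊ b Bool.≟ true ⌋
    flat true = refl
    flat false = refl
    cls : ∀ {i j} -> i ~ j -> FC i j ⊎ FB i j ⊎ X i j
    cls {i} {j} e with B? i | B? j
    ... | yes a | yes b = inr (inl (e , a , b))
    ... | yes a | no b = inr (inr (e , inr (a , b)))
    ... | no a | yes b = inr (inr (e , inl (a , b)))
    ... | no a | no b = inl (e , a , b)
   half : ∀ {D : Fin m -> Set} (D? : Dec₁ D) {z} -> Conn _~_ D z -> cnt (Inside? D?) + cnt D? ≤ suc (ec (λ i j -> ~? i j ×? (D? i ×? D? j)))
   half {D} D? R = collapse _ (Inside? D?) ≤-refl (λ i j -> ~? i j ×? (D? i ×? D? j)) (λ (e , a , b) -> ~-sym e , b , a) (λ (e , _) -> ~-irr e) D?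
    (fst R , λ d -> narrow (λ a b e -> e , a , b) (fst R) (snd R d)) (λ (_ , _ , b) -> b)
    λ {t} i d -> darts~ t d , inn t i d
    where
    inn : ∀ t -> Inside D t -> ∀ {u v} -> (u , v) ∈ cpairs (triList (tri t)) -> D u × D v
    inn t (a , b , c) (here refl) = a , b
    inn t (a , b , c) (there (here refl)) = b , c
    inn t (a , b , c) (there (there (here refl))) = c , a
   CB : ∀ {i} -> ¬ C i -> B i
   CB {i} n = stable (B? i) n
   -- Going once around a triangle with vertices on both sides, some step leads from `C` to `B`.
   -- Distinct mixed triangles give distinct darts, hence distinct crossing edges.
   dart : ∀ t -> Σ (Fin m × Fin m) λ (u , v) -> Mixed t -> (u , v) ∈ cpairs (triList (tri t)) × C u × B v
   dart t = go (C? _) (C? _) (C? _)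
    where
    go : Dec (C (fst (tri t))) -> Dec (C (fst (snd (tri t)))) -> Dec (C (snd (snd (tri t)))) ->
       Σ (Fin m × Fin m) λ (u , v) -> Mixed t -> (u , v) ∈ cpairs (triList (tri t)) × C u × B v
    go (yes x) (no y) _ = _ , λ _ -> here refl , x , CB y
    go (yes x) (yes y) (no z) = _ , λ _ -> there (here refl) , y , CB z
    -- The triangle is not mixed, and `(p , q)` is a dummy.
    go (yes x) (yes y) (yes z) = (p , q) , λ (a , _) -> absurd (a (x , y , z))
    go (no x) (yes y) (no z) = _ , λ _ -> there (here refl) , y , CB z
    go (no x) (no y) (no z) = (p , q) , λ (_ , b) -> absurd (b (CB x , CB y , CB z))
    go (no x) (yes y) (yes z) = _ , λ _ -> there (there (here refl)) , z , CB x
    go (no x) (no y) (yes z) = _ , λ _ -> there (there (here refl)) , z , CB x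
   sorted : Fin m × Fin m -> Fin m × Fin m
   sorted (u , v) = if lt u v then (u , v) else (v , u)
   -- The orientation of a crossing edge is recovered from which end lies in `B`.
   sorted-inj : ∀ {u v u' v'} -> C u -> B v -> C u' -> B v' -> sorted (u , v) ≡ sorted (u' , v') -> (u , v) ≡ (u' , v')
   sorted-inj {u} {v} {u'} {v'} cu bv cu' bv' e with lt u v | lt u' v'
   ... | true | true = e
   ... | true | false = absurd (cu (subst B (sym (cong fst e)) bv'))
   ... | false | true = absurd (cu' (subst B (cong fst e) bv))
   ... | false | false = cong (λ (a , b) -> b , a) e
   sorted-X : ∀ {u v i j} -> u ~ v -> C u -> B v -> sorted (u , v) ≡ (i , j) -> ⌊ X? i j ⌋ ∧ lt i j ≡ true
   sorted-X {u} {v} e c b eq with lt u v in l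
   sorted-X {u} {v} e c b refl | true = cong₂ _∧_ (⌊⌋⁺ (X? u v) (e , inl (c , b))) l
   sorted-X {u} {v} e c b refl | false with <-cmp (toℕ u) (toℕ v)
   ... | tri< x _ _ with trans (sym l) (lt⁺ {i = u} {v} x)
   ... | ()
   sorted-X {u} {v} e c b refl | false | tri≈ _ x _ = absurd (~-irr e (toℕ-injective x))
   sorted-X {u} {v} e c b refl | false | tri> _ _ x = cong₂ _∧_ (⌊⌋⁺ (X? v u) (~-sym e , inr (b , c))) (lt⁺ {i = v} {u} x)
   Ms : List (Fin k)
   Ms = filter Mixed? (allFin k)
   dart∈ : ∀ {t} -> t ∈ Ms -> fst (dart t) ∈ cpairs (triList (tri t)) × C (fst (fst (dart t))) × B (snd (fst (dart t)))
   dart∈ {t} i = snd (dart t) (snd (∈-filter⁻ Mixed? {xs = allFin k} i))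
   Cp : C p
   Cp = A⊂C (fst Ap)
   Cr : C r
   Cr = A⊂C Ar
   cd : Fin k -> Fin m × Fin m
   cd t = sorted (fst (dart t))
   -- One edge for each mixed triangle, and two more because the outer cycle changes from `C` to `B`
   -- at `p q` and at `r s`.
   crossings : List (Fin m × Fin m)
   crossings = sorted (p , q) ∷ sorted (r , s) ∷ map cd Ms
   same : ∀ {t t'} -> t ∈ Ms -> t' ∈ Ms -> cd t ≡ cd t' -> t ≡ t'
   same {t} {t'} i j e = suc-inj (dartUniq _ _ (suc t) (suc t') (fst (dart∈ i)) (subst (_∈ cpairs (triList (tri t'))) (sym eq) (fst (dart∈ j))))
    where
    eq = sorted-inj (fst (snd (dart∈ i))) (snd (snd (dart∈ i))) (fst (snd (dart∈ j))) (snd (snd (dart∈ j))) e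
    suc-inj : ∀ {a b : Fin k} -> suc a ≡ suc b -> a ≡ b
    suc-inj refl = refl
   uniqM : ∀ {ts} -> Unique ts -> (∀ {t} -> t ∈ ts -> t ∈ Ms) -> Unique (map cd ts)
   uniqM [] f = []
   uniqM (a ∷ u) f = All.tabulate (λ i e -> let t , j , e' = ∈-map⁻ cd i in All.lookup a j (same (f (here refl)) (f (there j)) (trans e e'))) ∷ uniqM u (λ i -> f (there i))
   off : ∀ {u v t} -> t ∈ Ms -> C u -> B v -> (u , v) ∈ cpairs (fs zero) -> sorted (u , v) ≢ cd t
   off {u} {v} {t} i c b d e with dartUniq u v zero (suc t) d (subst (_∈ cpairs (triList (tri t))) (sym eq) (fst (dart∈ i)))
    where
    eq = sorted-inj c b (fst (snd (dart∈ i))) (snd (snd (dart∈ i))) e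
   ... | ()
   crossings-uniq : Unique crossings
   crossings-uniq = ((λ e -> p≢r (cong fst (sorted-inj Cp ε Cr Bs e))) ∷ All.tabulate λ i e -> let t , j , e' = ∈-map⁻ cd i in off j Cp ε (here refl) (trans e e'))
    ∷ All.tabulate (λ i e -> let t , j , e' = ∈-map⁻ cd i in off j Cr Bs (there (there (here refl))) (trans e e'))
    ∷ uniqM (Unique-filter Mixed? (allFin⁺ k)) (λ i -> i)
   crossing : ∀ {i j} -> (i , j) ∈ crossings -> ⌊ X? i j ⌋ ∧ lt i j ≡ true
   crossing (here e) = sorted-X pq Cp ε (sym e)
   crossing (there (here e)) = sorted-X rs Cr Bs (sym e)
   crossing (there (there i)) = let t , j , e = ∈-map⁻ cd i ; d , c , b = dart∈ j in sorted-X (darts~ t d) c b (sym e)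
   none? : ∀ {n} -> Dec₁ {A = Fin n} (λ _ -> ⊥)
   none? _ = no λ ()
   none-0 : ∀ {n} (xs : List (Fin n)) -> cntL none? xs ≡ 0
   none-0 [] = refl
   none-0 (x ∷ xs) = none-0 xs

  -- On each of the two connected sides, triangles plus vertices exceed edges by at most one. The
  -- crossing edges outnumber the mixed triangles by at least two. In total, vertices plus triangles
  -- are at most the number of edges, while Euler's formula makes them one more.
  jordan : ⊥
  jordan = <-irrefl refl (begin-strict
   2 + edgeCount P ≡⟨ sym euler ⟩
   m + suc k ≡⟨ +-suc m k ⟩
   suc (m + k) ≤⟨ s≤s (+-mono-≤ vs ts) ⟩
   suc ((nC + nB) + (tC + (tB + mx))) ≡⟨ regroup nC nB tC tB mx ⟩
   suc ((tC + nC) + ((tB + nB) + mx)) ≤⟨ s≤s (+-mono-≤ (half C? connC) (+-monoˡ-≤ mx (half B? connB))) ⟩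
   suc (suc eC + (suc eB + mx)) ≡⟨ regroup' eC eB mx ⟩
   suc (eC + (eB + (2 + mx))) ≤⟨ s≤s (+-monoʳ-≤ eC (+-monoʳ-≤ eB xs)) ⟩
   suc (eC + (eB + eX)) ≡⟨ cong suc (sym total) ⟩
   suc (edgeCount P) <⟨ n<1+n _ ⟩
   2 + edgeCount P ∎)
   where
   open ≤-Reasoning
   open import Data.Nat.Solver using (module +-*-Solver)
   open +-*-Solver
   nC = cnt C?
   nB = cnt B?
   tC = cnt (Inside? C?)
   tB = cnt (Inside? B?)
   mx = cnt Mixed?
   eC = ec FC?
   eB = ec FB?
   eX = ec X?
   regroup : ∀ a b c d e -> suc ((a + b) + (c + (d + e))) ≡ suc ((c + a) + ((d + b) + e))
   regroup = solve 5 (λ a b c d e -> con 1 :+ ((a :+ b) :+ (c :+ (d :+ e))) := con 1 :+ ((c :+ a) :+ ((d :+ b) :+ e))) refl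
   regroup' : ∀ a b c -> suc (suc a + (suc b + c)) ≡ suc (a + (b + (2 + c)))
   regroup' = solve 3 (λ a b c -> con 1 :+ ((con 1 :+ a) :+ ((con 1 :+ b) :+ c)) := con 1 :+ (a :+ (b :+ (con 2 :+ c)))) refl
   len : ∀ n -> length (allFin n) ≡ n
   len n = length-tabulate (λ (x : Fin n) -> x)
   vs : m ≤ nC + nB
   vs = subst (_≤ nC + nB) (len m) (subst (λ z -> length (allFin m) ≤ nC + z) (trans (cong (nB +_) (none-0 (allFin m))) (+-identityʳ nB))
       (cntL-cover C? B? none? (λ i -> [ (λ b -> inr (inl b)) , inl ]′ (toSum (B? i))) (allFin m)))
   ts : k ≤ tC + (tB + mx)
   ts = subst (_≤ tC + (tB + mx)) (len k) (cntL-cover (Inside? C?) (Inside? B?) Mixed? cls (allFin k))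
    where
    cls : ∀ t -> Inside C t ⊎ Inside B t ⊎ Mixed t
    cls t with Inside? C? t | Inside? B? t
    ... | yes a | _ = inl a
    ... | no _ | yes b = inr (inl b)
    ... | no a | no b = inr (inr (a , b))
   xs : 2 + mx ≤ eX
   xs = subst (λ z -> suc (suc z) ≤ eX) (trans (length-map cd Ms) (filter-length Mixed? (allFin k))) (uniq-Σ² crossings crossings-uniq crossing)

rotate : ∀ {m} {P : Graph m} {p q r s} -> PlaneQuad P p q r s -> PlaneQuad P q r s p
rotate {m} {P} {p} {q} {r} {s} Q = record
 { k = k ; tri = tri ; pq = qr ; qr = rs ; rs = sp ; sp = pq ; p≢r = q≢s ; q≢s = λ e -> p≢r (sym e) ; triOK = triOK
 ; dartFace = λ u v e -> let i , d = dartFace u v e in i , to i d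
 ; dartUniq = λ u v i j d d' -> dartUniq u v i j (from i d) (from j d')
 ; rotation = λ v u u' e e' -> turns (rotation v u u' e e')
 ; connected = connected ; euler = euler ; trianglesAreFaces = trianglesAreFaces }
 where
 open PlaneQuad Q
 to : ∀ i {d} -> d ∈ cpairs (faces p q r s tri i) -> d ∈ cpairs (faces q r s p tri i)
 to (suc i) d = d
 to zero (here e) = there (there (there (here e)))
 to zero (there (here e)) = here e
 to zero (there (there (here e))) = there (here e)
 to zero (there (there (there (here e)))) = there (there (here e))
 from : ∀ i {d} -> d ∈ cpairs (faces q r s p tri i) -> d ∈ cpairs (faces p q r s tri i)
 from (suc i) d = d
 from zero (here e) = there (here e)
 from zero (there (here e)) = there (there (here e))
 from zero (there (there (here e))) = there (there (there (here e)))
 from zero (there (there (there (here e)))) = here e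
 turns : ∀ {v u u'} -> Star (Turn (faces p q r s tri) v) u u' -> Star (Turn (faces q r s p tri) v) u u'
 turns ε = ε
 turns ((i , a , b) ◅ p) = (i , to i a , to i b) ◅ turns p

-- Adjacent nominated vertices in the classes

abstract
 HA-sym : Sym HA
 HA-sym = toWitness {a? = all? λ x -> all? λ y -> HA x y Bool.≟ HA y x} _
 HB-sym : Sym HB
 HB-sym = toWitness {a? = all? λ x -> all? λ y -> HB x y Bool.≟ HB y x} _

 HB-nom : ∀ i j -> HB (nomB i) (nomB j) ≡ false
 HB-nom = toWitness {a? = all? λ i -> all? λ j -> HB (nomB i) (nomB j) Bool.≟ false} _
 HC-nom : ∀ i j -> HC (nomC i) (nomC j) ≡ false
 HC-nom = toWitness {a? = all? λ i -> all? λ j -> HC (nomC i) (nomC j) Bool.≟ false} _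

HA-nom : ∀ i j -> HA (nomA i) (nomA j) ≡ true -> i ≡ zero × j ≢ zero ⊎ i ≢ zero × j ≡ zero
HA-nom zero zero ()
HA-nom zero (suc j) _ = inl (refl , λ ())
HA-nom (suc i) zero _ = inr ((λ ()) , refl)
HA-nom 1F 1F ()
HA-nom 1F 2F ()
HA-nom 1F 3F ()
HA-nom 2F 1F ()
HA-nom 2F 2F ()
HA-nom 2F 3F ()
HA-nom 3F 1F ()
HA-nom 3F 2F ()
HA-nom 3F 3F ()

-- A graph in class A with two more leaves on the nominated hub and the leaf nomA (suc j) is in class C.
HA² : Fin 3 -> Adj 7
HA² j = ext (ext HA zero (nomA (suc j))) 1F (suc (nomA (suc j)))

toC fromC : Fin 3 -> Fin 7 -> Fin 7
toC zero = Vec.lookup (# 3 ∷ # 4 ∷ # 1 ∷ # 2 ∷ # 0 ∷ # 5 ∷ # 6 ∷ [])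
toC 1F = Vec.lookup (# 3 ∷ # 4 ∷ # 1 ∷ # 2 ∷ # 5 ∷ # 0 ∷ # 6 ∷ [])
toC 2F = Vec.lookup (# 3 ∷ # 4 ∷ # 1 ∷ # 2 ∷ # 5 ∷ # 6 ∷ # 0 ∷ [])
fromC zero = Vec.lookup (# 4 ∷ # 2 ∷ # 3 ∷ # 0 ∷ # 1 ∷ # 5 ∷ # 6 ∷ [])
fromC 1F = Vec.lookup (# 5 ∷ # 2 ∷ # 3 ∷ # 0 ∷ # 1 ∷ # 4 ∷ # 6 ∷ [])
fromC 2F = Vec.lookup (# 6 ∷ # 2 ∷ # 3 ∷ # 0 ∷ # 1 ∷ # 4 ∷ # 5 ∷ [])

abstract
 toC-from : ∀ j i -> toC j (fromC j i) ≡ i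
 toC-from = toWitness {a? = all? λ j -> all? λ i -> toC j (fromC j i) ≟ i} _
 fromC-to : ∀ j i -> fromC j (toC j i) ≡ i
 fromC-to = toWitness {a? = all? λ j -> all? λ i -> fromC j (toC j i) ≟ i} _
 toC-hom : ∀ j a b -> a ∼[ HA² j ] b -> toC j a ∼[ HC ] toC j b
 toC-hom = toWitness {a? = all? λ j -> all? λ a -> all? λ b -> (HA² j a b Bool.≟ true) →? (HC (toC j a) (toC j b) Bool.≟ true)} _
 toC-nom : ∀ j i -> i ≢ zero -> i ≢ suc j -> ∃ λ i' -> toC j (suc (suc (nomA i))) ≡ nomC i'
 toC-nom = toWitness {a? = all? λ j -> all? λ i -> ¬? (i ≟ zero) →? (¬? (i ≟ suc j) →? any? λ i' -> toC j (suc (suc (nomA i))) ≟ nomC i')} _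
 toC-new : ∀ j -> toC j zero ≡ nomC zero × toC j 1F ≡ nomC 1F
 toC-new = toWitness {a? = all? λ j -> (toC j zero ≟ nomC zero) ×? (toC j 1F ≟ nomC 1F)} _

F-nom : ∀ {m} {P : Graph m} {p q r s} {Q : PlaneQuad P p q r s} i j -> graphH (cF m P p q r s Q) (nominated (cF m P p q r s Q) i) (nominated (cF m P p q r s Q) j) ≡ false
F-nom zero zero = refl
F-nom zero 1F = refl
F-nom zero 2F = refl
F-nom zero 3F = refl
F-nom 1F zero = refl
F-nom 1F 1F = refl
F-nom 1F 2F = refl
F-nom 1F 3F = refl
F-nom 2F zero = refl
F-nom 2F 1F = refl
F-nom 2F 2F = refl
F-nom 2F 3F = refl
F-nom 3F zero = refl
F-nom 3F 1F = refl
F-nom 3F 2F = refl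
F-nom 3F 3F = refl

module _ {m} {P : Graph m} {p q r s} (Q : PlaneQuad P p q r s) where
 open PlaneQuad Q
 private
  loop : ∀ {x} -> ¬ (x ∼[ adj P ] x)
  loop {x} e with trans (sym e) (Graph.irrefl P x)
  ... | ()
  p≢s : p ≢ s
  p≢s refl = loop sp
  q≢r : q ≢ r
  q≢r refl = loop qr
  off : ∀ {i a b : Fin m} -> i ≢ a -> i ≢ b -> ⌊ i ≟ a ⌋ ∨ ⌊ i ≟ b ⌋ ≢ true
  off {i} {a} {b} x y e with i ≟ a | i ≟ b
  ... | yes z | _ = x z
  ... | no _ | yes z = y z
  off x y () | no _ | no _
  off' : ∀ {i a b : Fin m} -> i ≢ a -> i ≢ b -> ⌊ suc i ≟ suc a ⌋ ∨ ⌊ suc i ≟ suc b ⌋ ≢ true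
  off' {i} {a} {b} x y e with i ≟ a | i ≟ b
  ... | yes z | _ = x z
  ... | no _ | yes z = y z
  off' x y () | no _ | no _

 E-nom : ∀ i j -> graphH (cE m P p q r s Q) (nominated (cE m P p q r s Q) i) (nominated (cE m P p q r s Q) j) ≡ true -> (i ≡ zero × j ≡ 1F) ⊎ (i ≡ 1F × j ≡ zero)
 E-nom zero zero e = absurd (loop e)
 E-nom zero 1F _ = inl (refl , refl)
 E-nom zero 2F e = absurd (off p≢r p≢s e)
 E-nom zero 3F e = absurd (off' p≢r p≢s e)
 E-nom 1F zero _ = inr (refl , refl)
 E-nom 1F 1F e = absurd (loop e)
 E-nom 1F 2F e = absurd (off q≢r q≢s e)
 E-nom 1F 3F e = absurd (off' q≢r q≢s e)
 E-nom 2F zero e = absurd (off p≢r p≢s e)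
 E-nom 2F 1F e = absurd (off q≢r q≢s e)
 E-nom 2F 2F ()
 E-nom 2F 3F ()
 E-nom 3F zero e = absurd (off' p≢r p≢s e)
 E-nom 3F 1F e = absurd (off' q≢r q≢s e)
 E-nom 3F 2F ()
 E-nom 3F 3F ()

E⁺ : ∀ {n} -> (Fin n -> Fin n -> Set) -> Fin n -> Fin n -> Fin n -> Fin n -> Set
E⁺ E a b u v = E u v ⊎ (u ≡ a × v ≡ b) ⊎ (u ≡ b × v ≡ a)

mkCert : ∀ {n} {E : Fin n -> Fin n -> Set} {U r} w (ℓ : Lab E U (graphH w)) -> (∀ i -> ∃ λ j -> Lab.lab ℓ (r i) ≡ inl (nominated w j)) -> Cert E U r
mkCert w ℓ f = record { w = w ; ℓ = ℓ ; κ = λ i -> fst (f i) ; nom = λ i -> snd (f i) }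

-- Putting back the pieces behind a 2-cut

module Reduce {n : ℕ} {E : Fin n -> Fin n -> Set} (Esym : ∀ {u v} -> E u v -> E v u) (irr : ∀ {u v} -> E u v -> u ≢ v) {U : Fin n -> Set}
       (r : Fin 4 -> Fin n) (r-inj : ∀ {i j} -> r i ≡ r j -> i ≡ j) {Xx Xy : Fin n -> Set} (Xx? : Dec₁ Xx) (Xy? : Dec₁ Xy)
       {h x y k : Fin 4} (F : Four h x y k) (v s : Fin n) (r∈U : ∀ i -> U (r i)) (x∈ : Xx (r x)) (y∈ : Xy (r y)) (dis : ∀ {u} -> Xx u -> ¬ Xy u)
       (Uv : (U v × ¬ Xy v) × ¬ Xx v) (Us : (U s × ¬ Xy s) × ¬ Xx s) (Uh : (U (r h) × ¬ Xy (r h)) × ¬ Xx (r h)) (Uk : (U (r k) × ¬ Xy (r k)) × ¬ Xx (r k))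
       (v≢s : v ≢ s) (h≢v : r h ≢ v) (h≢s : r h ≢ s) (k≢v : r k ≢ v) (k≢s : r k ≢ s)
       (cx : ∀ {u w} -> Xx u -> E u w -> U w -> Xx w ⊎ w ≡ v ⊎ w ≡ s) (cy : ∀ {u w} -> Xy u -> E u w -> U w -> Xy w ⊎ w ≡ v ⊎ w ≡ s)
       (path : W E (λ u -> ((U u × ¬ Xy u) × ¬ Xx u) × u ≢ v × u ≢ s) (r h) (r k)) where
 U' : Fin n -> Set
 U' u = (U u × ¬ Xy u) × ¬ Xx u
 E' : Fin n -> Fin n -> Set
 E' = E⁺ E v s

 -- The cut vertices `v` and `s` take the places of the roots `x` and `y`.
 r' : Fin 4 -> Fin n
 r' z with z ≟ x | z ≟ y
 ... | yes _ | _ = v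
 ... | no _ | yes _ = s
 ... | no _ | no _ = r z

 r'x : r' x ≡ v
 r'x with x ≟ x
 ... | yes _ = refl
 ... | no n = absurd (n refl)
 r'y : r' y ≡ s
 r'y with y ≟ x | y ≟ y
 ... | yes e | _ = absurd (Four.jk F (sym e))
 ... | no _ | yes _ = refl
 ... | no _ | no n = absurd (n refl)
 r'o : ∀ {z} -> z ≢ x -> z ≢ y -> r' z ≡ r z
 r'o {z} a b with z ≟ x | z ≟ y
 ... | yes e | _ = absurd (a e)
 ... | no _ | yes e = absurd (b e)
 ... | no _ | no _ = refl
 r'h : r' h ≡ r h
 r'h = r'o (Four.ij F) (Four.ik F)
 r'k : r' k ≡ r k
 r'k = r'o (λ e -> Four.jl F (sym e)) (λ e -> Four.kl F (sym e))
 h≢k : r h ≢ r k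
 h≢k e = Four.il F (r-inj e)

 module Two {m} {A : Adj m} (SA : Sym A) (R S : Fin m) (RS : R ∼[ A ] S) (ℓ : Lab E' U' A)
       (pos : (Lab.lab ℓ v ≡ inl R × Lab.lab ℓ s ≡ inl S) ⊎ (Lab.lab ℓ v ≡ inl S × Lab.lab ℓ s ≡ inl R)) where
  open Lab ℓ
  near : ∀ {u} -> u ≡ v ⊎ u ≡ s -> lab u ≡ inl R ⊎ lab u ≡ inl S
  near (inl refl) = [ (λ (a , _) -> inl a) , (λ (a , _) -> inr a) ]′ pos
  near (inr refl) = [ (λ (_ , a) -> inr a) , (λ (_ , a) -> inl a) ]′ pos
  module A₁ = Attach {E = E} {E'} {λ u -> U u × ¬ Xy u} {Xx} SA Esym irr inl Xx? (r x) x∈ (r∈U x , dis x∈) R S RS ℓ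
         (λ (uu , _) nx xv e -> near ([ (λ z -> absurd (nx z)) , (λ z -> z) ]′ (cx xv (Esym e) uu)))
  lifted : ∀ {u} -> u ≡ v ⊎ u ≡ s -> Lab.lab A₁.attach u ≡ inl (suc R) ⊎ Lab.lab A₁.attach u ≡ inl (suc S)
  lifted (inl refl) = Sum.map (λ e -> trans (A₁.lab-old (snd Uv)) (cong lift e)) (λ e -> trans (A₁.lab-old (snd Uv)) (cong lift e)) (near (inl refl))
  lifted (inr refl) = Sum.map (λ e -> trans (A₁.lab-old (snd Us)) (cong lift e)) (λ e -> trans (A₁.lab-old (snd Us)) (cong lift e)) (near (inr refl))
  module A₂ = Attach {E = E} {E} {U} {Xy} (ext-sym SA R S) Esym irr (λ e -> e) Xy? (r y) y∈ (r∈U y) (suc R) (suc S) RS A₁.attach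
         (λ uu ny yv e -> lifted ([ (λ z -> absurd (ny z)) , (λ z -> z) ]′ (cy yv (Esym e) uu)))
  ℓ₂ : Lab E U (ext (ext A R S) (suc R) (suc S))
  ℓ₂ = A₂.attach
  at-x : Lab.lab ℓ₂ (r x) ≡ inl 1F
  at-x = trans (A₂.lab-old (dis x∈)) (cong lift A₁.lab-new)
  at-y : Lab.lab ℓ₂ (r y) ≡ inl zero
  at-y = A₂.lab-new
  at-old : ∀ {u} -> U' u -> Lab.lab ℓ₂ u ≡ lift (lift (lab u))
  at-old ((_ , ny) , nx) = trans (A₂.lab-old ny) (cong lift (A₁.lab-old nx))

 module Back (C : Cert E' U' r') where
  private
   vs' : E' v s
   vs' = inr (inl (refl , refl))

  Nom : ∀ {m} {A : Adj m} -> Lab E' U' A -> (Fin 4 -> Fin m) -> Set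
  Nom ℓ nm = ∃ λ κx -> ∃ λ κy -> ∃ λ κh -> ∃ λ κk ->
   Lab.lab ℓ v ≡ inl (nm κx) × Lab.lab ℓ s ≡ inl (nm κy) × Lab.lab ℓ (r h) ≡ inl (nm κh) × Lab.lab ℓ (r k) ≡ inl (nm κk)

  noms : Nom (Cert.ℓ C) (nominated (Cert.w C))
  noms = κ x , κ y , κ h , κ k , subst (λ z -> lab z ≡ _) r'x (nom x) , subst (λ z -> lab z ≡ _) r'y (nom y) , subst (λ z -> lab z ≡ _) r'h (nom h) , subst (λ z -> lab z ≡ _) r'k (nom k)
   where
   open Cert C
   lab = Lab.lab ℓ

  module _ {m} {A : Adj m} (ℓ : Lab E' U' A) where
   open Lab ℓ
   apart : ∀ {u w i j} -> U' u -> U' w -> u ≢ w -> lab u ≡ inl i -> lab w ≡ inl j -> i ≢ j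
   apart uu uw ne a b refl = ne (inj uu uw a b)
   joined : ∀ {i j} -> lab v ≡ inl i -> lab s ≡ inl j -> i ∼[ A ] j
   joined a b with lab v | lab s | edges Uv Us vs'
   joined refl refl | _ | _ | e = e
   roots4 : ∀ {P : Fin 4 -> Set} -> P h -> P x -> P y -> P k -> ∀ z -> P z
   roots4 a b c d z with Four.all F z
   ... | inl refl = a
   ... | inr (inl refl) = b
   ... | inr (inr (inl refl)) = c
   ... | inr (inr (inr refl)) = d

  -- The side `r₀ s₀` carries `v` and `s`, so the two pieces hang on it as the extra vertices of
  -- class E, and the other two roots are `p` and `q`.
  fromD : ∀ {m} {P : Graph m} {p q r₀ s₀} (Q : PlaneQuad P p q r₀ s₀) (ℓ : Lab E' U' (adj P)) -> Nom ℓ (Vec.lookup (p ∷ q ∷ r₀ ∷ s₀ ∷ [])) ->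
      ∀ {R S} -> R ≡ r₀ -> S ≡ s₀ -> (Lab.lab ℓ v ≡ inl R × Lab.lab ℓ s ≡ inl S) ⊎ (Lab.lab ℓ v ≡ inl S × Lab.lab ℓ s ≡ inl R) -> Cert E U r
  fromD {m} {P} {p} {q} {r₀} {s₀} Q ℓ (_ , _ , κh , κk , _ , _ , nh , nk) refl refl pos =
   mkCert {r = r} (cE m P p q r₀ s₀ Q) T.ℓ₂ (roots4 ℓ (old Uh h≢v h≢s κh nh) (2F , T.at-x) (3F , T.at-y) (old Uk k≢v k≢s κk nk))
   where
   module T = Two (Graph.sym P) r₀ s₀ (PlaneQuad.rs Q) ℓ pos
   old : ∀ {u} -> U' u -> u ≢ v -> u ≢ s -> ∀ κ -> Lab.lab ℓ u ≡ inl (Vec.lookup (p ∷ q ∷ r₀ ∷ s₀ ∷ []) κ) -> ∃ λ j -> Lab.lab T.ℓ₂ u ≡ inl (nominated (cE m P p q r₀ s₀ Q) j)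
   old uu a b zero e = zero , trans (T.at-old uu) (cong (λ z -> lift (lift z)) e)
   old uu a b 1F e = 1F , trans (T.at-old uu) (cong (λ z -> lift (lift z)) e)
   old uu a b 2F e = absurd ([ (λ (c , _) -> apart ℓ uu Uv a e c refl) , (λ (_ , c) -> apart ℓ uu Us b e c refl) ]′ pos)
   old uu a b 3F e = absurd ([ (λ (_ , c) -> apart ℓ uu Us b e c refl) , (λ (c , _) -> apart ℓ uu Uv a e c refl) ]′ pos)

  shift : ∀ {m} {A : Adj m} {ℓ : Lab E' U' A} {p q r₀ s₀} -> Nom ℓ (Vec.lookup (p ∷ q ∷ r₀ ∷ s₀ ∷ [])) -> Nom ℓ (Vec.lookup (q ∷ r₀ ∷ s₀ ∷ p ∷ []))
  shift {p = p} {q} {r₀} {s₀} (a , b , c , d , ea , eb , ec , ed) = pr a , pr b , pr c , pr d , trans ea (ok a) , trans eb (ok b) , trans ec (ok c) , trans ed (ok d)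
   where
   pr : Fin 4 -> Fin 4
   pr zero = 3F
   pr 1F = zero
   pr 2F = 1F
   pr 3F = 2F
   ok : ∀ κ -> _≡_ {A = Label _} (inl (Vec.lookup (p ∷ q ∷ r₀ ∷ s₀ ∷ []) κ)) (inl (Vec.lookup (q ∷ r₀ ∷ s₀ ∷ p ∷ []) (pr κ)))
   ok zero = refl
   ok 1F = refl
   ok 2F = refl
   ok 3F = refl

  -- Opposite corners p, r₀ cannot be joined, since q and s₀ are joined outside them.
  opposite : ∀ {m} {P : Graph m} {p q r₀ s₀} -> PlaneQuad P p q r₀ s₀ -> (ℓ : Lab E' U' (adj P)) -> Nom ℓ (Vec.lookup (p ∷ q ∷ r₀ ∷ s₀ ∷ [])) ->
        (Lab.lab ℓ v ≡ inl p × Lab.lab ℓ s ≡ inl r₀) ⊎ (Lab.lab ℓ v ≡ inl r₀ × Lab.lab ℓ s ≡ inl p) -> ⊥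
  opposite {m} {P} {p} {q} {r₀} {s₀} Q ℓ (_ , _ , κh , κk , _ , _ , nh , nk) pos = go κh κk nh nk
   where
   open Lab ℓ
   A : Fin m -> Set
   A i = i ≡ p ⊎ i ≡ r₀
   pr : p ∼[ adj P ] r₀
   pr = [ (λ (a , b) -> joined ℓ a b) , (λ (a , b) -> trans (Graph.sym P p r₀) (joined ℓ a b)) ]′ pos
   is-vs : ∀ {u i} -> U' u -> lab u ≡ inl i -> A i -> u ≡ v ⊎ u ≡ s
   is-vs uu e (inl refl) = [ (λ (a , _) -> inl (inj uu Uv e a)) , (λ (_ , a) -> inr (inj uu Us e a)) ]′ pos
   is-vs uu e (inr refl) = [ (λ (_ , a) -> inr (inj uu Us e a)) , (λ (a , _) -> inl (inj uu Uv e a)) ]′ pos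
   module Pr = Project (Graph.sym P) ℓ {S = λ u -> U' u × u ≢ v × u ≢ s} fst
   off : ∀ {i} -> Pr.Im i -> ¬ A i
   off (z , (uz , a , b) , e) i = [ a , b ]′ (is-vs uz e i)
   bridge : ∀ {i j} -> lab (r h) ≡ inl i -> lab (r k) ≡ inl j -> W (λ a b -> a ∼[ adj P ] b) (λ i -> ¬ A i) i j
   bridge a b = W-mono off (Pr.project (Uh , h≢v , h≢s) a (W-map inl (λ z -> z) path) b)
   jord : W (λ a b -> a ∼[ adj P ] b) (λ i -> ¬ A i) q s₀ -> ¬ A q -> ⊥
   jord b nq = Jordan.jordan Q (λ i -> (i ≟ p) ⊎? (i ≟ r₀)) (inl refl , λ { (inl refl) -> ε ; (inr refl) -> edge pr (inr refl) }) (inr refl) nq b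
   ends : ∀ {u} -> U' u -> u ≢ v -> u ≢ s -> ∀ {i} -> lab u ≡ inl i -> ¬ A i
   ends uu a b e i = [ a , b ]′ (is-vs uu e i)
   go : ∀ κh κk -> lab (r h) ≡ inl (Vec.lookup (p ∷ q ∷ r₀ ∷ s₀ ∷ []) κh) -> lab (r k) ≡ inl (Vec.lookup (p ∷ q ∷ r₀ ∷ s₀ ∷ []) κk) -> ⊥
   go zero _ e _ = ends Uh h≢v h≢s e (inl refl)
   go 2F _ e _ = ends Uh h≢v h≢s e (inr refl)
   go _ zero _ e = ends Uk k≢v k≢s e (inl refl)
   go _ 2F _ e = ends Uk k≢v k≢s e (inr refl)
   go 1F 1F a b = apart ℓ Uh Uk h≢k a b refl
   go 3F 3F a b = apart ℓ Uh Uk h≢k a b refl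
   go 1F 3F a b = jord (bridge a b) (ends Uh h≢v h≢s a)
   go 3F 1F a b = jord (W-rev (λ {i} {j} e -> trans (Graph.sym P j i) e) (ends Uh h≢v h≢s a) (bridge a b)) (ends Uk k≢v k≢s b)

  -- The adjacent roots `v` and `s` are not opposite corners, by `opposite`, so a rotation brings
  -- them to the side `r₀ s₀`.
  caseD : ∀ {m} {P : Graph m} {p q r₀ s₀} -> PlaneQuad P p q r₀ s₀ -> (ℓ : Lab E' U' (adj P)) -> Nom ℓ (Vec.lookup (p ∷ q ∷ r₀ ∷ s₀ ∷ [])) -> Cert E U r
  caseD {m} {P} {p} {q} {r₀} {s₀} Q ℓ N@(κx , κy , _ , _ , ex , ey , _) = go κx κy ex ey
   where
   nm = Vec.lookup (p ∷ q ∷ r₀ ∷ s₀ ∷ [])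
   N₁ = shift {ℓ = ℓ} N
   N₂ = shift {ℓ = ℓ} N₁
   N₃ = shift {ℓ = ℓ} N₂
   Q₁ = rotate Q
   Q₂ = rotate Q₁
   Q₃ = rotate Q₂
   go : ∀ κx κy -> Lab.lab ℓ v ≡ inl (nm κx) -> Lab.lab ℓ s ≡ inl (nm κy) -> Cert E U r
   go zero zero a b = absurd (apart ℓ Uv Us v≢s a b refl)
   go zero 1F a b = fromD Q₂ ℓ N₂ refl refl (inl (a , b))
   go zero 2F a b = absurd (opposite Q ℓ N (inl (a , b)))
   go zero 3F a b = fromD Q₁ ℓ N₁ refl refl (inr (a , b))
   go 1F zero a b = fromD Q₂ ℓ N₂ refl refl (inr (a , b))
   go 1F 1F a b = absurd (apart ℓ Uv Us v≢s a b refl)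
   go 1F 2F a b = fromD Q₃ ℓ N₃ refl refl (inl (a , b))
   go 1F 3F a b = absurd (opposite Q₁ ℓ N₁ (inl (a , b)))
   go 2F zero a b = absurd (opposite Q ℓ N (inr (a , b)))
   go 2F 1F a b = fromD Q₃ ℓ N₃ refl refl (inr (a , b))
   go 2F 2F a b = absurd (apart ℓ Uv Us v≢s a b refl)
   go 2F 3F a b = fromD Q ℓ N refl refl (inl (a , b))
   go 3F zero a b = fromD Q₁ ℓ N₁ refl refl (inl (a , b))
   go 3F 1F a b = absurd (opposite Q₁ ℓ N₁ (inr (a , b)))
   go 3F 2F a b = fromD Q ℓ N refl refl (inr (a , b))
   go 3F 3F a b = absurd (apart ℓ Uv Us v≢s a b refl)

  -- The only adjacent nominated vertices of class E are `p` and `q`. The new pair of vertices hangs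
  -- on them as the old pair hangs on `r₀` and `s₀`, which is class F.
  caseE : ∀ {m} {P : Graph m} {p q r₀ s₀} (Q : PlaneQuad P p q r₀ s₀) -> let w = cE m P p q r₀ s₀ Q in (ℓ : Lab E' U' (graphH w)) -> Nom ℓ (nominated w) -> Cert E U r
  caseE {m} {P} {p} {q} {r₀} {s₀} Q ℓ (κx , κy , κh , κk , nx , ny , nh , nk) = go (E-nom Q κx κy (joined ℓ nx ny)) nx ny
   where
   w = cE m P p q r₀ s₀ Q
   nm = nominated w
   done : (Lab.lab ℓ v ≡ inl (nm zero) × Lab.lab ℓ s ≡ inl (nm 1F)) ⊎ (Lab.lab ℓ v ≡ inl (nm 1F) × Lab.lab ℓ s ≡ inl (nm zero)) -> Cert E U r
   done pos = mkCert {r = r} (cF m P r₀ s₀ p q (rotate (rotate Q))) T.ℓ₂ (roots4 ℓ (old Uh h≢v h≢s κh nh) (1F , T.at-x) (zero , T.at-y) (old Uk k≢v k≢s κk nk))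
    where
    module T = Two (ext-sym {A = ext (adj P) r₀ s₀} (ext-sym {A = adj P} (Graph.sym P) r₀ s₀) (suc r₀) (suc s₀)) (suc (suc p)) (suc (suc q)) (PlaneQuad.pq Q) ℓ pos
    old : ∀ {u} -> U' u -> u ≢ v -> u ≢ s -> ∀ κ -> Lab.lab ℓ u ≡ inl (nm κ) -> ∃ λ j -> Lab.lab T.ℓ₂ u ≡ inl (nominated (cF m P r₀ s₀ p q (rotate (rotate Q))) j)
    old uu a b zero e = absurd ([ (λ (c , _) -> apart ℓ uu Uv a e c refl) , (λ (_ , c) -> apart ℓ uu Us b e c refl) ]′ pos)
    old uu a b 1F e = absurd ([ (λ (_ , c) -> apart ℓ uu Us b e c refl) , (λ (c , _) -> apart ℓ uu Uv a e c refl) ]′ pos)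
    old uu a b 2F e = 3F , trans (T.at-old uu) (cong (λ z -> lift (lift z)) e)
    old uu a b 3F e = 2F , trans (T.at-old uu) (cong (λ z -> lift (lift z)) e)
   go : (κx ≡ zero × κy ≡ 1F) ⊎ (κx ≡ 1F × κy ≡ zero) -> Lab.lab ℓ v ≡ inl (nm κx) -> Lab.lab ℓ s ≡ inl (nm κy) -> Cert E U r
   go (inl (refl , refl)) a b = done (inl (a , b))
   go (inr (refl , refl)) a b = done (inr (a , b))

  -- Adjacent nominated vertices of class A are the nominated hub and a leaf. With the other hub
  -- they form the triangle of class C: the new pair hangs on hub and leaf, and the remaining two
  -- leaves hang on both hubs.
  caseA : (ℓ : Lab E' U' HA) -> Nom ℓ nomA -> Cert E U r
  caseA ℓ (κx , κy , κh , κk , nx , ny , nh , nk) = go (HA-nom κx κy (joined ℓ nx ny)) nx ny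
   where
   done : ∀ j -> (Lab.lab ℓ v ≡ inl zero × Lab.lab ℓ s ≡ inl (nomA (suc j))) ⊎ (Lab.lab ℓ v ≡ inl (nomA (suc j)) × Lab.lab ℓ s ≡ inl zero) -> Cert E U r
   done j pos = mkCert {r = r} cC Rl.relabel (roots4 ℓ (old Uh h≢v h≢s κh nh) (1F , trans (cong relab T.at-x) (cong inl (snd (toC-new j))))
     (zero , trans (cong relab T.at-y) (cong inl (fst (toC-new j)))) (old Uk k≢v k≢s κk nk))
    where
    hub : ∀ j -> HA zero (nomA (suc j)) ≡ true
    hub zero = refl
    hub 1F = refl
    hub 2F = refl
    module T = Two HA-sym zero (nomA (suc j)) (hub j) ℓ pos
    module Rl = Relabel {B = HC} (toC j) (fromC j) (toC-from j) (fromC-to j) (toC-hom j) T.ℓ₂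
    relab : Label 7 -> Label 7
    relab = Sum.map (toC j) (on₃ (toC j))
    old : ∀ {u} -> U' u -> u ≢ v -> u ≢ s -> ∀ κ -> Lab.lab ℓ u ≡ inl (nomA κ) -> ∃ λ i -> relab (Lab.lab T.ℓ₂ u) ≡ inl (nomC i)
    old uu a b κ e = let i , e' = toC-nom j κ n₀ nj in i , trans (cong relab (trans (T.at-old uu) (cong (λ z -> lift (lift z)) e))) (cong inl e')
     where
     n₀ : κ ≢ zero
     n₀ refl = [ (λ (c , _) -> apart ℓ uu Uv a e c refl) , (λ (_ , c) -> apart ℓ uu Us b e c refl) ]′ pos
     nj : κ ≢ suc j
     nj refl = [ (λ (_ , c) -> apart ℓ uu Us b e c refl) , (λ (c , _) -> apart ℓ uu Uv a e c refl) ]′ pos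
   go : ∀ {κx κy} -> (κx ≡ zero × κy ≢ zero) ⊎ (κx ≢ zero × κy ≡ zero) -> Lab.lab ℓ v ≡ inl (nomA κx) -> Lab.lab ℓ s ≡ inl (nomA κy) -> Cert E U r
   go {κy = zero} (inl (refl , n)) a b = absurd (n refl)
   go {κy = suc j} (inl (refl , n)) a b = done j (inl (a , b))
   go {κx = zero} (inr (n , refl)) a b = absurd (n refl)
   go {κx = suc j} (inr (n , refl)) a b = done j (inr (a , b))

  -- The virtual edge joins the roots `v` and `s`, which is impossible in classes B, C and F.
  back : Cert E U r
  back = go (Cert.w C) (Cert.ℓ C) noms
   where
   false≢ : ∀ {b} -> b ≡ true -> b ≡ false -> ⊥
   false≢ refl ()
   go : ∀ w (ℓ : Lab E' U' (graphH w)) -> Nom ℓ (nominated w) -> Cert E U r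
   go cA ℓ N = caseA ℓ N
   go cB ℓ (a , b , _ , _ , nx , ny , _) = absurd (false≢ (joined ℓ nx ny) (HB-nom a b))
   go cC ℓ (a , b , _ , _ , nx , ny , _) = absurd (false≢ (joined ℓ nx ny) (HC-nom a b))
   go (cD m P p q r₀ s₀ Q) ℓ N = caseD Q ℓ N
   go (cE m P p q r₀ s₀ Q) ℓ N = caseE Q ℓ N
   go (cF m P p q r₀ s₀ Q) ℓ (a , b , _ , _ , nx , ny , _) = absurd (false≢ (joined ℓ nx ny) (F-nom {Q = Q} a b))

-- The recursion

others : ∀ i -> ∃ λ j -> ∃ λ k -> ∃ λ l -> Four i j k l
others zero = 1F , 2F , fourth _ _ _ (λ ()) (λ ()) (λ ())
others 1F = zero , 2F , fourth _ _ _ (λ ()) (λ ()) (λ ())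
others 2F = zero , 1F , fourth _ _ _ (λ ()) (λ ()) (λ ())
others 3F = zero , 1F , fourth _ _ _ (λ ()) (λ ()) (λ ())

others₂ : ∀ i j -> i ≢ j -> ∃₂ λ k l -> Four i j k l
others₂ i j ne with others i
... | a , b , c , F with Four.all F j
... | inl e = absurd (ne (sym e))
... | inr (inl refl) = b , c , F
... | inr (inr (inl refl)) = a , c , swap₂₃ F
... | inr (inr (inr refl)) = b , fourth i j b ne (Four.ik F) (λ e -> Four.kl F (sym e))

record Inst (n : ℕ) : Set₁ where
 field
  E     : Fin n -> Fin n -> Set
  E?    : Dec₂ E
  Esym  : ∀ {u v} -> E u v -> E v u
  irr   : ∀ {u v} -> E u v -> u ≢ v
  U     : Fin n -> Set
  U?    : Dec₁ U
  r     : Fin 4 -> Fin n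
  r-inj : ∀ {i j} -> r i ≡ r j -> i ≡ j
  r∈U   : ∀ i -> U (r i)

K4of : ∀ {n} -> Inst n -> Set
K4of I = Minors.K4 E E? Esym U r
 where
  open Inst I

Res : ∀ {n} -> Inst n -> Set
Res I = K4of I ⊎ Cert E U r
 where
  open Inst I

unplus : ∀ {n} {E : Fin n -> Fin n -> Set} {a b} {D : Fin n -> Set} -> ¬ (D a × D b) -> ∀ {u w} -> D u -> W (E⁺ E a b) D u w -> W E D u w
unplus n du ε = ε
unplus n du (step (inl e) s p) = step e s (unplus n s p)
unplus n du (step (inr (inl (refl , refl))) s p) = absurd (n (du , s))
unplus n du (step (inr (inr (refl , refl))) s p) = absurd (n (s , du))

plus : ∀ {n} (I : Inst n) a b -> a ≢ b -> Inst n
plus I a b ne = record { E = E⁺ E a b ; E? = λ u v -> E? u v ⊎? (((u ≟ a) ×? (v ≟ b)) ⊎? ((u ≟ b) ×? (v ≟ a)))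
 ; Esym = [ (λ e -> inl (Esym e)) , [ (λ (x , y) -> inr (inr (y , x))) , (λ (x , y) -> inr (inl (y , x))) ]′ ]′
 ; irr = λ { (inl e) -> irr e ; (inr (inl (refl , refl))) -> ne ; (inr (inr (refl , refl))) e -> ne (sym e) }
 ; U = U ; U? = U? ; r = r ; r-inj = r-inj ; r∈U = r∈U }
 where
  open Inst I

within : ∀ {n} (I : Inst n) {U' : Fin n -> Set} -> Dec₁ U' -> (r' : Fin 4 -> Fin n) -> (∀ {i j} -> r' i ≡ r' j -> i ≡ j) -> (∀ i -> U' (r' i)) -> Inst n
within I U'? r' inj r∈ = record { E = E ; E? = E? ; Esym = Esym ; irr = irr ; U? = U'? ; r = r' ; r-inj = inj ; r∈U = r∈ }
 where
  open Inst I

module OnInst {n} (I : Inst n) where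
 open Inst I
 open Shrink E E? Esym U U? r hiding (V; star)

 adjacent : (∀ i j -> i ≢ j -> E (r i) (r j)) -> K4
 adjacent f = record { φ = φ
  ; model = record { conn = λ i -> record { base = at i ; reach = λ {v} e -> subst (W E (Cl φ (rt i)) (r i)) (sym (of e)) ε } ; alive = al }
  ; touch = λ i j ne -> r i , r j , at i , at j , f i j ne }
  where
  φ : Fin n -> Part
  φ v with any? (λ i -> v ≟ r i)
  ... | yes (i , _) = rt i
  ... | no _ = fr
  at : ∀ i -> φ (r i) ≡ rt i
  at i with any? (λ j -> r i ≟ r j)
  ... | yes (j , e) = cong rt (sym (r-inj e))
  ... | no n = absurd (n (i , refl))
  of : ∀ {v i} -> φ v ≡ rt i -> v ≡ r i
  of {v} e with any? (λ i -> v ≟ r i)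
  of refl | yes (i , e) = e
  al : ∀ {v} -> φ v ≢ fr -> U v
  al {v} ne with any? (λ i -> v ≟ r i)
  ... | yes (i , refl) = r∈U i
  ... | no _ = absurd (ne refl)

 at-root : ∀ {φ} -> Model φ -> ∀ i -> φ (r i) ≡ rt i
 at-root M i = base (conn M i)

 starCert : ∀ {φ h s} -> StarCore φ h s -> Cert E U r
 starCert {φ} {h} {s} St = go (others h)
  where
  open StarCore St
  go : (∃ λ x -> ∃ λ y -> ∃ λ k -> Four h x y k) -> Cert E U r
  go (x , y , k , F) = mkCert {r = r} cA Hb.lab nom
   where
   gz : Fin 4 -> Fin 3
   gz z with z ≟ y | z ≟ k
   ... | yes _ | _ = 1F
   ... | no _ | yes _ = 2F
   ... | no _ | no _ = zero
   g : Part -> Fin 3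
   g (rt z) = gz z
   -- Apart from the hubs, vertices outside the three leaf sets touch none of these sets; they are
   -- put into the clique at the first leaf.
   g aux = zero
   g fr = zero
   back : Fin 3 -> Fin 4
   back zero = x
   back 1F = y
   back 2F = k
   inv : ∀ z -> z ≢ h -> z ≡ back (gz z)
   inv z zh with z ≟ y | z ≟ k
   ... | yes e | _ = e
   ... | no _ | yes e = e
   ... | no a | no b with Four.all F z
   ... | inl e = absurd (zh e)
   ... | inr (inl e) = e
   ... | inr (inr (inl e)) = absurd (a e)
   ... | inr (inr (inr e)) = absurd (b e)
   none : ∀ z -> z ≢ y -> z ≢ k -> gz z ≡ zero
   none z a b with z ≟ y | z ≟ k
   ... | yes e | _ = absurd (a e)
   ... | no _ | yes e = absurd (b e)
   ... | no _ | no _ = refl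
   gback : ∀ j -> gz (back j) ≡ j
   gback zero = none x (Four.jk F) (Four.jl F)
   gback 1F with y ≟ y
   ... | yes _ = refl
   ... | no n = absurd (n refl)
   gback 2F with k ≟ y | k ≟ k
   ... | yes e | _ = absurd (Four.kl F (sym e))
   ... | no _ | yes _ = refl
   ... | no _ | no n = absurd (n refl)
   gh : gz h ≡ zero
   gh = none h (Four.ik F) (Four.il F)
   backh : ∀ j -> back j ≢ h
   backh zero e = Four.ij F (sym e)
   backh 1F e = Four.ik F (sym e)
   backh 2F e = Four.il F (sym e)
   r≢s : ∀ i -> r i ≢ s
   r≢s i refl with trans (sym s-sp) (at-root model i)
   ... | ()
   sp≢fr : aux ≢ fr
   sp≢fr ()
   κ : Fin n -> Fin 5
   κ v = suc (suc (g (φ v)))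
   κr : ∀ z -> κ (r z) ≡ suc (suc (gz z))
   κr z = cong (λ c -> suc (suc (g c))) (at-root model z)
   ss : ∀ {a b : Fin 3} -> _≡_ {A = Fin 5} (suc (suc a)) (suc (suc b)) -> a ≡ b
   ss refl = refl
   leaf : ∀ c -> (∃ λ z -> c ≡ rt z × z ≢ h) ⊎ g c ≡ zero
   leaf aux = inr refl
   leaf fr = inr refl
   leaf (rt z) with z ≟ h
   ... | yes refl = inr gh
   ... | no ne = inl (z , refl , ne)
   half : ∀ {u v} -> U v -> v ≢ r h -> v ≢ s -> E u v -> (∃ λ z -> φ u ≡ rt z × z ≢ h) -> φ u ≡ φ v
   half uv a b e (z , p , zh) = [ (λ q -> trans p (sym q)) , [ (λ q -> absurd (a q)) , (λ q -> absurd (b q)) ]′ ]′ (closed zh p e uv)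
   cl : ∀ {u v} -> U u -> U v -> u ≢ r h -> u ≢ s -> v ≢ r h -> v ≢ s -> E u v -> κ u ≡ κ v
   cl {u} {v} uu uv a b c d e with leaf (φ u) | leaf (φ v)
   ... | inl l | _ = cong (λ c -> suc (suc (g c))) (half uv c d e l)
   ... | inr _ | inl l = cong (λ c -> suc (suc (g c))) (sym (half uu a b (Esym e) l))
   ... | inr p | inr q = cong (λ c -> suc (suc c)) (trans p (sym q))
   tri : ∀ j -> IsTriangle HA (zero , 1F , suc (suc j))
   tri zero = refl , refl , refl
   tri 1F = refl , refl , refl
   tri 2F = refl , refl , refl
   Rep : Fin n -> Set
   Rep v = ∃ λ z -> z ≢ h × v ≡ r z
   uniq : ∀ {u v} -> Rep u -> Rep v -> κ u ≡ κ v -> u ≡ v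
   uniq (z , zh , refl) (z' , zh' , refl) e = cong r (trans (inv z zh) (trans (cong back (ss (trans (sym (κr z)) (trans e (κr z'))))) (sym (inv z' zh'))))
   reps : ∀ i -> i ≡ zero ⊎ i ≡ 1F ⊎ ∃ λ v -> U v × v ≢ r h × v ≢ s × Rep v × κ v ≡ i
   reps zero = inl refl
   reps 1F = inr (inl refl)
   reps (suc (suc j)) = inr (inr (r (back j) , r∈U _ , (λ e -> backh j (r-inj e)) , r≢s _ , (back j , backh j , refl) , trans (κr (back j)) (cong (λ c -> suc (suc c)) (gback j))))
   module Hb = Hubs {U = U} HA-sym Esym irr zero 1F (λ ()) refl (r h) s (r≢s h) (r∈U h) (alive model λ q -> sp≢fr (trans (sym s-sp) q)) κ
    (λ v -> tri (g (φ v))) (λ _ ()) (λ _ ()) {Rep} (λ v -> any? λ z -> ¬? (z ≟ h) ×? (v ≟ r z))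
    uniq
    reps
    cl
   nomA≡ : ∀ j -> suc (suc j) ≡ nomA (suc j)
   nomA≡ zero = refl
   nomA≡ 1F = refl
   nomA≡ 2F = refl
   nom : ∀ z -> ∃ λ j -> Lab.lab Hb.lab (r z) ≡ inl (nomA j)
   nom z with z ≟ h
   ... | yes refl = zero , Hb.lab-p
   ... | no zh = suc (gz z) , trans (Hb.lab-rep (λ e -> zh (r-inj e)) (r≢s z) (z , zh , refl)) (cong inl (trans (κr z) (nomA≡ (gz z))))

 module OfCut {φ h x y k v s} (C : Cut φ h x y k v s) where
  open Cut C
  Xx Xy U' Rest : Fin n -> Set
  Xx u = φ u ≡ rt x
  Xy u = φ u ≡ rt y
  U' u = (U u × ¬ Xy u) × ¬ Xx u
  Rest u = U' u × u ≢ v × u ≢ s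
  Xx? : Dec₁ Xx
  Xx? u = φ u ≟ₚ rt x
  Xy? : Dec₁ Xy
  Xy? u = φ u ≟ₚ rt y
  U'? : Dec₁ U'
  U'? u = (U? u ×? ¬? (Xy? u)) ×? ¬? (Xx? u)
  Rest? : Dec₁ Rest
  Rest? u = U'? u ×? (¬? (u ≟ v) ×? ¬? (u ≟ s))
  not : ∀ {u c d} -> φ u ≡ c -> c ≢ d -> φ u ≢ d
  not e ne q = ne (trans (sym e) q)
  inU' : ∀ {u c} -> φ u ≡ c -> c ≢ fr -> c ≢ rt x -> c ≢ rt y -> U' u
  inU' e a b d = (alive model (not e a) , not e d) , not e b
  Uv : U' v
  Uv = inU' v-h (λ ()) (λ q -> Four.ij four (rt-inj q)) (λ q -> Four.ik four (rt-inj q))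
  Us : U' s
  Us = inU' s-sp (λ ()) (λ ()) (λ ())
  Uh : U' (r h)
  Uh = inU' (at-root model h) (λ ()) (λ q -> Four.ij four (rt-inj q)) (λ q -> Four.ik four (rt-inj q))
  Uk : U' (r k)
  Uk = inU' (at-root model k) (λ ()) (λ q -> Four.jl four (sym (rt-inj q))) (λ q -> Four.kl four (sym (rt-inj q)))
  differ : ∀ {u w c d} -> φ u ≡ c -> φ w ≡ d -> c ≢ d -> u ≢ w
  differ a b ne refl = ne (trans (sym a) b)
  v≢s : v ≢ s
  v≢s = differ v-h s-sp λ ()
  h≢v : r h ≢ v
  h≢v e = v≢ (sym e)
  r≢s : ∀ i -> r i ≢ s
  r≢s i = differ (at-root model i) s-sp λ ()
  k≢v : r k ≢ v
  k≢v = differ (at-root model k) v-h λ q -> Four.il four (sym (rt-inj q))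
  hkRest : Rest (r h) × Rest (r k)
  hkRest = (Uh , h≢v , r≢s h) , (Uk , k≢v , r≢s k)
  dis : ∀ {u} -> Xx u -> ¬ Xy u
  dis p q = Four.jk four (rt-inj (trans (sym p) q))

  -- Without `v` and `s` the roots lie in four different parts: the sets of `x` and of `y`, the
  -- component of `r k`, and all the rest, which contains `r h`. No edge joins two parts, so `v` and
  -- `s` are the hubs of class B.
  cutB : ¬ W E Rest (r h) (r k) -> Cert E U r
  cutB apart = mkCert {r = r} cB Hb.lab nom
   where
   Ck : Fin n -> Set
   Ck = W E Rest (r k)
   Ck? : Dec₁ Ck
   Ck? = W? E? Rest? (r k)
   gd : ∀ {A B C : Set} -> Dec A -> Dec B -> Dec C -> Fin 4
   gd (yes _) _ _ = 1F
   gd (no _) (yes _) _ = 2F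
   gd (no _) (no _) (yes _) = 3F
   gd (no _) (no _) (no _) = zero
   gd-cong : ∀ {A B C A' B' C' : Set} (a : Dec A) (b : Dec B) (c : Dec C) (a' : Dec A') (b' : Dec B') (c' : Dec C') ->
        (A -> A') -> (A' -> A) -> (B -> B') -> (B' -> B) -> (C -> C') -> (C' -> C) -> gd a b c ≡ gd a' b' c'
   gd-cong (yes _) _ _ (yes _) _ _ _ _ _ _ _ _ = refl
   gd-cong (yes a) _ _ (no n) _ _ f _ _ _ _ _ = absurd (n (f a))
   gd-cong (no n) _ _ (yes a) _ _ _ f _ _ _ _ = absurd (n (f a))
   gd-cong (no _) (yes _) _ (no _) (yes _) _ _ _ _ _ _ _ = refl
   gd-cong (no _) (yes b) _ (no _) (no n) _ _ _ f _ _ _ = absurd (n (f b))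
   gd-cong (no _) (no n) _ (no _) (yes b) _ _ _ _ f _ _ = absurd (n (f b))
   gd-cong (no _) (no _) (yes _) (no _) (no _) (yes _) _ _ _ _ _ _ = refl
   gd-cong (no _) (no _) (yes c) (no _) (no _) (no n) _ _ _ _ f _ = absurd (n (f c))
   gd-cong (no _) (no _) (no n) (no _) (no _) (yes c) _ _ _ _ _ f = absurd (n (f c))
   gd-cong (no _) (no _) (no _) (no _) (no _) (no _) _ _ _ _ _ _ = refl
   g : Fin n -> Fin 4
   g u = gd (Xx? u) (Xy? u) (Ck? u)
   back : Fin 4 -> Fin 4
   back zero = h
   back 1F = x
   back 2F = y
   back 3F = k
   CkRest : ∀ {u} -> Ck u -> Rest u
   CkRest = W-end∈ (snd hkRest)
   ¬Ckh : ¬ Ck (r h)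
   ¬Ckh c = apart (W-rev Esym (snd hkRest) c)
   gr : ∀ j -> g (r (back j)) ≡ j
   gr zero = gd-no (Xx? _) (Xy? _) (Ck? _) (snd Uh) (snd (fst Uh)) ¬Ckh
    where
    gd-no : ∀ {A B C : Set} (a : Dec A) (b : Dec B) (c : Dec C) -> ¬ A -> ¬ B -> ¬ C -> gd a b c ≡ zero
    gd-no (yes a) _ _ na _ _ = absurd (na a)
    gd-no (no _) (yes b) _ _ nb _ = absurd (nb b)
    gd-no (no _) (no _) (yes c) _ _ nc = absurd (nc c)
    gd-no (no _) (no _) (no _) _ _ _ = refl
   gr 1F with Xx? (r x)
   ... | yes _ = refl
   ... | no n = absurd (n (at-root model x))
   gr 2F with Xx? (r y) | Xy? (r y)
   ... | yes e | _ = absurd (dis e (at-root model y))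
   ... | no _ | yes _ = refl
   ... | no _ | no n = absurd (n (at-root model y))
   gr 3F with Xx? (r k) | Xy? (r k) | Ck? (r k)
   ... | yes e | _ | _ = absurd (snd Uk e)
   ... | no _ | yes e | _ = absurd (snd (fst Uk) e)
   ... | no _ | no _ | yes _ = refl
   ... | no _ | no _ | no n = absurd (n ε)
   inv : ∀ z -> ∃ λ j -> z ≡ back j
   inv z with Four.all four z
   ... | inl e = zero , e
   ... | inr (inl e) = 1F , e
   ... | inr (inr (inl e)) = 2F , e
   ... | inr (inr (inr e)) = 3F , e
   gz : ∀ z -> z ≡ back (g (r z))
   gz z with inv z
   ... | j , refl = cong back (sym (gr j))
   r≢v : ∀ i -> r i ≢ v
   r≢v i e with i ≟ h
   ... | yes refl = v≢ (sym e)
   ... | no ne = differ (at-root model i) v-h (λ q -> ne (rt-inj q)) e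
   stuck : ∀ {X : Fin n -> Set} {w} -> w ≢ v -> w ≢ s -> X w ⊎ w ≡ v ⊎ w ≡ s -> X w
   stuck a b = [ (λ z -> z) , [ (λ e -> absurd (a e)) , (λ e -> absurd (b e)) ]′ ]′
   cl : ∀ {u w} -> U u -> U w -> u ≢ v -> u ≢ s -> w ≢ v -> w ≢ s -> E u w -> g u ≡ g w
   cl {u} {w} uu uw a b c d e = gd-cong (Xx? u) (Xy? u) (Ck? u) (Xx? w) (Xy? w) (Ck? w) xu xw yu yw
     (λ q -> q ∙ edge e ((((uw , λ p -> snd (fst (fst (CkRest q))) (yw p)) , λ p -> snd (fst (CkRest q)) (xw p))) , c , d))
     (λ q -> q ∙ edge (Esym e) ((((uu , λ p -> snd (fst (fst (CkRest q))) (yu p)) , λ p -> snd (fst (CkRest q)) (xu p))) , a , b))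
    where
    xu : Xx u -> Xx w
    xu p = stuck {Xx} c d (cx p e uw)
    xw : Xx w -> Xx u
    xw p = stuck {Xx} a b (cx p (Esym e) uu)
    yu : Xy u -> Xy w
    yu p = stuck {Xy} c d (cy p e uw)
    yw : Xy w -> Xy u
    yw p = stuck {Xy} a b (cy p (Esym e) uu)
   tri : ∀ j -> IsTriangle HB (zero , 1F , suc (suc j))
   tri zero = refl , refl , refl
   tri 1F = refl , refl , refl
   tri 2F = refl , refl , refl
   tri 3F = refl , refl , refl
   ss : ∀ {a b : Fin 4} -> _≡_ {A = Fin 6} (suc (suc a)) (suc (suc b)) -> a ≡ b
   ss refl = refl
   Rep : Fin n -> Set
   Rep u = ∃ λ z -> u ≡ r z
   uniq : ∀ {u w} -> Rep u -> Rep w -> suc (suc (g u)) ≡ suc (suc (g w)) -> u ≡ w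
   uniq (z , refl) (z' , refl) e = cong r (trans (gz z) (trans (cong back (ss e)) (sym (gz z'))))
   reps : ∀ i -> i ≡ zero ⊎ i ≡ 1F ⊎ ∃ λ u -> U u × u ≢ v × u ≢ s × Rep u × suc (suc (g u)) ≡ i
   reps zero = inl refl
   reps 1F = inr (inl refl)
   reps (suc (suc j)) = inr (inr (r (back j) , r∈U _ , r≢v _ , r≢s _ , (back j , refl) , cong (λ c -> suc (suc c)) (gr j)))
   module Hb = Hubs {U = U} HB-sym Esym irr zero 1F (λ ()) refl v s v≢s (fst (fst Uv)) (fst (fst Us)) (λ u -> suc (suc (g u)))
    (λ u -> tri (g u)) (λ _ ()) (λ _ ()) {Rep} (λ u -> any? λ z -> u ≟ r z)
    uniq
    reps
    (λ a b c d e f q -> cong (λ c -> suc (suc c)) (cl a b c d e f q))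
   nomB≡ : ∀ j -> suc (suc j) ≡ nomB j
   nomB≡ zero = refl
   nomB≡ 1F = refl
   nomB≡ 2F = refl
   nomB≡ 3F = refl
   nom : ∀ z -> ∃ λ j -> Lab.lab Hb.lab (r z) ≡ inl (nomB j)
   nom z = g (r z) , trans (Hb.lab-rep (r≢v z) (r≢s z) (z , refl)) (cong inl (nomB≡ (g (r z))))

  module Rd (path : W E Rest (r h) (r k)) = Reduce {E = E} Esym irr {U} r r-inj {Xx} {Xy} Xx? Xy? four v s r∈U (at-root model x) (at-root model y) dis
    Uv Us Uh Uk v≢s h≢v (r≢s h) k≢v (r≢s k) cx cy path

  smaller : cnt U'? < cnt U?
  smaller = cnt-strict U'? U? (λ u -> fst (fst u)) (r x) (r∈U x) λ u -> snd u (at-root model x)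

  module Recur (path : W E Rest (r h) (r k)) where
   open Rd path using (r'; r'x; r'y; r'h; r'k)
   r'∈ : ∀ z -> U' (r' z)
   r'∈ z with Four.all four z
   ... | inl refl = subst U' (sym r'h) Uh
   ... | inr (inl refl) = subst U' (sym r'x) Uv
   ... | inr (inr (inl refl)) = subst U' (sym r'y) Us
   ... | inr (inr (inr refl)) = subst U' (sym r'k) Uk
   r'-inj : ∀ {i j} -> r' i ≡ r' j -> i ≡ j
   r'-inj = Four-inj four r' (λ e -> h≢v (trans (sym r'h) (trans e r'x))) (λ e -> r≢s h (trans (sym r'h) (trans e r'y)))
    (λ e -> Four.il four (r-inj (trans (sym r'h) (trans e r'k)))) (λ e -> v≢s (trans (sym r'x) (trans e r'y)))
    (λ e -> k≢v (trans (sym r'k) (trans (sym e) r'x))) (λ e -> r≢s k (trans (sym r'k) (trans (sym e) r'y)))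
   I' : Inst n
   I' = plus (within I U'? r' r'-inj r'∈) v s v≢s

   -- The virtual edge v s is replaced by an edge from s to the piece of r x.
   lift-k4 : K4of I' -> K4
   lift-k4 K = record { φ = ψ ; model = record { conn = cn ; alive = al } ; touch = λ i j ne -> tch (K.touch i j ne) }
    where
    module I' = Inst I'
    module M' = Minors I'.E I'.E? I'.Esym I'.U I'.r
    module K = M'.K4 K
    ψ : Fin n -> Part
    ψ = paint Xx? (rt x) (paint Xy? (rt y) K.φ)
    out : ∀ {u z} -> K.φ u ≡ rt z -> U' u
    out e = M'.alive K.model λ q -> rt≢fr (trans (sym e) q)
     where
     rt≢fr : ∀ {z} -> rt z ≢ fr
     rt≢fr ()
    ψ-K : ∀ {u z} -> K.φ u ≡ rt z -> ψ u ≡ rt z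
    ψ-K e = let (_ , ny) , nx = out e in trans (paint-out Xx? nx) (trans (paint-out Xy? ny) e)
    ψ-x : ∀ {u} -> Xx u -> ψ u ≡ rt x
    ψ-x = paint-in Xx?
    ψ-y : ∀ {u} -> Xy u -> ψ u ≡ rt y
    ψ-y e = trans (paint-out Xx? λ p -> dis p e) (paint-in Xy? e)
    ψ-inv : ∀ {u z} -> ψ u ≡ rt z -> (Xx u × z ≡ x) ⊎ (Xy u × z ≡ y) ⊎ K.φ u ≡ rt z
    ψ-inv e = [ (λ (a , q) -> inl (a , sym (rt-inj q))) , (λ (_ , q) -> inr ([ (λ (a , q) -> inl (a , sym (rt-inj q))) , (λ (_ , q) -> inr q) ]′ (paint-inv Xy? q))) ]′ (paint-inv Xx? e)
    Kv : K.φ v ≡ rt x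
    Kv = subst (λ u -> K.φ u ≡ rt x) r'x (M'.Rooted.base (M'.conn K.model x))
    Ks : K.φ s ≡ rt y
    Ks = subst (λ u -> K.φ u ≡ rt y) r'y (M'.Rooted.base (M'.conn K.model y))
    cls : ∀ z -> Rooted (λ u -> K.φ u ≡ rt z) (r' z)
    cls z = record { base = b ; reach = λ d -> unplus (λ (p , q) -> Four.jk four (rt-inj (trans (sym Kv) (trans p (trans (sym q) Ks))))) b (M'.Rooted.reach (M'.conn K.model z) d) }
     where
      b = M'.Rooted.base (M'.conn K.model z)
    cn : ∀ z -> Rooted (Cl ψ (rt z)) (r z)
    cn z = at (Four.all four z)
     where
     plain : z ≢ x -> z ≢ y -> r' z ≡ r z -> Rooted (Cl ψ (rt z)) (r z)
     plain zx zy eq = subst (Rooted (Cl ψ (rt z))) eq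
      (Rooted-≃ ψ-K (λ q -> [ (λ (_ , e) -> absurd (zx e)) , [ (λ (_ , e) -> absurd (zy e)) , (λ e -> e) ]′ ]′ (ψ-inv q)) (cls z))
     at : z ≡ h ⊎ z ≡ x ⊎ z ≡ y ⊎ z ≡ k -> Rooted (Cl ψ (rt z)) (r z)
     at (inl refl) = plain (Four.ij four) (Four.ik four) r'h
     at (inr (inl refl)) = let b , pb , e = xv in
      Rooted-≃ [ ψ-K , ψ-x ]′ (λ q -> [ (λ (a , _) -> inr a) , [ (λ (_ , e) -> absurd (Four.jk four e)) , inl ]′ ]′ (ψ-inv q))
       (grow (conn model x) (subst (Rooted (λ u -> K.φ u ≡ rt x)) r'x (cls x)) pb (Esym e))
     at (inr (inr (inl refl))) = let b , pb , e = ys in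
      Rooted-≃ [ ψ-K , ψ-y ]′ (λ q -> [ (λ (_ , e) -> absurd (Four.jk four (sym e))) , [ (λ (a , _) -> inr a) , inl ]′ ]′ (ψ-inv q))
       (grow (conn model y) (subst (Rooted (λ u -> K.φ u ≡ rt y)) r'y (cls y)) pb (Esym e))
     at (inr (inr (inr refl))) = plain (λ e -> Four.jl four (sym e)) (λ e -> Four.kl four (sym e)) r'k
    al : ∀ {u} -> ψ u ≢ fr -> U u
    al {u} ne = go (Xx? u) (Xy? u)
     where
     go : Dec (Xx u) -> Dec (Xy u) -> U u
     go (yes p) _ = alive model (not p λ ())
     go (no _) (yes p) = alive model (not p λ ())
     go (no a) (no b) = fst (fst (M'.alive K.model λ q -> ne (trans (paint-out Xx? a) (trans (paint-out Xy? b) q))))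
    xy : Touch ψ (rt x) (rt y)
    xy = let b , pb , e = xs in b , s , ψ-x pb , ψ-K Ks , Esym e
    tch : ∀ {i j} -> M'.Touch K.φ (rt i) (rt j) -> Touch ψ (rt i) (rt j)
    tch (u , w , p , q , inl e) = u , w , ψ-K p , ψ-K q , e
    tch (u , w , p , q , inr (inl (refl , refl))) with trans (sym p) Kv | trans (sym q) Ks
    ... | refl | refl = xy
    tch (u , w , p , q , inr (inr (refl , refl))) with trans (sym p) Ks | trans (sym q) Kv
    ... | refl | refl = Touch-sym xy

-- Removing an added root edge

module _ {n : ℕ} where
 supp : ∀ {E : Fin n -> Fin n -> Set} {S u v} -> W E S u v -> List (Fin n)
 supp ε = []
 supp (step {w = w} e s p) = w ∷ supp p

 supp⊂ : ∀ {E : Fin n -> Fin n -> Set} {S u v} (p : W E S u v) -> ∀ {w} -> w ∈ supp p -> S w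
 supp⊂ (step e s p) (here refl) = s
 supp⊂ (step e s p) (there m) = supp⊂ p m

 within-supp : ∀ {E : Fin n -> Fin n -> Set} {S u v} (p : W E S u v) {D : Fin n -> Set} -> (∀ {w} -> w ∈ supp p -> D w) -> W E D u v
 within-supp ε f = ε
 within-supp (step e s p) f = step e (f (here refl)) (within-supp p (λ m -> f (there m)))

 subset : {D : Fin n -> Set} -> Dec₁ D -> Subset n
 subset D? = Vec.tabulate λ v -> ⌊ D? v ⌋

 subset⁺ : {D : Fin n -> Set} (D? : Dec₁ D) -> ∀ {v} -> D v -> v Subset.∈ subset D?
 subset⁺ D? {v} d = lookup⇒[]= v (subset D?) (trans (lookup∘tabulate (λ v -> ⌊ D? v ⌋) v) (⌊⌋⁺ (D? v) d))

 subset⁻ : {D : Fin n -> Set} (D? : Dec₁ D) -> ∀ {v} -> v Subset.∈ subset D? -> D v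
 subset⁻ D? {v} m = ⌊⌋⁻ (D? v) (trans (sym (lookup∘tabulate (λ v -> ⌊ D? v ⌋) v)) ([]=⇒lookup m))

module FromK4 {n} (I : Inst n) (N : ℕ) (rec : ∀ (I' : Inst n) -> cnt (Inst.U? I') < N -> Res I') (lt : cnt (Inst.U? I) < suc N)
       (i j : Fin 4) (i≢j : i ≢ j) where
 open Inst I
 open Shrink E E? Esym U U? r hiding (V) renaming (Res to Outcome)
 open OnInst I
 private
  ri≢rj : r i ≢ r j
  ri≢rj e = i≢j (r-inj e)
  I⁺ = plus I (r i) (r j) ri≢rj
  k l : Fin 4
  k = fst (others₂ i j i≢j)
  l = fst (snd (others₂ i j i≢j))
  F : Four i j k l
  F = snd (snd (others₂ i j i≢j))
  -- Disjoint paths are encoded by a vertex set that contains one and misses the other. There are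
  -- finitely many sets, so the existence of such paths is decidable.
  Cond : Subset n -> Set
  Cond p = ((r i Subset.∈ p) × W E (λ v -> U v × v Subset.∈ p) (r i) (r j)) × (¬ (r k Subset.∈ p) × W E (λ v -> U v × ¬ (v Subset.∈ p)) (r k) (r l))
  Cond? : Dec₁ Cond
  Cond? p = ((r i ∈ₛ? p) ×? W? E? (λ v -> U? v ×? (v ∈ₛ? p)) (r i) (r j)) ×? (¬? (r k ∈ₛ? p) ×? W? E? (λ v -> U? v ×? ¬? (v ∈ₛ? p)) (r k) (r l))

 noLink : ¬ (∃ Cond) -> NoLink E U (r i) (r j) (r k) (r l)
 noLink none P Q P⊂ Q⊂ dis pi qk wp wq = none (subset D? ,
   (subset⁺ D? (here refl) , within-supp wp (λ m -> P⊂ (supp⊂ wp m) , subset⁺ D? (there m))) ,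
   (λ m -> dis (D⊂ (subset⁻ D? m)) qk) , W-mono (λ q -> Q⊂ q , λ m -> dis (D⊂ (subset⁻ D? m)) q) wq)
  where
  D? : Dec₁ (_∈ r i ∷ supp wp)
  D? v = v ∈? (r i ∷ supp wp)
  D⊂ : ∀ {v} -> v ∈ r i ∷ supp wp -> P v
  D⊂ (here refl) = pi
  D⊂ (there m) = supp⊂ wp m

 planeCert : Plane E U (r j) (r k) (r i) (r l) -> Cert E U r
 planeCert D = mkCert {r = r} (cD _ P p' q' r' s' plane) ℓ nom
  where
  open Plane D
  nom : ∀ z -> ∃ λ t -> Lab.lab ℓ (r z) ≡ inl (nominated (cD _ P p' q' r' s' plane) t)
  nom z with Four.all F z
  ... | inl refl = 2F , lr
  ... | inr (inl refl) = zero , lp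
  ... | inr (inr (inl refl)) = 1F , lq
  ... | inr (inr (inr refl)) = 3F , ls

 planarCert : ¬ (∃ Cond) -> Cert E U r
 planarCert none = planeCert (planar (suc (cnt U?)) E? Esym irr U? ≤-refl un inU (noLink none))
  where
  ne : ∀ {a b} -> a ≢ b -> r a ≢ r b
  ne n e = n (r-inj e)
  un = (ne (Four.ik F) ∷ ne (Four.ij F) ∷ ne (Four.il F) ∷ []) ∷ (ne (λ e -> Four.jk F (sym e)) ∷ ne (Four.kl F) ∷ []) ∷ (ne (Four.jl F) ∷ []) ∷ [] ∷ []
  inU : ∀ {v} -> v ∈ r i ∷ r k ∷ r j ∷ [ r l ] -> U v
  inU (here refl) = r∈U i
  inU (there (here refl)) = r∈U k
  inU (there (there (here refl))) = r∈U j
  inU (there (there (there (here refl)))) = r∈U l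

 outcome : Outcome -> Res I
 outcome (k4! K) = inl K
 outcome (star S) = inr (starCert S)
 outcome (cut {φ} {h} {x} {y} {k'} {v} {s} C) = go (W? E? Rest? (r h) (r k'))
  where
  open OfCut C
  go : Dec (W E Rest (r h) (r k')) -> Res I
  go (no apart) = inr (cutB apart)
  go (yes path) = [ (λ K -> inl (Recur.lift-k4 path K)) , (λ c -> inr (Rd.Back.back path c)) ]′ (rec (Recur.I' path) (≤-trans smaller (≤-pred lt)))

 -- The added edge joins the sets of `i` and `j`, so no branch set and no other contact relies on
 -- it. Hence the K₄ leaves a model of the cycle `i k j l`. Its colour `aux` is cleared, as the
 -- uncrossing starts without a fifth set.
 linked : K4of I⁺ -> (∃ Cond) -> Res I
 linked K (p , (pi , wp) , (nk , wq)) = [ inl , (λ (_ , _ , _ , _ , _ , A) -> outcome (core _ ≤-refl (fromA A))) ]′ (Cy.cycle _ ≤-refl cyc)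
  where
  module I⁺ = Inst I⁺
  module M' = Minors I⁺.E I⁺.E? I⁺.Esym I⁺.U I⁺.r
  module K = M'.K4 K
  S? : Dec₁ (λ u -> K.φ u ≡ aux)
  S? u = K.φ u ≟ₚ aux
  φ₀ : Fin n -> Part
  φ₀ = paint S? fr K.φ
  up : ∀ {u z} -> K.φ u ≡ rt z -> φ₀ u ≡ rt z
  up e = trans (paint-out S? λ q -> nosp (trans (sym q) e)) e
   where
   nosp : ∀ {z} -> aux ≢ rt z
   nosp ()
  dn : ∀ {u z} -> φ₀ u ≡ rt z -> K.φ u ≡ rt z
  dn e = [ (λ ()) , snd ]′ (Sum.map (λ (_ , q) -> q) (λ q -> q) (Sum.map (λ (a , q) -> a , fr≢ q) (λ q -> q) (paint-inv S? e)))
   where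
   fr≢ : ∀ {z} -> fr ≡ rt z -> ⊥
   fr≢ ()
  at : ∀ z -> K.φ (r z) ≡ rt z
  at z = M'.Rooted.base (M'.conn K.model z)
  model₀ : Model φ₀
  model₀ = record
   { conn = λ z -> record { base = up (at z) ; reach = λ e -> W-mono up (unplus (λ (a , b) -> i≢j (rt-inj (trans (sym (at i)) (trans a (trans (sym b) (at j)))))) (at z) (M'.Rooted.reach (M'.conn K.model z) (dn e))) }
   ; alive = λ {u} ne -> M'.alive K.model λ q -> ne (trans (paint-out S? λ q' -> bad (trans (sym q) q')) q) }
   where
   bad : fr ≢ aux
   bad ()
  t : ∀ z z' -> z ≢ z' -> ¬ (z ≡ i × z' ≡ j) -> ¬ (z ≡ j × z' ≡ i) -> Touch φ₀ (rt z) (rt z')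
  t z z' ne a b with K.touch z z' ne
  ... | u , w , p , q , inl e = u , w , up p , up q , e
  ... | u , w , p , q , inr (inl (refl , refl)) = absurd (a (rt-inj (trans (sym p) (at i)) , rt-inj (trans (sym q) (at j))))
  ... | u , w , p , q , inr (inr (refl , refl)) = absurd (b (rt-inj (trans (sym p) (at j)) , rt-inj (trans (sym q) (at i))))
  P Q : Fin n -> Set
  P = W E (λ v -> U v × v Subset.∈ p) (r i)
  Q = W E (λ v -> U v × ¬ (v Subset.∈ p)) (r k)
  P? : Dec₁ P
  P? = W? E? (λ v -> U? v ×? (v ∈ₛ? p)) (r i)
  Q? : Dec₁ Q
  Q? = W? E? (λ v -> U? v ×? ¬? (v ∈ₛ? p)) (r k)
  P⊂ : ∀ {v} -> P v -> U v × v Subset.∈ p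
  P⊂ = W-end∈ (r∈U i , pi)
  Q⊂ : ∀ {v} -> Q v -> U v × ¬ (v Subset.∈ p)
  Q⊂ = W-end∈ (r∈U k , nk)
  M : Fin n -> Fin n -> Set
  M u v = (P u × P v) ⊎ (Q u × Q v)
  module Cy = Cycle M (λ u v -> (P? u ×? P? v) ⊎? (Q? u ×? Q? v)) (Sum.map (λ (a , b) -> b , a) (λ (a , b) -> b , a))
  open Four F
  cyc : Cy.Cyc φ₀ P Q i k j l
  cyc = record
   { four = swap₂₃ F ; model = model₀ ; nosp = λ e -> [ (λ (_ , q) -> fs q) , (λ (a , q) -> a q) ]′ (paint-inv S? e)
   ; tij = t i k ik (λ (_ , e) -> jk (sym e)) (λ (e , _) -> ij e)
   ; tjk = t k j (λ e -> jk (sym e)) (λ (e , _) -> ik (sym e)) (λ (e , _) -> jk (sym e))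
   ; tkl = t j l jl (λ (e , _) -> ij (sym e)) (λ (_ , e) -> il (sym e))
   ; tli = t l i (λ e -> il (sym e)) (λ (e , _) -> il (sym e)) (λ (e , _) -> jl (sym e))
   ; P? = P? ; Q? = Q? ; P⊂U = λ x -> fst (P⊂ x) ; Q⊂U = λ x -> fst (Q⊂ x) ; dis = λ x y -> snd (Q⊂ y) (snd (P⊂ x))
   ; Pi = comp (r∈U i , pi) ; Pk = wp ; Qj = comp (r∈U k , nk) ; Ql = wq
   ; PM = λ a b -> inl (a , b) ; QM = λ a b -> inr (a , b) ; M⁻ = λ m -> m }
   where
   fs : fr ≢ aux
   fs ()

 fromK4 : K4of I⁺ -> Res I
 fromK4 K = go (anySubset? Cond?)
  where
  go : Dec (∃ Cond) -> Res I
  go (yes c) = linked K c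
  go (no none) = inr (planarCert none)

module _ {n} (N : ℕ) (rec : ∀ (I' : Inst n) -> cnt (Inst.U? I') < N -> Res I') where
 -- The pairs in ps are the ones that may still be non-adjacent.
 loop : ∀ ps (I : Inst n) -> cnt (Inst.U? I) < suc N -> (∀ i j -> i ≢ j -> Inst.E I (Inst.r I i) (Inst.r I j) ⊎ (i , j) ∈ ps) -> Res I
 loop [] I lt f = inl (OnInst.adjacent I λ i j ne -> [ (λ e -> e) , (λ ()) ]′ (f i j ne))
 loop ((i , j) ∷ ps) I lt f with i ≟ j
 ... | yes refl = loop ps I lt λ a b ne -> [ inl , (λ { (here refl) -> absurd (ne refl) ; (there m) -> inr m }) ]′ (f a b ne)
 ... | no ne = [ FromK4.fromK4 I N rec lt i j ne , (λ c -> inr (Cert-mono inl c)) ]′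
   (loop ps (plus I (Inst.r I i) (Inst.r I j) λ e -> ne (Inst.r-inj I e)) lt λ a b n -> [ (λ e -> inl (inl e)) , (λ { (here refl) -> inl (inr (inl (refl , refl))) ; (there m) -> inr m }) ]′ (f a b n))

solve : ∀ {n} N (I : Inst n) -> cnt (Inst.U? I) < N -> Res I
solve zero I lt = absurd (n≮0 lt)
solve (suc N) I lt = loop N (solve N) (cartesianProduct (allFin 4) (allFin 4)) I lt λ i j _ -> inr (∈-cartesianProduct⁺ (∈-allFin i) (∈-allFin j))

-- The converse

onto : (κ : Fin 4 -> Fin 4) -> (∀ {i j} -> κ i ≡ κ j -> i ≡ j) -> ∀ k -> ∃ λ i -> κ i ≡ k
onto κ inj k with any? (λ i -> κ i ≟ k)
... | yes p = p
... | no n with pigeonhole (ℕ.s≤s (ℕ.s≤s (ℕ.s≤s (ℕ.s≤s ℕ.z≤n)))) (λ i -> punchOut {i = k} {κ i} λ e -> n (i , sym e))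
... | i , j , lt , e = absurd (<⇒≢ lt (inj (punchOut-injective (λ q -> n (i , sym q)) (λ q -> n (j , sym q)) e)))

record HModel {m} (A : Adj m) (nm : Fin 4 -> Fin m) : Set₁ where
 field
  D     : Fin 4 -> Fin m -> Set
  D?    : ∀ k -> Dec₁ (D k)
  conn  : ∀ k -> Conn (λ i j -> i ∼[ A ] j) (D k) (nm k)
  dis   : ∀ {k l i} -> D k i -> D l i -> k ≡ l
  touch : ∀ {k l} -> k ≢ l -> ∃₂ λ i j -> D k i × D l j × i ∼[ A ] j

module _ {m} {A : Adj m} {nm : Fin 4 -> Fin m} (SA : Sym A) (H : HModel A nm) where
 open HModel H
 private
  ~-sym : ∀ {i j} -> i ∼[ A ] j -> j ∼[ A ] i
  ~-sym {i} {j} e = trans (SA j i) e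

 apart : ∀ {k l i} -> k ≢ l -> D k i -> D l i -> ⊥
 apart ne a b = ne (dis a b)

 crowded : ∀ {a b c x y} -> a ≢ b -> a ≢ c -> b ≢ c -> D a x ⊎ D a y -> D b x ⊎ D b y -> D c x ⊎ D c y -> ⊥
 crowded ab ac bc (inl p) (inl q) _ = apart ab p q
 crowded ab ac bc (inr p) (inr q) _ = apart ab p q
 crowded ab ac bc (inl p) (inr q) (inl s) = apart ac p s
 crowded ab ac bc (inl p) (inr q) (inr s) = apart bc q s
 crowded ab ac bc (inr p) (inl q) (inl s) = apart bc q s
 crowded ab ac bc (inr p) (inl q) (inr s) = apart ac p s

 share : ∀ {a b x y} -> a ≢ b -> D a x ⊎ D a y -> D b x ⊎ D b y -> (D a x × D b y) ⊎ (D a y × D b x)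
 share ab (inl p) (inl q) = absurd (apart ab p q)
 share ab (inl p) (inr q) = inl (p , q)
 share ab (inr p) (inl q) = inr (p , q)
 share ab (inr p) (inr q) = absurd (apart ab p q)

 -- A nominated vertex of degree two shares its branch set with a neighbour, for it cannot see three other sets on its own.
 leaf : ∀ k {x y} -> (∀ j -> nm k ∼[ A ] j -> j ≡ x ⊎ j ≡ y) -> D k x ⊎ D k y
 leaf k {x} {y} nb with D? k x | D? k y
 ... | yes p | _ = inl p
 ... | no _ | yes p = inr p
 ... | no nx | no ny = let a , b , c , F = others k in absurd (crowded (Four.jk F) (Four.jl F) (Four.kl F) (sees (Four.ij F)) (sees (Four.ik F)) (sees (Four.il F)))
  where
  lone : ∀ {i} -> W (λ i j -> i ∼[ A ] j) (D k) (nm k) i -> i ≡ nm k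
  lone ε = refl
  lone (step e d _) = absurd ([ (λ { refl -> nx d }) , (λ { refl -> ny d }) ]′ (nb _ e))
  sees : ∀ {l} -> k ≢ l -> D l x ⊎ D l y
  sees ne with touch ne
  ... | i , j , di , dj , e with lone (snd (conn k) di)
  ... | refl = [ (λ { refl -> inl dj }) , (λ { refl -> inr dj }) ]′ (nb j e)

 Join : Fin 4 -> Fin 4 -> Fin m -> Set
 Join k l i = D k i ⊎ D l i

 across : ∀ {k l i j} -> k ≢ l -> D k i -> D l j -> W (λ i j -> i ∼[ A ] j) (Join k l) i j
 across {k} {l} ne di dj = let a , b , da , db , e = touch ne in
  W-mono inl (W-rev ~-sym (fst (conn k)) (snd (conn k) di)) ∙ W-mono inl (snd (conn k) da) ∙
  step e (inr db) (W-mono inr (W-rev ~-sym (fst (conn l)) (snd (conn l) db)) ∙ W-mono inr (snd (conn l) dj))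

module _ {m} {A : Adj m} {x y : Fin m} where
 ext-zero : ∀ j -> zero ∼[ ext A x y ] j -> j ≡ suc x ⊎ j ≡ suc y
 ext-zero (suc j) e with j ≟ x | j ≟ y
 ... | yes p | _ = inl (cong suc p)
 ... | no _ | yes p = inr (cong suc p)
 ext-zero (suc j) () | no _ | no _

 unext : ∀ {S : Fin (suc m) -> Set} -> ¬ (S (suc x) × S (suc y)) -> ∀ {i j} -> S (suc i) -> W (λ i j -> i ∼[ ext A x y ] j) S (suc i) (suc j) -> W (λ i j -> i ∼[ A ] j) (λ i -> S (suc i)) i j
 unext n si ε = ε
 unext n si (step {w = suc w} e s p) = step e s (unext n s p)
 unext {S} n {i} {j} si (step {w = zero} e s (step {w = suc w} e' s' p)) = subst (λ z -> W _ _ z j) (same (at e) (ext-zero (suc w) e')) (unext n s' p)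
  where
  at : ⌊ i ≟ x ⌋ ∨ ⌊ i ≟ y ⌋ ≡ true -> suc i ≡ suc x ⊎ suc i ≡ suc y
  at e = ext-zero (suc i) e
  same : suc i ≡ suc x ⊎ suc i ≡ suc y -> suc w ≡ suc x ⊎ suc w ≡ suc y -> w ≡ i
  same (inl refl) (inl refl) = refl
  same (inr refl) (inr refl) = refl
  same (inl refl) (inr refl) = absurd (n (si , s'))
  same (inr refl) (inl refl) = absurd (n (s' , si))

planeCross : ∀ {m} {P : Graph m} {p q r s} -> PlaneQuad P p q r s -> {S T : Fin m -> Set} -> Dec₁ S -> (∀ {i} -> S i -> T i -> ⊥) -> S p -> T q ->
       W (λ i j -> i ∼[ adj P ] j) S p r -> W (λ i j -> i ∼[ adj P ] j) T q s -> ⊥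
planeCross {P = P} {p} {q} {r} {s} Q {S} {T} S? d sp tq wp wq = Jordan.jordan Q (W? (λ i j -> adj P i j Bool.≟ true) S? p)
  (ε , λ a -> W-mono snd (W-keep (W _ S p) (λ z e t -> z ∙ edge e t) ε a)) wp (λ a -> d (S⊂ a) tq) (W-mono (λ t a -> d (S⊂ a) t) wq)
 where
 S⊂ : ∀ {i} -> W (λ i j -> i ∼[ adj P ] j) S p i -> S i
 S⊂ = W-end∈ sp

abstract
 leafA : ∀ k j -> nomA (suc k) ∼[ HA ] j -> j ≡ zero ⊎ j ≡ 1F
 leafA = toWitness {a? = all? λ k -> all? λ j -> (HA (nomA (suc k)) j Bool.≟ true) →? ((j ≟ zero) ⊎? (j ≟ 1F))} _
 leafB : ∀ k j -> nomB k ∼[ HB ] j -> j ≡ zero ⊎ j ≡ 1F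
 leafB = toWitness {a? = all? λ k -> all? λ j -> (HB (nomB k) j Bool.≟ true) →? ((j ≟ zero) ⊎? (j ≟ 1F))} _
 leafC : (∀ j -> nomC zero ∼[ HC ] j -> j ≡ zero ⊎ j ≡ 1F) × (∀ j -> nomC 1F ∼[ HC ] j -> j ≡ zero ⊎ j ≡ 1F) ×
     (∀ j -> nomC 2F ∼[ HC ] j -> j ≡ 1F ⊎ j ≡ 2F) × (∀ j -> nomC 3F ∼[ HC ] j -> j ≡ 1F ⊎ j ≡ 2F)
 leafC = toWitness {a? = (all? λ j -> (HC (nomC zero) j Bool.≟ true) →? ((j ≟ zero) ⊎? (j ≟ 1F)))
  ×? ((all? λ j -> (HC (nomC 1F) j Bool.≟ true) →? ((j ≟ zero) ⊎? (j ≟ 1F)))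
  ×? ((all? λ j -> (HC (nomC 2F) j Bool.≟ true) →? ((j ≟ 1F) ⊎? (j ≟ 2F)))
  ×? (all? λ j -> (HC (nomC 3F) j Bool.≟ true) →? ((j ≟ 1F) ⊎? (j ≟ 2F)))))} _
 HC-sym : Sym HC
 HC-sym = toWitness {a? = all? λ x -> all? λ y -> HC x y Bool.≟ HC y x} _

graphH-sym : ∀ w -> Sym (graphH w)
graphH-sym cA = HA-sym
graphH-sym cB = HB-sym
graphH-sym cC = HC-sym
graphH-sym (cD m P p q r s Q) = Graph.sym P
graphH-sym (cE m P p q r s Q) = ext-sym {A = ext (adj P) r s} (ext-sym {A = adj P} (Graph.sym P) r s) (suc r) (suc s)
graphH-sym (cF m P p q r s Q) = ext-sym {A = ext (ext (ext (adj P) p q) (suc p) (suc q)) (suc (suc r)) (suc (suc s))}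
 (ext-sym {A = ext (ext (adj P) p q) (suc p) (suc q)} (ext-sym {A = ext (adj P) p q} (ext-sym {A = adj P} (Graph.sym P) p q) (suc p) (suc q)) (suc (suc r)) (suc (suc s))) _ _

-- The branch set of a nominated vertex of degree two must occupy one of its two neighbours. In A
-- and B there are not enough neighbours, and in C both pairs of leaves need the common vertex `1F`.
-- In D, E and F the sets occupying opposite corners, joined in pairs, would cross in the
-- quadrangle.
noModel : ∀ w -> HModel (graphH w) (nominated w) -> ⊥
noModel cA H = apart HA-sym H {1F} {2F} (λ ()) (own 0F (λ ())) (own 1F (λ ()))
 where
 open HModel H
 own : ∀ k -> 0F ≢ suc k -> D (suc k) 1F
 own k ne = [ (λ d -> absurd (apart HA-sym H ne (fst (conn 0F)) d)) , (λ d -> d) ]′ (leaf HA-sym H (suc k) (leafA k))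
noModel cB H = crowded HB-sym H {0F} {1F} {2F} (λ ()) (λ ()) (λ ()) (own 0F) (own 1F) (own 2F)
 where
 own = λ k -> leaf HB-sym H k (leafB k)
noModel cC H = go (share HC-sym H {0F} {1F} (λ ()) (leaf HC-sym H 0F (fst leafC)) (leaf HC-sym H 1F (fst (snd leafC))))
         (share HC-sym H {2F} {3F} (λ ()) (leaf HC-sym H 2F (fst (snd (snd leafC)))) (leaf HC-sym H 3F (snd (snd (snd leafC)))))
 where
 open HModel H
 ap : ∀ {k l i} -> k ≢ l -> D k i -> D l i -> ⊥
 ap = apart HC-sym H
 go : (D 0F 0F × D 1F 1F) ⊎ (D 0F 1F × D 1F 0F) -> (D 2F 1F × D 3F 2F) ⊎ (D 2F 2F × D 3F 1F) -> ⊥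
 go (inl (_ , a)) (inl (b , _)) = ap (λ ()) a b
 go (inl (_ , a)) (inr (_ , b)) = ap (λ ()) a b
 go (inr (a , _)) (inl (b , _)) = ap (λ ()) a b
 go (inr (a , _)) (inr (_ , b)) = ap (λ ()) a b
noModel (cD m P p q r s Q) H = planeCross Q (λ i -> D? 0F i ⊎? D? 2F i) ds (inl (fst (conn 0F))) (inl (fst (conn 1F)))
  (across SA H {0F} {2F} (λ ()) (fst (conn 0F)) (fst (conn 2F))) (across SA H {1F} {3F} (λ ()) (fst (conn 1F)) (fst (conn 3F)))
 where
 open HModel H
 SA = Graph.sym P
 ds : ∀ {i} -> D 0F i ⊎ D 2F i -> D 1F i ⊎ D 3F i -> ⊥
 ds (inl a) (inl b) = apart SA H (λ ()) a b
 ds (inl a) (inr b) = apart SA H (λ ()) a b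
 ds (inr a) (inl b) = apart SA H (λ ()) a b
 ds (inr a) (inr b) = apart SA H (λ ()) a b
-- The sets of the two extra vertices occupy `r` and `s`. The one at `r` is joined to the set of
-- `p`, the one at `s` to that of `q`.
noModel w@(cE m P p q r s Q) H = [ (λ (a , b) -> cross {2F} {3F} (λ ()) (λ ()) (λ ()) (λ ()) (λ ()) (λ ()) a b) , (λ (a , b) -> cross {3F} {2F} (λ ()) (λ ()) (λ ()) (λ ()) (λ ()) (λ ()) b a) ]′
  (share SA H {2F} {3F} (λ ()) (leaf SA H 2F low) (leaf SA H 3F (ext-zero {A = ext (adj P) r s} {suc r} {suc s})))
 where
 open HModel H
 SA = graphH-sym w
 low : ∀ j -> 1F ∼[ graphH w ] j -> j ≡ suc (suc r) ⊎ j ≡ suc (suc s)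
 low zero ()
 low (suc j) e = Sum.map (cong suc) (cong suc) (ext-zero {A = adj P} {r} {s} j e)
 cross : ∀ {kr ks} -> kr ≢ 0F -> kr ≢ 1F -> ks ≢ 0F -> ks ≢ 1F -> kr ≢ ks -> 0F ≢ 1F -> D kr (suc (suc r)) -> D ks (suc (suc s)) -> ⊥
 cross {kr} {ks} r0 r1 s0 s1 rs ne01 dr dsk = planeCross Q {S = λ i -> Join SA H 0F kr (suc (suc i))} {λ i -> Join SA H 1F ks (suc (suc i))} (λ i -> D? 0F _ ⊎? D? kr _) ds
   (inl (fst (conn 0F))) (inl (fst (conn 1F)))
   (unext {A = adj P} {r} {s} notS (inl (fst (conn 0F))) (unext {A = ext (adj P) r s} {suc r} {suc s} notS (inl (fst (conn 0F))) (across SA H (λ e -> r0 (sym e)) (fst (conn 0F)) dr)))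
   (unext {A = adj P} {r} {s} notT (inl (fst (conn 1F))) (unext {A = ext (adj P) r s} {suc r} {suc s} notT (inl (fst (conn 1F))) (across SA H (λ e -> s1 (sym e)) (fst (conn 1F)) dsk)))
  where
  ds : ∀ {i} -> D 0F i ⊎ D kr i -> D 1F i ⊎ D ks i -> ⊥
  ds (inl a) (inl b) = apart SA H ne01 a b
  ds (inl a) (inr b) = apart SA H s0 b a
  ds (inr a) (inl b) = apart SA H r1 a b
  ds (inr a) (inr b) = apart SA H rs a b
  notS : ¬ (Join SA H 0F kr (suc (suc r)) × Join SA H 0F kr (suc (suc s)))
  notS (_ , a) = ds a (inr dsk)
  notT : ¬ (Join SA H 1F ks (suc (suc r)) × Join SA H 1F ks (suc (suc s)))
  notT (a , _) = ds (inr dr) a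
-- Each pair of extra vertices occupies one side of the quadrangle, so all four corners lie in
-- different branch sets.
noModel w@(cF m P p q r s Q) H = go (share SA H {0F} {1F} (λ ()) (leaf SA H 0F (ext-zero {A = B₃} {R₃} {S₃})) (leaf SA H 1F low₁))
                  (share SA H {2F} {3F} (λ ()) (leaf SA H 2F low₂) (leaf SA H 3F low₃))
 where
 open HModel H
 SA = graphH-sym w
 B₁ = ext (adj P) p q
 B₂ = ext B₁ (suc p) (suc q)
 R₂ = suc (suc r)
 S₂ = suc (suc s)
 B₃ = ext B₂ R₂ S₂
 R₃ = suc R₂
 S₃ = suc S₂
 up : ∀ {n} -> Fin n -> Fin (suc (suc (suc (suc n))))
 up i = suc (suc (suc (suc i)))
 low₁ : ∀ j -> 1F ∼[ graphH w ] j -> j ≡ up r ⊎ j ≡ up s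
 low₁ zero ()
 low₁ (suc j) e = Sum.map (cong suc) (cong suc) (ext-zero {A = B₂} {R₂} {S₂} j e)
 low₂ : ∀ j -> 2F ∼[ graphH w ] j -> j ≡ up p ⊎ j ≡ up q
 low₂ zero ()
 low₂ 1F ()
 low₂ (suc (suc j)) e = Sum.map (cong (λ z -> suc (suc z))) (cong (λ z -> suc (suc z))) (ext-zero {A = B₁} {suc p} {suc q} j e)
 low₃ : ∀ j -> 3F ∼[ graphH w ] j -> j ≡ up p ⊎ j ≡ up q
 low₃ zero ()
 low₃ 1F ()
 low₃ 2F ()
 low₃ (suc (suc (suc j))) e = Sum.map (cong (λ z -> suc (suc (suc z)))) (cong (λ z -> suc (suc (suc z)))) (ext-zero {A = adj P} {p} {q} j e)
 cross : ∀ {kp kq kr ks} -> kp ≢ kr -> kq ≢ ks -> kp ≢ kq -> kp ≢ ks -> kr ≢ kq -> kr ≢ ks -> D kp (up p) -> D kq (up q) -> D kr (up r) -> D ks (up s) -> ⊥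
 cross {kp} {kq} {kr} {ks} pr qs pq ps rq rs dp dq dr dsk = planeCross Q {S = λ i -> Join SA H kp kr (up i)} {λ i -> Join SA H kq ks (up i)} (λ i -> D? kp _ ⊎? D? kr _) ds (inl dp) (inl dq)
   (unext {A = adj P} {p} {q} nS (inl dp) (unext {A = B₁} {suc p} {suc q} nS (inl dp) (unext {A = B₂} {R₂} {S₂} nS' (inl dp) (unext {A = B₃} {R₃} {S₃} nS' (inl dp) (across SA H pr dp dr)))))
   (unext {A = adj P} {p} {q} nT (inl dq) (unext {A = B₁} {suc p} {suc q} nT (inl dq) (unext {A = B₂} {R₂} {S₂} nT' (inl dq) (unext {A = B₃} {R₃} {S₃} nT' (inl dq) (across SA H qs dq dsk)))))
  where
  ds : ∀ {i} -> D kp i ⊎ D kr i -> D kq i ⊎ D ks i -> ⊥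
  ds (inl a) (inl b) = apart SA H pq a b
  ds (inl a) (inr b) = apart SA H ps a b
  ds (inr a) (inl b) = apart SA H rq a b
  ds (inr a) (inr b) = apart SA H rs a b
  nS : ¬ (Join SA H kp kr (up p) × Join SA H kp kr (up q))
  nS (_ , a) = ds a (inl dq)
  nS' : ¬ (Join SA H kp kr (up r) × Join SA H kp kr (up s))
  nS' (_ , a) = ds a (inr dsk)
  nT : ¬ (Join SA H kq ks (up p) × Join SA H kq ks (up q))
  nT (a , _) = ds (inl dp) a
  nT' : ¬ (Join SA H kq ks (up r) × Join SA H kq ks (up s))
  nT' (a , _) = ds (inr dr) a
 go : (D 0F (up r) × D 1F (up s)) ⊎ (D 0F (up s) × D 1F (up r)) -> (D 2F (up p) × D 3F (up q)) ⊎ (D 2F (up q) × D 3F (up p)) -> ⊥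
 go (inl (a , b)) (inl (c , d)) = cross {2F} {3F} {0F} {1F} (λ ()) (λ ()) (λ ()) (λ ()) (λ ()) (λ ()) c d a b
 go (inl (a , b)) (inr (c , d)) = cross {3F} {2F} {0F} {1F} (λ ()) (λ ()) (λ ()) (λ ()) (λ ()) (λ ()) d c a b
 go (inr (a , b)) (inl (c , d)) = cross {2F} {3F} {1F} {0F} (λ ()) (λ ()) (λ ()) (λ ()) (λ ()) (λ ()) c d b a
 go (inr (a , b)) (inr (c , d)) = cross {3F} {2F} {1F} {0F} (λ ()) (λ ()) (λ ()) (λ ()) (λ ()) (λ ()) d c b a

-- The two alternatives for a given graph

module Answer {n} (G : Graph n) (a b c d : Fin n) (a≢b : a ≢ b) (a≢c : a ≢ c) (a≢d : a ≢ d) (b≢c : b ≢ c) (b≢d : b ≢ d) (c≢d : c ≢ d) where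
 rs : Fin 4 -> Fin n
 rs = roots a b c d

 rs-inj : ∀ {i j} -> rs i ≡ rs j -> i ≡ j
 rs-inj = Four-inj (record { ij = λ () ; ik = λ () ; il = λ () ; jk = λ () ; jl = λ () ; kl = λ ()
  ; all = λ { 0F -> inl refl ; 1F -> inr (inl refl) ; 2F -> inr (inr (inl refl)) ; 3F -> inr (inr (inr refl)) } }) rs a≢b a≢c a≢d b≢c b≢d c≢d

 E : Fin n -> Fin n -> Set
 E u v = u ∼[ adj G ] v

 I : Inst n
 I = record { E = E ; E? = λ u v -> adj G u v Bool.≟ true ; Esym = λ {u} {v} e -> trans (Graph.sym G v u) e
  ; irr = λ { {u} e refl -> no-loop u e } ; U = λ _ -> ⊤ ; U? = λ _ -> yes tt ; r = rs ; r-inj = rs-inj ; r∈U = λ _ -> tt }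
  where
  no-loop : ∀ u -> adj G u u ≡ true -> ⊥
  no-loop u e with trans (sym e) (Graph.irrefl G u)
  ... | ()

 fromModel : K4of I -> RootedK4 G a b c d
 fromModel K = record
  { branch = λ i v -> ⌊ K.φ v ≟ₚ rt i ⌋
  ; rooted = λ i -> ⌊⌋⁺ (_ ≟ₚ _) (M.Rooted.base (M.conn K.model i))
  ; disjoint = λ i j x ne p q -> ne (rt-inj (trans (sym (⌊⌋⁻ (K.φ x ≟ₚ rt i) p)) (⌊⌋⁻ (K.φ x ≟ₚ rt j) q)))
  ; connected = λ i x y p q -> let R = M.conn K.model i ; px = ⌊⌋⁻ (K.φ x ≟ₚ rt i) p in
    star px (W-rev (Inst.Esym I) (M.Rooted.base R) (M.Rooted.reach R px) ∙ M.Rooted.reach R (⌊⌋⁻ (K.φ y ≟ₚ rt i) q))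
  ; touching = λ i j ne -> let x , y , p , q , e = K.touch i j ne in x , y , ⌊⌋⁺ (K.φ x ≟ₚ rt i) p , ⌊⌋⁺ (K.φ y ≟ₚ rt j) q , e }
  where
  module M = Minors (Inst.E I) (Inst.E? I) (Inst.Esym I) (Inst.U I) (Inst.r I)
  module K = M.K4 K
  star : ∀ {i x y} -> K.φ x ≡ rt i -> W E (λ v -> K.φ v ≡ rt i) x y -> Star (λ u v -> (u ∼[ adj G ] v) × ⌊ K.φ u ≟ₚ rt i ⌋ ≡ true × ⌊ K.φ v ≟ₚ rt i ⌋ ≡ true) x y
  star p ε = ε
  star {i} {x} p (step {w = w} e s q) = (e , ⌊⌋⁺ (K.φ x ≟ₚ rt i) p , ⌊⌋⁺ (K.φ w ≟ₚ rt i) s) ◅ star s q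

 LAdj? : ∀ {m} (A : Adj m) k l -> Dec (LAdj A k l)
 LAdj? A (inl i) (inl j) = A i j Bool.≟ true
 LAdj? A (inl i) (inr t) = (i ≟ _) ⊎? ((i ≟ _) ⊎? (i ≟ _))
 LAdj? A (inr t) (inl i) = (i ≟ _) ⊎? ((i ≟ _) ⊎? (i ≟ _))
 LAdj? A (inr t) (inr s) = all? λ h -> map′ (λ (f , g) -> mk⇔ f g) (λ e -> Equivalence.to e , Equivalence.from e) ((t? h →? s? h) ×? (s? h →? t? h))
  where
  t? : ∀ h -> Dec (h ∈₃ t)
  t? h = (h ≟ _) ⊎? ((h ≟ _) ⊎? (h ≟ _))
  s? : ∀ h -> Dec (h ∈₃ s)
  s? h = (h ≟ _) ⊎? ((h ≟ _) ⊎? (h ≟ _))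

 fromCert : Cert E (λ _ -> ⊤) rs -> Obstructed G a b c d
 fromCert C = G' , (λ x y e -> adj⁺ (Inst.irr I e) (edges tt tt e)) , w , π , λ x -> mk⇔ (λ { (i , refl) -> κ i , nom i })
   λ (k , e) -> let i , q = onto κ κ-inj k in i , inj tt tt e (trans (nom i) (cong (λ z -> inl (nominated w z)) q))
  where
  open Cert C
  open Lab ℓ hiding (onto)
  H = graphH w
  κ-inj : ∀ {i j} -> κ i ≡ κ j -> i ≡ j
  κ-inj {i} {j} e = rs-inj (inj tt tt (nom i) (trans (nom j) (cong (λ z -> inl (nominated w z)) (sym e))))
  adj? : ∀ x y -> Dec (x ≢ y × LAdj H (lab x) (lab y))
  adj? x y = ¬? (x ≟ y) ×? LAdj? H (lab x) (lab y)
  adj⁺ : ∀ {x y} -> x ≢ y -> LAdj H (lab x) (lab y) -> ⌊ adj? x y ⌋ ≡ true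
  adj⁺ {x} {y} ne l = ⌊⌋⁺ (adj? x y) (ne , l)
  G' : Graph n
  G' = record
   { adj = λ x y -> ⌊ adj? x y ⌋
   ; sym = λ x y -> eq (adj? x y) (adj? y x) (λ (ne , l) -> (λ e -> ne (sym e)) , LAdj-sym (graphH-sym w) (lab x) (lab y) l)
                        (λ (ne , l) -> (λ e -> ne (sym e)) , LAdj-sym (graphH-sym w) (lab y) (lab x) l)
   ; irrefl = λ x -> ⌊⌋-false (adj? x x) λ (ne , _) -> ne refl }
   where
   eq : ∀ {A B : Set} (x : Dec A) (y : Dec B) -> (A -> B) -> (B -> A) -> ⌊ x ⌋ ≡ ⌊ y ⌋
   eq (yes p) y f g = sym (⌊⌋⁺ y (f p))
   eq (no n) y f g = sym (⌊⌋-false y λ q -> n (g q))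
  π : PlusOf G' H
  π = record { label = lab ; onto = λ i -> let v , _ , e = Lab.onto ℓ i in v , e ; inj = λ x y i -> inj tt tt ; triOK = λ x t -> triOK tt
        ; adjOK = λ x y ne -> mk⇔ (λ e -> snd (⌊⌋⁻ (adj? x y) e)) (adj⁺ ne) }

 decide : RootedK4 G a b c d ⊎ Obstructed G a b c d
 decide = Sum.map fromModel fromCert (solve _ I ≤-refl)

 -- Each branch set is replaced by the vertices of `H` in it. By projection these are still
 -- connected, so they form a rooted K₄-minor of `H`.
 exclusive : ¬ (RootedK4 G a b c d × Obstructed G a b c d)
 exclusive (K , G' , sub , w , π , iff) = noModel w record
  { D = λ k -> Pr.Im k ; D? = λ k i -> any? λ z -> (_ Bool.≟ true) ×? lab? z i
  ; conn = λ k -> (rs (ρ k) , K.rooted (ρ k) , nom' k) , λ (z , s , e) -> Pr.project k (K.rooted (ρ k)) (nom' k) (walk (K.connected (ρ k) _ z (K.rooted (ρ k)) s)) e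
  ; dis = λ {k} {l} (z , s , e) (z' , s' , e') -> dis k l z z' s s' (Lab.inj ℓ tt tt e e')
  ; touch = λ {k} {l} ne -> tch k l ne }
  where
  module K = RootedK4 K
  module π = PlusOf π
  SA = graphH-sym w
  ℓ : Lab E (λ _ -> ⊤) (graphH w)
  ℓ = record { lab = π.label ; onto = λ i -> let v , e = π.onto i in v , tt , e ; inj = λ _ _ -> π.inj _ _ _ ; triOK = λ _ -> π.triOK _ _
        ; edges = λ {u} {v} _ _ e -> Equivalence.to (π.adjOK u v (Inst.irr I e)) (sub u v e) }
  nom : ∀ i -> ∃ λ k -> π.label (rs i) ≡ inl (nominated w k)
  nom i = Equivalence.to (iff (rs i)) (i , refl)
  κ : Fin 4 -> Fin 4
  κ i = fst (nom i)
  κ-inj : ∀ {i j} -> κ i ≡ κ j -> i ≡ j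
  κ-inj {i} {j} e = rs-inj (π.inj _ _ _ (snd (nom i)) (trans (snd (nom j)) (cong (λ z -> inl (nominated w z)) (sym e))))
  ρ : Fin 4 -> Fin 4
  ρ k = fst (onto κ κ-inj k)
  κρ : ∀ k -> κ (ρ k) ≡ k
  κρ k = snd (onto κ κ-inj k)
  nom' : ∀ k -> π.label (rs (ρ k)) ≡ inl (nominated w k)
  nom' k = trans (snd (nom (ρ k))) (cong (λ z -> inl (nominated w z)) (κρ k))
  B : Fin 4 -> Fin n -> Set
  B k v = K.branch (ρ k) v ≡ true
  module Pr (k : Fin 4) = Project SA ℓ {S = B k} (λ _ -> tt)
  lab? : ∀ z i -> Dec (π.label z ≡ inl i)
  lab? z i with π.label z
  ... | inl j = map′ (cong inl) inl-inj (j ≟ i)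
  ... | inr t = no λ ()
  walk : ∀ {i x y} -> Star (λ u v -> (u ∼[ adj G ] v) × K.branch i u ≡ true × K.branch i v ≡ true) x y -> W E (λ v -> K.branch i v ≡ true) x y
  walk ε = ε
  walk ((e , _ , s) ◅ p) = step e s (walk p)
  dis : ∀ k l z z' -> B k z -> B l z' -> z ≡ z' -> k ≡ l
  dis k l z .z s s' refl with ρ k ≟ ρ l
  ... | yes e = trans (sym (κρ k)) (trans (cong κ e) (κρ l))
  ... | no ne = absurd (K.disjoint (ρ k) (ρ l) z ne s s')
  -- A branch set contains a root and is therefore not contained in a clique `X_T`. On a walk from
  -- the root, a vertex of `X_T` remembers the vertex of `T` through which the clique was entered.
  anchor : ∀ k {z} -> B k z -> ∃ λ c -> Pr.Im k c × Pr.At k (π.label z) c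
  anchor k {z} s = W-ind (λ z -> B k z × ∃ λ c -> Pr.Im k c × Pr.At k (π.label z) c) next
    (K.rooted (ρ k) , nominated w k , (rs (ρ k) , K.rooted (ρ k) , nom' k) , subst (λ l -> Pr.At k l (nominated w k)) (sym (nom' k)) refl)
    (walk (K.connected (ρ k) (rs (ρ k)) z (K.rooted (ρ k)) s)) .snd
   where
   next : ∀ {u v} -> (B k u × ∃ λ c -> Pr.Im k c × Pr.At k (π.label u) c) -> E u v -> B k v -> B k v × ∃ λ c -> Pr.Im k c × Pr.At k (π.label v) c
   next {u} {v} (_ , c , im , at) e s with Pr.step-At k (π.label u) (π.label v) c (Lab.edges ℓ tt tt e) at (Lab.triOK ℓ tt)
   ... | inl at' = s , c , im , at'
   ... | inr (d , q , _) = s , d , (v , s , q) , subst (λ l -> Pr.At k l d) (sym q) refl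
  -- The edge between two branch sets of the large graph may lie inside a clique `X_T` or lead into
  -- one. The anchors of its ends are then distinct vertices of a common triangle and hence
  -- adjacent.
  tch : ∀ k l -> k ≢ l -> ∃₂ λ i j -> Pr.Im k i × Pr.Im l j × i ∼[ graphH w ] j
  tch k l ne with K.touching (ρ k) (ρ l) (λ e -> ne (trans (sym (κρ k)) (trans (cong κ e) (κρ l))))
  ... | x , y , sx , sy , e with anchor k sx | anchor l sy
  ... | i , im , at | j , im' , at' = i , j , im , im' , go (Pr.step-At k (π.label x) (π.label y) i (Lab.edges ℓ tt tt e) at (Lab.triOK ℓ tt))
   where
   i≢j : i ≢ j
   i≢j refl = let z , s , p = im ; z' , s' , p' = im' in ne (dis k l z z' s s' (π.inj _ _ _ p p'))
   meet : ∀ m -> π.label y ≡ m -> Pr.At k m i -> Pr.At l m j -> i ∼[ graphH w ] j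
   meet (inl c) _ refl refl = absurd (i≢j refl)
   meet (inr t) q a b = [ (λ p -> absurd (i≢j p)) , (λ p -> p) ]′ (tri-adj SA (π.triOK y t q) a b)
   go : Pr.At k (π.label y) i ⊎ (∃ λ c -> π.label y ≡ inl c × (i ≡ c ⊎ i ∼[ graphH w ] c)) -> i ∼[ graphH w ] j
   go (inl a) = meet _ refl a at'
   go (inr (c , q , adj)) with subst (λ m -> Pr.At l m j) q at'
   ... | refl = [ (λ p -> absurd (i≢j p)) , (λ p -> p) ]′ adj

theorem15 : ∀ {n} (G : Graph n) (a b c d : Fin n) ->
      a ≢ b -> a ≢ c -> a ≢ d -> b ≢ c -> b ≢ d -> c ≢ d ->
      (RootedK4 G a b c d ⊎ Obstructed G a b c d) × ¬ (RootedK4 G a b c d × Obstructed G a b c d)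
theorem15 G a b c d ab ac ad bc bd cd = Answer.decide G a b c d ab ac ad bc bd cd , Answer.exclusive G a b c d ab ac ad bc bd cd
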